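{- For all $k\ge 0$ and all partitions $\lambda$, $a_{\lambda,k}\ge a'_{\lambda,k}$. Furthermore, equality holds when either $k=2$ or $\ell(\lambda)\le k+2$.
   Context: A $k$-family is a finite collection of distinct $k$-subsets of $\mathbb{P}=\{1,2,\dots\}$, with degree sequence $d(K)=(d_1,d_2,\dots)$, $d_i=|\{S\in K:i\in S\}|$; it is shifted if down-closed in the componentwise order on $k$-sets ($\{x_1<\dots<x_k\}\le\{y_1<\dots<y_k\}$ iff $x_i\le y_i$ for all $i$). The plethysm coefficients $a_{\lambda,k}$ are the Schur coefficients in $\sum_{m\ge0}e_m[e_k]=\prod_{S\in\binom{\mathbb{P}}{k}}(1+\prod_{i\in S}x_i)=\sum_\lambda a_{\lambda,k}s_\lambda$, and $a'_{\lambda,k}$ is the number of shifted $k$-families $K$ with $d(K)=\lambda$ (the Schur coefficients of $\sum_{K\text{ shifted}}s_{d(K)}$). $\ell(\lambda)$ is the number of parts of $\lambda$. -}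

module Defs where

open import Data.Nat using (ℕ; zero; suc; _≤_; _<_; _≤?_; _<?_; _≟_; _∸_)
open import Data.Integer using (ℤ; +_) renaming (_+_ to _+ℤ_; _*_ to _*ℤ_)
open import Data.List using (List; []; _∷_; [_]; map; concat; concatMap; filter; length; upTo; replicate; zip; _++_; foldr)
open import Data.Nat.ListAction using (sum)
open import Data.List.Relation.Unary.All using (All; all?)
open import Data.List.Relation.Unary.Linked using (Linked; linked?)
open import Data.List.Relation.Binary.Pointwise using (Pointwise)
import Data.List.Relation.Binary.Pointwise.Properties as PwP
open import Data.List.Membership.DecPropositional _≟_ using (_∈_; _∈?_)
import Data.List.Properties as LP
open import Data.Product using (_×_; uncurry)
open import Relation.Nullary using (Dec)
open import Relation.Nullary.Decidable using (_×-dec_; _→-dec_)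
open import Relation.Unary using (Decidable)
open import Relation.Binary.PropositionalEquality using (_≡_)

count : ∀ {A : Set} {P : A → Set} → Decidable P → List A → ℕ
count P? xs = length (filter P? xs)

sublists : ∀ {A : Set} → List A → List (List A)
sublists []       = [ [] ]
sublists (x ∷ xs) = sublists xs ++ map (x ∷_) (sublists xs)

listsBelow : ℕ → ℕ → List (List ℕ)
listsBelow n zero    = [ [] ]
listsBelow n (suc r) = concatMap (λ i → map (i ∷_) (listsBelow n r)) (upTo n)

_≟L_ : (xs ys : List ℕ) → Dec (xs ≡ ys)
_≟L_ = LP.≡-dec _≟_

open import Data.List.Membership.DecPropositional _≟L_ public
  using () renaming (_∈_ to _∈K_; _∈?_ to _∈K?_)

sumℤ : List ℤ → ℤ
sumℤ = foldr _+ℤ_ (+ 0)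

IsPartition : List ℕ → Set
IsPartition xs = Linked (λ a b → b ≤ a) xs × All (λ a → 1 ≤ a) xs

isPartition? : Decidable IsPartition
isPartition? xs = linked? (λ a b → b ≤? a) xs ×-dec all? (λ a → 1 ≤? a) xs

-- all partitions of d (each has ≤ d parts, each part ≤ d)
partitionsOf : ℕ → List (List ℕ)
partitionsOf d =
  filter (λ xs → isPartition? xs ×-dec (sum xs ≟ d))
         (concatMap (listsBelow (suc d)) (upTo (suc d)))

pad : ℕ → List ℕ → List ℕ
pad n xs = xs ++ replicate (n ∸ length xs) 0

-- k-families on the ground set [n] = {0,…,n-1}
-- (a k-subset is represented by its strictly increasing list of elements)

ksets : ℕ → ℕ → List (List ℕ)
ksets n k = filter (linked? _<?_) (listsBelow n k)

kFamilies : ℕ → ℕ → List (List (List ℕ))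
kFamilies n k = sublists (ksets n k)

degree : ℕ → List (List ℕ) → List ℕ
degree n K = map (λ i → count (i ∈?_) K) (upTo n)

_≤set_ : List ℕ → List ℕ → Set
T ≤set S = Pointwise _≤_ T S

Shifted : ℕ → ℕ → List (List ℕ) → Set
Shifted n k K = All (λ S → All (λ T → T ≤set S → T ∈K K) (ksets n k)) K

shifted? : (n k : ℕ) → Decidable (Shifted n k)
shifted? n k K =
  all? (λ S → all? (λ T → PwP.decidable _≤?_ T S →-dec (T ∈K? K)) (ksets n k)) K

-- monomial coefficient [x^α] of ∏_{S ⊆ [n], |S|=k} (1 + x^S)
famCount : ℕ → ℕ → List ℕ → ℕ
famCount n k α = count (λ K → degree n K ≟L α) (kFamilies n k)

-- a'_{λ,k}: number of shifted k-families with degree sequence λ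
-- (computed on [n] with n ≥ ℓ(λ); all such families live in [ℓ(λ)])
aShift : ℕ → ℕ → List ℕ → ℕ
aShift n k la =
  count (λ K → shifted? n k K ×-dec (degree n K ≟L pad n la)) (kFamilies n k)

fillings : ℕ → List ℕ → List (List (List ℕ))
fillings n []       = [ [] ]
fillings n (r ∷ rs) = concatMap (λ row → map (row ∷_) (fillings n rs)) (listsBelow n r)

ColStrict : List ℕ → List ℕ → Set
ColStrict R₁ R₂ = All (uncurry _<_) (zip R₁ R₂)

IsSSYT : List (List ℕ) → Set
IsSSYT T = All (Linked _≤_) T × Linked ColStrict T

isSSYT? : Decidable IsSSYT
isSSYT? T = all? (linked? _≤?_) T
      ×-dec linked? (λ R₁ R₂ → all? (λ p → uncurry _<?_ p) (zip R₁ R₂)) T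

content : ℕ → List (List ℕ) → List ℕ
content n T = map (λ i → count (_≟ i) (concat T)) (upTo n)

-- Kostka number K_{μ,α}: coefficient of x^α in the Schur polynomial s_μ(x_1..x_n)
kostka : ℕ → List ℕ → List ℕ → ℕ
kostka n μ α = count (λ T → isSSYT? T ×-dec (content n T ≟L α)) (fillings n μ)

-- c is the family of Schur coefficients of ∑_m e_m[e_k] in n variables:
--   ∏_{S}(1 + x^S) = ∑_μ c_μ s_μ(x_1,…,x_n), compared monomial by monomial.

IsSchurExpansion : ℕ → ℕ → (List ℕ → ℤ) → Set
IsSchurExpansion n k c =
  ∀ (α : List ℕ) → length α ≡ n →
    + famCount n k α ≡ sumℤ (map (λ μ → c μ *ℤ + kostka n μ α) (partitionsOf (sum α)))

-- By the Jacobi–Trudi inversion ∏ (1 − x_j / x_i), i < j, the coefficient a_λ is the number of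
-- even minus the number of odd basis vectors of weight λ in the Fock space with a fermionic
-- mode for each k-set and a ghost mode for each positive root. Kostant's cubic Dirac operator D
-- is odd and symmetric, and D² is half of (Casimir − |λ + ρ|²), so on weight λ it vanishes only
-- on highest weight vectors without ghosts. Shifted families are such vectors; hence D + 1 embeds
-- the odd and the shifted basis vectors into the even ones (≥). If any two members differ in at
-- most four places, as for k = 2 and for ℓ(λ) ≤ k + 2, then the Casimir is diagonal, and every
-- basis vector occurring in a highest weight vector is shifted (=).
module Submission where

-- The signed count is the Euler characteristic, in weight λ, of the complex of cochains of 𝔫
-- (strictly upper triangular matrices) with values in ⋀(⋀ᵏ), and `D` is its differential plus the
-- transpose. Highest weight vectors are the cohomology of degree 0; for dominant λ no other degree
-- contributes, and positivity of D² is what proves this. Two obstacles shape the proof. The ghost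
-- part of `D` is cubic, which makes a direct expansion of D² unwieldy; so `dirac` peels off one row
-- of positive roots at a time, and each step only meets bilinear terms. Moreover all vectors are
-- integral: no eigenspaces are formed, identities are stated doubled instead of halved, and numbers
-- of basis vectors are compared through injectivity and fraction-free elimination. The bound of
-- four places comes from the two-body part of the Casimir, ∑ Eᵢⱼ ⊗ Eⱼᵢ acting on T ∧ V. Positions
-- where T and V agree can be deleted at the cost of a known scalar, and on the at most four that
-- remain the scalar is found by a finite computation.

open import Algebra.Bundles using (Ring)

-- Polynomial identities in noncommutative rings

module NCRingSolver {c ℓ} (R : Ring c ℓ) where

  open Ring R renaming (Carrier to A)
  open import Algebra.Properties.Ring R
  open import Data.Bool.Base using (Bool; true; false; not; _xor_)
  open import Data.Bool.Properties using () renaming (_≟_ to _≟ᵇ_)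
  open import Data.Fin.Base using (Fin)
  import Data.Fin.Properties as Fin
  open import Data.List.Base using (List; []; _∷_; _++_; map; foldr)
  import Data.List.Properties as List
  open import Data.Nat.Base using (ℕ; zero; suc)
  open import Data.Product.Base using (_×_; _,_; proj₁; proj₂)
  open import Data.Vec.Base using (Vec; []; _∷_; lookup; allFin) renaming (map to vmap)
  open import Data.Vec.N-ary using (N-ary; ∀ⁿ; curryⁿ; _$ⁿ_)
  open import Relation.Binary.PropositionalEquality as ≡ using (_≡_)
  open import Relation.Nullary using (Dec; yes; no)
  open import Relation.Nullary.Decidable using (_×-dec_)
  open import Relation.Binary.Reasoning.Setoid setoid

  infixl 6 _⊕_ _⊝_ _⊟_ _⊡_
  infixl 7 _⊗_
  infix 4 _⊜_

  data Expr (m : ℕ) : Set where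
    var : Fin m → Expr m
    _⊕_ _⊗_ : Expr m → Expr m → Expr m
    neg : Expr m → Expr m
    O I : Expr m

  _⊝_ : ∀ {m} → Expr m → Expr m → Expr m
  e ⊝ f = e ⊕ neg f

  _⊟_ _⊡_ : ∀ {m} → Expr m → Expr m → Expr m
  e ⊟ f = e ⊗ f ⊝ f ⊗ e
  e ⊡ f = e ⊗ f ⊕ f ⊗ e

  _⊜_ : ∀ {m} → Expr m → Expr m → Expr m × Expr m
  _⊜_ = _,_

  private variable m : ℕ

  Env : ℕ → Set c
  Env = Vec A

  ⟦_⟧ : Expr m → Env m → A
  ⟦ var x ⟧ ρ = lookup ρ x
  ⟦ e ⊕ f ⟧ ρ = ⟦ e ⟧ ρ + ⟦ f ⟧ ρ
  ⟦ e ⊗ f ⟧ ρ = ⟦ e ⟧ ρ * ⟦ f ⟧ ρ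
  ⟦ neg e ⟧ ρ = - ⟦ e ⟧ ρ
  ⟦ O ⟧ ρ = 0#
  ⟦ I ⟧ ρ = 1#

  Mono : ℕ → Set
  Mono m = Bool × List (Fin m)

  word : List (Fin m) → Env m → A
  word [] ρ = 1#
  word (x ∷ xs) ρ = lookup ρ x * word xs ρ

  signed : Bool → A → A
  signed true x = x
  signed false x = - x

  mono : Mono m → Env m → A
  mono (s , w) ρ = signed s (word w ρ)

  poly : List (Mono m) → Env m → A
  poly [] ρ = 0#
  poly (t ∷ ts) ρ = mono t ρ + poly ts ρ

  opposite? : (t u : Mono m) → Dec (proj₁ t ≡ not (proj₁ u) × proj₂ t ≡ proj₂ u)
  opposite? (s , w) (s′ , w′) = (s ≟ᵇ not s′) ×-dec List.≡-dec Fin._≟_ w w′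

  -- A coefficient is a multiplicity of equal signed words, and a new term cancels against an
  -- opposite one already present. No list built this way contains two opposite terms, so a
  -- polynomial that vanishes identically normalises to `[]`.
  insert : Mono m → List (Mono m) → List (Mono m)
  insert t [] = t ∷ []
  insert t (u ∷ us) with opposite? t u
  ... | yes _ = us
  ... | no _ = u ∷ insert t us

  mulᵐ : Mono m → Mono m → Mono m
  mulᵐ (s , w) (s′ , w′) = not (s xor s′) , w ++ w′

  mul₁ : Mono m → List (Mono m) → List (Mono m) → List (Mono m)
  mul₁ t [] acc = acc
  mul₁ t (u ∷ us) acc = insert (mulᵐ t u) (mul₁ t us acc)

  mul : List (Mono m) → List (Mono m) → List (Mono m)
  mul [] us = []
  mul (t ∷ ts) us = mul₁ t us (mul ts us)

  add : List (Mono m) → List (Mono m) → List (Mono m)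
  add ts us = foldr insert us ts

  negᵐ : Mono m → Mono m
  negᵐ (s , w) = not s , w

  nf : Expr m → List (Mono m)
  nf (var x) = (true , x ∷ []) ∷ []
  nf (e ⊕ f) = add (nf e) (nf f)
  nf (e ⊗ f) = mul (nf e) (nf f)
  nf (neg e) = map negᵐ (nf e)
  nf O = []
  nf I = (true , []) ∷ []

  signed-not : ∀ s x → signed (not s) x ≈ - signed s x
  signed-not true x = refl
  signed-not false x = sym (-‿involutive x)

  signed-mul : ∀ s s′ x y → signed (not (s xor s′)) (x * y) ≈ signed s x * signed s′ y
  signed-mul true true x y = refl
  signed-mul true false x y = -‿distribʳ-* x y
  signed-mul false true x y = -‿distribˡ-* x y
  signed-mul false false x y = sym (begin
    - x * - y ≈⟨ -‿distribˡ-* x (- y) ⟨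
    - (x * - y) ≈⟨ -‿cong (sym (-‿distribʳ-* x y)) ⟩
    - - (x * y) ≈⟨ -‿involutive _ ⟩
    x * y ∎)

  signed-cong : ∀ s {x y} → x ≈ y → signed s x ≈ signed s y
  signed-cong true e = e
  signed-cong false e = -‿cong e

  swapˡ : ∀ x y z → x + (y + z) ≈ y + (x + z)
  swapˡ x y z = begin
    x + (y + z) ≈⟨ +-assoc x y z ⟨
    x + y + z ≈⟨ +-congʳ (+-comm x y) ⟩
    y + x + z ≈⟨ +-assoc y x z ⟩
    y + (x + z) ∎

  insert-sound : ∀ (t : Mono m) us ρ → poly (insert t us) ρ ≈ mono t ρ + poly us ρ
  insert-sound t [] ρ = refl
  insert-sound (s , w) ((s′ , w′) ∷ us) ρ with opposite? (s , w) (s′ , w′)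
  ... | yes (≡.refl , ≡.refl) = sym (begin
    signed (not s′) (word w ρ) + (signed s′ (word w ρ) + poly us ρ)
      ≈⟨ +-assoc _ _ _ ⟨
    signed (not s′) (word w ρ) + signed s′ (word w ρ) + poly us ρ
      ≈⟨ +-congʳ (+-congʳ (signed-not s′ _)) ⟩
    - signed s′ (word w ρ) + signed s′ (word w ρ) + poly us ρ
      ≈⟨ +-congʳ (-‿inverseˡ _) ⟩
    0# + poly us ρ
      ≈⟨ +-identityˡ _ ⟩
    poly us ρ ∎)
  ... | no _ = trans (+-congˡ (insert-sound (s , w) us ρ)) (swapˡ _ _ _)

  word-++ : ∀ (w w′ : List (Fin m)) ρ → word (w ++ w′) ρ ≈ word w ρ * word w′ ρ
  word-++ [] w′ ρ = sym (*-identityˡ _)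
  word-++ (x ∷ w) w′ ρ = trans (*-congˡ (word-++ w w′ ρ)) (sym (*-assoc _ _ _))

  mulᵐ-sound : ∀ (t u : Mono m) ρ → mono (mulᵐ t u) ρ ≈ mono t ρ * mono u ρ
  mulᵐ-sound (s , w) (s′ , w′) ρ =
    trans (signed-cong (not (s xor s′)) (word-++ w w′ ρ)) (signed-mul s s′ _ _)

  mul₁-sound : ∀ (t : Mono m) us acc ρ → poly (mul₁ t us acc) ρ ≈ mono t ρ * poly us ρ + poly acc ρ
  mul₁-sound t [] acc ρ = sym (trans (+-congʳ (zeroʳ _)) (+-identityˡ _))
  mul₁-sound t (u ∷ us) acc ρ = begin
    poly (insert (mulᵐ t u) (mul₁ t us acc)) ρ
      ≈⟨ insert-sound (mulᵐ t u) (mul₁ t us acc) ρ ⟩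
    mono (mulᵐ t u) ρ + poly (mul₁ t us acc) ρ
      ≈⟨ +-cong (mulᵐ-sound t u ρ) (mul₁-sound t us acc ρ) ⟩
    mono t ρ * mono u ρ + (mono t ρ * poly us ρ + poly acc ρ)
      ≈⟨ +-assoc _ _ _ ⟨
    mono t ρ * mono u ρ + mono t ρ * poly us ρ + poly acc ρ
      ≈⟨ +-congʳ (distribˡ _ _ _) ⟨
    mono t ρ * (mono u ρ + poly us ρ) + poly acc ρ ∎

  mul-sound : ∀ (ts us : List (Mono m)) ρ → poly (mul ts us) ρ ≈ poly ts ρ * poly us ρ
  mul-sound [] us ρ = sym (zeroˡ _)
  mul-sound (t ∷ ts) us ρ = begin
    poly (mul₁ t us (mul ts us)) ρ ≈⟨ mul₁-sound t us _ ρ ⟩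
    mono t ρ * poly us ρ + poly (mul ts us) ρ ≈⟨ +-congˡ (mul-sound ts us ρ) ⟩
    mono t ρ * poly us ρ + poly ts ρ * poly us ρ ≈⟨ distribʳ _ _ _ ⟨
    (mono t ρ + poly ts ρ) * poly us ρ ∎

  add-sound : ∀ (ts us : List (Mono m)) ρ → poly (add ts us) ρ ≈ poly ts ρ + poly us ρ
  add-sound [] us ρ = sym (+-identityˡ _)
  add-sound (t ∷ ts) us ρ = begin
    poly (insert t (add ts us)) ρ ≈⟨ insert-sound t (add ts us) ρ ⟩
    mono t ρ + poly (add ts us) ρ ≈⟨ +-congˡ (add-sound ts us ρ) ⟩
    mono t ρ + (poly ts ρ + poly us ρ) ≈⟨ +-assoc _ _ _ ⟨
    mono t ρ + poly ts ρ + poly us ρ ∎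

  neg-sound : ∀ (ts : List (Mono m)) ρ → poly (map negᵐ ts) ρ ≈ - poly ts ρ
  neg-sound [] ρ = sym -0#≈0#
  neg-sound ((s , w) ∷ ts) ρ = begin
    signed (not s) (word w ρ) + poly (map negᵐ ts) ρ ≈⟨ +-cong (signed-not s _) (neg-sound ts ρ) ⟩
    - signed s (word w ρ) + - poly ts ρ ≈⟨ -‿+-comm _ _ ⟩
    - (signed s (word w ρ) + poly ts ρ) ∎

  nf-sound : ∀ (e : Expr m) ρ → poly (nf e) ρ ≈ ⟦ e ⟧ ρ
  nf-sound (var x) ρ = trans (+-identityʳ _) (*-identityʳ _)
  nf-sound (e ⊕ f) ρ = trans (add-sound (nf e) (nf f) ρ) (+-cong (nf-sound e ρ) (nf-sound f ρ))
  nf-sound (e ⊗ f) ρ = trans (mul-sound (nf e) (nf f) ρ) (*-cong (nf-sound e ρ) (nf-sound f ρ))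
  nf-sound (neg e) ρ = trans (neg-sound (nf e) ρ) (-‿cong (nf-sound e ρ))
  nf-sound O ρ = refl
  nf-sound I ρ = +-identityʳ _

  x-y≈0⇒x≈y : ∀ x y → x - y ≈ 0# → x ≈ y
  x-y≈0⇒x≈y x y e = begin
    x ≈⟨ +-identityʳ x ⟨
    x + 0# ≈⟨ +-congˡ (-‿inverseˡ y) ⟨
    x + (- y + y) ≈⟨ +-assoc x (- y) y ⟨
    x - y + y ≈⟨ +-congʳ e ⟩
    0# + y ≈⟨ +-identityˡ y ⟩
    y ∎

  -- Only the difference is normalised, so the order of the terms in a normal form is irrelevant,
  -- and the side condition is a closed computation that `refl` settles.
  prove : ∀ (e f : Expr m) → nf (e ⊝ f) ≡ [] → ∀ ρ → ⟦ e ⟧ ρ ≈ ⟦ f ⟧ ρ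
  prove e f p ρ = x-y≈0⇒x≈y _ _
    (trans (sym (nf-sound (e ⊝ f) ρ)) (reflexive (≡.cong (λ ts → poly ts ρ) p)))

  curry∀ : ∀ m {P : Env m → Set ℓ} → (∀ ρ → P ρ) → ∀ⁿ m (curryⁿ P)
  curry∀ zero f = f []
  curry∀ (suc m) f = λ x → curry∀ m (λ ρ → f (x ∷ ρ))

  close : ∀ m → N-ary m (Expr m) (Expr m × Expr m) → Expr m × Expr m
  close m f = f $ⁿ vmap var (allFin m)

  solve : ∀ m (f : N-ary m (Expr m) (Expr m × Expr m)) →
          nf (proj₁ (close m f) ⊝ proj₂ (close m f)) ≡ [] →
          ∀ⁿ m (curryⁿ (λ ρ → ⟦ proj₁ (close m f) ⟧ ρ ≈ ⟦ proj₂ (close m f) ⟧ ρ))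
  solve m f p = curry∀ m (prove (proj₁ (close m f)) (proj₂ (close m f)) p)

  -- Combinators for deriving x ≈ y from hypotheses u ≈ v by exhibiting
  -- x − y as a sum of terms l (u − v) r.
  infixl 5 _⊞_
  infix 1 _by_

  kill : ∀ l {u v} r → u ≈ v → l * (u - v) * r ≈ 0#
  kill l {u} {v} r e = begin
    l * (u - v) * r ≈⟨ *-congʳ (*-congˡ (trans (+-congʳ e) (-‿inverseʳ v))) ⟩
    l * 0# * r ≈⟨ *-congʳ (zeroʳ l) ⟩
    0# * r ≈⟨ zeroˡ r ⟩
    0# ∎

  _⊞_ : ∀ {x y} → x ≈ 0# → y ≈ 0# → x + y ≈ 0#
  p ⊞ q = trans (+-cong p q) (+-identityʳ 0#)

  _by_ : ∀ {x y s} → x - y ≈ s → s ≈ 0# → x ≈ y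
  p by q = x-y≈0⇒x≈y _ _ (trans p q)

-- The cubic Dirac operator over an arbitrary ring

module DiracOperator {c ℓ} (R : Ring c ℓ) where

  open Ring R hiding (zero) renaming (Carrier to A)
  open NCRingSolver R
  import Algebra.Properties.Semiring.Sum semiring as Sum
  open import Data.Fin.Base using (Fin; zero; suc; _↑ˡ_; _↑ʳ_)
  open import Data.Nat.Base as ℕ using (ℕ; zero; suc)
  import Level
  open import Function.Base using (_∘_)
  open import Relation.Binary.PropositionalEquality as ≡ using (_≡_)
  open import Relation.Binary.Reasoning.Setoid setoid

  δ : ∀ {n} → Fin n → Fin n → A
  δ zero zero = 1#
  δ zero (suc j) = 0#
  δ (suc i) zero = 0#
  δ (suc i) (suc j) = δ i j

  δ-sym : ∀ {n} (i j : Fin n) → δ i j ≡ δ j i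
  δ-sym zero zero = ≡.refl
  δ-sym zero (suc j) = ≡.refl
  δ-sym (suc i) zero = ≡.refl
  δ-sym (suc i) (suc j) = δ-sym i j

  δ-diag : ∀ {n} (i : Fin n) → δ i i ≈ 1#
  δ-diag zero = refl
  δ-diag (suc i) = δ-diag i

  δ-central : ∀ {n} (i j : Fin n) x → δ i j * x ≈ x * δ i j
  δ-central zero zero x = trans (*-identityˡ x) (sym (*-identityʳ x))
  δ-central zero (suc j) x = trans (zeroˡ x) (sym (zeroʳ x))
  δ-central (suc i) zero x = trans (zeroˡ x) (sym (zeroʳ x))
  δ-central (suc i) (suc j) x = δ-central i j x

  opaque

    -- Opaque, so that a sum is an atom of the polynomial identities below and is only touched
    -- through the laws that follow.
    sum : ∀ {n} → (Fin n → A) → A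
    sum = Sum.sum

    sum-zero : (f : Fin 0 → A) → sum f ≈ 0#
    sum-zero f = refl

    sum-suc : ∀ {n} (f : Fin (suc n) → A) → sum f ≈ f zero + sum (λ i → f (suc i))
    sum-suc f = refl

    sum-+ : ∀ {n} (f g : Fin n → A) → sum (λ i → f i + g i) ≈ sum f + sum g
    sum-+ = Sum.∑-distrib-+

    sum-swap : ∀ {m n} (f : Fin m → Fin n → A) →
               sum (λ i → sum (λ j → f i j)) ≈ sum (λ j → sum (λ i → f i j))
    sum-swap = Sum.∑-comm

    sum-*ˡ : ∀ {n} x (f : Fin n → A) → x * sum f ≈ sum (λ i → x * f i)
    sum-*ˡ x f = Sum.*-distribˡ-sum x f

    sum-*ʳ : ∀ {n} x (f : Fin n → A) → sum f * x ≈ sum (λ i → f i * x)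
    sum-*ʳ x f = Sum.*-distribʳ-sum x f

    sum-cong : ∀ {n} {f g : Fin n → A} → (∀ i → f i ≈ g i) → sum f ≈ sum g
    sum-cong {n} e = Sum.sum-cong-≋ {n} e

  sum-0 : ∀ {n} {f : Fin n → A} → (∀ i → f i ≈ 0#) → sum f ≈ 0#
  sum-0 {zero} e = sum-zero _
  sum-0 {suc n} e = trans (sum-suc _) (trans (+-cong (e zero) (sum-0 (λ i → e (suc i)))) (+-identityʳ 0#))

  sum-neg : ∀ {n} (f : Fin n → A) → sum (λ i → - f i) ≈ - sum f
  sum-neg f = solve 2 (λ x y → x ⊝ neg y ⊜ I ⊗ (x ⊕ y ⊝ O) ⊗ I) ≡.refl _ _
    by kill 1# 1# (trans (sym (sum-+ _ _)) (sum-0 (λ i → -‿inverseˡ (f i))))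

  sum-δ : ∀ {n} (i : Fin n) (f : Fin n → A) → sum (λ j → δ i j * f j) ≈ f i
  sum-δ zero f = trans (sum-suc _)
    (trans (+-cong (*-identityˡ _) (sum-0 (λ j → zeroˡ _))) (+-identityʳ _))
  sum-δ (suc i) f = trans (sum-suc _)
    (trans (+-cong (zeroˡ _) (sum-δ i (f ∘ suc))) (+-identityˡ _))

  sum-δδ : ∀ {n} (f : Fin n → Fin n → A) →
           sum (λ i → sum (λ j → δ i j * f i j)) ≈ sum (λ i → f i i)
  sum-δδ f = sum-cong (λ i → sum-δ i (f i))

  sum-sum-+ : ∀ {m n} (f g : Fin m → Fin n → A) →
              sum (λ i → sum (λ j → f i j + g i j)) ≈ sum (λ i → sum (f i)) + sum (λ i → sum (g i))
  sum-sum-+ f g = trans (sum-cong (λ i → sum-+ (f i) (g i))) (sum-+ _ _)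

  sum-comm : ∀ {m} {x} (f : Fin m → A) → (∀ i → x * f i ≈ f i * x) → x * sum f ≈ sum f * x
  sum-comm f e = trans (sum-*ˡ _ f) (trans (sum-cong e) (sym (sum-*ʳ _ f)))

  sum-anticomm : ∀ {n} {x} (f : Fin n → A) → (∀ i → x * f i + f i * x ≈ 0#) →
                 x * sum f + sum f * x ≈ 0#
  sum-anticomm f e = trans (+-cong (sum-*ˡ _ f) (sum-*ʳ _ f)) (trans (sym (sum-+ _ _)) (sum-0 e))

  sum-sum-* : ∀ {m n} (f : Fin m → A) (g : Fin n → A) →
              sum f * sum g ≈ sum (λ i → sum (λ j → f i * g j))
  sum-sum-* f g = trans (sum-*ʳ _ f) (sum-cong (λ i → sum-*ˡ (f i) g))

  sum-bracket : ∀ {m n} (f : Fin m → A) (g : Fin n → A) →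
                sum f * sum g + sum g * sum f ≈ sum (λ i → sum (λ j → f i * g j + g j * f i))
  sum-bracket f g = begin
    sum f * sum g + sum g * sum f
      ≈⟨ +-cong (sum-sum-* f g) (trans (sum-sum-* g f) (sum-swap _)) ⟩
    sum (λ i → sum (λ j → f i * g j)) + sum (λ i → sum (λ j → g j * f i))
      ≈⟨ sum-sum-+ _ _ ⟨
    sum (λ i → sum (λ j → f i * g j + g j * f i)) ∎

  record CAR {m} (a a† : Fin m → A) : Set ℓ where
    field
      aa : ∀ i j → a i * a j + a j * a i ≈ 0#
      a†a† : ∀ i j → a† i * a† j + a† j * a† i ≈ 0#
      aa† : ∀ i j → a i * a† j + a† j * a i ≈ δ i j

  -- The relations `[E a b, E i j] = δ b i E a j − δ a j E i b` of the matrix units of 𝔤𝔩ₙ, with the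
  -- negative term moved to the left.
  IsGL : ∀ {n} → (Fin n → Fin n → A) → Set ℓ
  IsGL E = ∀ a b i j → E a b * E i j + δ a j * E i b ≈ E i j * E a b + δ b i * E a j

  Commute : ∀ {m n} → (Fin m → A) → (Fin n → Fin n → A) → Set ℓ
  Commute a E = ∀ i x y → a i * E x y ≈ E x y * a i

  -- The number of positive roots. In `tri (suc n)` the summand `n` counts the roots through the
  -- index 0: `top` selects their ghosts, `rest` those of the roots among the other indices.
  tri : ℕ → ℕ
  tri zero = zero
  tri (suc n) = n ℕ.+ tri n

  -- Under the copy of 𝔤𝔩ₙ on the indices from 1 on, the ghosts of the roots at index 0 form the
  -- defining representation; `a† i * a j` is the induced action on their exterior algebra.
  twist : ∀ {n} (a a† : Fin n → A) (E : Fin (suc n) → Fin (suc n) → A) →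
          Fin n → Fin n → A
  twist a a† E i j = E (suc i) (suc j) + a† i * a j

  -- The differential of the abelian ideal spanned by the E₀ᵢ, plus its transpose: a ghost is
  -- created together with a raising operator and destroyed together with a lowering one.
  hopping : ∀ {n} (a a† : Fin n → A) (E : Fin (suc n) → Fin (suc n) → A) → A
  hopping a a† E = sum (λ i → a† i * E zero (suc i)) + sum (λ i → a i * E (suc i) zero)

  top : ∀ n → (Fin (tri (suc n)) → A) → Fin n → A
  top n a i = a (i ↑ˡ tri n)

  rest : ∀ n → (Fin (tri (suc n)) → A) → Fin (tri n) → A
  rest n a i = a (n ↑ʳ i)

  -- The cubic Dirac operator d + dᵀ on W ⊗ ⋀𝔫*, with the ghost number operators
  -- a†a carrying the weights of 𝔫*. Peeling off the abelian ideal spanned by the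
  -- E₀ᵢ absorbs the cubic term into the twisted 𝔤𝔩ₙ action on W ⊗ ⋀(ghosts of the ideal).
  dirac : ∀ n (a a† : Fin (tri n) → A) (E : Fin n → Fin n → A) → A
  dirac zero a a† E = 0#
  dirac (suc n) a a† E = hopping (top n a) (top n a†) E
                       + dirac n (rest n a) (rest n a†) (twist (top n a) (top n a†) E)

  weight : ∀ n (a a† : Fin (tri n) → A) (E : Fin n → Fin n → A) → Fin n → A
  weight (suc n) a a† E zero = E zero zero - sum (λ i → top n a† i * top n a i)
  weight (suc n) a a† E (suc i) = weight n (rest n a) (rest n a†) (twist (top n a) (top n a†) E) i

  casimir : ∀ n → (Fin n → Fin n → A) → A
  casimir n E = sum (λ i → sum (λ j → E i j * E j i))

  -- The pairing of `h` with 2ρ, in the form in which it arises from commuting `E i j` past `E j i`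
  -- for i < j.
  differences : ∀ n → (Fin n → A) → A
  differences zero h = 0#
  differences (suc n) h = sum (λ i → h zero - h (suc i)) + differences n (h ∘ suc)

  squares : ∀ n → (Fin n → A) → A
  squares n h = sum (λ i → h i * h i)

  lowerRaise : ∀ n → (Fin n → Fin n → A) → A
  lowerRaise zero E = 0#
  lowerRaise (suc n) E = sum (λ i → E (suc i) zero * E zero (suc i))
                       + lowerRaise n (λ i j → E (suc i) (suc j))

  sum-const-sub : ∀ {n} x (f : Fin n → A) →
                  sum (λ i → x - f i) ≈ sum {n} (λ _ → x) - sum f
  sum-const-sub x f = trans (sum-+ _ _) (+-congˡ (sum-neg f))

  module _ {n} {E : Fin (suc n) → Fin (suc n) → A} (gl : IsGL E) where

    XY : ∀ i j → E zero (suc i) * E (suc j) zero + E (suc j) (suc i)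
               ≈ E (suc j) zero * E zero (suc i) + δ i j * E zero zero
    XY i j = trans (+-congˡ (sym (*-identityˡ _))) (gl zero (suc i) (suc j) zero)

    XX : ∀ i j → E zero (suc i) * E zero (suc j) ≈ E zero (suc j) * E zero (suc i)
    XX i j = solve 4 (λ p q r s → p ⊝ q ⊜ I ⊗ ((p ⊕ O ⊗ r) ⊝ (q ⊕ O ⊗ s)) ⊗ I) ≡.refl _ _ _ _
      by kill 1# 1# (gl zero (suc i) zero (suc j))

    YY : ∀ i j → E (suc i) zero * E (suc j) zero ≈ E (suc j) zero * E (suc i) zero
    YY i j = solve 4 (λ p q r s → p ⊝ q ⊜ I ⊗ ((p ⊕ O ⊗ r) ⊝ (q ⊕ O ⊗ s)) ⊗ I) ≡.refl _ _ _ _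
      by kill 1# 1# (gl (suc i) zero (suc j) zero)

    casimir-suc : casimir (suc n) E ≈
      E zero zero * E zero zero + sum (λ i → E zero zero - E (suc i) (suc i))
      + (sum (λ i → E (suc i) zero * E zero (suc i)) + sum (λ i → E (suc i) zero * E zero (suc i)))
      + casimir n (λ i j → E (suc i) (suc j))
    casimir-suc = begin
      casimir (suc n) E
        ≈⟨ trans (sum-suc _) (+-cong (sum-suc _) (sum-cong (λ i → sum-suc _))) ⟩
      E zero zero * E zero zero + sum (λ i → E zero (suc i) * E (suc i) zero)
        + sum (λ i → E (suc i) zero * E zero (suc i) + sum (λ j → E (suc i) (suc j) * E (suc j) (suc i)))
        ≈⟨ +-cong (+-congˡ (trans (sum-cong xy) (sum-+ _ _))) (sum-+ _ _) ⟩
      E zero zero * E zero zero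
        + (sum (λ i → E zero zero - E (suc i) (suc i)) + sum (λ i → E (suc i) zero * E zero (suc i)))
        + (sum (λ i → E (suc i) zero * E zero (suc i)) + casimir n (λ i j → E (suc i) (suc j)))
        ≈⟨ solve 4 (λ p q r s → p ⊕ (q ⊕ r) ⊕ (r ⊕ s) ⊜ p ⊕ q ⊕ (r ⊕ r) ⊕ s) ≡.refl _ _ _ _ ⟩
      _ ∎
      where
      xy : ∀ i → E zero (suc i) * E (suc i) zero
               ≈ (E zero zero - E (suc i) (suc i)) + E (suc i) zero * E zero (suc i)
      xy i = solve 5 (λ p q r s d → p ⊝ ((q ⊝ s) ⊕ r) ⊜
          I ⊗ ((p ⊕ s) ⊝ (r ⊕ d ⊗ q)) ⊗ I ⊕ I ⊗ (d ⊝ I) ⊗ q) ≡.refl _ _ _ _ (δ i i)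
        by kill 1# 1# (XY i i) ⊞ kill 1# (E zero zero) (δ-diag i)

  -- Freudenthal's form of the Casimir element: the off-diagonal part is
  -- reordered so that raising operators act first.
  casimir-ordered : ∀ n {E : Fin n → Fin n → A} → IsGL E →
    casimir n E ≈ squares n (λ i → E i i) + differences n (λ i → E i i)
                + (lowerRaise n E + lowerRaise n E)
  casimir-ordered zero gl = trans (sum-0 (λ ())) (trans
    (solve 0 (O ⊜ O ⊕ O ⊕ (O ⊕ O)) ≡.refl) (+-congʳ (+-congʳ (sym (sum-0 (λ ()))))))
  casimir-ordered (suc n) {E} gl = begin
    casimir (suc n) E ≈⟨ casimir-suc gl ⟩
    _ ≈⟨ +-congˡ (casimir-ordered n (λ a b i j → gl (suc a) (suc b) (suc i) (suc j))) ⟩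
    _ ≈⟨ solve 6 (λ e d l s w m → e ⊕ d ⊕ (l ⊕ l) ⊕ (s ⊕ w ⊕ (m ⊕ m)) ⊜
      (e ⊕ s) ⊕ (d ⊕ w) ⊕ ((l ⊕ m) ⊕ (l ⊕ m))) ≡.refl _ _ _ _ _ _ ⟩
    _ ≈⟨ +-congʳ (+-congʳ (sum-suc _)) ⟨
    _ ∎

  -- One step of the recursion for D². Here `a` and `a†` belong to the roots at index 0 only, and
  -- everything that concerns the remaining roots sees `E` through the twisted action `E′`.
  module Step {n} {a a† : Fin n → A} {E : Fin (suc n) → Fin (suc n) → A}
    (car : CAR a a†) (gl : IsGL E) (aE : Commute a E) (a†E : Commute a† E) where

    open CAR car

    E₀₀ : A
    E₀₀ = E zero zero

    E′ : Fin n → Fin n → A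
    E′ = twist a a† E

    X Y : Fin n → A
    X i = E zero (suc i)
    Y i = E (suc i) zero

    P Q T N : A
    P = sum (λ i → a† i * X i)
    Q = sum (λ i → a i * Y i)
    T = hopping a a† E
    N = sum (λ i → a† i * a i)

    -- A sum of two commuting actions. The right-hand side of the identity is the certificate: each
    -- line is one hypothesis, multiplied on both sides, and the `kill`s below supply them in the
    -- same order.
    twist-GL : IsGL E′
    twist-GL x y i j =
      solve 11 (λ e f g h p q r s dxj dyi _ →
        (e ⊕ p ⊗ q) ⊗ (f ⊕ r ⊗ s) ⊕ dxj ⊗ (g ⊕ r ⊗ q) ⊝ ((f ⊕ r ⊗ s) ⊗ (e ⊕ p ⊗ q) ⊕ dyi ⊗ (h ⊕ p ⊗ s)) ⊜
        I ⊗ (e ⊗ f ⊕ dxj ⊗ g ⊝ (f ⊗ e ⊕ dyi ⊗ h)) ⊗ I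
        ⊕ neg I ⊗ (r ⊟ e) ⊗ s
        ⊕ neg r ⊗ (s ⊟ e) ⊗ I
        ⊕ I ⊗ (p ⊟ f) ⊗ q
        ⊕ p ⊗ (q ⊟ f) ⊗ I
        ⊕ p ⊗ (q ⊡ r ⊝ dyi) ⊗ s
        ⊕ neg I ⊗ (p ⊡ r ⊝ O) ⊗ (q ⊗ s)
        ⊕ r ⊗ p ⊗ (q ⊡ s ⊝ O) ⊗ I
        ⊕ neg r ⊗ (s ⊡ p ⊝ dxj) ⊗ q
        ⊕ neg I ⊗ (dyi ⊟ p) ⊗ s
        ⊕ I ⊗ (dxj ⊟ r) ⊗ q)
        ≡.refl _ _ _ _ (a† x) (a y) (a† i) (a j) (δ x j) (δ y i) 0#
      by kill 1# 1# (gl (suc x) (suc y) (suc i) (suc j))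
        ⊞ kill (- 1#) (a j) (a†E i (suc x) (suc y))
        ⊞ kill (- a† i) 1# (aE j (suc x) (suc y))
        ⊞ kill 1# (a y) (a†E x (suc i) (suc j))
        ⊞ kill (a† x) 1# (aE y (suc i) (suc j))
        ⊞ kill (a† x) (a j) (aa† y i)
        ⊞ kill (- 1#) (a y * a j) (a†a† x i)
        ⊞ kill (a† i * a† x) 1# (aa y j)
        ⊞ kill (- a† i) (a y) (trans (aa† j x) (reflexive (δ-sym j x)))
        ⊞ kill (- 1#) (a j) (δ-central y i (a† x))
        ⊞ kill 1# (a y) (δ-central x j (a† i))

    private
      e′p : ∀ x y i → E′ x y * (a† i * X i) + δ x i * (a† i * X y)
                    ≈ (a† i * X i) * E′ x y + δ y i * (a† x * X i)
      e′p x y i = solve 9 (λ e p q r Xi Xy dxi dyi d →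
        (e ⊕ p ⊗ q) ⊗ (r ⊗ Xi) ⊕ dxi ⊗ (r ⊗ Xy) ⊝ (r ⊗ Xi ⊗ (e ⊕ p ⊗ q) ⊕ dyi ⊗ (p ⊗ Xi)) ⊜
          I ⊗ (e ⊟ r) ⊗ Xi
          ⊕ r ⊗ (e ⊗ Xi ⊕ dxi ⊗ Xy ⊝ (Xi ⊗ e ⊕ O ⊗ d)) ⊗ I
          ⊕ I ⊗ (dxi ⊟ r) ⊗ Xy
          ⊕ p ⊗ (q ⊡ r ⊝ dyi) ⊗ Xi
          ⊕ neg I ⊗ (dyi ⊟ p) ⊗ Xi
          ⊕ neg I ⊗ (p ⊡ r ⊝ O) ⊗ (q ⊗ Xi)
          ⊕ r ⊗ p ⊗ (q ⊟ Xi) ⊗ I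
          ⊕ r ⊗ (p ⊟ Xi) ⊗ q)
          ≡.refl (E (suc x) (suc y)) (a† x) (a y) (a† i) (X i) (X y) (δ x i) (δ y i) (E zero (suc i))
        by kill 1# (X i) (sym (a†E i (suc x) (suc y)))
          ⊞ kill (a† i) 1# (trans (trans (+-congˡ refl) (gl′ x y i)) (+-congˡ (trans (zeroˡ _) (sym (zeroˡ _)))))
          ⊞ kill 1# (X y) (δ-central x i (a† i))
          ⊞ kill (a† x) (X i) (aa† y i)
          ⊞ kill (- 1#) (X i) (δ-central y i (a† x))
          ⊞ kill (- 1#) (a y * X i) (a†a† x i)
          ⊞ kill (a† i * a† x) 1# (aE y zero (suc i))
          ⊞ kill (a† i) (a y) (a†E x zero (suc i))
        where
        gl′ : ∀ x y i → E (suc x) (suc y) * X i + δ x i * X y ≈ X i * E (suc x) (suc y) + 0# * E (suc x) (suc i)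
        gl′ x y i = gl (suc x) (suc y) zero (suc i)

      e′q : ∀ x y i → E′ x y * (a i * Y i) + δ x i * (a y * Y i)
                    ≈ (a i * Y i) * E′ x y + δ y i * (a i * Y x)
      e′q x y i = solve 9 (λ e p q r Yi Yx dxi dyi d →
        (e ⊕ p ⊗ q) ⊗ (r ⊗ Yi) ⊕ dxi ⊗ (q ⊗ Yi) ⊝ (r ⊗ Yi ⊗ (e ⊕ p ⊗ q) ⊕ dyi ⊗ (r ⊗ Yx)) ⊜
          I ⊗ (e ⊟ r) ⊗ Yi
          ⊕ r ⊗ (e ⊗ Yi ⊕ O ⊗ d ⊝ (Yi ⊗ e ⊕ dyi ⊗ Yx)) ⊗ I
          ⊕ neg I ⊗ (dyi ⊟ r) ⊗ Yx
          ⊕ p ⊗ (q ⊡ r ⊝ O) ⊗ Yi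
          ⊕ neg I ⊗ (r ⊡ p ⊝ dxi) ⊗ (q ⊗ Yi)
          ⊕ r ⊗ p ⊗ (q ⊟ Yi) ⊗ I
          ⊕ r ⊗ (p ⊟ Yi) ⊗ q)
          ≡.refl (E (suc x) (suc y)) (a† x) (a y) (a i) (Y i) (Y x) (δ x i) (δ y i) (E zero zero)
        by kill 1# (Y i) (sym (aE i (suc x) (suc y)))
          ⊞ kill (a i) 1# (trans (+-congˡ (trans (zeroˡ _) (sym (zeroˡ _)))) (gl (suc x) (suc y) (suc i) zero))
          ⊞ kill (- 1#) (Y x) (δ-central y i (a i))
          ⊞ kill (a† x) (Y i) (aa y i)
          ⊞ kill (- 1#) (a y * Y i) (trans (aa† i x) (reflexive (δ-sym i x)))
          ⊞ kill (a i * a† x) 1# (aE y (suc i) zero)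
          ⊞ kill (a i) (a y) (a†E x (suc i) zero)

    cancel-sum : ∀ {x} (f g h : Fin n → A) u v → sum g ≈ u → sum h ≈ v → u ≈ v →
      (∀ i → x * f i + g i ≈ f i * x + h i) → x * sum f ≈ sum f * x
    cancel-sum {x} f g h u v gu hv uv e =
      solve 4 (λ p q g h → p ⊝ q ⊜ I ⊗ (p ⊕ g ⊝ (q ⊕ h)) ⊗ I ⊕ neg I ⊗ (g ⊝ h) ⊗ I) ≡.refl _ _ (sum g) (sum h)
      by kill 1# 1# (begin
           x * sum f + sum g ≈⟨ +-congʳ (sum-*ˡ x f) ⟩
           sum (λ i → x * f i) + sum g ≈⟨ sum-+ _ _ ⟨
           sum (λ i → x * f i + g i) ≈⟨ sum-cong e ⟩
           sum (λ i → f i * x + h i) ≈⟨ sum-+ _ _ ⟩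
           sum (λ i → f i * x) + sum h ≈⟨ +-congʳ (sum-*ʳ x f) ⟨
           sum f * x + sum h ∎)
         ⊞ kill (- 1#) 1# (trans gu (trans uv (sym hv)))

    -- Under `E′` the `a† i` transform as a basis of the defining representation and the `X i` as
    -- the dual basis, so `P` is an invariant contraction; the same holds for `a i`, `Y i` and `Q`
    -- with the roles exchanged.
    hopping-commutes : ∀ x y → T * E′ x y ≈ E′ x y * T
    hopping-commutes x y = sym (begin
      E′ x y * (P + Q) ≈⟨ distribˡ _ _ _ ⟩
      E′ x y * P + E′ x y * Q ≈⟨ +-cong
        (cancel-sum _ _ _ (a† x * X y) (a† x * X y) (sum-δ x (λ i → a† i * X y)) (sum-δ y (λ i → a† x * X i)) refl (e′p x y))
        (cancel-sum _ _ _ (a y * Y x) (a y * Y x) (sum-δ x (λ i → a y * Y i)) (sum-δ y (λ i → a i * Y x)) refl (e′q x y)) ⟩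
      P * E′ x y + Q * E′ x y ≈⟨ distribʳ _ _ _ ⟨
      (P + Q) * E′ x y ∎)

    -- C is cancelled by the cross term of the Casimir element of the twisted action.
    C : A
    C = sum (λ i → sum (λ j → a† i * a j * E (suc j) (suc i)))

    private
      -- The `X i` commute while the `a† i` anticommute, so the terms (i, j) and (j, i) cancel. The
      -- square is taken twice because the ring need not admit division by 2.
      PP : P * P + P * P ≈ 0#
      PP = trans (sum-bracket _ _) (sum-0 (λ i → sum-0 (λ j → solve 4 (λ p q x y →
          p ⊗ x ⊗ (q ⊗ y) ⊕ q ⊗ y ⊗ (p ⊗ x) ⊝ O ⊜
          I ⊗ (p ⊡ q ⊝ O) ⊗ (x ⊗ y) ⊕ neg p ⊗ (q ⊟ x) ⊗ y
          ⊕ neg q ⊗ (p ⊟ y) ⊗ x ⊕ neg (q ⊗ p) ⊗ (x ⊟ y) ⊗ I)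
          ≡.refl (a† i) (a† j) (X i) (X j)
        by kill 1# (X i * X j) (a†a† i j) ⊞ kill (- a† i) (X j) (a†E j zero (suc i))
          ⊞ kill (- a† j) (X i) (a†E i zero (suc j)) ⊞ kill (- (a† j * a† i)) 1# (XX gl i j))))

      QQ : Q * Q + Q * Q ≈ 0#
      QQ = trans (sum-bracket _ _) (sum-0 (λ i → sum-0 (λ j → solve 4 (λ p q x y →
          p ⊗ x ⊗ (q ⊗ y) ⊕ q ⊗ y ⊗ (p ⊗ x) ⊝ O ⊜
          I ⊗ (p ⊡ q ⊝ O) ⊗ (x ⊗ y) ⊕ neg p ⊗ (q ⊟ x) ⊗ y
          ⊕ neg q ⊗ (p ⊟ y) ⊗ x ⊕ neg (q ⊗ p) ⊗ (x ⊟ y) ⊗ I)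
          ≡.refl (a i) (a j) (Y i) (Y j)
        by kill 1# (Y i * Y j) (aa i j) ⊞ kill (- a i) (Y j) (aE j (suc i) zero)
          ⊞ kill (- a j) (Y i) (aE i (suc j) zero) ⊞ kill (- (a j * a i)) 1# (YY gl i j))))

      -- Anticommuting `a j` with `a† i` leaves the diagonal terms `Y i * X i`. Commuting `X i` with
      -- `Y j` leaves `δ i j E₀₀`, the source of `N * E₀₀`, and the entry `E (suc j) (suc i)`, the
      -- source of `C`.
      PQ : P * Q + Q * P + C ≈ sum (λ i → Y i * X i) + N * E₀₀
      PQ = begin
        P * Q + Q * P + C
          ≈⟨ +-congʳ (sum-bracket _ _) ⟩
        sum (λ i → sum (λ j → a† i * X i * (a j * Y j) + a j * Y j * (a† i * X i))) + C
          ≈⟨ sum-sum-+ _ _ ⟨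
        sum (λ i → sum (λ j → a† i * X i * (a j * Y j) + a j * Y j * (a† i * X i) + a† i * a j * E (suc j) (suc i)))
          ≈⟨ sum-cong (λ i → sum-cong (λ j → pq i j)) ⟩
        sum (λ i → sum (λ j → δ i j * (Y j * X i + a† i * a j * E₀₀)))
          ≈⟨ sum-δδ _ ⟩
        sum (λ i → Y i * X i + a† i * a i * E₀₀)
          ≈⟨ sum-+ _ _ ⟩
        sum (λ i → Y i * X i) + sum (λ i → a† i * a i * E₀₀)
          ≈⟨ +-congˡ (sym (sum-*ʳ E₀₀ (λ i → a† i * a i))) ⟩
        sum (λ i → Y i * X i) + N * E₀₀ ∎
        where
        pq : ∀ i j → a† i * X i * (a j * Y j) + a j * Y j * (a† i * X i) + a† i * a j * E (suc j) (suc i)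
                   ≈ δ i j * (Y j * X i + a† i * a j * E₀₀)
        pq i j = solve 7 (λ p q x y e z d →
            p ⊗ x ⊗ (q ⊗ y) ⊕ q ⊗ y ⊗ (p ⊗ x) ⊕ p ⊗ q ⊗ e ⊝ d ⊗ (y ⊗ x ⊕ p ⊗ q ⊗ z) ⊜
            neg p ⊗ (q ⊟ x) ⊗ y ⊕ neg q ⊗ (p ⊟ y) ⊗ x
            ⊕ I ⊗ (q ⊡ p ⊝ d) ⊗ (y ⊗ x)
            ⊕ p ⊗ q ⊗ (x ⊗ y ⊕ e ⊝ (y ⊗ x ⊕ d ⊗ z)) ⊗ I
            ⊕ neg I ⊗ (d ⊗ (p ⊗ q) ⊝ p ⊗ q ⊗ d) ⊗ z)
            ≡.refl (a† i) (a j) (X i) (Y j) (E (suc j) (suc i)) E₀₀ (δ i j)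
          by kill (- a† i) (Y j) (aE j zero (suc i)) ⊞ kill (- a j) (X i) (a†E i (suc j) zero)
            ⊞ kill 1# (Y j * X i) (trans (aa† j i) (reflexive (δ-sym j i)))
            ⊞ kill (a† i * a j) 1# (XY gl i j)
            ⊞ kill (- 1#) E₀₀ (δ-central i j (a† i * a j))

    YX : A
    YX = sum (λ i → Y i * X i)

    hopping-square : T * T + T * T + (C + C) ≈ (YX + N * E₀₀) + (YX + N * E₀₀)
    hopping-square = solve 4 (λ p q c r →
      (p ⊕ q) ⊗ (p ⊕ q) ⊕ (p ⊕ q) ⊗ (p ⊕ q) ⊕ (c ⊕ c) ⊝ (r ⊕ r) ⊜
        I ⊗ (p ⊡ p ⊝ O) ⊗ I ⊕ I ⊗ (q ⊡ q ⊝ O) ⊗ I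
        ⊕ (I ⊕ I) ⊗ (p ⊡ q ⊕ c ⊝ r) ⊗ I) ≡.refl P Q C (YX + N * E₀₀)
      by kill 1# 1# PP ⊞ kill 1# 1# QQ ⊞ kill (1# + 1#) 1# PQ

    -- ∑N is n N.
    ∑N : A
    ∑N = sum {n} (λ _ → N)

    -- The two cross terms of the squared sum both equal `C`. The pure ghost part ∑ a†ᵢ aⱼ a†ⱼ aᵢ is
    -- n N + N - N², which explains the remaining terms.
    casimir-twist : casimir n E′ + N * N ≈ casimir n (λ i j → E (suc i) (suc j)) + (C + C) + ∑N + N
    casimir-twist = begin
      casimir n E′ + N * N
        ≈⟨ +-congˡ (sum-sum-* _ _) ⟩
      casimir n E′ + sum (λ i → sum (λ j → a† i * a i * (a† j * a j)))
        ≈⟨ sum-sum-+ _ _ ⟨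
      sum (λ i → sum (λ j → E′ i j * E′ j i + a† i * a i * (a† j * a j)))
        ≈⟨ sum-cong (λ i → sum-cong (λ j → summand i j)) ⟩
      sum (λ i → sum (λ j → Eₛ i j * Eₛ j i + a† i * a j * Eₛ j i + a† j * a i * Eₛ i j + a† i * a i + δ i j * (a† i * a j)))
        ≈⟨ trans (sum-sum-+ _ _) (+-congʳ (trans (sum-sum-+ _ _) (+-congʳ (trans (sum-sum-+ _ _) (+-congʳ (sum-sum-+ _ _)))))) ⟩
      casimir n Eₛ + C + sum (λ i → sum (λ j → a† j * a i * Eₛ i j))
        + sum (λ i → sum {n} (λ j → a† i * a i)) + sum (λ i → sum (λ j → δ i j * (a† i * a j)))
        ≈⟨ +-cong (+-cong (+-congˡ (sum-swap _)) (sum-swap _)) (sum-δδ _) ⟩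
      casimir n Eₛ + C + C + ∑N + N
        ≈⟨ solve 4 (λ c d e f → c ⊕ d ⊕ d ⊕ e ⊕ f ⊜ c ⊕ (d ⊕ d) ⊕ e ⊕ f) ≡.refl _ _ _ _ ⟩
      casimir n Eₛ + (C + C) + ∑N + N ∎
      where
      Eₛ : Fin n → Fin n → A
      Eₛ i j = E (suc i) (suc j)
      summand : ∀ i j → E′ i j * E′ j i + a† i * a i * (a† j * a j)
        ≈ Eₛ i j * Eₛ j i + a† i * a j * Eₛ j i + a† j * a i * Eₛ i j + a† i * a i + δ i j * (a† i * a j)
      summand i j = solve 7 (λ e f p q r s d →
        (e ⊕ p ⊗ s) ⊗ (f ⊕ r ⊗ q) ⊕ p ⊗ q ⊗ (r ⊗ s)
            ⊝ (e ⊗ f ⊕ p ⊗ s ⊗ f ⊕ r ⊗ q ⊗ e ⊕ p ⊗ q ⊕ d ⊗ (p ⊗ s)) ⊜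
          neg I ⊗ (r ⊟ e) ⊗ q ⊕ neg r ⊗ (q ⊟ e) ⊗ I
          ⊕ p ⊗ (s ⊡ r ⊝ I) ⊗ q
          ⊕ p ⊗ (q ⊡ r ⊝ d) ⊗ s
          ⊕ neg (p ⊗ r) ⊗ (q ⊡ s ⊝ O) ⊗ I
          ⊕ neg I ⊗ (d ⊟ p) ⊗ s)
          ≡.refl (Eₛ i j) (Eₛ j i) (a† i) (a i) (a† j) (a j) (δ i j)
        by kill (- 1#) (a i) (a†E j (suc i) (suc j)) ⊞ kill (- a† j) 1# (aE i (suc i) (suc j))
          ⊞ kill (a† i) (a i) (trans (aa† j j) (δ-diag j))
          ⊞ kill (a† i) (a j) (aa† i j)
          ⊞ kill (- (a† i * a† j)) 1# (aa i j)
          ⊞ kill (- 1#) (a j) (δ-central i j (a† i))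

    N-comm : N * E₀₀ ≈ E₀₀ * N
    N-comm = sym (sum-comm _ (λ i → solve 3 (λ e p q → e ⊗ (p ⊗ q) ⊝ p ⊗ q ⊗ e ⊜
        neg I ⊗ (p ⊟ e) ⊗ q ⊕ neg p ⊗ (q ⊟ e) ⊗ I) ≡.refl E₀₀ (a† i) (a i)
      by kill (- 1#) (a i) (a†E i zero zero) ⊞ kill (- a† i) 1# (aE i zero zero)))

  CAR-injection : ∀ {m k} {a a† : Fin m → A} (f : Fin k → Fin m) →
    (∀ i j → δ (f i) (f j) ≡ δ i j) → CAR a a† → CAR (a ∘ f) (a† ∘ f)
  CAR-injection f inj car = record
    { aa = λ i j → aa (f i) (f j) ; a†a† = λ i j → a†a† (f i) (f j)
    ; aa† = λ i j → trans (aa† (f i) (f j)) (reflexive (inj i j)) }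
    where open CAR car

  δ-↑ˡ : ∀ {n} m (i j : Fin n) → δ (i ↑ˡ m) (j ↑ˡ m) ≡ δ i j
  δ-↑ˡ m zero zero = ≡.refl
  δ-↑ˡ m zero (suc j) = ≡.refl
  δ-↑ˡ m (suc i) zero = ≡.refl
  δ-↑ˡ m (suc i) (suc j) = δ-↑ˡ m i j

  δ-↑ʳ : ∀ {m} n (i j : Fin m) → δ (n ↑ʳ i) (n ↑ʳ j) ≡ δ i j
  δ-↑ʳ zero i j = ≡.refl
  δ-↑ʳ (suc n) i j = δ-↑ʳ n i j

  δ-↑ˡʳ : ∀ {n m} (i : Fin n) (j : Fin m) → δ (i ↑ˡ m) (n ↑ʳ j) ≡ 0#
  δ-↑ˡʳ zero j = ≡.refl
  δ-↑ˡʳ (suc i) j = δ-↑ˡʳ i j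

  record System n (a a† : Fin (tri n) → A) (E : Fin n → Fin n → A) : Set (c Level.⊔ ℓ) where
    field
      car : CAR a a†
      gl : IsGL E
      aE : Commute a E
      a†E : Commute a† E

  -- An element that anticommutes with all ghosts commutes with the bilinear `a† x * a y`, hence
  -- with the twisted action. The hypotheses therefore pass to the tail, and the induction goes
  -- through.
  dirac-anticomm : ∀ n {t} (a a† : Fin (tri n) → A) E →
    (∀ i → t * a i + a i * t ≈ 0#) → (∀ i → t * a† i + a† i * t ≈ 0#) →
    (∀ x y → t * E x y ≈ E x y * t) → t * dirac n a a† E + dirac n a a† E * t ≈ 0#
  dirac-anticomm zero a a† E ta ta† tE = trans (+-cong (zeroʳ _) (zeroˡ _)) (+-identityʳ 0#)
  dirac-anticomm (suc n) {t} a a† E ta ta† tE =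
    solve 4 (λ t p q r → t ⊗ (p ⊕ q ⊕ r) ⊕ (p ⊕ q ⊕ r) ⊗ t ⊝ O ⊜
        I ⊗ (t ⊡ p ⊝ O) ⊗ I ⊕ I ⊗ (t ⊡ q ⊝ O) ⊗ I ⊕ I ⊗ (t ⊡ r ⊝ O) ⊗ I)
        ≡.refl t _ _ _
      by kill 1# 1# (sum-anticomm _ (λ i → anti (ta† (i ↑ˡ tri n)) (tE zero (suc i))))
        ⊞ kill 1# 1# (sum-anticomm _ (λ i → anti (ta (i ↑ˡ tri n)) (tE (suc i) zero)))
        ⊞ kill 1# 1# (dirac-anticomm n (rest n a) (rest n a†) (twist (top n a) (top n a†) E)
          (λ i → ta (n ↑ʳ i)) (λ i → ta† (n ↑ʳ i)) twist-comm)
    where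
    anti : ∀ {b e} → t * b + b * t ≈ 0# → t * e ≈ e * t → t * (b * e) + b * e * t ≈ 0#
    anti {b} {e} p q = solve 3 (λ t b e → t ⊗ (b ⊗ e) ⊕ b ⊗ e ⊗ t ⊝ O ⊜
        I ⊗ (t ⊡ b ⊝ O) ⊗ e ⊕ neg b ⊗ (t ⊟ e) ⊗ I) ≡.refl t b e
      by kill 1# e p ⊞ kill (- b) 1# q
    twist-comm : ∀ x y → t * twist (top n a) (top n a†) E x y ≈ twist (top n a) (top n a†) E x y * t
    twist-comm x y = solve 4 (λ t e p q → t ⊗ (e ⊕ p ⊗ q) ⊝ (e ⊕ p ⊗ q) ⊗ t ⊜
        I ⊗ (t ⊟ e) ⊗ I ⊕ I ⊗ (t ⊡ p ⊝ O) ⊗ q ⊕ neg p ⊗ (t ⊡ q ⊝ O) ⊗ I)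
        ≡.refl t (E (suc x) (suc y)) (top n a† x) (top n a y)
      by kill 1# 1# (tE (suc x) (suc y)) ⊞ kill 1# (top n a y) (ta† (x ↑ˡ tri n))
        ⊞ kill (- top n a† x) 1# (ta (y ↑ˡ tri n))

  -- Each ghost carries the weight of a root, whose coordinates add up to 0.
  sum-weight : ∀ n (a a† : Fin (tri n) → A) E → sum (weight n a a† E) ≈ sum (λ i → E i i)
  sum-weight zero a a† E = trans (sum-0 (λ ())) (sym (sum-0 (λ ())))
  sum-weight (suc n) a a† E = begin
    sum (weight (suc n) a a† E) ≈⟨ sum-suc _ ⟩
    E zero zero - N + sum (weight n (rest n a) (rest n a†) (twist (top n a) (top n a†) E))
      ≈⟨ +-congˡ (trans (sum-weight n (rest n a) (rest n a†) (twist (top n a) (top n a†) E)) (sum-+ _ _)) ⟩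
    E zero zero - N + (sum (λ i → E (suc i) (suc i)) + N)
      ≈⟨ solve 3 (λ p q r → p ⊝ q ⊕ (r ⊕ q) ⊜ p ⊕ r) ≡.refl _ _ _ ⟩
    E zero zero + sum (λ i → E (suc i) (suc i)) ≈⟨ sum-suc _ ⟨
    sum (λ i → E i i) ∎
    where
    N : A
    N = sum (λ i → top n a† i * top n a i)

  module SystemStep {n} {a a† : Fin (tri (suc n)) → A} {E} (S : System (suc n) a a† E) where

    open System S
    open CAR car

    car-top : CAR (top n a) (top n a†)
    car-top = CAR-injection (_↑ˡ tri n) (δ-↑ˡ (tri n)) car

    open Step car-top gl (λ i → aE (i ↑ˡ tri n)) (λ i → a†E (i ↑ˡ tri n)) public

    tail-system : System n (rest n a) (rest n a†) E′
    tail-system = record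
      { car = CAR-injection (n ↑ʳ_) (δ-↑ʳ n) car
      ; gl = twist-GL
      ; aE = λ i x y → comm (aE (n ↑ʳ i) (suc x) (suc y))
        (trans (aa† (n ↑ʳ i) (x ↑ˡ tri n)) (reflexive (≡.trans (δ-sym (n ↑ʳ i) (x ↑ˡ tri n)) (δ-↑ˡʳ x i))))
        (aa (n ↑ʳ i) (y ↑ˡ tri n))
      ; a†E = λ i x y → comm (a†E (n ↑ʳ i) (suc x) (suc y)) (a†a† (n ↑ʳ i) (x ↑ˡ tri n))
        (trans (+-comm _ _) (trans (aa† (y ↑ˡ tri n) (n ↑ʳ i)) (reflexive (δ-↑ˡʳ y i))))
      }
      where
      comm : ∀ {b e p q} → b * e ≈ e * b → b * p + p * b ≈ 0# → b * q + q * b ≈ 0# →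
             b * (e + p * q) ≈ (e + p * q) * b
      comm {b} {e} {p} {q} x y z = solve 4 (λ b e p q → b ⊗ (e ⊕ p ⊗ q) ⊝ (e ⊕ p ⊗ q) ⊗ b ⊜
          I ⊗ (b ⊟ e) ⊗ I ⊕ I ⊗ (b ⊡ p ⊝ O) ⊗ q ⊕ neg p ⊗ (b ⊡ q ⊝ O) ⊗ I)
          ≡.refl b e p q
        by kill 1# 1# x ⊞ kill 1# q y ⊞ kill (- p) 1# z

    hopping-anticommutes : T * dirac n (rest n a) (rest n a†) E′ + dirac n (rest n a) (rest n a†) E′ * T ≈ 0#
    hopping-anticommutes = dirac-anticomm n (rest n a) (rest n a†) E′
      (λ i → trans (+-comm _ _) (anti-T
        (λ j → trans (aa† (n ↑ʳ i) (j ↑ˡ tri n)) (reflexive (≡.trans (δ-sym (n ↑ʳ i) (j ↑ˡ tri n)) (δ-↑ˡʳ j i))))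
        (λ j → aa (n ↑ʳ i) (j ↑ˡ tri n)) (aE (n ↑ʳ i))))
      (λ i → trans (+-comm _ _) (anti-T
        (λ j → a†a† (n ↑ʳ i) (j ↑ˡ tri n))
        (λ j → trans (+-comm _ _) (trans (aa† (j ↑ˡ tri n) (n ↑ʳ i)) (reflexive (δ-↑ˡʳ j i)))) (a†E (n ↑ʳ i))))
      hopping-commutes
      where
      anti : ∀ {b p e} → b * p + p * b ≈ 0# → b * e ≈ e * b → b * (p * e) + p * e * b ≈ 0#
      anti {b} {p} {e} x y = solve 3 (λ b p e → b ⊗ (p ⊗ e) ⊕ p ⊗ e ⊗ b ⊝ O ⊜
          I ⊗ (b ⊡ p ⊝ O) ⊗ e ⊕ neg p ⊗ (b ⊟ e) ⊗ I) ≡.refl b p e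
        by kill 1# e x ⊞ kill (- p) 1# y
      anti-T : ∀ {b} → (∀ j → b * top n a† j + top n a† j * b ≈ 0#) →
        (∀ j → b * top n a j + top n a j * b ≈ 0#) → (∀ x y → b * E x y ≈ E x y * b) →
               b * T + T * b ≈ 0#
      anti-T {b} x y z = solve 3 (λ b p q → b ⊗ (p ⊕ q) ⊕ (p ⊕ q) ⊗ b ⊝ O ⊜
          I ⊗ (b ⊡ p ⊝ O) ⊗ I ⊕ I ⊗ (b ⊡ q ⊝ O) ⊗ I) ≡.refl b P Q
        by kill 1# 1# (sum-anticomm _ (λ j → anti (x j) (z zero (suc j))))
          ⊞ kill 1# 1# (sum-anticomm _ (λ j → anti (y j) (z (suc j) zero)))

  -- Kostant's formula with denominators cleared. `D` is `T` plus the tail operator, and the two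
  -- anticommute, so their squares add. The `C` of `hopping-square` cancels against the cross terms
  -- of the twisted Casimir element, and the terms `N * E₀₀` and `N * N` complete the square of the
  -- weight `E₀₀ − N`; the multiples of `N` that are left are absorbed by `differences`, with
  -- `sum-weight` evaluating the tail.
  dirac-square : ∀ n {a a† : Fin (tri n) → A} {E} → System n a a† E →
    dirac n a a† E * dirac n a a† E + dirac n a a† E * dirac n a a† E
      + squares n (weight n a a† E) + differences n (weight n a a† E)
    ≈ casimir n E
  dirac-square zero S = trans (+-congʳ (+-congˡ (sum-0 (λ ())))) (trans
    (solve 0 (O ⊡ O ⊕ O ⊕ O ⊜ O) ≡.refl) (sym (sum-0 (λ ()))))
  dirac-square (suc n) {a} {a†} {E} S =
    trans (+-cong (+-congˡ (sum-suc _)) (+-congʳ (trans (sum-const-sub _ _)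
      (+-cong (sum-const-sub _ _) (-‿cong (trans (sum-weight n (rest n a) (rest n a†) E′) (sum-+ _ _)))))))
    (trans
    (solve 13 (λ t d e nn ee c yx en nnn s w ct cas →
      (t ⊕ d) ⊗ (t ⊕ d) ⊕ (t ⊕ d) ⊗ (t ⊕ d) ⊕ ((e ⊝ nn) ⊗ (e ⊝ nn) ⊕ s) ⊕ ((en ⊝ nnn ⊝ (ee ⊕ nn)) ⊕ w)
          ⊝ (e ⊗ e ⊕ (en ⊝ ee) ⊕ (yx ⊕ yx) ⊕ cas) ⊜
        I ⊗ (t ⊡ t ⊕ (c ⊕ c) ⊝ (yx ⊕ nn ⊗ e ⊕ (yx ⊕ nn ⊗ e))) ⊗ I
        ⊕ (I ⊕ I) ⊗ (t ⊡ d ⊝ O) ⊗ I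
        ⊕ I ⊗ (d ⊡ d ⊕ s ⊕ w ⊝ ct) ⊗ I
        ⊕ I ⊗ (ct ⊕ nn ⊗ nn ⊝ (cas ⊕ (c ⊕ c) ⊕ nnn ⊕ nn)) ⊗ I
        ⊕ I ⊗ (nn ⊟ e) ⊗ I)
        ≡.refl T (dirac n (rest n a) (rest n a†) E′) E₀₀ N (sum (λ i → E (suc i) (suc i))) C YX
          (sum {n} (λ _ → E₀₀)) ∑N _ _ (casimir n E′) (casimir n (λ i j → E (suc i) (suc j)))
      by kill 1# 1# hopping-square ⊞ kill (1# + 1#) 1# hopping-anticommutes
        ⊞ kill 1# 1# (dirac-square n tail-system)
        ⊞ kill 1# 1# casimir-twist ⊞ kill 1# 1# N-comm)
    (sym (trans (casimir-suc (System.gl S)) (+-congʳ (+-congʳ (+-congˡ (sum-const-sub _ _)))))))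
    where open SystemStep S

-- Second quantisation of one-particle matrices

module SecondQuantization {c ℓ} (R : Ring c ℓ) where

  open Ring R hiding (zero) renaming (Carrier to A)
  open NCRingSolver R
  open DiracOperator R
  open import Data.Fin.Base using (Fin; zero)
  open import Data.Nat.Base using (ℕ)
  import Level
  open import Relation.Binary.PropositionalEquality as ≡ using (_≡_)
  open import Relation.Binary.Reasoning.Setoid setoid

  Matrix : ℕ → Set c
  Matrix m = Fin m → Fin m → A

  -- Matrix entries are taken from the operator ring itself; centrality is what makes them behave as
  -- scalars.
  Central : ∀ {m} → Matrix m → Set (c Level.⊔ ℓ)
  Central M = ∀ s t x → M s t * x ≈ x * M s t

  sum² : ∀ {m} → Matrix m → A
  sum² f = sum (λ s → sum (f s))

  sum²-cong : ∀ {m} {f g : Matrix m} → (∀ s t → f s t ≈ g s t) → sum² f ≈ sum² g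
  sum²-cong e = sum-cong (λ s → sum-cong (e s))

  sum²-*ˡ : ∀ {m} x (f : Matrix m) → x * sum² f ≈ sum² (λ s t → x * f s t)
  sum²-*ˡ x f = trans (sum-*ˡ x _) (sum-cong (λ s → sum-*ˡ x (f s)))

  sum²-*ʳ : ∀ {m} x (f : Matrix m) → sum² f * x ≈ sum² (λ s t → f s t * x)
  sum²-*ʳ x f = trans (sum-*ʳ x _) (sum-cong (λ s → sum-*ʳ x (f s)))

  sum²-swap : ∀ {m} (f : Fin m → Fin m → Fin m → Fin m → A) →
              sum² (λ s t → sum² (f s t)) ≈ sum² (λ u v → sum² (λ s t → f s t u v))
  sum²-swap f = begin
    sum (λ s → sum (λ t → sum (λ u → sum (λ v → f s t u v))))
      ≈⟨ sum-cong (λ s → sum-swap (λ t u → sum (f s t u))) ⟩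
    sum (λ s → sum (λ u → sum (λ t → sum (λ v → f s t u v))))
      ≈⟨ sum-cong (λ s → sum-cong (λ u → sum-swap (λ t v → f s t u v))) ⟩
    sum (λ s → sum (λ u → sum (λ v → sum (λ t → f s t u v))))
      ≈⟨ sum-swap (λ s u → sum (λ v → sum (λ t → f s t u v))) ⟩
    sum (λ u → sum (λ s → sum (λ v → sum (λ t → f s t u v))))
      ≈⟨ sum-cong (λ u → sum-swap (λ s v → sum (λ t → f s t u v))) ⟩
    sum (λ u → sum (λ v → sum (λ s → sum (λ t → f s t u v)))) ∎

  module _ {m} {a a† : Fin m → A} (car : CAR a a†) where

    open CAR car

    dΓ : Matrix m → A
    dΓ M = sum² (λ s t → M s t * (a† s * a t))

    dΓ-+ : ∀ M M′ → dΓ (λ s t → M s t + M′ s t) ≈ dΓ M + dΓ M′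
    dΓ-+ M M′ = trans (sum²-cong (λ s t → distribʳ _ _ _)) (sum-sum-+ _ _)

    dΓ-cong : ∀ {M M′ : Matrix m} → (∀ s t → M s t ≈ M′ s t) → dΓ M ≈ dΓ M′
    dΓ-cong e = sum²-cong (λ s t → *-congʳ (e s t))

    dΓ-* : ∀ x M → x * dΓ M ≈ dΓ (λ s t → x * M s t)
    dΓ-* x M = trans (sum²-*ˡ x _) (sum²-cong (λ s t → sym (*-assoc x (M s t) _)))

    _·_ : Matrix m → Matrix m → Matrix m
    (M · M′) s t = sum (λ u → M s u * M′ u t)

    quartic : (Fin m → Fin m → Fin m → Fin m → A) → A
    quartic Q = sum² (λ s t → sum² (λ u v → Q s t u v * (a† s * a† u * (a v * a t))))

    -- Normal ordering: the single contraction of `a t` with `a† u` produces the matrix product, and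
    -- what is left over is the two-body part.
    dΓ-product : ∀ {M M′ : Matrix m} → Central M′ →
                 dΓ M * dΓ M′ ≈ dΓ (M · M′) + quartic (λ s t u v → M s t * M′ u v)
    dΓ-product {M} {M′} central = begin
      dΓ M * dΓ M′
        ≈⟨ sum²-*ʳ (dΓ M′) _ ⟩
      sum² (λ s t → M s t * (a† s * a t) * dΓ M′)
        ≈⟨ sum²-cong (λ s t → sum²-*ˡ (M s t * (a† s * a t)) _) ⟩
      sum² (λ s t → sum² (λ u v → M s t * (a† s * a t) * (M′ u v * (a† u * a v))))
        ≈⟨ sum²-cong (λ s t → sum²-cong (λ u v → reorder s t u v)) ⟩
      sum² (λ s t → sum² (λ u v → δ t u * (M s t * M′ u v * (a† s * a v)) + M s t * M′ u v * (a† s * a† u * (a v * a t))))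
        ≈⟨ sum²-cong (λ s t → sum-sum-+ _ _) ⟩
      sum² (λ s t → sum² (λ u v → δ t u * (M s t * M′ u v * (a† s * a v))) + sum² (λ u v → M s t * M′ u v * (a† s * a† u * (a v * a t))))
        ≈⟨ sum-sum-+ _ _ ⟩
      sum² (λ s t → sum² (λ u v → δ t u * (M s t * M′ u v * (a† s * a v)))) + quartic (λ s t u v → M s t * M′ u v)
        ≈⟨ +-congʳ (sum-cong contract) ⟩
      dΓ (M · M′) + quartic (λ s t u v → M s t * M′ u v) ∎
      where
      reorder : ∀ s t u v → M s t * (a† s * a t) * (M′ u v * (a† u * a v))
              ≈ δ t u * (M s t * M′ u v * (a† s * a v)) + M s t * M′ u v * (a† s * a† u * (a v * a t))
      reorder s t u v = solve 7 (λ d m n s† t u† v →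
          m ⊗ (s† ⊗ t) ⊗ (n ⊗ (u† ⊗ v)) ⊝ (d ⊗ (m ⊗ n ⊗ (s† ⊗ v)) ⊕ m ⊗ n ⊗ (s† ⊗ u† ⊗ (v ⊗ t))) ⊜
          neg m ⊗ (n ⊗ (s† ⊗ t) ⊝ s† ⊗ t ⊗ n) ⊗ (u† ⊗ v)
          ⊕ m ⊗ n ⊗ s† ⊗ (t ⊡ u† ⊝ d) ⊗ v
          ⊕ neg (m ⊗ n ⊗ s† ⊗ u†) ⊗ (t ⊡ v ⊝ O) ⊗ I
          ⊕ neg I ⊗ (d ⊗ (m ⊗ n ⊗ s†) ⊝ m ⊗ n ⊗ s† ⊗ d) ⊗ v)
          ≡.refl (δ t u) (M s t) (M′ u v) (a† s) (a t) (a† u) (a v)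
        by kill (- M s t) (a† u * a v) (central u v (a† s * a t))
          ⊞ kill (M s t * M′ u v * a† s) (a v) (aa† t u)
          ⊞ kill (- (M s t * M′ u v * a† s * a† u)) 1# (aa t v)
          ⊞ kill (- 1#) (a v) (δ-central t u _)
      contract : ∀ s → sum (λ t → sum² (λ u v → δ t u * (M s t * M′ u v * (a† s * a v))))
                     ≈ sum (λ v → (M · M′) s v * (a† s * a v))
      contract s = begin
        sum (λ t → sum (λ u → sum (λ v → δ t u * (M s t * M′ u v * (a† s * a v)))))
          ≈⟨ sum²-cong (λ t u → sym (sum-*ˡ (δ t u) _)) ⟩
        sum (λ t → sum (λ u → δ t u * sum (λ v → M s t * M′ u v * (a† s * a v))))
          ≈⟨ sum-δδ _ ⟩
        sum (λ t → sum (λ v → M s t * M′ t v * (a† s * a v)))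
          ≈⟨ sum-swap _ ⟩
        sum (λ v → sum (λ t → M s t * M′ t v * (a† s * a v)))
          ≈⟨ sum-cong (λ v → sum-*ʳ _ _) ⟨
        sum (λ v → (M · M′) s v * (a† s * a v)) ∎

    -- Exchanging the index pairs transposes the two creators and the two annihilators, and the
    -- signs cancel. Hence the two-body parts drop out of a commutator of one-body operators, which
    -- is why `dΓ` preserves the relations of 𝔤𝔩ₙ.
    quartic-sym : ∀ {M M′ : Matrix m} → Central M →
                  quartic (λ s t u v → M s t * M′ u v) ≈ quartic (λ s t u v → M′ s t * M u v)
    quartic-sym {M} {M′} central = trans
      (sum²-cong (λ s t → sum²-cong (λ u v → flip s t u v))) (sum²-swap _)
      where
      flip : ∀ s t u v → M s t * M′ u v * (a† s * a† u * (a v * a t))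
                       ≈ M′ u v * M s t * (a† u * a† s * (a t * a v))
      flip s t u v = solve 6 (λ m n p q x y →
          m ⊗ n ⊗ (p ⊗ q ⊗ (x ⊗ y)) ⊝ n ⊗ m ⊗ (q ⊗ p ⊗ (y ⊗ x)) ⊜
          I ⊗ (m ⊟ n) ⊗ (p ⊗ q ⊗ (x ⊗ y))
          ⊕ n ⊗ m ⊗ (p ⊡ q ⊝ O) ⊗ (x ⊗ y)
          ⊕ neg (n ⊗ m ⊗ q ⊗ p) ⊗ (x ⊡ y ⊝ O) ⊗ I)
          ≡.refl (M s t) (M′ u v) (a† s) (a† u) (a v) (a t)
        by kill 1# (a† s * a† u * (a v * a t)) (central s t (M′ u v))
          ⊞ kill (M′ u v * M s t) (a v * a t) (a†a† s u)
          ⊞ kill (- (M′ u v * M s t * a† u * a† s)) 1# (aa v t)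

    dΓ-GL : ∀ {n} (M : Fin n → Fin n → Matrix m) → (∀ x y → Central (M x y)) →
      (∀ x y i j s t → (M x y · M i j) s t + δ x j * M i y s t ≈ (M i j · M x y) s t + δ y i * M x j s t) →
      IsGL (λ x y → dΓ (M x y))
    dΓ-GL M central rel x y i j = begin
      dΓ (M x y) * dΓ (M i j) + δ x j * dΓ (M i y)
        ≈⟨ +-cong (dΓ-product (central i j)) (dΓ-* _ _) ⟩
      dΓ (M x y · M i j) + quartic (λ s t u v → M x y s t * M i j u v) + dΓ (λ s t → δ x j * M i y s t)
        ≈⟨ solve 3 (λ p q r → p ⊕ q ⊕ r ⊜ p ⊕ r ⊕ q) ≡.refl _ _ _ ⟩
      dΓ (M x y · M i j) + dΓ (λ s t → δ x j * M i y s t) + quartic (λ s t u v → M x y s t * M i j u v)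
        ≈⟨ +-cong (trans (sym (dΓ-+ _ _)) (trans (dΓ-cong (rel x y i j)) (dΓ-+ _ _))) (quartic-sym {M x y} {M i j} (central x y)) ⟩
      dΓ (M i j · M x y) + dΓ (λ s t → δ y i * M x j s t) + quartic (λ s t u v → M i j s t * M x y u v)
        ≈⟨ solve 3 (λ p q r → p ⊕ q ⊕ r ⊜ p ⊕ r ⊕ q) ≡.refl _ _ _ ⟩
      dΓ (M i j · M x y) + quartic (λ s t u v → M i j s t * M x y u v) + dΓ (λ s t → δ y i * M x j s t)
        ≈⟨ +-cong (dΓ-product (central x y)) (dΓ-* _ _) ⟨
      dΓ (M i j) * dΓ (M x y) + δ y i * dΓ (M x j) ∎

    dΓ-commute : ∀ {M : Matrix m} x → Central M → (∀ s → x * a s + a s * x ≈ 0#) →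
      (∀ s → x * a† s + a† s * x ≈ 0#) → x * dΓ M ≈ dΓ M * x
    dΓ-commute {M} x central xa xa† = sum-comm (λ s → sum (λ t → M s t * (a† s * a t))) (λ s → sum-comm (λ t → M s t * (a† s * a t)) (λ t → solve 4 (λ x m p q →
        x ⊗ (m ⊗ (p ⊗ q)) ⊝ m ⊗ (p ⊗ q) ⊗ x ⊜
        neg I ⊗ (m ⊟ x) ⊗ (p ⊗ q) ⊕ m ⊗ (x ⊡ p ⊝ O) ⊗ q
        ⊕ neg (m ⊗ p) ⊗ (x ⊡ q ⊝ O) ⊗ I) ≡.refl x (M s t) (a† s) (a t)
      by kill (- 1#) (a† s * a t) (central s t x) ⊞ kill (M s t) (a t) (xa† s)
        ⊞ kill (- (M s t * a† s)) 1# (xa t)))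

open import Data.Bool.Base using (true; false; Bool; not; _xor_)
import Data.Bool.Properties as Bool
open import Data.Fin.Base using (Fin; zero; suc; _↑ˡ_; _↑ʳ_)
import Data.Fin.Properties as Fin
open import Data.Integer.Base as ℤ using (ℤ; 0ℤ; 1ℤ)
open import Data.Integer.Properties as ℤ hiding (_≟_; _<?_; _≤?_)
open import Data.Integer.Tactic.RingSolver using (solve-∀)
open import Data.List.Base as List using (List; []; _∷_; concatMap; length; allFin; replicate)
open import Data.List.Membership.Propositional using (_∈_)
open import Data.List.Membership.Propositional.Properties using (∈-++⁺ˡ; ∈-++⁺ʳ; ∈-map⁺; ∈-map⁻; ∈-allFin; ∈-filter⁻; ∈-filter⁺)
import Data.List.Properties as List
open import Data.List.Relation.Binary.Pointwise using (Pointwise; []; _∷_)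
open import Data.List.Relation.Unary.All as All using ([]; All; _∷_)
import Data.List.Relation.Unary.All.Properties as All
open import Data.List.Relation.Unary.AllPairs using (_∷_; [])
open import Data.List.Relation.Unary.Any using (here; there)
open import Data.List.Relation.Unary.Linked using (Linked; []; [-]; _∷_; linked?)
open import Data.List.Relation.Unary.Unique.Propositional using (Unique)
import Data.List.Relation.Unary.Unique.Propositional.Properties as Unique
open import Data.Nat.Base as ℕ using (ℕ; zero; suc; z≤n; s≤s; _∸_)
import Data.Nat.Properties as ℕ
open import Data.Product.Base using (_×_; _,_; proj₁; proj₂; Σ)
open import Data.Sum.Base using (inj₁; inj₂; _⊎_; [_,_]′)
open import Data.Vec.Base using ([]; _∷_)
open import Data.Vec.Properties using (lookup∘updateAt; lookup∘updateAt′)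
open import Function.Base using (_∘_)
open import Relation.Binary.Definitions using (DecidableEquality)
open import Relation.Binary.PropositionalEquality
open import Relation.Nullary using (Dec; yes; no; ¬_; contradiction; ¬?)
open import Relation.Nullary.Decidable using (_×-dec_; _⊎-dec_)
open import Relation.Unary using (Decidable)
open ≡-Reasoning

-- Integer identities and finite sums over lists

module IntegerIdentities where

  open import Algebra.Properties.CommutativeSemigroup *-commutativeSemigroup public
    using () renaming (x∙yz≈y∙xz to *-swapˡ; interchange to *-interchange)
  open import Algebra.Properties.CommutativeSemigroup +-commutativeSemigroup public
    using () renaming (interchange to +-interchange)
  open import Data.Integer.Base using (_+_; _*_; -_; _-_)

  *-swap-assoc : ∀ x y z → x * (y * z) ≡ y * x * z
  *-swap-assoc = solve-∀

  *-minusˡ : ∀ x y z → x * y - x * z ≡ x * (y - z)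
  *-minusˡ = solve-∀

  *-minusʳ : ∀ x y z → x * z - y * z ≡ (x - y) * z
  *-minusʳ = solve-∀

  neg-linear : ∀ x y z → - (x * y + z) ≡ x * - y + - z
  neg-linear = solve-∀

  x≡x+y-y : ∀ x y → x ≡ x + y - y
  x≡x+y-y = solve-∀

  x+y-x≡y : ∀ x y → x + y - x ≡ y
  x+y-x≡y = solve-∀

  y≡x+y-x : ∀ x y → y ≡ x + y - x
  y≡x+y-x = solve-∀

open IntegerIdentities

module ListSums where

  open import Data.Integer.Base using (_+_; _*_; -_; _≤_) renaming (+_ to pos)
  open import Data.List.Base using (_++_; map)
  open import Defs using (count)

  private variable A B : Set

  ∑ : List A → (A → ℤ) → ℤ
  ∑ [] f = 0ℤ
  ∑ (x ∷ xs) f = f x + ∑ xs f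

  ∑-cong∈ : ∀ (xs : List A) {f g : A → ℤ} → (∀ {x} → x ∈ xs → f x ≡ g x) → ∑ xs f ≡ ∑ xs g
  ∑-cong∈ [] e = refl
  ∑-cong∈ (x ∷ xs) e = cong₂ _+_ (e (here refl)) (∑-cong∈ xs (e ∘ there))

  ∑-cong : ∀ (xs : List A) {f g : A → ℤ} → (∀ x → f x ≡ g x) → ∑ xs f ≡ ∑ xs g
  ∑-cong xs e = ∑-cong∈ xs (λ {x} _ → e x)

  ∑-0 : ∀ (xs : List A) {f : A → ℤ} → (∀ {x} → x ∈ xs → f x ≡ 0ℤ) → ∑ xs f ≡ 0ℤ
  ∑-0 [] e = refl
  ∑-0 (x ∷ xs) e = trans (cong₂ _+_ (e (here refl)) (∑-0 xs (e ∘ there))) refl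

  ∑-+ : ∀ (xs : List A) (f g : A → ℤ) → ∑ xs (λ x → f x + g x) ≡ ∑ xs f + ∑ xs g
  ∑-+ [] f g = refl
  ∑-+ (x ∷ xs) f g = trans (cong ((f x + g x) +_) (∑-+ xs f g)) (+-interchange (f x) (g x) _ _)

  ∑-*ˡ : ∀ (xs : List A) z (f : A → ℤ) → ∑ xs (λ x → z * f x) ≡ z * ∑ xs f
  ∑-*ˡ [] z f = sym (*-zeroʳ z)
  ∑-*ˡ (x ∷ xs) z f = trans (cong (z * f x +_) (∑-*ˡ xs z f)) (sym (*-distribˡ-+ z (f x) _))

  ∑-*ʳ : ∀ (xs : List A) z (f : A → ℤ) → ∑ xs (λ x → f x * z) ≡ ∑ xs f * z
  ∑-*ʳ xs z f = trans (∑-cong xs (λ x → *-comm (f x) z)) (trans (∑-*ˡ xs z f) (*-comm z _))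

  ∑-neg : ∀ (xs : List A) (f : A → ℤ) → ∑ xs (λ x → - f x) ≡ - ∑ xs f
  ∑-neg [] f = refl
  ∑-neg (x ∷ xs) f = trans (cong (- f x +_) (∑-neg xs f)) (sym (neg-distrib-+ (f x) _))

  ∑-++ : ∀ (xs ys : List A) f → ∑ (xs ++ ys) f ≡ ∑ xs f + ∑ ys f
  ∑-++ [] ys f = sym (+-identityˡ _)
  ∑-++ (x ∷ xs) ys f = trans (cong (f x +_) (∑-++ xs ys f)) (sym (+-assoc (f x) _ _))

  ∑-map : ∀ (g : A → B) xs f → ∑ (map g xs) f ≡ ∑ xs (f ∘ g)
  ∑-map g [] f = refl
  ∑-map g (x ∷ xs) f = cong (f (g x) +_) (∑-map g xs f)

  ∑-concatMap : ∀ (g : A → List B) xs f → ∑ (concatMap g xs) f ≡ ∑ xs (λ x → ∑ (g x) f)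
  ∑-concatMap g [] f = refl
  ∑-concatMap g (x ∷ xs) f = trans (∑-++ (g x) _ f) (cong (∑ (g x) f +_) (∑-concatMap g xs f))

  ∑-swap : ∀ (xs : List A) (ys : List B) (f : A → B → ℤ) →
           ∑ xs (λ x → ∑ ys (f x)) ≡ ∑ ys (λ y → ∑ xs (λ x → f x y))
  ∑-swap [] ys f = sym (∑-0 ys (λ _ → refl))
  ∑-swap (x ∷ xs) ys f = trans (cong (∑ ys (f x) +_) (∑-swap xs ys f)) (sym (∑-+ ys (f x) _))

  ∑-nonneg : ∀ (xs : List A) {f} → (∀ x → 0ℤ ≤ f x) → 0ℤ ≤ ∑ xs f
  ∑-nonneg [] p = ≤-refl
  ∑-nonneg (x ∷ xs) p = +-mono-≤ (p x) (∑-nonneg xs p)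

  ∑-nonneg-0 : ∀ (xs : List A) {f} → (∀ x → 0ℤ ≤ f x) → ∑ xs f ≡ 0ℤ → ∀ {x} → x ∈ xs → f x ≡ 0ℤ
  ∑-nonneg-0 (x ∷ xs) {f} p e (here refl) = ≤-antisym
    (≤-trans (≤-reflexive (sym (+-identityʳ (f x))))
      (≤-trans (+-monoʳ-≤ (f x) (∑-nonneg xs p)) (≤-reflexive e))) (p x)
  ∑-nonneg-0 (x ∷ xs) {f} p e (there i) = ∑-nonneg-0 xs p (≤-antisym
    (≤-trans (≤-reflexive (sym (+-identityˡ _)))
      (≤-trans (+-monoˡ-≤ (∑ xs f) (p x)) (≤-reflexive e))) (∑-nonneg xs p)) i

  ι : {P : Set} → Dec P → ℤ
  ι (yes _) = 1ℤ
  ι (no _) = 0ℤ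

  ι-yes : ∀ {P : Set} (d : Dec P) → P → ι d ≡ 1ℤ
  ι-yes (yes _) p = refl
  ι-yes (no ¬p) p = contradiction p ¬p

  ι-no : ∀ {P : Set} (d : Dec P) → ¬ P → ι d ≡ 0ℤ
  ι-no (yes p) ¬p = contradiction p ¬p
  ι-no (no _) ¬p = refl

  ι-cong : ∀ {P Q : Set} (d : Dec P) (e : Dec Q) → (P → Q) → (Q → P) → ι d ≡ ι e
  ι-cong (yes p) e f g = sym (ι-yes e (f p))
  ι-cong (no ¬p) e f g = sym (ι-no e (¬p ∘ g))

  ι-× : ∀ {P Q : Set} (d : Dec P) (e : Dec Q) → ι (d ×-dec e) ≡ ι d * ι e
  ι-× (yes _) (yes _) = refl
  ι-× (yes _) (no _) = refl
  ι-× (no _) (yes _) = refl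
  ι-× (no _) (no _) = refl

  ι-*-cong : ∀ {P : Set} (d : Dec P) {x y : ℤ} → (P → x ≡ y) → ι d * x ≡ ι d * y
  ι-*-cong (yes p) e = cong (1ℤ *_) (e p)
  ι-*-cong (no _) e = refl

  count-∑ : ∀ {P : A → Set} (P? : Decidable P) xs → pos (count P? xs) ≡ ∑ xs (ι ∘ P?)
  count-∑ P? [] = refl
  count-∑ P? (x ∷ xs) with P? x
  ... | yes _ = cong (1ℤ +_) (count-∑ P? xs)
  ... | no _ = trans (count-∑ P? xs) (sym (+-identityˡ _))

  ∑-unique : ∀ {P : A → Set} (P? : Decidable P) {xs} {x} (f : A → ℤ) → Unique xs → x ∈ xs → P x →
    (∀ {y} → P y → y ≡ x) → ∑ xs (λ y → ι (P? y) * f y) ≡ f x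
  ∑-unique P? {x ∷ xs} f (x∉ ∷ _) (here refl) px only = begin
    ι (P? x) * f x + ∑ xs (λ y → ι (P? y) * f y)
      ≡⟨ cong₂ _+_ (cong (_* f x) (ι-yes (P? x) px))
        (∑-0 xs (λ {y} i → trans (cong (_* f y) (ι-no (P? y) (λ py → All.lookup x∉ i (sym (only py))))) (*-zeroˡ (f y)))) ⟩
    1ℤ * f x + 0ℤ ≡⟨ trans (+-identityʳ (1ℤ * f x)) (*-identityˡ (f x)) ⟩
    f x ∎
  ∑-unique P? {y ∷ xs} {x} f (y∉ ∷ u) (there i) px only = begin
    ι (P? y) * f y + ∑ xs (λ z → ι (P? z) * f z)
      ≡⟨ cong₂ _+_ (cong (_* f y) (ι-no (P? y) (λ py → All.lookup y∉ i (only py)))) (∑-unique P? f u i px only) ⟩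
    0ℤ * f y + f x ≡⟨ trans (cong (_+ f x) (*-zeroˡ (f y))) (+-identityˡ (f x)) ⟩
    f x ∎

-- The ring of linear operators on integer-valued functions

module LinearOperators where

  open import Data.Integer.Base using (_+_; _*_; -_)
  open import Level using (0ℓ)

  -- Operators are compared by their values only, and vectors that agree at every point need not be
  -- equal as functions; `ext` is what makes composition respect this equality.
  record LinOp (B : Set) : Set where
    field
      app : (B → ℤ) → B → ℤ
      lin : ∀ z x y b → app (λ b′ → z * x b′ + y b′) b ≡ z * app x b + app y b
      ext : ∀ {x y} → (∀ b → x b ≡ y b) → ∀ b → app x b ≡ app y b
  open LinOp public

  module _ {B : Set} (f : LinOp B) where

    app-+ : ∀ x y b → app f (λ b′ → x b′ + y b′) b ≡ app f x b + app f y b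
    app-+ x y b = begin
      app f (λ b′ → x b′ + y b′) b ≡⟨ ext f (λ b′ → cong (_+ y b′) (sym (*-identityˡ (x b′)))) b ⟩
      app f (λ b′ → 1ℤ * x b′ + y b′) b ≡⟨ lin f 1ℤ x y b ⟩
      1ℤ * app f x b + app f y b ≡⟨ cong (_+ app f y b) (*-identityˡ (app f x b)) ⟩
      app f x b + app f y b ∎

    app-0 : ∀ b → app f (λ _ → 0ℤ) b ≡ 0ℤ
    app-0 b = begin
      app f (λ _ → 0ℤ) b ≡⟨ lin f (- 1ℤ) (λ _ → 0ℤ) (λ _ → 0ℤ) b ⟩
      - 1ℤ * app f (λ _ → 0ℤ) b + app f (λ _ → 0ℤ) b ≡⟨ cancel (app f (λ _ → 0ℤ) b) ⟩
      0ℤ ∎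
      where
      cancel : ∀ a → - 1ℤ * a + a ≡ 0ℤ
      cancel = solve-∀

    app-vanish : ∀ {x} → (∀ b → x b ≡ 0ℤ) → ∀ b → app f x b ≡ 0ℤ
    app-vanish e b = trans (ext f e b) (app-0 b)

    app-* : ∀ z x b → app f (λ b′ → z * x b′) b ≡ z * app f x b
    app-* z x b = begin
      app f (λ b′ → z * x b′) b ≡⟨ ext f (λ b′ → sym (+-identityʳ _)) b ⟩
      app f (λ b′ → z * x b′ + 0ℤ) b ≡⟨ lin f z x (λ _ → 0ℤ) b ⟩
      z * app f x b + app f (λ _ → 0ℤ) b ≡⟨ cong (z * app f x b +_) (app-0 b) ⟩
      z * app f x b + 0ℤ ≡⟨ +-identityʳ _ ⟩
      z * app f x b ∎

    app-neg : ∀ x b → app f (λ b′ → - x b′) b ≡ - app f x b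
    app-neg x b = begin
      app f (λ b′ → - x b′) b ≡⟨ ext f (λ b′ → sym (-1*i≡-i (x b′))) b ⟩
      app f (λ b′ → - 1ℤ * x b′) b ≡⟨ app-* (- 1ℤ) x b ⟩
      - 1ℤ * app f x b ≡⟨ -1*i≡-i _ ⟩
      - app f x b ∎

  opRing : Set → Ring 0ℓ 0ℓ
  opRing B = record
    { Carrier = LinOp B
    ; _≈_ = λ f g → ∀ x b → app f x b ≡ app g x b
    ; _+_ = λ f g → record
        { app = λ x b → app f x b + app g x b
        ; lin = λ z x y b → trans (cong₂ _+_ (lin f z x y b) (lin g z x y b)) (lin-+ z _ _ _ _)
        ; ext = λ e b → cong₂ _+_ (ext f e b) (ext g e b) }
    ; _*_ = λ f g → record
        { app = λ x → app f (app g x)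
        ; lin = λ z x y b → trans (ext f (lin g z x y) b) (lin f z (app g x) (app g y) b)
        ; ext = λ e → ext f (ext g e) }
    ; -_ = λ f → record
        { app = λ x b → - app f x b
        ; lin = λ z x y b → trans (cong (-_) (lin f z x y b)) (neg-linear z _ _)
        ; ext = λ e b → cong (-_) (ext f e b) }
    ; 0# = record
        { app = λ _ _ → 0ℤ
        ; lin = λ z x y b → sym (trans (+-identityʳ _) (*-zeroʳ z))
        ; ext = λ _ _ → refl }
    ; 1# = record { app = λ x → x ; lin = λ _ _ _ _ → refl ; ext = λ e → e }
    ; isRing = record
        { +-isAbelianGroup = record
            { isGroup = record
                { isMonoid = record
                    { isSemigroup = record
                        { isMagma = record
                            { isEquivalence = record
                                { refl = λ _ _ → refl
                                ; sym = λ p x b → sym (p x b)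
                                ; trans = λ p q x b → trans (p x b) (q x b) }
                            ; ∙-cong = λ p q x b → cong₂ _+_ (p x b) (q x b) }
                        ; assoc = λ f g h x b → +-assoc (app f x b) (app g x b) (app h x b) }
                    ; identity = (λ f x b → +-identityˡ (app f x b)) , (λ f x b → +-identityʳ (app f x b)) }
                ; inverse = (λ f x b → +-inverseˡ (app f x b)) , (λ f x b → +-inverseʳ (app f x b))
                ; ⁻¹-cong = λ p x b → cong (-_) (p x b) }
            ; comm = λ f g x b → +-comm (app f x b) (app g x b) }
        ; *-cong = λ {f} {g} {h} {k} p q x b → trans (ext f (q x) b) (p (app k x) b)
        ; *-assoc = λ f g h x b → refl
        ; *-identity = (λ f x b → refl) , (λ f x b → refl)
        ; distrib = (λ f g h x b → app-+ f (app g x) (app h x) b) , (λ f g h x b → refl) } }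
    where
    lin-+ : ∀ z a b c d → (z * a + b) + (z * c + d) ≡ z * (a + c) + (b + d)
    lin-+ = solve-∀

-- Fermionic Fock space with an integral inner product

module Fermions where

  open import Data.Fin.Base using (splitAt; _<_; punchIn)
  open import Data.Fin.Properties using (splitAt-↑ˡ; splitAt-↑ʳ; any?)
  open import Data.Integer.Base using (_+_; _*_; -_; _≤_; _-_; +≤+; -[1+_]) renaming (+_ to pos)
  open import Data.Integer.Properties using (_≟_)
  open import Data.List.Base using (_++_; filter)
  open import Data.List.Membership.Propositional using (_∉_)
  open import Data.List.Membership.Propositional.Properties using (∈-lookup)
  open import Data.List.Properties using (map-tabulate)
  open import Data.List.Relation.Unary.Any using (index)
  open import Data.List.Relation.Unary.Any.Properties using (lookup-index)
  open import Data.Product.Base using (∃)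
  open import Data.Vec.Base using (Vec; lookup; updateAt) renaming (map to vmap)
  open import Data.Vec.Functional using (insertAt)
  open import Data.Vec.Functional.Properties using (insertAt-lookup; insertAt-punchIn)
  open import Data.Vec.Properties using (≡-dec; ∷-injectiveʳ; ∷-injectiveˡ)
  open import Relation.Nullary.Decidable using (from-yes; _→-dec_)
  open ListSums
  open LinearOperators

  Bits : ℕ → Set
  Bits = Vec Bool

  _≟ᵇ_ : ∀ {N} (b c : Bits N) → Dec (b ≡ c)
  _≟ᵇ_ = ≡-dec Bool._≟_

  bits : ∀ N → List (Bits N)
  bits zero = [] ∷ []
  bits (suc N) = List.map (false ∷_) (bits N) ++ List.map (true ∷_) (bits N)

  ∈-bits : ∀ {N} (b : Bits N) → b ∈ bits N
  ∈-bits [] = here refl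
  ∈-bits (false ∷ b) = ∈-++⁺ˡ (∈-map⁺ (false ∷_) (∈-bits b))
  ∈-bits (true ∷ b) = ∈-++⁺ʳ (List.map (false ∷_) (bits _)) (∈-map⁺ (true ∷_) (∈-bits b))

  bits-unique : ∀ N → Unique (bits N)
  bits-unique zero = [] ∷ []
  bits-unique (suc N) = Unique.++⁺ (Unique.map⁺ ∷-injectiveʳ (bits-unique N))
    (Unique.map⁺ ∷-injectiveʳ (bits-unique N)) λ (i , j) → disjoint (∈-map⁻ _ i) (∈-map⁻ _ j)
    where
    disjoint : ∀ {v} → Σ (Bits N) (λ b → b ∈ bits N × v ≡ false ∷ b) → Σ (Bits N) (λ b → b ∈ bits N × v ≡ true ∷ b) → _
    disjoint (_ , _ , refl) (_ , _ , e) = contradiction (∷-injectiveˡ e) λ ()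

  Vector : ℕ → Set
  Vector N = Bits N → ℤ

  ∑-bits : ∀ N (f : Vector (suc N)) → ∑ (bits (suc N)) f ≡ ∑ (bits N) (f ∘ (false ∷_)) + ∑ (bits N) (f ∘ (true ∷_))
  ∑-bits N f = trans (∑-++ (List.map (false ∷_) (bits N)) _ f) (cong₂ _+_ (∑-map _ (bits N) f) (∑-map _ (bits N) f))

  basis : ∀ {N} → Bits N → Vector N
  basis b c = ι (c ≟ᵇ b)

  basis-expansion : ∀ {N} (x : Vector N) c → x c ≡ ∑ (bits N) (λ b → x b * basis b c)
  basis-expansion {N} x c = sym (begin
    ∑ (bits N) (λ b → x b * ι (c ≟ᵇ b)) ≡⟨ ∑-cong (bits N) (λ b → *-comm (x b) (ι (c ≟ᵇ b))) ⟩
    ∑ (bits N) (λ b → ι (c ≟ᵇ b) * x b) ≡⟨ ∑-unique (c ≟ᵇ_) x (bits-unique N) (∈-bits c) refl sym ⟩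
    x c ∎)

  app-∑ : ∀ {B A : Set} (f : LinOp B) (xs : List A) (z : A → ℤ) (v : A → B → ℤ) b →
          app f (λ c → ∑ xs (λ i → z i * v i c)) b ≡ ∑ xs (λ i → z i * app f (v i) b)
  app-∑ f [] z v b = app-0 f b
  app-∑ f (i ∷ xs) z v b = trans (lin f (z i) (v i) (λ c → ∑ xs (λ i → z i * v i c)) b)
    (cong (z i * app f (v i) b +_) (app-∑ f xs z v b))

  signed : Bool → ℤ → ℤ
  signed false z = z
  signed true z = - z

  signed-lin : ∀ s z x y → signed s (z * x + y) ≡ z * signed s x + signed s y
  signed-lin false z x y = refl
  signed-lin true z x y = neg-linear z x y

  -- The Jordan–Wigner operators: ladder true i creates the i-th mode, ladder false i annihilates it.
  lad : ∀ {N} → Fin N → Bool → Vector N → Vector N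
  lad zero true x (true ∷ b) = x (false ∷ b)
  lad zero true x (false ∷ b) = 0ℤ
  lad zero false x (true ∷ b) = 0ℤ
  lad zero false x (false ∷ b) = x (true ∷ b)
  lad (suc i) κ x (h ∷ b) = signed h (lad i κ (x ∘ (h ∷_)) b)

  ladder : ∀ {N} → Bool → Fin N → LinOp (Bits N)
  ladder {N} κ i = record { app = lad i κ ; lin = lin′ κ i ; ext = ext′ κ i }
    where
    lin′ : ∀ {N} κ (i : Fin N) z x y b →
           lad i κ (λ c → z * x c + y c) b ≡ z * lad i κ x b + lad i κ y b
    lin′ true zero z x y (true ∷ b) = refl
    lin′ true zero z x y (false ∷ b) = sym (trans (+-identityʳ (z * 0ℤ)) (*-zeroʳ z))
    lin′ false zero z x y (true ∷ b) = sym (trans (+-identityʳ (z * 0ℤ)) (*-zeroʳ z))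
    lin′ false zero z x y (false ∷ b) = refl
    lin′ κ (suc i) z x y (h ∷ b) = trans (cong (signed h) (lin′ κ i z _ _ b)) (signed-lin h z _ _)
    ext′ : ∀ {N} κ (i : Fin N) {x y : Vector N} → (∀ b → x b ≡ y b) → ∀ b → lad i κ x b ≡ lad i κ y b
    ext′ true zero e (true ∷ b) = e (false ∷ b)
    ext′ true zero e (false ∷ b) = refl
    ext′ false zero e (true ∷ b) = refl
    ext′ false zero e (false ∷ b) = e (true ∷ b)
    ext′ κ (suc i) e (h ∷ b) = cong (signed h) (ext′ κ i (λ c → e (h ∷ c)) b)

  δᶻ : ∀ {n} → Fin n → Fin n → ℤ
  δᶻ zero zero = 1ℤ
  δᶻ zero (suc j) = 0ℤ
  δᶻ (suc i) zero = 0ℤ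
  δᶻ (suc i) (suc j) = δᶻ i j

  δᶻ-diag : ∀ {n} (i : Fin n) → δᶻ i i ≡ 1ℤ
  δᶻ-diag zero = refl
  δᶻ-diag (suc i) = δᶻ-diag i

  δᶻ-off : ∀ {n} {i j : Fin n} → i ≢ j → δᶻ i j ≡ 0ℤ
  δᶻ-off {i = zero} {zero} i≢j = contradiction refl i≢j
  δᶻ-off {i = zero} {suc j} i≢j = refl
  δᶻ-off {i = suc i} {zero} i≢j = refl
  δᶻ-off {i = suc i} {suc j} i≢j = δᶻ-off (i≢j ∘ cong suc)

  contraction : Bool → Bool → ℤ
  contraction true true = 0ℤ
  contraction true false = 1ℤ
  contraction false true = 1ℤ
  contraction false false = 0ℤ

  signed-head : ∀ {N} κ (i : Fin N) h h′ (x : Vector N) b →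
                signed h (lad i κ (λ c → signed h′ (x c)) b) ≡ signed h (signed h′ (lad i κ x b))
  signed-head κ i h false x b = refl
  signed-head κ i h true x b = cong (signed h) (app-neg (ladder κ i) x b)

  -- An operator on a later mode carries the sign of the head bit, and the operator on the head mode
  -- flips that bit; so the two orders of application differ by a sign.
  headTail : ∀ {N} κ κ′ (j : Fin N) x b →
    lad zero κ (lad (suc j) κ′ x) b + lad (suc j) κ′ (lad zero κ x) b ≡ 0ℤ
  headTail true κ′ j x (true ∷ b) = +-inverseʳ (lad j κ′ (x ∘ (false ∷_)) b)
  headTail true κ′ j x (false ∷ b) = trans (+-identityˡ _) (app-0 (ladder κ′ j) b)
  headTail false κ′ j x (true ∷ b) = trans (+-identityˡ _) (cong (-_) (app-0 (ladder κ′ j) b))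
  headTail false κ′ j x (false ∷ b) = +-inverseˡ (lad j κ′ (x ∘ (true ∷_)) b)

  anticommutator : ∀ {N} κ κ′ (i j : Fin N) x b →
    lad i κ (lad j κ′ x) b + lad j κ′ (lad i κ x) b ≡ contraction κ κ′ * δᶻ i j * x b
  anticommutator true true zero zero x (true ∷ b) = refl
  anticommutator true true zero zero x (false ∷ b) = refl
  anticommutator true false zero zero x (true ∷ b) = trans (+-identityʳ _) (sym (*-identityˡ (x (true ∷ b))))
  anticommutator true false zero zero x (false ∷ b) = trans (+-identityˡ _) (sym (*-identityˡ (x (false ∷ b))))
  anticommutator false true zero zero x (true ∷ b) = trans (+-identityˡ _) (sym (*-identityˡ (x (true ∷ b))))
  anticommutator false true zero zero x (false ∷ b) = trans (+-identityʳ _) (sym (*-identityˡ (x (false ∷ b))))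
  anticommutator false false zero zero x (true ∷ b) = refl
  anticommutator false false zero zero x (false ∷ b) = refl
  anticommutator κ κ′ zero (suc j) x b = trans (headTail κ κ′ j x b)
    (cong (_* x b) (sym (*-zeroʳ (contraction κ κ′))))
  anticommutator κ κ′ (suc i) zero x b = trans (+-comm (lad (suc i) κ (lad zero κ′ x) b) _)
    (trans (headTail κ′ κ i x b) (cong (_* x b) (sym (*-zeroʳ (contraction κ κ′)))))
  anticommutator κ κ′ (suc i) (suc j) x (h ∷ b) = begin
    signed h (lad i κ (λ c → signed h (lad j κ′ xₕ c)) b)
      + signed h (lad j κ′ (λ c → signed h (lad i κ xₕ c)) b)
      ≡⟨ cong₂ _+_ (trans (signed-head κ i h h _ b) (signed² h _)) (trans (signed-head κ′ j h h _ b) (signed² h _)) ⟩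
    lad i κ (lad j κ′ xₕ) b + lad j κ′ (lad i κ xₕ) b
      ≡⟨ anticommutator κ κ′ i j xₕ b ⟩
    contraction κ κ′ * δᶻ i j * x (h ∷ b) ∎
    where
    xₕ : Vector _
    xₕ = x ∘ (h ∷_)
    signed² : ∀ h z → signed h (signed h z) ≡ z
    signed² false z = refl
    signed² true z = neg-involutive z

  inner : ∀ {N} → Vector N → Vector N → ℤ
  inner {N} x y = ∑ (bits N) (λ b → x b * y b)

  Adjoint : ∀ {N} → LinOp (Bits N) → LinOp (Bits N) → Set
  Adjoint f g = ∀ x y → inner x (app f y) ≡ inner (app g x) y

  ladder-adjoint : ∀ {N} κ (i : Fin N) → Adjoint (ladder κ i) (ladder (not κ) i)
  ladder-adjoint {suc N} κ i x y = trans (∑-bits N _) (trans (go κ i x y) (sym (∑-bits N _)))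
    where
    zeros : ∀ (f : Vector N) → ∑ (bits N) (λ b → f b * 0ℤ) ≡ 0ℤ
    zeros f = ∑-0 (bits N) (λ {b} _ → *-zeroʳ (f b))
    zerosˡ : ∀ (f : Vector N) → ∑ (bits N) (λ b → 0ℤ * f b) ≡ 0ℤ
    zerosˡ f = ∑-0 (bits N) (λ {b} _ → *-zeroˡ (f b))
    go : ∀ κ i x y → ∑ (bits N) (λ b → x (false ∷ b) * lad i κ y (false ∷ b))
                     + ∑ (bits N) (λ b → x (true ∷ b) * lad i κ y (true ∷ b))
                   ≡ ∑ (bits N) (λ b → lad i (not κ) x (false ∷ b) * y (false ∷ b))
                     + ∑ (bits N) (λ b → lad i (not κ) x (true ∷ b) * y (true ∷ b))
    go true zero x y = trans (+-comm (∑ (bits N) (λ b → x (false ∷ b) * 0ℤ)) _)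
      (cong (∑ (bits N) (λ b → x (true ∷ b) * y (false ∷ b)) +_) (trans (zeros (x ∘ (false ∷_))) (sym (zerosˡ (y ∘ (true ∷_))))))
    go false zero x y = trans (+-comm _ (∑ (bits N) (λ b → x (true ∷ b) * 0ℤ)))
      (cong (_+ ∑ (bits N) (λ b → x (false ∷ b) * y (true ∷ b))) (trans (zeros (x ∘ (true ∷_))) (sym (zerosˡ (y ∘ (false ∷_))))))
    go κ (suc i) x y = cong₂ _+_ (ladder-adjoint κ i (x ∘ (false ∷_)) (y ∘ (false ∷_)))
      (begin
        ∑ (bits N) (λ b → x (true ∷ b) * - lad i κ (y ∘ (true ∷_)) b)
          ≡⟨ ∑-cong (bits N) (λ b → sym (neg-distribʳ-* (x (true ∷ b)) _)) ⟩
        ∑ (bits N) (λ b → - (x (true ∷ b) * lad i κ (y ∘ (true ∷_)) b))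
          ≡⟨ ∑-neg (bits N) _ ⟩
        - ∑ (bits N) (λ b → x (true ∷ b) * lad i κ (y ∘ (true ∷_)) b)
          ≡⟨ cong (-_) (ladder-adjoint κ i (x ∘ (true ∷_)) (y ∘ (true ∷_))) ⟩
        - ∑ (bits N) (λ b → lad i (not κ) (x ∘ (true ∷_)) b * y (true ∷ b))
          ≡⟨ ∑-neg (bits N) _ ⟨
        ∑ (bits N) (λ b → - (lad i (not κ) (x ∘ (true ∷_)) b * y (true ∷ b)))
          ≡⟨ ∑-cong (bits N) (λ b → neg-distribˡ-* (lad i (not κ) (x ∘ (true ∷_)) b) _) ⟩
        ∑ (bits N) (λ b → - lad i (not κ) (x ∘ (true ∷_)) b * y (true ∷ b)) ∎)

  occ : ∀ {N} → Bits N → Fin N → ℤ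
  occ b i with lookup b i
  ... | true = 1ℤ
  ... | false = 0ℤ

  number : ∀ {N} (i : Fin N) x b → lad i true (lad i false x) b ≡ occ b i * x b
  number zero x (true ∷ b) = sym (*-identityˡ (x (true ∷ b)))
  number zero x (false ∷ b) = refl
  number (suc i) x (h ∷ b) = begin
    signed h (lad i true (λ c → signed h (lad i false (x ∘ (h ∷_)) c)) b)
      ≡⟨ trans (signed-head true i h h _ b) (signed² h _) ⟩
    lad i true (lad i false (x ∘ (h ∷_))) b ≡⟨ number i _ b ⟩
    occ b i * x (h ∷ b) ∎
    where
    signed² : ∀ h z → signed h (signed h z) ≡ z
    signed² false z = refl
    signed² true z = neg-involutive z

  square-nonneg : ∀ z → 0ℤ ≤ z * z
  square-nonneg (pos zero) = +≤+ z≤n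
  square-nonneg (pos (suc n)) = +≤+ z≤n
  square-nonneg -[1+ n ] = +≤+ z≤n

  inner-self-0 : ∀ {N} (x : Vector N) → inner x x ≡ 0ℤ → ∀ b → x b ≡ 0ℤ
  inner-self-0 {N} x e b with i*j≡0⇒i≡0∨j≡0 (x b) (∑-nonneg-0 (bits N) (λ c → square-nonneg (x c)) e (∈-bits b))
  ... | inj₁ p = p
  ... | inj₂ p = p

  ∑-allFin-suc : ∀ n (f : Fin (suc n) → ℤ) → ∑ (allFin (suc n)) f ≡ f zero + ∑ (allFin n) (f ∘ suc)
  ∑-allFin-suc n f = cong (f zero +_)
    (trans (cong (λ xs → ∑ xs f) (sym (map-tabulate {n = n} (λ i → i) suc))) (∑-map suc (allFin n) f))

  ∑-lookup : ∀ {A : Set} (xs : List A) (f : A → ℤ) →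
             ∑ (allFin (List.length xs)) (f ∘ List.lookup xs) ≡ ∑ xs f
  ∑-lookup [] f = refl
  ∑-lookup (x ∷ xs) f = trans (∑-allFin-suc (List.length xs) (f ∘ List.lookup (x ∷ xs))) (cong (f x +_) (∑-lookup xs f))

  ∑-support : ∀ {A : Set} (_≟_ : DecidableEquality A) {xs ys : List A} (f : A → ℤ) → Unique xs → Unique ys →
    (∀ {y} → y ∈ ys → y ∈ xs) → (∀ {x} → x ∉ ys → f x ≡ 0ℤ) → ∑ xs f ≡ ∑ ys f
  ∑-support {A} _≟_ {xs} {ys} f ux uy sub vanish = begin
    ∑ xs f ≡⟨ ∑-cong xs expand ⟩
    ∑ xs (λ x → ∑ ys (λ y → ι (y ≟ x) * f y)) ≡⟨ ∑-swap xs ys _ ⟩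
    ∑ ys (λ y → ∑ xs (λ x → ι (y ≟ x) * f y)) ≡⟨ ∑-cong∈ ys (λ {y} i → ∑-unique (y ≟_) (λ _ → f y) ux (sub i) refl sym) ⟩
    ∑ ys f ∎
    where
    open import Data.List.Membership.DecPropositional _≟_ using (_∈?_)
    expand : ∀ x → f x ≡ ∑ ys (λ y → ι (y ≟ x) * f y)
    expand x with x ∈? ys
    ... | yes i = sym (∑-unique (_≟ x) f uy i refl (λ e → e))
    ... | no i = trans (vanish i) (sym (∑-0 ys (λ {y} j →
                    trans (cong (_* f y) (ι-no (y ≟ x) (λ { refl → i j }))) (*-zeroˡ (f y)))))

  flip : ∀ {N} → Fin N → Bits N → Bits N
  flip i b = updateAt b i not

  ladder-flip : ∀ {N} κ (i : Fin N) x b → x (flip i b) ≡ 0ℤ → lad i κ x b ≡ 0ℤ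
  ladder-flip true zero x (true ∷ b) e = e
  ladder-flip true zero x (false ∷ b) e = refl
  ladder-flip false zero x (true ∷ b) e = refl
  ladder-flip false zero x (false ∷ b) e = e
  ladder-flip κ (suc i) x (h ∷ b) e = trans (cong (signed h) (ladder-flip κ i (x ∘ (h ∷_)) b e)) (signed-0 h)
    where
    signed-0 : ∀ h → signed h 0ℤ ≡ 0ℤ
    signed-0 false = refl
    signed-0 true = refl

  ladder-head : ∀ {N} κ (i : Fin N) x b → lookup b i ≢ κ → lad i κ x b ≡ 0ℤ
  ladder-head true zero x (true ∷ b) e = contradiction refl e
  ladder-head true zero x (false ∷ b) e = refl
  ladder-head false zero x (true ∷ b) e = refl
  ladder-head false zero x (false ∷ b) e = contradiction refl e
  ladder-head κ (suc i) x (h ∷ b) e = trans (cong (signed h) (ladder-head κ i (x ∘ (h ∷_)) b e)) (signed-0 h)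
    where
    signed-0 : ∀ h → signed h 0ℤ ≡ 0ℤ
    signed-0 false = refl
    signed-0 true = refl

  bit : Bool → ℤ
  bit true = 1ℤ
  bit false = 0ℤ

  occ-bit : ∀ {N} (b : Bits N) i → occ b i ≡ bit (lookup b i)
  occ-bit b i with lookup b i
  ... | true = refl
  ... | false = refl

  grade : ∀ {N} → (Fin N → ℤ) → Bits N → ℤ
  grade w [] = 0ℤ
  grade w (h ∷ b) = bit h * w zero + grade (w ∘ suc) b

  grade-∑ : ∀ {N} (w : Fin N → ℤ) b → grade w b ≡ ∑ (allFin N) (λ i → occ b i * w i)
  grade-∑ w [] = refl
  grade-∑ {suc N} w (h ∷ b) = trans (cong₂ _+_ (cong (_* w zero) (sym (occ-bit (h ∷ b) zero))) (grade-∑ (w ∘ suc) b))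
    (sym (∑-allFin-suc N (λ i → occ (h ∷ b) i * w i)))

  grade-δᶻ : ∀ {k} (x : Fin k) S → grade (δᶻ x) S ≡ occ S x
  grade-δᶻ zero (h ∷ S) = trans (cong₂ _+_ (*-identityʳ (bit h)) (grade-zero S))
    (trans (+-identityʳ (bit h)) (sym (occ-bit (h ∷ S) zero)))
    where
    grade-zero : ∀ {k} (S : Bits k) → grade (λ _ → 0ℤ) S ≡ 0ℤ
    grade-zero [] = refl
    grade-zero (h ∷ S) = trans (cong₂ _+_ (*-zeroʳ (bit h)) (grade-zero S)) refl
  grade-δᶻ (suc x) (h ∷ S) = trans (cong₂ _+_ (*-zeroʳ (bit h)) (grade-δᶻ x S)) (+-identityˡ (occ S x))

  grade-flip : ∀ {N} (w : Fin N → ℤ) i κ b → lookup b i ≡ κ →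
               grade w b ≡ grade w (flip i b) + (bit κ - bit (not κ)) * w i
  grade-flip w zero κ (.κ ∷ b) refl = arith (bit κ) (bit (not κ)) (w zero) _
    where
    arith : ∀ p q z g → p * z + g ≡ q * z + g + (p - q) * z
    arith = solve-∀
  grade-flip w (suc i) κ (h ∷ b) e =
    trans (cong (bit h * w zero +_) (grade-flip (w ∘ suc) i κ b e)) (sym (+-assoc (bit h * w zero) _ _))

  -- Gradings, and operators of definite degree

  module _ {N} (w : Fin N → ℤ) where

    Supported : ℤ → Vector N → Set
    Supported g x = ∀ b → grade w b ≢ g → x b ≡ 0ℤ

    Shifts : ℤ → LinOp (Bits N) → Set
    Shifts d f = ∀ {g x} → Supported g x → Supported (g + d) (app f x)

    module F = Ring (opRing (Bits N))
    open DiracOperator (opRing (Bits N)) using (sum; sum-zero; sum-suc)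

    shifts-≡ : ∀ {d e f} → d ≡ e → Shifts d f → Shifts e f
    shifts-≡ refl p = p

    shifts-+ : ∀ {d} f g → Shifts d f → Shifts d g → Shifts d (f F.+ g)
    shifts-+ f g p q s b ne = cong₂ _+_ (p s b ne) (q s b ne)

    shifts-* : ∀ {d e} f g → Shifts d f → Shifts e g → Shifts (d + e) (f F.* g)
    shifts-* {d} {e} f g p q {γ} s b ne = p (q s) b (ne ∘ λ eq → trans eq (arith γ d e))
      where
      arith : ∀ g d e → g + e + d ≡ g + (d + e)
      arith = solve-∀

    shifts-0 : ∀ {d} → Shifts d F.0#
    shifts-0 s b ne = refl

    shifts-sum : ∀ {d k} (f : Fin k → LinOp (Bits N)) → (∀ i → Shifts d (f i)) → Shifts d (sum f)
    shifts-sum {k = zero} f p s b ne = sum-zero f _ b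
    shifts-sum {k = suc k} f p s b ne = trans (sum-suc f _ b)
      (cong₂ _+_ (p zero s b ne) (shifts-sum (f ∘ suc) (p ∘ suc) s b ne))

    shifts-create : ∀ i → Shifts (w i) (ladder true i)
    shifts-create i {x = x} s b ne with lookup b i in eq
    ... | false = ladder-head true i x b (λ e → contradiction (trans (sym e) eq) λ ())
    ... | true = ladder-flip true i x b (s (flip i b) (λ e → ne (trans (grade-flip w i true b eq)
      (cong₂ _+_ e (*-identityˡ (w i))))))

    shifts-annihilate : ∀ i → Shifts (- w i) (ladder false i)
    shifts-annihilate i {x = x} s b ne with lookup b i in eq
    ... | true = ladder-head false i x b (λ e → contradiction (trans (sym e) eq) λ ())
    ... | false = ladder-flip false i x b (s (flip i b) (λ e → ne (trans (grade-flip w i false b eq)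
      (cong₂ _+_ e (-1*i≡-i (w i))))))

  sum-app : ∀ {B : Set} {k} → let open DiracOperator (opRing B) in
    (f : Fin k → LinOp B) → ∀ x b → app (sum f) x b ≡ ∑ (allFin k) (λ i → app (f i) x b)
  sum-app {B} {zero} f x b = DiracOperator.sum-zero (opRing B) f x b
  sum-app {B} {suc k} f x b = trans (DiracOperator.sum-suc (opRing B) f x b)
    (trans (cong (app (f zero) x b +_) (sum-app (f ∘ suc) x b)) (sym (∑-allFin-suc k (λ i → app (f i) x b))))

  δ-app : ∀ {B : Set} {k} (i j : Fin k) x b → app (DiracOperator.δ (opRing B) i j) x b ≡ δᶻ i j * x b
  δ-app zero zero x b = sym (*-identityˡ (x b))
  δ-app zero (suc j) x b = refl
  δ-app (suc i) zero x b = refl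
  δ-app (suc i) (suc j) x b = δ-app i j x b

  ladder-CAR : ∀ N → DiracOperator.CAR (opRing (Bits N)) (ladder {N} false) (ladder true)
  ladder-CAR N = record
    { aa = λ i j x b → trans (anticommutator false false i j x b) (cong (_* x b) (*-zeroˡ (δᶻ i j)))
    ; a†a† = λ i j x b → trans (anticommutator true true i j x b) (cong (_* x b) (*-zeroˡ (δᶻ i j)))
    ; aa† = λ i j x b → trans (anticommutator false true i j x b)
      (trans (cong (_* x b) (*-identityˡ (δᶻ i j))) (sym (δ-app {Bits N} i j x b))) }

  scale : ∀ {B : Set} → ℤ → LinOp B
  scale z = record
    { app = λ x b → z * x b
    ; lin = λ u x y b → arith z u (x b) (y b)
    ; ext = λ e b → cong (z *_) (e b) }
    where
    arith : ∀ z u a c → z * (u * a + c) ≡ u * (z * a) + z * c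
    arith = solve-∀

  module _ {N : ℕ} where

    private module R = Ring (opRing (Bits N))
    open DiracOperator (opRing (Bits N)) using (sum; sum-zero; sum-suc)

    inner-+ˡ : ∀ (x y z : Vector N) → inner (λ b → x b + y b) z ≡ inner x z + inner y z
    inner-+ˡ x y z = trans (∑-cong (bits N) (λ b → *-distribʳ-+ (z b) (x b) (y b))) (∑-+ (bits N) _ _)

    inner-+ʳ : ∀ (x y z : Vector N) → inner x (λ b → y b + z b) ≡ inner x y + inner x z
    inner-+ʳ x y z = trans (∑-cong (bits N) (λ b → *-distribˡ-+ (x b) (y b) (z b))) (∑-+ (bits N) _ _)

    inner-congʳ : ∀ (x : Vector N) {y z} → (∀ b → y b ≡ z b) → inner x y ≡ inner x z
    inner-congʳ x e = ∑-cong (bits N) (λ b → cong (x b *_) (e b))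

    inner-congˡ : ∀ {x y} (z : Vector N) → (∀ b → x b ≡ y b) → inner x z ≡ inner y z
    inner-congˡ z e = ∑-cong (bits N) (λ b → cong (_* z b) (e b))

    inner-zeroʳ : ∀ (x : Vector N) {y} → (∀ b → y b ≡ 0ℤ) → inner x y ≡ 0ℤ
    inner-zeroʳ x e = ∑-0 (bits N) (λ {b} _ → trans (cong (x b *_) (e b)) (*-zeroʳ (x b)))

    inner-zeroˡ : ∀ {x} (y : Vector N) → (∀ b → x b ≡ 0ℤ) → inner x y ≡ 0ℤ
    inner-zeroˡ y e = ∑-0 (bits N) (λ {b} _ → trans (cong (_* y b) (e b)) (*-zeroˡ (y b)))

    inner-basis : ∀ (S : Bits N) (y : Vector N) → inner (basis S) y ≡ y S
    inner-basis S y = ∑-unique (_≟ᵇ S) y (bits-unique N) (∈-bits S) refl (λ e → e)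

    inner-comm : ∀ (x y : Vector N) → inner x y ≡ inner y x
    inner-comm x y = ∑-cong (bits N) (λ b → *-comm (x b) (y b))

    adjoint-* : ∀ {f f′ g g′ : LinOp (Bits N)} → Adjoint f f′ → Adjoint g g′ → Adjoint (f R.* g) (g′ R.* f′)
    adjoint-* {f} {f′} {g} p q x y = trans (p x (app g y)) (q (app f′ x) y)

    adjoint-+ : ∀ {f f′ g g′ : LinOp (Bits N)} → Adjoint f f′ → Adjoint g g′ → Adjoint (f R.+ g) (f′ R.+ g′)
    adjoint-+ {f} {f′} {g} {g′} p q x y = trans (inner-+ʳ x (app f y) (app g y))
      (trans (cong₂ _+_ (p x y) (q x y)) (sym (inner-+ˡ (app f′ x) (app g′ x) y)))

    adjoint-sum : ∀ {k} {f f′ : Fin k → LinOp (Bits N)} → (∀ i → Adjoint (f i) (f′ i)) → Adjoint (sum f) (sum f′)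
    adjoint-sum {zero} {f} {f′} p x y = trans (inner-zeroʳ x (sum-zero f y)) (sym (inner-zeroˡ y (sum-zero f′ x)))
    adjoint-sum {suc k} {f} {f′} p x y = trans (inner-congʳ x (sum-suc f y)) (trans
      (adjoint-+ {f zero} {f′ zero} {sum (f ∘ suc)} {sum (f′ ∘ suc)} (p zero) (adjoint-sum (p ∘ suc)) x y)
      (inner-congˡ y (λ b → sym (sum-suc f′ x b))))

    adjoint-scale : ∀ z → Adjoint {N} (scale z) (scale z)
    adjoint-scale z x y = ∑-cong (bits N) (λ b → arith z (x b) (y b))
      where
      arith : ∀ z a c → a * (z * c) ≡ z * a * c
      arith = solve-∀

    adjoint-≈ : ∀ {f g g′ : LinOp (Bits N)} → g R.≈ g′ → Adjoint f g → Adjoint f g′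
    adjoint-≈ e p x y = trans (p x y) (inner-congˡ y (e x))

  tri : ℕ → ℕ
  tri = DiracOperator.tri (opRing (Bits 0))

  -- The ghost in the position of the pair i < j has weight θ j − θ i.
  ghostWt : ∀ n → (Fin n → ℤ) → Fin (tri n) → ℤ
  ghostWt (suc n) θ p = [ (λ i → θ (suc i) - θ zero) , ghostWt n (θ ∘ suc) ]′ (splitAt n p)

  ghostWt-top : ∀ n θ i → ghostWt (suc n) θ (i ↑ˡ tri n) ≡ θ (suc i) - θ zero
  ghostWt-top n θ i = cong [ _ , _ ]′ (splitAt-↑ˡ n i (tri n))

  ghostWt-rest : ∀ n θ p → ghostWt (suc n) θ (n ↑ʳ p) ≡ ghostWt n (θ ∘ suc) p
  ghostWt-rest n θ p = cong [ _ , _ ]′ (splitAt-↑ʳ n (tri n) p)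

  ∑-allFin-+ : ∀ m k (f : Fin (m ℕ.+ k) → ℤ) →
               ∑ (allFin (m ℕ.+ k)) f ≡ ∑ (allFin m) (λ i → f (i ↑ˡ k)) + ∑ (allFin k) (λ j → f (m ↑ʳ j))
  ∑-allFin-+ zero k f = sym (+-identityˡ _)
  ∑-allFin-+ (suc m) k f = begin
    ∑ (allFin (suc m ℕ.+ k)) f
      ≡⟨ ∑-allFin-suc (m ℕ.+ k) f ⟩
    f zero + ∑ (allFin (m ℕ.+ k)) (f ∘ suc)
      ≡⟨ cong (f zero +_) (∑-allFin-+ m k (f ∘ suc)) ⟩
    f zero + (∑ (allFin m) (λ i → f (suc (i ↑ˡ k))) + ∑ (allFin k) (λ j → f (suc (m ↑ʳ j))))
      ≡⟨ +-assoc (f zero) _ _ ⟨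
    f zero + ∑ (allFin m) (λ i → f (suc (i ↑ˡ k))) + ∑ (allFin k) (λ j → f (suc (m ↑ʳ j)))
      ≡⟨ cong (_+ ∑ (allFin k) (λ j → f (suc (m ↑ʳ j)))) (∑-allFin-suc m (λ i → f (i ↑ˡ k))) ⟨
    ∑ (allFin (suc m)) (λ i → f (i ↑ˡ k)) + ∑ (allFin k) (λ j → f (suc (m ↑ʳ j))) ∎

  ∑-tri : ∀ n (f : Fin (tri (suc n)) → ℤ) →
          ∑ (allFin (tri (suc n))) f ≡ ∑ (allFin n) (λ i → f (i ↑ˡ tri n)) + ∑ (allFin (tri n)) (λ p → f (n ↑ʳ p))
  ∑-tri n f = ∑-allFin-+ n (tri n) f

  differencesᶻ : ∀ n → (Fin n → ℤ) → ℤ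
  differencesᶻ zero f = 0ℤ
  differencesᶻ (suc n) f = ∑ (allFin n) (λ i → f zero - f (suc i)) + differencesᶻ n (f ∘ suc)

  -- q f = (f, f + 2ρ)
  q : ∀ n → (Fin n → ℤ) → ℤ
  q n f = ∑ (allFin n) (λ i → f i * f i) + differencesᶻ n f

  module _ {N : ℕ} where

    private module R = Ring (opRing (Bits N))
    open DiracOperator (opRing (Bits N)) hiding (tri)

    Op : Set
    Op = LinOp (Bits N)

    -- Every ghost creator of weight `θ j − θ i` is accompanied by an operator of the opposite
    -- weight. A single linear functional `θ` is treated at a time; the coordinates `δᶻ x` together
    -- recover the whole weight.
    dirac-shifts : ∀ (w : Fin N → ℤ) n θ (a a† : Fin (tri n) → Op) (E : Fin n → Fin n → Op) →
      (∀ p → Shifts w (- ghostWt n θ p) (a p)) → (∀ p → Shifts w (ghostWt n θ p) (a† p)) →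
      (∀ x y → Shifts w (θ x - θ y) (E x y)) → Shifts w 0ℤ (dirac n a a† E)
    dirac-shifts w zero θ a a† E sa sa† sE = shifts-0 w
    dirac-shifts w (suc n) θ a a† E sa sa† sE =
      shifts-+ w (hopping (top n a) (top n a†) E) (dirac n (rest n a) (rest n a†) (twist (top n a) (top n a†) E))
        (shifts-+ w (sum (λ i → top n a† i R.* E zero (suc i))) (sum (λ i → top n a i R.* E (suc i) zero))
          (shifts-sum w (λ i → top n a† i R.* E zero (suc i)) (λ i →
            shifts-≡ w {f = top n a† i R.* E zero (suc i)} (arith₁ (θ (suc i)) (θ zero))
              (shifts-* w (top n a† i) (E zero (suc i)) (sa†-top i) (sE zero (suc i)))))
          (shifts-sum w (λ i → top n a i R.* E (suc i) zero) (λ i →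
            shifts-≡ w {f = top n a i R.* E (suc i) zero} (arith₂ (θ (suc i)) (θ zero))
              (shifts-* w (top n a i) (E (suc i) zero) (sa-top i) (sE (suc i) zero)))))
        (dirac-shifts w n (θ ∘ suc) (rest n a) (rest n a†) (twist (top n a) (top n a†) E)
          (λ p → shifts-≡ w {f = rest n a p} (cong (-_) (ghostWt-rest n θ p)) (sa (n ↑ʳ p)))
          (λ p → shifts-≡ w {f = rest n a† p} (ghostWt-rest n θ p) (sa† (n ↑ʳ p)))
          (λ x y → shifts-+ w (E (suc x) (suc y)) (top n a† x R.* top n a y) (sE (suc x) (suc y))
            (shifts-≡ w {f = top n a† x R.* top n a y} (arith₃ (θ (suc x)) (θ (suc y)) (θ zero))
              (shifts-* w (top n a† x) (top n a y) (sa†-top x) (sa-top y)))))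
      where
      sa-top : ∀ i → Shifts w (- (θ (suc i) - θ zero)) (top n a i)
      sa-top i = shifts-≡ w {f = top n a i} (cong (-_) (ghostWt-top n θ i)) (sa (i ↑ˡ tri n))
      sa†-top : ∀ i → Shifts w (θ (suc i) - θ zero) (top n a† i)
      sa†-top i = shifts-≡ w {f = top n a† i} (ghostWt-top n θ i) (sa† (i ↑ˡ tri n))
      arith₁ : ∀ a b → (a - b) + (b - a) ≡ 0ℤ
      arith₁ = solve-∀
      arith₂ : ∀ a b → - (a - b) + (a - b) ≡ 0ℤ
      arith₂ = solve-∀
      arith₃ : ∀ x y z → (x - z) + - (y - z) ≡ x - y
      arith₃ = solve-∀

    module _ (par : Bits N → Bool) where

      Parity : Bool → Vector N → Set
      Parity g x = ∀ b → par b ≢ g → x b ≡ 0ℤ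

      Toggles : Bool → Op → Set
      Toggles κ f = ∀ {g x} → Parity g x → Parity (g xor κ) (app f x)

      toggles-+ : ∀ {κ} f g → Toggles κ f → Toggles κ g → Toggles κ (f R.+ g)
      toggles-+ f g p q s b ne = cong₂ _+_ (p s b ne) (q s b ne)

      toggles-* : ∀ {κ κ′} f g → Toggles κ f → Toggles κ′ g → Toggles (κ xor κ′) (f R.* g)
      toggles-* {κ} {κ′} f g p q {γ} s b ne = p (q s) b (ne ∘ λ e → trans e (trans (Bool.xor-assoc γ κ′ κ)
        (cong (γ xor_) (Bool.xor-comm κ′ κ))))

      toggles-sum : ∀ {κ k} (f : Fin k → Op) → (∀ i → Toggles κ (f i)) → Toggles κ (sum f)
      toggles-sum {k = zero} f p s b ne = sum-zero f _ b
      toggles-sum {k = suc k} f p s b ne = trans (sum-suc f _ b)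
        (cong₂ _+_ (p zero s b ne) (toggles-sum (f ∘ suc) (p ∘ suc) s b ne))

      toggles-scale : ∀ z → Toggles false (scale z)
      toggles-scale z {γ} s b ne = trans (cong (z *_) (s b (ne ∘ λ e → trans e (sym (Bool.xor-identityʳ γ))))) (*-zeroʳ z)

      toggles-ladder : ∀ ε κ i → (∀ b → par (flip i b) ≡ par b xor κ) → Toggles κ (ladder ε i)
      toggles-ladder ε κ i flips {γ} {x} s b ne = ladder-flip ε i x b (s (flip i b) (λ e → ne (begin
        par b ≡⟨ Bool.xor-identityʳ (par b) ⟨
        par b xor false ≡⟨ cong (par b xor_) (Bool.xor-same κ) ⟨
        par b xor (κ xor κ) ≡⟨ Bool.xor-assoc (par b) κ κ ⟨
        (par b xor κ) xor κ ≡⟨ cong (_xor κ) (trans (sym (flips b)) e) ⟩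
        γ xor κ ∎)))

      dirac-toggles : ∀ n (a a† : Fin (tri n) → Op) (E : Fin n → Fin n → Op) →
        (∀ p → Toggles true (a p)) → (∀ p → Toggles true (a† p)) → (∀ x y → Toggles false (E x y)) →
        Toggles true (dirac n a a† E)
      dirac-toggles zero a a† E ta ta† tE s b ne = refl
      dirac-toggles (suc n) a a† E ta ta† tE =
        toggles-+ (hopping (top n a) (top n a†) E) (dirac n (rest n a) (rest n a†) (twist (top n a) (top n a†) E))
          (toggles-+ (sum (λ i → top n a† i R.* E zero (suc i))) (sum (λ i → top n a i R.* E (suc i) zero))
            (toggles-sum (λ i → top n a† i R.* E zero (suc i))
              (λ i → toggles-* (top n a† i) (E zero (suc i)) (ta† (i ↑ˡ tri n)) (tE zero (suc i))))
            (toggles-sum (λ i → top n a i R.* E (suc i) zero)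
              (λ i → toggles-* (top n a i) (E (suc i) zero) (ta (i ↑ˡ tri n)) (tE (suc i) zero))))
          (dirac-toggles n (rest n a) (rest n a†) (twist (top n a) (top n a†) E)
            (ta ∘ (n ↑ʳ_)) (ta† ∘ (n ↑ʳ_))
            (λ x y → toggles-+ (E (suc x) (suc y)) (top n a† x R.* top n a y) (tE (suc x) (suc y))
              (toggles-* (top n a† x) (top n a y) (ta† (x ↑ˡ tri n)) (ta (y ↑ˡ tri n)))))

    sum-vanish : ∀ {k} (f : Fin k → Op) x → (∀ i b → app (f i) x b ≡ 0ℤ) → ∀ b → app (sum f) x b ≡ 0ℤ
    sum-vanish {k} f x e b = trans (sum-app f x b) (∑-0 (allFin k) (λ {i} _ → e i b))

    -- After commuting, each term of `dirac` acts first by a raising operator or by a ghost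
    -- annihilator. Both properties pass to the twisted raising operators, since their extra summand
    -- ends in an annihilator.
    dirac-kills : ∀ n {a a† : Fin (tri n) → Op} {E : Fin n → Fin n → Op} → System n a a† E → ∀ x →
      (∀ p b → app (a p) x b ≡ 0ℤ) → (∀ i j → i < j → ∀ b → app (E i j) x b ≡ 0ℤ) →
      ∀ b → app (dirac n a a† E) x b ≡ 0ℤ
    dirac-kills zero S x ax Ex b = refl
    dirac-kills (suc n) {a} {a†} {E} S x ax Ex b = cong₂ _+_ (cong₂ _+_
      (sum-vanish (λ i → top n a† i R.* E zero (suc i)) x (λ i → app-vanish (top n a† i) (Ex zero (suc i) (s≤s z≤n))) b)
      (sum-vanish (λ i → top n a i R.* E (suc i) zero) x (λ i c → trans (System.aE S (i ↑ˡ tri n) (suc i) zero x c)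
        (app-vanish (E (suc i) zero) (ax (i ↑ˡ tri n)) c)) b))
      (dirac-kills n (SystemStep.tail-system S) x (ax ∘ (n ↑ʳ_)) (λ i j i<j c → cong₂ _+_
        (Ex (suc i) (suc j) (s≤s i<j) c) (app-vanish (top n a† i) (ax (j ↑ˡ tri n)) c)) b)

    Eigen : Op → (Bits N → ℤ) → Set
    Eigen f φ = ∀ x b → app f x b ≡ φ b * x b

    eigen-sum : ∀ {k} {f : Fin k → Op} {φ : Fin k → Bits N → ℤ} → (∀ i → Eigen (f i) (φ i)) →
                Eigen (sum f) (λ b → ∑ (allFin k) (λ i → φ i b))
    eigen-sum {k} {f} p x b = trans (sum-app f x b) (trans (∑-cong (allFin k) (λ i → p i x b)) (∑-*ʳ (allFin k) (x b) _))

    eigen-squares : ∀ n {h : Fin n → Op} {φ : Fin n → Bits N → ℤ} → (∀ i → Eigen (h i) (φ i)) →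
                    Eigen (squares n h) (λ b → ∑ (allFin n) (λ i → φ i b * φ i b))
    eigen-squares n {h} {φ} p = eigen-sum {f = λ i → h i R.* h i} (λ i x b →
      trans (p i (app (h i) x) b) (trans (cong (φ i b *_) (p i x b)) (sym (*-assoc (φ i b) (φ i b) (x b)))))

    eigen-differences : ∀ n {h : Fin n → Op} {φ : Fin n → Bits N → ℤ} → (∀ i → Eigen (h i) (φ i)) →
                        Eigen (differences n h) (λ b → differencesᶻ n (λ i → φ i b))
    eigen-differences zero p x b = sym (*-zeroˡ (x b))
    eigen-differences (suc n) {h} {φ} p x b = trans (cong₂ _+_
      (eigen-sum {f = λ i → h zero R.- h (suc i)} {λ i c → φ zero c - φ (suc i) c} (λ i y c →
        trans (cong₂ (λ u v → u - v) (p zero y c) (p (suc i) y c)) (*-minusʳ (φ zero c) (φ (suc i) c) (y c))) x b)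
      (eigen-differences n {φ = φ ∘ suc} (p ∘ suc) x b)) (sym (*-distribʳ-+ (x b) (∑ (allFin n) (λ i → φ zero b - φ (suc i) b)) (differencesᶻ n (λ i → φ (suc i) b))))

    -- The recursive `weight` resolved into closed form: an occupied ghost of the pair i < j
    -- contributes -1 at i and +1 at j. The diagonal entry of the twist adds the contribution of the
    -- ghosts peeled off before.
    weight-eigen : ∀ n {a a† : Fin (tri n) → Op} {E : Fin n → Fin n → Op}
      {ν : Fin (tri n) → Bits N → ℤ} {d : Fin n → Bits N → ℤ} →
      (∀ p → Eigen (a† p R.* a p) (ν p)) → (∀ i → Eigen (E i i) (d i)) →
      ∀ i → Eigen (weight n a a† E i) (λ b → d i b + ∑ (allFin (tri n)) (λ p → ν p b * ghostWt n (δᶻ i) p))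
    weight-eigen (suc n) {a} {a†} {E} {ν} {d} eν eE zero x b = begin
      app (E zero zero) x b - app (sum (λ i → top n a† i R.* top n a i)) x b
        ≡⟨ cong₂ (λ u v → u - v) (eE zero x b) (eigen-sum {f = λ i → top n a† i R.* top n a i} {λ i → ν (i ↑ˡ tri n)} (λ i → eν (i ↑ˡ tri n)) x b) ⟩
      d zero b * x b - ∑ (allFin n) (λ i → ν (i ↑ˡ tri n) b) * x b
        ≡⟨ arith (d zero b) _ (x b) ⟩
      (d zero b + - ∑ (allFin n) (λ i → ν (i ↑ˡ tri n) b)) * x b
        ≡⟨ cong (λ s → (d zero b + s) * x b) (sym ghosts) ⟩
      (d zero b + ∑ (allFin (tri (suc n))) (λ p → ν p b * ghostWt (suc n) (δᶻ zero) p)) * x b ∎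
      where
      arith : ∀ u v y → u * y - v * y ≡ (u + - v) * y
      arith = solve-∀
      minus-one : ∀ z → z * (0ℤ - 1ℤ) ≡ - z
      minus-one = solve-∀
      ghostWt-0 : ∀ n p → ghostWt n (λ _ → 0ℤ) p ≡ 0ℤ
      ghostWt-0 (suc n) p with splitAt n p
      ... | inj₁ i = refl
      ... | inj₂ p = ghostWt-0 n p
      ghosts : ∑ (allFin (tri (suc n))) (λ p → ν p b * ghostWt (suc n) (δᶻ zero) p) ≡ - ∑ (allFin n) (λ i → ν (i ↑ˡ tri n) b)
      ghosts = begin
        ∑ (allFin (tri (suc n))) (λ p → ν p b * ghostWt (suc n) (δᶻ zero) p)
          ≡⟨ ∑-tri n (λ p → ν p b * ghostWt (suc n) (δᶻ zero) p) ⟩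
        ∑ (allFin n) (λ i → ν (i ↑ˡ tri n) b * ghostWt (suc n) (δᶻ zero) (i ↑ˡ tri n))
          + ∑ (allFin (tri n)) (λ p → ν (n ↑ʳ p) b * ghostWt (suc n) (δᶻ zero) (n ↑ʳ p))
          ≡⟨ cong₂ _+_
            (∑-cong (allFin n) (λ i → trans (cong (ν (i ↑ˡ tri n) b *_) (ghostWt-top n (δᶻ zero) i)) (minus-one (ν (i ↑ˡ tri n) b))))
            (∑-0 (allFin (tri n)) (λ {p} _ → trans (cong (ν (n ↑ʳ p) b *_)
              (trans (ghostWt-rest n (δᶻ zero) p) (ghostWt-0 n p))) (*-zeroʳ (ν (n ↑ʳ p) b)))) ⟩
        ∑ (allFin n) (λ i → - ν (i ↑ˡ tri n) b) + 0ℤ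
          ≡⟨ trans (+-identityʳ _) (∑-neg (allFin n) (λ i → ν (i ↑ˡ tri n) b)) ⟩
        - ∑ (allFin n) (λ i → ν (i ↑ˡ tri n) b) ∎
    weight-eigen (suc n) {a} {a†} {E} {ν} {d} eν eE (suc i) x b = trans
      (weight-eigen n {ν = ν ∘ (n ↑ʳ_)} {d = λ j c → d (suc j) c + ν (j ↑ˡ tri n) c} (eν ∘ (n ↑ʳ_))
        (λ j y c → trans (cong₂ _+_ (eE (suc j) y c) (eν (j ↑ˡ tri n) y c)) (sym (*-distribʳ-+ (y c) (d (suc j) c) _))) i x b)
      (cong (_* x b) (trans (+-assoc (d (suc i) b) _ _) (cong (d (suc i) b +_) (sym ghosts))))
      where
      ghosts : ∑ (allFin (tri (suc n))) (λ p → ν p b * ghostWt (suc n) (δᶻ (suc i)) p)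
             ≡ ν (i ↑ˡ tri n) b + ∑ (allFin (tri n)) (λ p → ν (n ↑ʳ p) b * ghostWt n (δᶻ i) p)
      ghosts = trans (∑-tri n (λ p → ν p b * ghostWt (suc n) (δᶻ (suc i)) p)) (cong₂ _+_
        (trans (∑-cong (allFin n) (λ j → trans (cong (ν (j ↑ˡ tri n) b *_) (ghostWt-top n (δᶻ (suc i)) j))
          (arith (ν (j ↑ˡ tri n) b) (δᶻ i j)))) (∑-δᶻ i (λ j → ν (j ↑ˡ tri n) b)))
        (∑-cong (allFin (tri n)) (λ p → cong (ν (n ↑ʳ p) b *_) (ghostWt-rest n (δᶻ (suc i)) p))))
        where
        arith : ∀ y z → y * (z - 0ℤ) ≡ z * y
        arith = solve-∀
        ∑-δᶻ : ∀ {k} (i : Fin k) (f : Fin k → ℤ) → ∑ (allFin k) (λ j → δᶻ i j * f j) ≡ f i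
        ∑-δᶻ {suc k} zero f = trans (∑-allFin-suc k (λ j → δᶻ zero j * f j))
          (trans (cong₂ _+_ (*-identityˡ (f zero)) (∑-0 (allFin k) (λ {j} _ → *-zeroˡ (f (suc j))))) (+-identityʳ _))
        ∑-δᶻ {suc k} (suc i) f = trans (∑-allFin-suc k (λ j → δᶻ (suc i) j * f j))
          (trans (cong₂ _+_ (*-zeroˡ (f zero)) (∑-δᶻ i (f ∘ suc))) (+-identityˡ _))

  -- Dominant weights and the norm inequality

  *-nonneg : ∀ {x y} → 0ℤ ≤ x → 0ℤ ≤ y → 0ℤ ≤ x * y
  *-nonneg {x} {y} p q = ≤-trans (≤-reflexive (sym (*-zeroʳ x))) (*-monoˡ-≤-nonNeg x {{ℤ.nonNegative p}} q)

  sum-zeroˡ : ∀ {x y} → 0ℤ ≤ x → 0ℤ ≤ y → x + y ≡ 0ℤ → x ≡ 0ℤ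
  sum-zeroˡ {x} {y} p q e = ≤-antisym (≤-trans (≤-reflexive (sym (+-identityʳ x)))
    (≤-trans (+-monoʳ-≤ x q) (≤-reflexive e))) p

  sum-zeroʳ : ∀ {x y} → 0ℤ ≤ x → 0ℤ ≤ y → x + y ≡ 0ℤ → y ≡ 0ℤ
  sum-zeroʳ {x} {y} p q e = sum-zeroˡ q p (trans (+-comm y x) e)

  -- The vector (n - 1, n - 3, ..., 1 - n), the sum of the positive roots.
  2ρ : ∀ n → Fin n → ℤ
  2ρ (suc n) zero = pos n
  2ρ (suc n) (suc i) = 2ρ n i - 1ℤ

  2ρ-≤ : ∀ n i → 2ρ n i ≤ pos n
  2ρ-≤ (suc n) zero = +≤+ (ℕ.n≤1+n n)
  2ρ-≤ (suc n) (suc i) = ≤-trans (i≤j⇒i-k≤j 1ℤ (2ρ-≤ n i)) (+≤+ (ℕ.n≤1+n n))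

  2ρ-decreasing : ∀ n {i j : Fin n} → i < j → 1ℤ ≤ 2ρ n i - 2ρ n j
  2ρ-decreasing (suc n) {zero} {suc j} _ =
    ≤-trans (+-monoʳ-≤ 1ℤ (i≤j⇒0≤j-i (2ρ-≤ n j))) (≤-reflexive (arith (pos n) (2ρ n j)))
    where
    arith : ∀ x y → 1ℤ + (x - y) ≡ x - (y - 1ℤ)
    arith = solve-∀
  2ρ-decreasing (suc n) {suc i} {suc j} (s≤s i<j) =
    ≤-trans (2ρ-decreasing n i<j) (≤-reflexive (arith (2ρ n i) (2ρ n j)))
    where
    arith : ∀ x y → x - y ≡ x - 1ℤ - (y - 1ℤ)
    arith = solve-∀

  differencesᶻ-2ρ : ∀ n f → differencesᶻ n f ≡ ∑ (allFin n) (λ i → 2ρ n i * f i)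
  differencesᶻ-2ρ zero f = refl
  differencesᶻ-2ρ (suc n) f = begin
    ∑ (allFin n) (λ i → f zero - f (suc i)) + differencesᶻ n (f ∘ suc)
      ≡⟨ cong₂ _+_ (∑-+ (allFin n) (λ _ → f zero) (λ i → - f (suc i))) (differencesᶻ-2ρ n (f ∘ suc)) ⟩
    ∑ (allFin n) (λ _ → f zero) + ∑ (allFin n) (λ i → - f (suc i)) + ∑ (allFin n) (λ i → 2ρ n i * f (suc i))
      ≡⟨ +-assoc (∑ (allFin n) (λ _ → f zero)) _ _ ⟩
    ∑ (allFin n) (λ _ → f zero) + (∑ (allFin n) (λ i → - f (suc i)) + ∑ (allFin n) (λ i → 2ρ n i * f (suc i)))
      ≡⟨ cong₂ _+_ (∑-const n (f zero)) (sym (∑-+ (allFin n) (λ i → - f (suc i)) (λ i → 2ρ n i * f (suc i)))) ⟩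
    pos n * f zero + ∑ (allFin n) (λ i → - f (suc i) + 2ρ n i * f (suc i))
      ≡⟨ cong (pos n * f zero +_) (∑-cong (allFin n) (λ i → arith (2ρ n i) (f (suc i)))) ⟩
    pos n * f zero + ∑ (allFin n) (λ i → (2ρ n i - 1ℤ) * f (suc i))
      ≡⟨ ∑-allFin-suc n (λ i → 2ρ (suc n) i * f i) ⟨
    ∑ (allFin (suc n)) (λ i → 2ρ (suc n) i * f i) ∎
    where
    open ≡-Reasoning
    arith : ∀ r x → - x + r * x ≡ (r - 1ℤ) * x
    arith = solve-∀
    ∑-const : ∀ n z → ∑ (allFin n) (λ _ → z) ≡ pos n * z
    ∑-const zero z = refl
    ∑-const (suc n) z = trans (∑-allFin-suc n (λ _ → z)) (trans (cong (z +_) (∑-const n z)) (sym (suc-* (pos n) z)))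

  ghostWt-nonpos : ∀ n {θ} → (∀ {i j} → i < j → θ j ≤ θ i) → ∀ p → 0ℤ ≤ - ghostWt n θ p
  ghostWt-nonpos (suc n) {θ} dec p with splitAt n p
  ... | inj₁ i = ≤-trans (i≤j⇒0≤j-i (dec {zero} {suc i} (s≤s z≤n))) (≤-reflexive (arith (θ zero) (θ (suc i))))
    where
    arith : ∀ x y → x - y ≡ - (y - x)
    arith = solve-∀
  ... | inj₂ p = ghostWt-nonpos n (λ i<j → dec (s≤s i<j)) p

  ghostWt-neg : ∀ n {θ} → (∀ {i j} → i < j → 1ℤ ≤ θ i - θ j) → ∀ p → 1ℤ ≤ - ghostWt n θ p
  ghostWt-neg (suc n) {θ} dec p with splitAt n p
  ... | inj₁ i = ≤-trans (dec {zero} {suc i} (s≤s z≤n)) (≤-reflexive (arith (θ zero) (θ (suc i))))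
    where
    arith : ∀ x y → x - y ≡ - (y - x)
    arith = solve-∀
  ... | inj₂ p = ghostWt-neg n (λ i<j → dec (s≤s i<j)) p

  ghostWt-linear : ∀ n θ p → ghostWt n θ p ≡ ∑ (allFin n) (λ i → θ i * ghostWt n (δᶻ i) p)
  ghostWt-linear (suc n) θ p = trans (split p) (sym (∑-allFin-suc n (λ i → θ i * ghostWt (suc n) (δᶻ i) p)))
    where
    open ≡-Reasoning
    ghostWt-0 : ∀ n p → ghostWt n (λ _ → 0ℤ) p ≡ 0ℤ
    ghostWt-0 (suc n) p with splitAt n p
    ... | inj₁ i = refl
    ... | inj₂ p = ghostWt-0 n p
    arith : ∀ x y → y - x ≡ x * (0ℤ - 1ℤ) + y
    arith = solve-∀
    arith′ : ∀ x d → x * (d - 0ℤ) ≡ d * x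
    arith′ = solve-∀
    ∑-δᶻ : ∀ {k} (i : Fin k) (f : Fin k → ℤ) → ∑ (allFin k) (λ j → δᶻ j i * f j) ≡ f i
    ∑-δᶻ {suc k} zero f = trans (∑-allFin-suc k (λ j → δᶻ j zero * f j))
      (trans (cong₂ _+_ (*-identityˡ (f zero)) (∑-0 (allFin k) (λ {j} _ → *-zeroˡ (f (suc j))))) (+-identityʳ _))
    ∑-δᶻ {suc k} (suc i) f = trans (∑-allFin-suc k (λ j → δᶻ j (suc i) * f j))
      (trans (cong₂ _+_ (*-zeroˡ (f zero)) (∑-δᶻ i (f ∘ suc))) (+-identityˡ _))
    split : ∀ p → ghostWt (suc n) θ p ≡ θ zero * ghostWt (suc n) (δᶻ zero) p
                  + ∑ (allFin n) (λ i → θ (suc i) * ghostWt (suc n) (δᶻ (suc i)) p)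
    split p with splitAt n p
    ... | inj₁ i = trans (arith (θ zero) (θ (suc i))) (cong (θ zero * (0ℤ - 1ℤ) +_) (sym (trans
      (∑-cong (allFin n) (λ j → arith′ (θ (suc j)) (δᶻ j i))) (∑-δᶻ i (θ ∘ suc)))))
    ... | inj₂ p = trans (ghostWt-linear n (θ ∘ suc) p) (sym (trans
      (cong (_+ ∑ (allFin n) (λ i → θ (suc i) * ghostWt n (δᶻ i) p)) (trans (cong (θ zero *_) (ghostWt-0 n p)) (*-zeroʳ (θ zero))))
      (+-identityˡ _)))

  -- The inequality |λ + ρ + φ| > |λ + ρ| for λ dominant and φ a nonzero sum of positive roots.
  module _ {n} (d ν : Fin n → ℤ) (occupied : Fin (tri n) → ℤ) (occ≥0 : ∀ p → 0ℤ ≤ occupied p)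
    (total : ∀ i → ν i ≡ d i + ∑ (allFin (tri n)) (λ p → occupied p * ghostWt n (δᶻ i) p))
    (dec : ∀ {i j} → i < j → ν j ≤ ν i) where

    private
      -- The value of `θ` on φ = d - ν, the sum of the occupied positive roots. The sign is there
      -- because a ghost has the weight of a negative root.
      pair : (Fin n → ℤ) → ℤ
      pair θ = ∑ (allFin (tri n)) (λ p → occupied p * - ghostWt n θ p)

      pairing : ∀ θ → ∑ (allFin n) (λ i → θ i * d i) ≡ ∑ (allFin n) (λ i → θ i * ν i) + pair θ
      pairing θ = begin
        ∑ (allFin n) (λ i → θ i * d i)
          ≡⟨ ∑-cong (allFin n) (λ i → trans (cong (θ i *_) (shift i)) (arith (θ i) (ν i) (G i))) ⟩
        ∑ (allFin n) (λ i → θ i * ν i + - (θ i * G i))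
          ≡⟨ ∑-+ (allFin n) (λ i → θ i * ν i) (λ i → - (θ i * G i)) ⟩
        ∑ (allFin n) (λ i → θ i * ν i) + ∑ (allFin n) (λ i → - (θ i * G i))
          ≡⟨ cong (∑ (allFin n) (λ i → θ i * ν i) +_) (trans (∑-neg (allFin n) (λ i → θ i * G i)) (trans (cong (-_) collect) (trans
            (sym (∑-neg (allFin (tri n)) (λ p → occupied p * ghostWt n θ p))) (∑-cong (allFin (tri n)) (λ p → neg-distribʳ-* (occupied p) (ghostWt n θ p)))))) ⟩
        ∑ (allFin n) (λ i → θ i * ν i) + pair θ ∎
        where
        open ≡-Reasoning
        G : Fin n → ℤ
        G i = ∑ (allFin (tri n)) (λ p → occupied p * ghostWt n (δᶻ i) p)
        cancel : ∀ x g → x ≡ (x + g) - g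
        cancel = solve-∀
        shift : ∀ i → d i ≡ ν i - G i
        shift i = trans (cancel (d i) (G i)) (cong (_- G i) (sym (total i)))
        arith : ∀ t x g → t * (x - g) ≡ t * x + - (t * g)
        arith = solve-∀
        collect : ∑ (allFin n) (λ i → θ i * G i) ≡ ∑ (allFin (tri n)) (λ p → occupied p * ghostWt n θ p)
        collect = begin
          ∑ (allFin n) (λ i → θ i * G i)
            ≡⟨ ∑-cong (allFin n) (λ i → sym (∑-*ˡ (allFin (tri n)) (θ i) (λ p → occupied p * ghostWt n (δᶻ i) p))) ⟩
          ∑ (allFin n) (λ i → ∑ (allFin (tri n)) (λ p → θ i * (occupied p * ghostWt n (δᶻ i) p)))
            ≡⟨ ∑-swap (allFin n) (allFin (tri n)) (λ i p → θ i * (occupied p * ghostWt n (δᶻ i) p)) ⟩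
          ∑ (allFin (tri n)) (λ p → ∑ (allFin n) (λ i → θ i * (occupied p * ghostWt n (δᶻ i) p)))
            ≡⟨ ∑-cong (allFin (tri n)) (λ p → trans (∑-cong (allFin n) (λ i → *-swapˡ (θ i) (occupied p) (ghostWt n (δᶻ i) p)))
              (trans (∑-*ˡ (allFin n) (occupied p) (λ i → θ i * ghostWt n (δᶻ i) p)) (cong (occupied p *_) (sym (ghostWt-linear n θ p))))) ⟩
          ∑ (allFin (tri n)) (λ p → occupied p * ghostWt n θ p) ∎

      φ² : ℤ
      φ² = ∑ (allFin n) (λ i → (d i - ν i) * (d i - ν i))

      pair-nonneg : ∀ θ → (∀ {i j} → i < j → θ j ≤ θ i) → 0ℤ ≤ pair θ
      pair-nonneg θ dec = ∑-nonneg (allFin (tri n)) (λ p → *-nonneg (occ≥0 p) (ghostWt-nonpos n {θ} dec p))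

      2ρ-dec : ∀ {i j} → i < j → 2ρ n j ≤ 2ρ n i
      2ρ-dec i<j = 0≤i-j⇒j≤i (≤-trans (+≤+ z≤n) (2ρ-decreasing n i<j))

      -- This is |ν + ρ + φ|² - |ν + ρ|² = |φ|² + 2 (ν, φ) + (2ρ, φ). For dominant ν every summand
      -- on the right is nonnegative.
      q-difference : q n d - q n ν ≡ (φ² + (pair ν + pair ν)) + pair (2ρ n)
      q-difference = begin
        q n d - q n ν
          ≡⟨ cong₂ _-_ (cong (∑ (allFin n) (λ i → d i * d i) +_) (differencesᶻ-2ρ n d))
            (cong (∑ (allFin n) (λ i → ν i * ν i) +_) (differencesᶻ-2ρ n ν)) ⟩
        (∑ (allFin n) (λ i → d i * d i) + Rd) - (∑ (allFin n) (λ i → ν i * ν i) + Rν)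
          ≡⟨ cong₂ (λ s r → (s + r) - (∑ (allFin n) (λ i → ν i * ν i) + Rν)) squares-d (pairing (2ρ n)) ⟩
        (φ² + (∑ (allFin n) (λ i → ν i * d i) + ∑ (allFin n) (λ i → ν i * d i))
          - ∑ (allFin n) (λ i → ν i * ν i) + (Rν + pair (2ρ n))) - (∑ (allFin n) (λ i → ν i * ν i) + Rν)
          ≡⟨ cong (λ s → (φ² + (s + s) - ∑ (allFin n) (λ i → ν i * ν i) + (Rν + pair (2ρ n))) - (∑ (allFin n) (λ i → ν i * ν i) + Rν)) (pairing ν) ⟩
        (φ² + ((∑ (allFin n) (λ i → ν i * ν i) + pair ν) + (∑ (allFin n) (λ i → ν i * ν i) + pair ν))
          - ∑ (allFin n) (λ i → ν i * ν i) + (Rν + pair (2ρ n))) - (∑ (allFin n) (λ i → ν i * ν i) + Rν)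
          ≡⟨ arith φ² (∑ (allFin n) (λ i → ν i * ν i)) (pair ν) Rν (pair (2ρ n)) ⟩
        (φ² + (pair ν + pair ν)) + pair (2ρ n) ∎
        where
        open ≡-Reasoning
        Rd Rν : ℤ
        Rd = ∑ (allFin n) (λ i → 2ρ n i * d i)
        Rν = ∑ (allFin n) (λ i → 2ρ n i * ν i)
        arith : ∀ f s p r t → (f + ((s + p) + (s + p)) - s + (r + t)) - (s + r) ≡ (f + (p + p)) + t
        arith = solve-∀
        expand : ∀ x y → x * x ≡ ((x - y) * (x - y) + (y * x + y * x)) + - (y * y)
        expand = solve-∀
        squares-d : ∑ (allFin n) (λ i → d i * d i) ≡
          φ² + (∑ (allFin n) (λ i → ν i * d i) + ∑ (allFin n) (λ i → ν i * d i)) - ∑ (allFin n) (λ i → ν i * ν i)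
        squares-d = begin
          ∑ (allFin n) (λ i → d i * d i)
            ≡⟨ ∑-cong (allFin n) (λ i → expand (d i) (ν i)) ⟩
          ∑ (allFin n) (λ i → (sq i + (ν i * d i + ν i * d i)) + - (ν i * ν i))
            ≡⟨ ∑-+ (allFin n) (λ i → sq i + (ν i * d i + ν i * d i)) (λ i → - (ν i * ν i)) ⟩
          ∑ (allFin n) (λ i → sq i + (ν i * d i + ν i * d i)) + ∑ (allFin n) (λ i → - (ν i * ν i))
            ≡⟨ cong₂ _+_ (∑-+ (allFin n) sq (λ i → ν i * d i + ν i * d i)) (∑-neg (allFin n) (λ i → ν i * ν i)) ⟩
          φ² + ∑ (allFin n) (λ i → ν i * d i + ν i * d i) - ∑ (allFin n) (λ i → ν i * ν i)
            ≡⟨ cong (λ s → φ² + s - ∑ (allFin n) (λ i → ν i * ν i)) (∑-+ (allFin n) (λ i → ν i * d i) (λ i → ν i * d i)) ⟩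
          φ² + (∑ (allFin n) (λ i → ν i * d i) + ∑ (allFin n) (λ i → ν i * d i)) - ∑ (allFin n) (λ i → ν i * ν i) ∎
          where
          sq : Fin n → ℤ
          sq i = (d i - ν i) * (d i - ν i)

      rest-nonneg : 0ℤ ≤ φ² + (pair ν + pair ν)
      rest-nonneg = +-mono-≤ (∑-nonneg (allFin n) (λ i → square-nonneg (d i - ν i)))
        (+-mono-≤ (pair-nonneg ν dec) (pair-nonneg ν dec))

    q-increases : 0ℤ ≤ q n d - q n ν
    q-increases = ≤-trans (+-mono-≤ rest-nonneg (pair-nonneg (2ρ n) 2ρ-dec)) (≤-reflexive (sym q-difference))

    -- A vanishing difference forces (2ρ, φ) = 0, a sum of nonnegative terms, while 2ρ takes a value
    -- of at least 1 on every positive root.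
    q-equal : q n d - q n ν ≡ 0ℤ → ∀ p → occupied p ≡ 0ℤ
    q-equal e p = [ (λ z → z) , (λ z → contradiction (≤-trans (ghostWt-neg n (2ρ-decreasing n) p) (≤-reflexive z)) λ { (+≤+ ()) }) ]′
      (i*j≡0⇒i≡0∨j≡0 (occupied p) (∑-nonneg-0 (allFin (tri n))
        {λ p → occupied p * - ghostWt n (2ρ n) p}
        (λ p → *-nonneg (occ≥0 p) (ghostWt-nonpos n {2ρ n} 2ρ-dec p))
        (sum-zeroʳ rest-nonneg (pair-nonneg (2ρ n) 2ρ-dec) (trans (sym q-difference) e)) (∈-allFin p)))

  module _ {N : ℕ} where

    private module R = Ring (opRing (Bits N))
    open DiracOperator (opRing (Bits N)) hiding (tri)

    -- `dirac-square` and `casimir-ordered` give two expressions for the Casimir element. Both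
    -- Cartan parts are diagonal, so comparing them shows 2 D² = q(d) - q(ν) + 2 `lowerRaise`,
    -- coordinate by coordinate.
    laplacian : ∀ n {a a† : Fin (tri n) → LinOp (Bits N)} {E : Fin n → Fin n → LinOp (Bits N)} → System n a a† E →
      {ν d : Fin n → Bits N → ℤ} → (∀ i → Eigen (weight n a a† E i) (ν i)) → (∀ i → Eigen (E i i) (d i)) →
      ∀ x b → let D = dirac n a a† E in
      app D (app D x) b + app D (app D x) b + q n (λ i → ν i b) * x b
      ≡ q n (λ i → d i b) * x b + (app (lowerRaise n E) x b + app (lowerRaise n E) x b)
    laplacian n {a} {a†} {E} S {ν} {d} eν ed x b = begin
      DD + q n (λ i → ν i b) * x b
        ≡⟨ cong (DD +_) (distrib (∑ (allFin n) (λ i → ν i b * ν i b)) (differencesᶻ n (λ i → ν i b)) (x b)) ⟩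
      DD + (∑ (allFin n) (λ i → ν i b * ν i b) * x b + differencesᶻ n (λ i → ν i b) * x b)
        ≡⟨ +-assoc DD _ _ ⟨
      DD + ∑ (allFin n) (λ i → ν i b * ν i b) * x b + differencesᶻ n (λ i → ν i b) * x b
        ≡⟨ cong₂ (λ s t → DD + s + t) (eigen-squares n {weight n a a† E} {ν} eν x b) (eigen-differences n {weight n a a† E} {ν} eν x b) ⟨
      DD + app (squares n (weight n a a† E)) x b + app (differences n (weight n a a† E)) x b
        ≡⟨ dirac-square n S x b ⟩
      app (casimir n E) x b
        ≡⟨ casimir-ordered n (System.gl S) x b ⟩
      app (squares n (λ i → E i i)) x b + app (differences n (λ i → E i i)) x b + LL
        ≡⟨ cong (_+ LL) (cong₂ _+_ (eigen-squares n {λ i → E i i} {d} ed x b) (eigen-differences n {λ i → E i i} {d} ed x b)) ⟩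
      ∑ (allFin n) (λ i → d i b * d i b) * x b + differencesᶻ n (λ i → d i b) * x b + LL
        ≡⟨ cong (_+ LL) (distrib (∑ (allFin n) (λ i → d i b * d i b)) (differencesᶻ n (λ i → d i b)) (x b)) ⟨
      q n (λ i → d i b) * x b + LL ∎
      where
      open ≡-Reasoning
      DD LL : ℤ
      DD = app (dirac n a a† E) (app (dirac n a a† E) x) b + app (dirac n a a† E) (app (dirac n a a† E) x) b
      LL = app (lowerRaise n E) x b + app (lowerRaise n E) x b
      distrib : ∀ s t y → (s + t) * y ≡ s * y + t * y
      distrib s t y = *-distribʳ-+ y s t

    energy : ∀ n → (Fin n → Fin n → LinOp (Bits N)) → Vector N → ℤ
    energy zero E x = 0ℤ
    energy (suc n) E x = ∑ (allFin n) (λ i → inner (app (E zero (suc i)) x) (app (E zero (suc i)) x))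
                       + energy n (λ i j → E (suc i) (suc j)) x

    inner-self-nonneg : ∀ (x : Vector N) → 0ℤ ≤ inner x x
    inner-self-nonneg x = ∑-nonneg (bits N) (λ b → square-nonneg (x b))

    energy-nonneg : ∀ n E x → 0ℤ ≤ energy n E x
    energy-nonneg zero E x = ≤-refl
    energy-nonneg (suc n) E x = +-mono-≤ (∑-nonneg (allFin n) (λ i → inner-self-nonneg (app (E zero (suc i)) x)))
      (energy-nonneg n _ x)

    energy-zero : ∀ n E x → energy n E x ≡ 0ℤ → ∀ i j → i < j → ∀ b → app (E i j) x b ≡ 0ℤ
    energy-zero (suc n) E x e zero (suc j) _ = inner-self-0 (app (E zero (suc j)) x)
      (∑-nonneg-0 (allFin n) (λ i → inner-self-nonneg (app (E zero (suc i)) x))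
        (sum-zeroˡ (∑-nonneg (allFin n) (λ i → inner-self-nonneg (app (E zero (suc i)) x))) (energy-nonneg n _ x) e) (∈-allFin j))
    energy-zero (suc n) E x e (suc i) (suc j) (s≤s i<j) = energy-zero n (λ i j → E (suc i) (suc j)) x
      (sum-zeroʳ (∑-nonneg (allFin n) (λ i → inner-self-nonneg (app (E zero (suc i)) x))) (energy-nonneg n _ x) e) i j i<j

    inner-lowerRaise : ∀ n {E : Fin n → Fin n → LinOp (Bits N)} → (∀ i j → Adjoint (E i j) (E j i)) →
                       ∀ x → inner x (app (lowerRaise n E) x) ≡ energy n E x
    inner-lowerRaise zero adj x = inner-zeroʳ x (λ _ → refl)
    inner-lowerRaise (suc n) {E} adj x = trans (inner-+ʳ x (app (sum F) x) (app (lowerRaise n (λ i j → E (suc i) (suc j))) x))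
      (cong₂ _+_ top-part (inner-lowerRaise n (λ i j → adj (suc i) (suc j)) x))
      where
      open ≡-Reasoning
      F : Fin n → LinOp (Bits N)
      F i = E (suc i) zero R.* E zero (suc i)
      top-part : inner x (app (sum F) x) ≡ ∑ (allFin n) (λ i → inner (app (E zero (suc i)) x) (app (E zero (suc i)) x))
      top-part = begin
        inner x (app (sum F) x)
          ≡⟨ inner-congʳ x (sum-app F x) ⟩
        ∑ (bits N) (λ b → x b * ∑ (allFin n) (λ i → app (F i) x b))
          ≡⟨ ∑-cong (bits N) (λ b → sym (∑-*ˡ (allFin n) (x b) (λ i → app (F i) x b))) ⟩
        ∑ (bits N) (λ b → ∑ (allFin n) (λ i → x b * app (F i) x b))
          ≡⟨ ∑-swap (bits N) (allFin n) (λ b i → x b * app (F i) x b) ⟩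
        ∑ (allFin n) (λ i → inner x (app (F i) x))
          ≡⟨ ∑-cong (allFin n) (λ i → adj (suc i) zero x (app (E zero (suc i)) x)) ⟩
        ∑ (allFin n) (λ i → inner (app (E zero (suc i)) x) (app (E zero (suc i)) x)) ∎

    -- Harmonic cochains of dominant weight have no ghosts and are highest weight vectors.
    harmonic : ∀ n {a a† : Fin (tri n) → LinOp (Bits N)} {E : Fin n → Fin n → LinOp (Bits N)} → System n a a† E →
      (∀ i j → Adjoint (E i j) (E j i)) → {g : Fin (tri n) → Bits N → ℤ} {d : Fin n → Bits N → ℤ} →
      (∀ p → Eigen (a† p R.* a p) (g p)) → (∀ p b → 0ℤ ≤ g p b) → (∀ i → Eigen (E i i) (d i)) →
      ∀ x → (∀ b → app (dirac n a a† E) (app (dirac n a a† E) x) b ≡ 0ℤ) →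
      (∀ b → x b ≢ 0ℤ → ∀ {i j} → i < j →
        d j b + ∑ (allFin (tri n)) (λ p → g p b * ghostWt n (δᶻ j) p)
        ≤ d i b + ∑ (allFin (tri n)) (λ p → g p b * ghostWt n (δᶻ i) p)) →
      (∀ p b → g p b ≢ 0ℤ → x b ≡ 0ℤ) × (∀ i j → i < j → ∀ b → app (E i j) x b ≡ 0ℤ)
    harmonic n {a} {a†} {E} S adj {g} {d} eg g≥0 ed x DDx dom = vacuum , energy-zero n E x energy≡0
      where
      open ≡-Reasoning
      ν : Fin n → Bits N → ℤ
      ν i b = d i b + ∑ (allFin (tri n)) (λ p → g p b * ghostWt n (δᶻ i) p)
      gap : Bits N → ℤ
      gap b = q n (λ i → d i b) - q n (λ i → ν i b)
      LR : Vector N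
      LR = app (lowerRaise n E) x
      -- The Laplacian identity with D² x = 0, multiplied by `x b`. Summed over `b`, the gaps are
      -- nonnegative by dominance and the rest is twice the energy, so both must vanish.
      pointwise : ∀ b → gap b * (x b * x b) + (x b * LR b + x b * LR b) ≡ 0ℤ
      pointwise b = begin
        (Q - Q′) * (x b * x b) + (x b * LR b + x b * LR b)
          ≡⟨ arith Q Q′ (x b) (LR b) ⟩
        x b * (Q * x b + (LR b + LR b) - Q′ * x b)
          ≡⟨ cong (x b *_) (cong (_- Q′ * x b) (sym (laplacian n S {ν} {d} (weight-eigen n {ν = g} {d = d} eg ed) ed x b))) ⟩
        x b * (app D (app D x) b + app D (app D x) b + Q′ * x b - Q′ * x b)
          ≡⟨ cong (λ z → x b * (z + z + Q′ * x b - Q′ * x b)) (DDx b) ⟩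
        x b * (0ℤ + 0ℤ + Q′ * x b - Q′ * x b)
          ≡⟨ arith′ (x b) (Q′ * x b) ⟩
        0ℤ ∎
        where
        D : LinOp (Bits N)
        D = dirac n a a† E
        Q Q′ : ℤ
        Q = q n (λ i → d i b)
        Q′ = q n (λ i → ν i b)
        arith : ∀ Q Q′ x l → (Q - Q′) * (x * x) + (x * l + x * l) ≡ x * (Q * x + (l + l) - Q′ * x)
        arith = solve-∀
        arith′ : ∀ x y → x * (0ℤ + 0ℤ + y - y) ≡ 0ℤ
        arith′ = solve-∀
      gap-nonneg : ∀ b → 0ℤ ≤ gap b * (x b * x b)
      gap-nonneg b = by-cases (x b ≟ 0ℤ)
        where
        by-cases : Dec (x b ≡ 0ℤ) → 0ℤ ≤ gap b * (x b * x b)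
        by-cases (yes e) = ≤-reflexive (sym (trans (cong (λ z → gap b * (z * z)) e) (*-zeroʳ (gap b))))
        by-cases (no ne) = *-nonneg (q-increases (λ i → d i b) (λ i → ν i b) (λ p → g p b) (λ p → g≥0 p b) (λ _ → refl) (dom b ne))
          (square-nonneg (x b))
      totals : ∑ (bits N) (λ b → gap b * (x b * x b)) + (energy n E x + energy n E x) ≡ 0ℤ
      totals = begin
        ∑ (bits N) (λ b → gap b * (x b * x b)) + (energy n E x + energy n E x)
          ≡⟨ cong (∑ (bits N) (λ b → gap b * (x b * x b)) +_) (cong₂ _+_ (inner-lowerRaise n adj x) (inner-lowerRaise n adj x)) ⟨
        ∑ (bits N) (λ b → gap b * (x b * x b)) + (inner x LR + inner x LR)
          ≡⟨ cong (∑ (bits N) (λ b → gap b * (x b * x b)) +_) (sym (∑-+ (bits N) (λ b → x b * LR b) (λ b → x b * LR b))) ⟩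
        ∑ (bits N) (λ b → gap b * (x b * x b)) + ∑ (bits N) (λ b → x b * LR b + x b * LR b)
          ≡⟨ ∑-+ (bits N) (λ b → gap b * (x b * x b)) (λ b → x b * LR b + x b * LR b) ⟨
        ∑ (bits N) (λ b → gap b * (x b * x b) + (x b * LR b + x b * LR b))
          ≡⟨ ∑-0 (bits N) (λ {b} _ → pointwise b) ⟩
        0ℤ ∎
      gaps≥0 : 0ℤ ≤ ∑ (bits N) (λ b → gap b * (x b * x b))
      gaps≥0 = ∑-nonneg (bits N) gap-nonneg
      energy≥0 : 0ℤ ≤ energy n E x + energy n E x
      energy≥0 = +-mono-≤ (energy-nonneg n E x) (energy-nonneg n E x)
      energy≡0 : energy n E x ≡ 0ℤ
      energy≡0 = sum-zeroˡ (energy-nonneg n E x) (energy-nonneg n E x) (sum-zeroʳ gaps≥0 energy≥0 totals)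
      vacuum : ∀ p b → g p b ≢ 0ℤ → x b ≡ 0ℤ
      vacuum p b ne = by-cases (x b ≟ 0ℤ)
        where
        by-cases : Dec (x b ≡ 0ℤ) → x b ≡ 0ℤ
        by-cases (yes e) = e
        by-cases (no ¬e) = [ (λ z → contradiction
          (q-equal (λ i → d i b) (λ i → ν i b) (λ p → g p b) (λ p → g≥0 p b) (λ _ → refl) (dom b ¬e) z p) ne)
          , (λ z → [ (λ e → e) , (λ e → e) ]′ (i*j≡0⇒i≡0∨j≡0 (x b) z)) ]′
          (i*j≡0⇒i≡0∨j≡0 (gap b) (∑-nonneg-0 (bits N) gap-nonneg (sum-zeroˡ gaps≥0 energy≥0 totals) (∈-bits b)))

  -- Linear dependence over the integers

  ∑-punchIn : ∀ {p} (k : Fin (suc p)) (f : Fin (suc p) → ℤ) →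
              ∑ (allFin (suc p)) f ≡ f k + ∑ (allFin p) (f ∘ punchIn k)
  ∑-punchIn {p} zero f = ∑-allFin-suc p f
  ∑-punchIn {suc p} (suc k) f = begin
    ∑ (allFin (suc (suc p))) f
      ≡⟨ ∑-allFin-suc (suc p) f ⟩
    f zero + ∑ (allFin (suc p)) (f ∘ suc)
      ≡⟨ cong (f zero +_) (∑-punchIn k (f ∘ suc)) ⟩
    f zero + (f (suc k) + ∑ (allFin p) (f ∘ suc ∘ punchIn k))
      ≡⟨ arith (f zero) (f (suc k)) _ ⟩
    f (suc k) + (f zero + ∑ (allFin p) (f ∘ suc ∘ punchIn k))
      ≡⟨ cong (f (suc k) +_) (sym (∑-allFin-suc p (f ∘ punchIn (suc k)))) ⟩
    f (suc k) + ∑ (allFin (suc p)) (f ∘ punchIn (suc k)) ∎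
    where
    arith : ∀ x y z → x + (y + z) ≡ y + (x + z)
    arith = solve-∀

  -- Fraction-free Gaussian elimination. With pivot `c = w k zero`, every other row is scaled by `c`
  -- before its first entry is cleared. A relation `z′` among the eliminated rows lifts with
  -- coefficients `c * z′ i`, still nonzero somewhere as `c` is nonzero, and `zₖ` is chosen to
  -- annihilate the first column.
  dependent : ∀ q {p} → q ℕ.< p → (w : Fin p → Fin q → ℤ) →
              Σ (Fin p → ℤ) λ z → (∃ λ i → z i ≢ 0ℤ) × (∀ j → ∑ (allFin p) (λ i → z i * w i j) ≡ 0ℤ)
  dependent zero (s≤s _) w = (λ _ → 1ℤ) , (zero , λ ()) , λ ()
  dependent (suc q) {suc p} (s≤s q<p) w with any? (λ i → ¬? (w i zero ≟ 0ℤ))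
  ... | no none =
    let z , nonzero , relation = dependent q (ℕ.m≤n⇒m≤1+n q<p) (λ i j → w i (suc j)) in
    z , nonzero , λ
      { zero → ∑-0 (allFin (suc p)) (λ {i} _ → trans (cong (z i *_) (vanish i)) (*-zeroʳ (z i)))
      ; (suc j) → relation j }
    where
    vanish : ∀ i → w i zero ≡ 0ℤ
    vanish i with w i zero ≟ 0ℤ
    ... | yes e = e
    ... | no ne = contradiction (i , ne) none
  ... | yes (k , pivot) = z , (punchIn k i₀ , nonzero) , relation
    where
    c : ℤ
    c = w k zero
    r : Fin p → Fin (suc q) → ℤ
    r i = w (punchIn k i)
    eliminated : Fin p → Fin q → ℤ
    eliminated i j = c * r i (suc j) - r i zero * w k (suc j)
    IH : Σ (Fin p → ℤ) λ z → (∃ λ i → z i ≢ 0ℤ) × (∀ j → ∑ (allFin p) (λ i → z i * eliminated i j) ≡ 0ℤ)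
    IH = dependent q q<p eliminated
    z′ : Fin p → ℤ
    z′ = proj₁ IH
    i₀ : Fin p
    i₀ = proj₁ (proj₁ (proj₂ IH))
    zₖ : ℤ
    zₖ = - ∑ (allFin p) (λ i → z′ i * r i zero)
    z : Fin (suc p) → ℤ
    z = insertAt (λ i → c * z′ i) k zₖ
    nonzero : z (punchIn k i₀) ≢ 0ℤ
    nonzero e with i*j≡0⇒i≡0∨j≡0 c (trans (sym (insertAt-punchIn (λ i → c * z′ i) k zₖ i₀)) e)
    ... | inj₁ c≡0 = pivot c≡0
    ... | inj₂ z≡0 = proj₂ (proj₁ (proj₂ IH)) z≡0
    expand : ∀ j → ∑ (allFin (suc p)) (λ i → z i * w i j) ≡ zₖ * w k j + ∑ (allFin p) (λ i → c * z′ i * r i j)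
    expand j = trans (∑-punchIn k (λ i → z i * w i j)) (cong₂ _+_
      (cong (_* w k j) (insertAt-lookup (λ i → c * z′ i) k zₖ))
      (∑-cong (allFin p) (λ i → cong (_* r i j) (insertAt-punchIn (λ i → c * z′ i) k zₖ i))))
    S : ℤ
    S = ∑ (allFin p) (λ i → z′ i * r i zero)
    relation : ∀ j → ∑ (allFin (suc p)) (λ i → z i * w i j) ≡ 0ℤ
    relation zero = begin
      ∑ (allFin (suc p)) (λ i → z i * w i zero) ≡⟨ expand zero ⟩
      - S * c + ∑ (allFin p) (λ i → c * z′ i * r i zero)
        ≡⟨ cong (- S * c +_) (trans (∑-cong (allFin p) (λ i → *-assoc c (z′ i) (r i zero))) (∑-*ˡ (allFin p) c (λ i → z′ i * r i zero))) ⟩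
      - S * c + c * S ≡⟨ arith S c ⟩
      0ℤ ∎
      where
      arith : ∀ s c → - s * c + c * s ≡ 0ℤ
      arith = solve-∀
    relation (suc j) = begin
      ∑ (allFin (suc p)) (λ i → z i * w i (suc j)) ≡⟨ expand (suc j) ⟩
      - S * w k (suc j) + ∑ (allFin p) (λ i → c * z′ i * r i (suc j))
        ≡⟨ cong (_+ ∑ (allFin p) (λ i → c * z′ i * r i (suc j))) (trans (arith′ S (w k (suc j))) (sym (∑-*ʳ (allFin p) (- w k (suc j)) (λ i → z′ i * r i zero)))) ⟩
      ∑ (allFin p) (λ i → z′ i * r i zero * - w k (suc j)) + ∑ (allFin p) (λ i → c * z′ i * r i (suc j))
        ≡⟨ ∑-+ (allFin p) (λ i → z′ i * r i zero * - w k (suc j)) (λ i → c * z′ i * r i (suc j)) ⟨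
      ∑ (allFin p) (λ i → z′ i * r i zero * - w k (suc j) + c * z′ i * r i (suc j))
        ≡⟨ ∑-cong (allFin p) (λ i → arith (z′ i) (r i zero) (w k (suc j)) c (r i (suc j))) ⟩
      ∑ (allFin p) (λ i → z′ i * eliminated i j) ≡⟨ proj₂ (proj₂ IH) j ⟩
      0ℤ ∎
      where
      arith : ∀ z r w c s → z * r * - w + c * z * s ≡ z * (c * s - r * w)
      arith = solve-∀
      arith′ : ∀ s w → - s * w ≡ s * - w
      arith′ = solve-∀

  lookup-injective : ∀ {A : Set} {xs : List A} → Unique xs → ∀ {i j} → List.lookup xs i ≡ List.lookup xs j → i ≡ j
  lookup-injective (_ ∷ u) {zero} {zero} e = refl
  lookup-injective {xs = _ ∷ xs} (x∉ ∷ u) {zero} {suc j} e = contradiction e (All.lookup x∉ (∈-lookup j))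
  lookup-injective {xs = _ ∷ xs} (x∉ ∷ u) {suc i} {zero} e = contradiction (sym e) (All.lookup x∉ (∈-lookup i))
  lookup-injective (_ ∷ u) {suc i} {suc j} e = cong suc (lookup-injective u e)

  -- An injective operator from vectors supported on P to their restriction to Q.
  dimension-≤ : ∀ {N} {P Q : Bits N → Set} (P? : Decidable P) (Q? : Decidable Q) (F : LinOp (Bits N)) →
    (∀ x → (∀ b → ¬ P b → x b ≡ 0ℤ) → (∀ b → Q b → app F x b ≡ 0ℤ) → ∀ b → x b ≡ 0ℤ) →
    length (filter P? (bits N)) ℕ.≤ length (filter Q? (bits N))
  dimension-≤ {N} {P} {Q} P? Q? F injective = ℕ.≮⇒≥ λ lt →
    let z , (i , nonzero) , relation = dependent (length Y) lt (λ i j → app F (basis (List.lookup X i)) (List.lookup Y j)) in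
    nonzero (trans (sym (value z i)) (injective (combination z) (off-support z)
      (λ b Qb → killed z relation (∈-filter⁺ Q? (∈-bits b) Qb)) (List.lookup X i)))
    where
    X Y : List (Bits N)
    X = filter P? (bits N)
    Y = filter Q? (bits N)
    X-unique : Unique X
    X-unique = Unique.filter⁺ P? (bits-unique N)
    combination : (Fin (length X) → ℤ) → Vector N
    combination z c = ∑ (allFin (length X)) (λ i → z i * basis (List.lookup X i) c)
    off-support : ∀ z b → ¬ P b → combination z b ≡ 0ℤ
    off-support z b ¬Pb = ∑-0 (allFin (length X)) (λ {i} _ → trans
      (cong (z i *_) (ι-no (b ≟ᵇ List.lookup X i) (λ e → ¬Pb (subst P (sym e) (proj₂ (∈-filter⁻ P? {xs = bits N} (∈-lookup i))))))) (*-zeroʳ (z i)))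
    killed : ∀ z → (∀ j → ∑ (allFin (length X)) (λ i → z i * app F (basis (List.lookup X i)) (List.lookup Y j)) ≡ 0ℤ) →
             ∀ {b} → b ∈ Y → app F (combination z) b ≡ 0ℤ
    killed z relation {b} b∈Y = trans (app-∑ F (allFin (length X)) z (λ i → basis (List.lookup X i)) b)
      (subst (λ c → ∑ (allFin (length X)) (λ i → z i * app F (basis (List.lookup X i)) c) ≡ 0ℤ) (sym (lookup-index b∈Y)) (relation (index b∈Y)))
    value : ∀ z i → combination z (List.lookup X i) ≡ z i
    value z i = trans (∑-cong (allFin (length X)) (λ j → *-comm (z j) (ι (List.lookup X i ≟ᵇ List.lookup X j))))
      (∑-unique (λ j → List.lookup X i ≟ᵇ List.lookup X j) z (Unique.allFin⁺ (length X)) (∈-allFin i) refl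
        (λ e → sym (lookup-injective X-unique e)))

  -- The matrix units acting on the exterior algebra of subsets

  hop : ∀ {n} → Fin n → Fin n → LinOp (Bits n)
  hop {n} i j = Ring._*_ (opRing (Bits n)) (ladder true i) (ladder false j)

  -- The relations of `a† i * a j` alone are those of `twist-GL` applied to the zero action `Z`.
  hop-GL : ∀ {n} (x y i j : Fin n) v b →
    app (hop x y) (app (hop i j) v) b + δᶻ x j * app (hop i y) v b
    ≡ app (hop i j) (app (hop x y) v) b + δᶻ y i * app (hop x j) v b
  hop-GL {n} x y i j v b = begin
    app (hop x y) (app (hop i j) v) b + δᶻ x j * app (hop i y) v b
      ≡⟨ cong₂ _+_ (clean x y i j) (cleanδ x j i y) ⟨
    app (T x y) (app (T i j) v) b + app (D.δ x j) (app (T i y) v) b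
      ≡⟨ twisted x y i j v b ⟩
    app (T i j) (app (T x y) v) b + app (D.δ y i) (app (T x j) v) b
      ≡⟨ cong₂ _+_ (clean i j x y) (cleanδ y i x j) ⟩
    app (hop i j) (app (hop x y) v) b + δᶻ y i * app (hop x j) v b ∎
    where
    module R = Ring (opRing (Bits n))
    module D = DiracOperator (opRing (Bits n))
    Z : Fin (suc n) → Fin (suc n) → LinOp (Bits n)
    Z _ _ = R.0#
    T : Fin n → Fin n → LinOp (Bits n)
    T = D.twist (ladder false) (ladder true) Z
    zero-GL : D.IsGL Z
    zero-GL a b i j x c = cong (0ℤ +_) (trans (δ-app a j (λ _ → 0ℤ) c)
      (trans (*-zeroʳ (δᶻ a j)) (sym (trans (δ-app b i (λ _ → 0ℤ) c) (*-zeroʳ (δᶻ b i))))))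
    twisted : D.IsGL T
    twisted = D.Step.twist-GL {n} {ladder false} {ladder true} {Z} (ladder-CAR n) zero-GL
      (λ i x y v b → app-0 (ladder false i) b) (λ i x y v b → app-0 (ladder true i) b)
    T-hop : ∀ x y v b → app (T x y) v b ≡ app (hop x y) v b
    T-hop x y v b = +-identityˡ (app (hop x y) v b)
    clean : ∀ x y i j → app (T x y) (app (T i j) v) b ≡ app (hop x y) (app (hop i j) v) b
    clean x y i j = trans (T-hop x y (app (T i j) v) b) (ext (hop x y) (T-hop i j v) b)
    cleanδ : ∀ x j i y → app (D.δ x j) (app (T i y) v) b ≡ δᶻ x j * app (hop i y) v b
    cleanδ x j i y = trans (δ-app x j (app (T i y) v) b) (cong (δᶻ x j *_) (T-hop i y v b))

  -- The matrix entry of the operator v†ᵢ vⱼ between basis vectors of the exterior algebra.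
  ρ : ∀ {n} → Fin n → Fin n → Bits n → Bits n → ℤ
  ρ i j S T = app (hop i j) (basis T) S

  ρ-sym : ∀ {n} (i j : Fin n) S T → ρ i j S T ≡ ρ j i T S
  ρ-sym i j S T = begin
    app (hop i j) (basis T) S ≡⟨ inner-basis S (app (hop i j) (basis T)) ⟨
    inner (basis S) (app (hop i j) (basis T))
      ≡⟨ adjoint-* {f = ladder true i} {ladder false i} {ladder false j} {ladder true j}
        (ladder-adjoint true i) (ladder-adjoint false j) (basis S) (basis T) ⟩
    inner (app (hop j i) (basis S)) (basis T) ≡⟨ inner-comm (app (hop j i) (basis S)) (basis T) ⟩
    inner (basis T) (app (hop j i) (basis S)) ≡⟨ inner-basis T (app (hop j i) (basis S)) ⟩
    app (hop j i) (basis S) T ∎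

  basis-supported : ∀ {n} (θ : Fin n → ℤ) T → Supported θ (grade θ T) (basis T)
  basis-supported θ T b ne = ι-no (b ≟ᵇ T) (λ e → ne (cong (grade θ) e))

  hop-shifts : ∀ {n} (θ : Fin n → ℤ) i j → Shifts θ (θ i - θ j) (hop i j)
  hop-shifts θ i j = shifts-* θ (ladder true i) (ladder false j) (shifts-create θ i) (shifts-annihilate θ j)

  ρ-grade : ∀ {n} (θ : Fin n → ℤ) i j S T → grade θ S ≢ grade θ T + (θ i - θ j) → ρ i j S T ≡ 0ℤ
  ρ-grade θ i j S T = hop-shifts θ i j (basis-supported θ T) S

  ρ-diag : ∀ {n} (i : Fin n) S T → ρ i i S T ≡ ι (S ≟ᵇ T) * occ T i
  ρ-diag i S T = trans (number i (basis T) S) (by-cases (S ≟ᵇ T))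
    where
    by-cases : (d : Dec (S ≡ T)) → occ S i * ι d ≡ ι d * occ T i
    by-cases (yes refl) = *-comm (occ S i) 1ℤ
    by-cases (no _) = trans (*-zeroʳ (occ S i)) (sym (*-zeroˡ (occ T i)))

  size : ∀ {n} → Bits n → ℤ
  size = grade (λ _ → 1ℤ)

  ρ-size : ∀ {n} (i j : Fin n) S T → size S ≢ size T → ρ i j S T ≡ 0ℤ
  ρ-size i j S T ne = ρ-grade (λ _ → 1ℤ) i j S T (λ e → ne (trans e (+-identityʳ (size T))))

  app-expand : ∀ {n} (f : LinOp (Bits n)) (v : Vector n) b → app f v b ≡ ∑ (bits n) (λ U → v U * app f (basis U) b)
  app-expand {n} f v b = trans (ext f (basis-expansion v) b) (app-∑ f (bits n) v basis b)

  ghostParity : ∀ G {k} → Bits (G ℕ.+ k) → Bool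
  ghostParity zero b = false
  ghostParity (suc G) (h ∷ b) = h xor ghostParity G b

  ghostParity-ghost : ∀ {G k} (p : Fin G) (b : Bits (G ℕ.+ k)) → ghostParity G (flip (p ↑ˡ k) b) ≡ ghostParity G b xor true
  ghostParity-ghost {suc G} zero (h ∷ b) = not-xor h (ghostParity G b)
    where
    not-xor : ∀ h g → not h xor g ≡ (h xor g) xor true
    not-xor true true = refl
    not-xor true false = refl
    not-xor false true = refl
    not-xor false false = refl
  ghostParity-ghost (suc p) (h ∷ b) = trans (cong (h xor_) (ghostParity-ghost p b)) (sym (Bool.xor-assoc h _ true))

  ghostParity-member : ∀ G {k} (s : Fin k) (b : Bits (G ℕ.+ k)) → ghostParity G (flip (G ↑ʳ s) b) ≡ ghostParity G b xor false
  ghostParity-member zero s b = refl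
  ghostParity-member (suc G) s (h ∷ b) = trans (cong (h xor_) (ghostParity-member G s b)) (sym (Bool.xor-assoc h _ false))

  ghostParity-odd : ∀ G {k} (b : Bits (G ℕ.+ k)) → ghostParity G b ≡ true → Σ (Fin G) λ p → lookup b (p ↑ˡ k) ≡ true
  ghostParity-odd (suc G) (true ∷ b) e = zero , refl
  ghostParity-odd (suc G) (false ∷ b) e = let p , q = ghostParity-odd G b e in suc p , q

  -- The Fock space of families, with ghosts

  module Families {n} (L : List (Bits n)) (L-unique : Unique L)
    (L-closed : ∀ {S T} → T ∈ L → size S ≡ size T → S ∈ L) where

    m : ℕ
    m = length L

    setOf : Fin m → Bits n
    setOf = List.lookup L

    setOf-∈ : ∀ s → setOf s ∈ L
    setOf-∈ s = ∈-lookup s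

    -- `hop` preserves the size of a set, and `L` contains with a set all sets of its size; so the
    -- intermediate sets outside `L` contribute nothing and the matrices over `L` multiply like the
    -- operators.
    ρ-product : ∀ x y i j S {T} → T ∈ L →
      ∑ (allFin m) (λ u → ρ x y S (setOf u) * ρ i j (setOf u) T) ≡ app (hop x y) (app (hop i j) (basis T)) S
    ρ-product x y i j S {T} T∈L = begin
      ∑ (allFin m) (λ u → ρ x y S (setOf u) * ρ i j (setOf u) T)
        ≡⟨ ∑-lookup L (λ U → ρ x y S U * ρ i j U T) ⟩
      ∑ L (λ U → ρ x y S U * ρ i j U T)
        ≡⟨ ∑-support _≟ᵇ_ (λ U → ρ x y S U * ρ i j U T) (bits-unique n) L-unique (λ _ → ∈-bits _) vanish ⟨
      ∑ (bits n) (λ U → ρ x y S U * ρ i j U T)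
        ≡⟨ ∑-cong (bits n) (λ U → *-comm (ρ x y S U) (ρ i j U T)) ⟩
      ∑ (bits n) (λ U → app (hop i j) (basis T) U * app (hop x y) (basis U) S)
        ≡⟨ app-expand (hop x y) (app (hop i j) (basis T)) S ⟨
      app (hop x y) (app (hop i j) (basis T)) S ∎
      where
      vanish : ∀ {U} → U ∉ L → ρ x y S U * ρ i j U T ≡ 0ℤ
      vanish {U} U∉L = trans (cong (ρ x y S U *_) (ρ-size i j U T (λ e → U∉L (L-closed T∈L e)))) (*-zeroʳ (ρ x y S U))

    -- The modes of the Fock space: the ghosts, followed by the sets of L.
    N : ℕ
    N = tri n ℕ.+ m

    private module R = Ring (opRing (Bits N))
    open DiracOperator (opRing (Bits N)) hiding (tri)
    open SecondQuantization (opRing (Bits N))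

    ghost : Fin (tri n) → Fin N
    ghost p = p ↑ˡ m

    member : Fin m → Fin N
    member s = tri n ↑ʳ s

    c c† : Fin (tri n) → LinOp (Bits N)
    c p = ladder false (ghost p)
    c† p = ladder true (ghost p)

    a a† : Fin m → LinOp (Bits N)
    a s = ladder false (member s)
    a† s = ladder true (member s)

    car-c : CAR c c†
    car-c = CAR-injection {a = ladder false} {ladder true} ghost (δ-↑ˡ m) (ladder-CAR N)

    car-a : CAR a a†
    car-a = CAR-injection {a = ladder false} {ladder true} member (δ-↑ʳ (tri n)) (ladder-CAR N)

    coeff : Fin n → Fin n → Matrix m
    coeff x y s t = scale (ρ x y (setOf s) (setOf t))

    scale-central : ∀ z f → scale z R.* f R.≈ f R.* scale z
    scale-central z f x b = sym (app-* f z x b)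

    central : ∀ x y → Central (coeff x y)
    central x y s t f = scale-central (ρ x y (setOf s) (setOf t)) f

    E : Fin n → Fin n → LinOp (Bits N)
    E x y = dΓ car-a (coeff x y)

    E-app : ∀ x y v b → app (E x y) v b ≡
      ∑ (allFin m) (λ s → ∑ (allFin m) (λ t → ρ x y (setOf s) (setOf t) * app (a† s) (app (a t) v) b))
    E-app x y v b = trans (sum-app (λ s → sum (λ t → coeff x y s t R.* (a† s R.* a t))) v b)
      (∑-cong (allFin m) (λ s → sum-app (λ t → coeff x y s t R.* (a† s R.* a t)) v b))

    coefficient-product : ∀ x y i j s t v b → app (sum (λ u → coeff x y s u R.* coeff i j u t)) v b
            ≡ app (hop x y) (app (hop i j) (basis (setOf t))) (setOf s) * v b
    coefficient-product x y i j s t v b = begin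
      app (sum (λ u → coeff x y s u R.* coeff i j u t)) v b
        ≡⟨ sum-app (λ u → coeff x y s u R.* coeff i j u t) v b ⟩
      ∑ (allFin m) (λ u → ρ x y (setOf s) (setOf u) * (ρ i j (setOf u) (setOf t) * v b))
        ≡⟨ ∑-cong (allFin m) (λ u → sym (*-assoc (ρ x y (setOf s) (setOf u)) (ρ i j (setOf u) (setOf t)) (v b))) ⟩
      ∑ (allFin m) (λ u → ρ x y (setOf s) (setOf u) * ρ i j (setOf u) (setOf t) * v b)
        ≡⟨ ∑-*ʳ (allFin m) (v b) (λ u → ρ x y (setOf s) (setOf u) * ρ i j (setOf u) (setOf t)) ⟩
      ∑ (allFin m) (λ u → ρ x y (setOf s) (setOf u) * ρ i j (setOf u) (setOf t)) * v b
        ≡⟨ cong (_* v b) (ρ-product x y i j (setOf s) (setOf-∈ t)) ⟩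
      app (hop x y) (app (hop i j) (basis (setOf t))) (setOf s) * v b ∎

    E-GL : IsGL E
    E-GL = dΓ-GL car-a coeff central (λ x y i j s t v b → begin
      app (sum (λ u → coeff x y s u R.* coeff i j u t)) v b + app (δ x j) (λ b′ → ρ i y (setOf s) (setOf t) * v b′) b
        ≡⟨ cong₂ _+_ (coefficient-product x y i j s t v b) (delta x j i y s t v b) ⟩
      app (hop x y) (app (hop i j) (basis (setOf t))) (setOf s) * v b + δᶻ x j * ρ i y (setOf s) (setOf t) * v b
        ≡⟨ *-distribʳ-+ (v b) (app (hop x y) (app (hop i j) (basis (setOf t))) (setOf s)) (δᶻ x j * ρ i y (setOf s) (setOf t)) ⟨
      (app (hop x y) (app (hop i j) (basis (setOf t))) (setOf s) + δᶻ x j * ρ i y (setOf s) (setOf t)) * v b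
        ≡⟨ cong (_* v b) (hop-GL x y i j (basis (setOf t)) (setOf s)) ⟩
      (app (hop i j) (app (hop x y) (basis (setOf t))) (setOf s) + δᶻ y i * ρ x j (setOf s) (setOf t)) * v b
        ≡⟨ *-distribʳ-+ (v b) (app (hop i j) (app (hop x y) (basis (setOf t))) (setOf s)) (δᶻ y i * ρ x j (setOf s) (setOf t)) ⟩
      app (hop i j) (app (hop x y) (basis (setOf t))) (setOf s) * v b + δᶻ y i * ρ x j (setOf s) (setOf t) * v b
        ≡⟨ cong₂ _+_ (coefficient-product i j x y s t v b) (delta y i x j s t v b) ⟨
      app (sum (λ u → coeff i j s u R.* coeff x y u t)) v b + app (δ y i) (λ b′ → ρ x j (setOf s) (setOf t) * v b′) b ∎)
      where
      delta : ∀ x j i y s t v b → app (δ x j) (λ b′ → ρ i y (setOf s) (setOf t) * v b′) b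
            ≡ δᶻ x j * ρ i y (setOf s) (setOf t) * v b
      delta x j i y s t v b = trans (δ-app x j (λ b′ → ρ i y (setOf s) (setOf t) * v b′) b)
        (sym (*-assoc (δᶻ x j) (ρ i y (setOf s) (setOf t)) (v b)))

    open CAR (ladder-CAR N)

    private
      ghost≢member : ∀ p s → δ (ghost p) (member s) R.≈ R.0#
      ghost≢member p s = R.reflexive (δ-↑ˡʳ p s)

      member≢ghost : ∀ s p → δ (member s) (ghost p) R.≈ R.0#
      member≢ghost s p = R.reflexive (trans (δ-sym (member s) (ghost p)) (δ-↑ˡʳ p s))

    system : System n c c† E
    system = record
      { car = car-c
      ; gl = E-GL
      ; aE = λ p x y → dΓ-commute car-a {coeff x y} (c p) (central x y)
        (λ s → aa (ghost p) (member s)) (λ s v b → trans (aa† (ghost p) (member s) v b) (ghost≢member p s v b))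
      ; a†E = λ p x y → dΓ-commute car-a {coeff x y} (c† p) (central x y)
        (λ s v b → trans (+-comm (app (c† p R.* a s) v b) (app (a s R.* c† p) v b)) (trans (aa† (member s) (ghost p) v b) (member≢ghost s p v b)))
        (λ s → a†a† (ghost p) (member s)) }

    E-adjoint : ∀ x y → Adjoint (E x y) (E y x)
    E-adjoint x y = adjoint-≈ {f = E x y} {sum² (λ s t → (a† t R.* a s) R.* coeff x y s t)} {E y x} transpose
      (adjoint-sum (λ s → adjoint-sum (λ t → adjoint-* {f = coeff x y s t} {coeff x y s t} {a† s R.* a t} {a† t R.* a s}
        (adjoint-scale (ρ x y (setOf s) (setOf t)))
        (adjoint-* {f = a† s} {a s} {a t} {a† t} (ladder-adjoint true (member s)) (ladder-adjoint false (member t))))))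
      where
      transpose : sum² (λ s t → (a† t R.* a s) R.* coeff x y s t) R.≈ E y x
      transpose v b = trans (sum²-cong {f = λ s t → (a† t R.* a s) R.* coeff x y s t}
          {λ s t → coeff y x t s R.* (a† t R.* a s)} (λ s t v b →
            trans (app-* (a† t R.* a s) (ρ x y (setOf s) (setOf t)) v b)
              (cong (_* app (a† t R.* a s) v b) (ρ-sym x y (setOf s) (setOf t)))) v b)
        (sum-swap (λ s t → coeff y x t s R.* (a† t R.* a s)) v b)

    modeWeight : (Fin n → ℤ) → Fin N → ℤ
    modeWeight θ i = [ ghostWt n θ , (λ s → grade θ (setOf s)) ]′ (splitAt (tri n) i)

    modeWeight-ghost : ∀ θ p → modeWeight θ (ghost p) ≡ ghostWt n θ p
    modeWeight-ghost θ p = cong [ ghostWt n θ , (λ s → grade θ (setOf s)) ]′ (splitAt-↑ˡ (tri n) p m)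

    modeWeight-member : ∀ θ s → modeWeight θ (member s) ≡ grade θ (setOf s)
    modeWeight-member θ s = cong [ ghostWt n θ , (λ s → grade θ (setOf s)) ]′ (splitAt-↑ʳ (tri n) m s)

    E-shifts : ∀ θ x y → Shifts (modeWeight θ) (θ x - θ y) (E x y)
    E-shifts θ x y = shifts-sum (modeWeight θ) (λ s → sum (λ t → coeff x y s t R.* (a† s R.* a t)))
      (λ s → shifts-sum (modeWeight θ) (λ t → coeff x y s t R.* (a† s R.* a t)) (λ t → entry s t))
      where
      w : Fin N → ℤ
      w = modeWeight θ
      entry : ∀ s t → Shifts w (θ x - θ y) (coeff x y s t R.* (a† s R.* a t))
      entry s t {g} {v} sup b ne = by-cases (grade θ (setOf s) ≟ grade θ (setOf t) + (θ x - θ y))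
        where
        arith : ∀ u d → (u + d) - u ≡ d
        arith = solve-∀
        by-cases : Dec (grade θ (setOf s) ≡ grade θ (setOf t) + (θ x - θ y)) → app (coeff x y s t R.* (a† s R.* a t)) v b ≡ 0ℤ
        by-cases (no ne′) = trans (cong (_* app (a† s R.* a t) v b) (ρ-grade θ x y (setOf s) (setOf t) ne′)) (*-zeroˡ (app (a† s R.* a t) v b))
        by-cases (yes e) = trans (cong (ρ x y (setOf s) (setOf t) *_)
          (shifts-≡ w {f = a† s R.* a t} (begin
            w (member s) - w (member t)
              ≡⟨ cong₂ _-_ (trans (modeWeight-member θ s) e) (modeWeight-member θ t) ⟩
            (grade θ (setOf t) + (θ x - θ y)) - grade θ (setOf t)
              ≡⟨ arith (grade θ (setOf t)) (θ x - θ y) ⟩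
            θ x - θ y ∎)
            (shifts-* w (a† s) (a t) (shifts-create w (member s)) (shifts-annihilate w (member t))) sup b ne)) (*-zeroʳ (ρ x y (setOf s) (setOf t)))

    D : LinOp (Bits N)
    D = dirac n c c† E

    D-shifts : ∀ θ → Shifts (modeWeight θ) 0ℤ D
    D-shifts θ = dirac-shifts (modeWeight θ) n θ c c† E
      (λ p → shifts-≡ (modeWeight θ) {f = c p} (cong (-_) (modeWeight-ghost θ p)) (shifts-annihilate (modeWeight θ) (ghost p)))
      (λ p → shifts-≡ (modeWeight θ) {f = c† p} (modeWeight-ghost θ p) (shifts-create (modeWeight θ) (ghost p)))
      (E-shifts θ)

    parity : Bits N → Bool
    parity = ghostParity (tri n)

    D-toggles : Toggles parity true D
    D-toggles = dirac-toggles parity n c c† E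
      (λ p → toggles-ladder parity false true (ghost p) (ghostParity-ghost p))
      (λ p → toggles-ladder parity true true (ghost p) (ghostParity-ghost p))
      (λ x y → toggles-sum parity (λ s → sum (λ t → coeff x y s t R.* (a† s R.* a t))) (λ s →
        toggles-sum parity (λ t → coeff x y s t R.* (a† s R.* a t)) (λ t →
          toggles-* parity (coeff x y s t) (a† s R.* a t) (toggles-scale parity (ρ x y (setOf s) (setOf t)))
            (toggles-* parity (a† s) (a t) (toggles-ladder parity true false (member s) (ghostParity-member (tri n) s))
              (toggles-ladder parity false false (member t) (ghostParity-member (tri n) t))))))

    degree : Fin n → Bits N → ℤ
    degree x b = ∑ (allFin m) (λ s → occ b (member s) * occ (setOf s) x)

    E-eigen : ∀ x → Eigen (E x x) (degree x)
    E-eigen x v b = trans (E-app x x v b) (trans (∑-cong (allFin m) diagonal)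
      (trans (∑-cong (allFin m) (λ s → *-swap-assoc (occ (setOf s) x) (occ b (member s)) (v b)))
        (∑-*ʳ (allFin m) (v b) (λ s → occ b (member s) * occ (setOf s) x))))
      where
      diagonal : ∀ s → ∑ (allFin m) (λ t → ρ x x (setOf s) (setOf t) * app (a† s) (app (a t) v) b)
                     ≡ occ (setOf s) x * (occ b (member s) * v b)
      diagonal s = trans (∑-cong (allFin m) (λ t → trans
        (cong (_* app (a† s) (app (a t) v) b) (ρ-diag x (setOf s) (setOf t)))
        (*-assoc (ι (setOf s ≟ᵇ setOf t)) (occ (setOf t) x) (app (a† s) (app (a t) v) b))))
        (trans (∑-unique (λ t → setOf s ≟ᵇ setOf t) (λ t → occ (setOf t) x * app (a† s) (app (a t) v) b)
          (Unique.allFin⁺ m) (∈-allFin s) refl (λ e → sym (lookup-injective L-unique e)))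
          (cong (occ (setOf s) x *_) (number (member s) v b)))

    number-ghost : ∀ p → Eigen (c† p R.* c p) (λ b → occ b (ghost p))
    number-ghost p = number (ghost p)

    wt : Bits N → Fin n → ℤ
    wt b x = grade (modeWeight (δᶻ x)) b

    wt-total : ∀ b x → wt b x ≡ degree x b + ∑ (allFin (tri n)) (λ p → occ b (ghost p) * ghostWt n (δᶻ x) p)
    wt-total b x = begin
      grade (modeWeight (δᶻ x)) b
        ≡⟨ grade-∑ (modeWeight (δᶻ x)) b ⟩
      ∑ (allFin N) (λ i → occ b i * modeWeight (δᶻ x) i)
        ≡⟨ ∑-allFin-+ (tri n) m (λ i → occ b i * modeWeight (δᶻ x) i) ⟩
      ∑ (allFin (tri n)) (λ p → occ b (ghost p) * modeWeight (δᶻ x) (ghost p))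
        + ∑ (allFin m) (λ s → occ b (member s) * modeWeight (δᶻ x) (member s))
        ≡⟨ cong₂ _+_ (∑-cong (allFin (tri n)) (λ p → cong (occ b (ghost p) *_) (modeWeight-ghost (δᶻ x) p)))
          (∑-cong (allFin m) (λ s → cong (occ b (member s) *_) (trans (modeWeight-member (δᶻ x) s) (grade-δᶻ x (setOf s))))) ⟩
      ∑ (allFin (tri n)) (λ p → occ b (ghost p) * ghostWt n (δᶻ x) p) + degree x b
        ≡⟨ +-comm _ (degree x b) ⟩
      degree x b + ∑ (allFin (tri n)) (λ p → occ b (ghost p) * ghostWt n (δᶻ x) p) ∎

    occ-nonneg : ∀ {k} (b : Bits k) i → 0ℤ ≤ occ b i
    occ-nonneg b i with lookup b i
    ... | true = ℤ.+≤+ ℕ.z≤n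
    ... | false = ℤ.+≤+ ℕ.z≤n

  -- Counting basis vectors of one dominant weight

  module Dominant {n} (L : List (Bits n)) (L-unique : Unique L)
    (L-closed : ∀ {S T} → T ∈ L → size S ≡ size T → S ∈ L)
    (lam : Fin n → ℤ) (lam-decreasing : ∀ {i j} → i < j → lam j ≤ lam i) where

    open Families L L-unique L-closed
    private module R = Ring (opRing (Bits N))

    AtWeight Vacuum Highest Even Odd : Bits N → Set
    AtWeight b = ∀ x → wt b x ≡ lam x
    Vacuum b = ∀ p → occ b (ghost p) ≡ 0ℤ
    Highest b = ∀ i j → i < j → ∀ v → app (E i j) (basis b) v ≡ 0ℤ
    Even b = AtWeight b × parity b ≡ false
    Odd b = AtWeight b × parity b ≡ true

    atWeight? : Decidable AtWeight
    atWeight? b = Fin.all? (λ x → wt b x ≟ lam x)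

    even? : Decidable Even
    even? b = atWeight? b ×-dec (parity b Bool.≟ false)

    odd? : Decidable Odd
    odd? b = atWeight? b ×-dec (parity b Bool.≟ true)

    vacuum-even : ∀ b → Vacuum b → parity b ≡ false
    vacuum-even b vac = by-cases (parity b) refl
      where
      by-cases : ∀ g → parity b ≡ g → parity b ≡ false
      by-cases false e = e
      by-cases true e = let p , q = ghostParity-odd (tri n) b e in
        contradiction (trans (sym (trans (occ-bit b (ghost p)) (cong bit q))) (vac p)) λ ()

    D-support : ∀ {x} → (∀ b → ¬ AtWeight b → x b ≡ 0ℤ) → ∀ b → ¬ AtWeight b → app D x b ≡ 0ℤ
    D-support {x} sup b ¬at = by-cases (Fin.¬∀⟶∃¬ n (λ i → wt b i ≡ lam i) (λ i → wt b i ≟ lam i) ¬at)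
      where
      by-cases : Σ (Fin n) (λ i → wt b i ≢ lam i) → app D x b ≡ 0ℤ
      by-cases (i , ne) = D-shifts (δᶻ i) {lam i} (λ c ne′ → sup c (λ at → ne′ (at i))) b
        (λ e → ne (trans e (+-identityʳ (lam i))))

    harmonic-vectors : ∀ x → (∀ b → ¬ AtWeight b → x b ≡ 0ℤ) → (∀ b → app D (app D x) b ≡ 0ℤ) →
      (∀ b → ¬ Vacuum b → x b ≡ 0ℤ) × (∀ i j → i < j → ∀ b → app (E i j) x b ≡ 0ℤ)
    harmonic-vectors x sup DDx = no-ghosts , proj₂ result
      where
      dominant : ∀ b → x b ≢ 0ℤ → ∀ {i j} → i < j →
        degree j b + ∑ (allFin (tri n)) (λ p → occ b (ghost p) * ghostWt n (δᶻ j) p)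
        ≤ degree i b + ∑ (allFin (tri n)) (λ p → occ b (ghost p) * ghostWt n (δᶻ i) p)
      dominant b ne {i} {j} i<j = by-cases (atWeight? b)
        where
        by-cases : Dec (AtWeight b) → _
        by-cases (no ¬at) = contradiction (sup b ¬at) ne
        by-cases (yes at) = subst₂ _≤_ (trans (sym (at j)) (wt-total b j)) (trans (sym (at i)) (wt-total b i)) (lam-decreasing i<j)
      result = harmonic n {c} {c†} {E} system E-adjoint {λ p b → occ b (ghost p)} {degree} number-ghost
        (λ p b → occ-nonneg b (ghost p)) E-eigen x DDx dominant
      no-ghosts : ∀ b → ¬ Vacuum b → x b ≡ 0ℤ
      no-ghosts b ¬vac = let p , ne = Fin.¬∀⟶∃¬ (tri n) (λ p → occ b (ghost p) ≡ 0ℤ) (λ p → occ b (ghost p) ≟ 0ℤ) ¬vac in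
        proj₁ result p b ne

    -- `Hw` will be the set of shifted families without ghosts. The inequality rests on `hw-sound`;
    -- the equality adds the converse, the hypothesis `span`, that highest weight vectors are
    -- supported on `Hw`.
    module Bound {Hw : Bits N → Set} (hw? : Decidable Hw)
      (hw-sound : ∀ {b} → Hw b → AtWeight b × Vacuum b × Highest b) where

      D-highest : ∀ {b} → Hw b → ∀ v → app D (basis b) v ≡ 0ℤ
      D-highest {b} h = dirac-kills n system (basis b) (λ p v → annihilated p v) (proj₂ (proj₂ (hw-sound h)))
        where
        annihilated : ∀ p v → app (c p) (basis b) v ≡ 0ℤ
        annihilated p v = by-cases (flip (ghost p) v ≟ᵇ b)
          where
          empty : ∀ g → lookup b (ghost p) ≡ g → g ≡ false
          empty false e = refl
          empty true e = contradiction (trans (sym (trans (occ-bit b (ghost p)) (cong bit e))) (proj₁ (proj₂ (hw-sound h)) p)) λ ()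
          by-cases : Dec (flip (ghost p) v ≡ b) → app (c p) (basis b) v ≡ 0ℤ
          by-cases (no ne) = ladder-flip false (ghost p) (basis b) v (ι-no (flip (ghost p) v ≟ᵇ b) ne)
          by-cases (yes e) = ladder-head false (ghost p) (basis b) v (λ occupied → true≢false (begin
            true ≡⟨ cong not occupied ⟨
            not (lookup v (ghost p)) ≡⟨ lookup∘updateAt (ghost p) v ⟨
            lookup (flip (ghost p) v) (ghost p) ≡⟨ cong (λ w → lookup w (ghost p)) e ⟩
            lookup b (ghost p) ≡⟨ empty (lookup b (ghost p)) refl ⟩
            false ∎))
            where
            open import Data.Vec.Properties using (lookup∘updateAt)
            true≢false : true ≢ false
            true≢false ()

      hw-even : ∀ {b} → Hw b → Even b
      hw-even {b} h = proj₁ (hw-sound h) , vacuum-even b (proj₁ (proj₂ (hw-sound h)))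

      -- Split x into its odd part and its part on `Hw`. `D` kills the latter and maps odd to even,
      -- so if `(D + 1) x` vanishes on even basis vectors then D xₒ = - xₑ and D² xₒ = 0.
      -- Harmonicity makes xₒ free of ghosts; being odd, it is 0, and then xₑ = - D xₒ is 0 as well.
      inequality : length (filter (λ b → odd? b ⊎-dec hw? b) (bits N)) ℕ.≤ length (filter even? (bits N))
      inequality = dimension-≤ (λ b → odd? b ⊎-dec hw? b) even? (D R.+ R.1#) injective
        where
        injective : ∀ x → (∀ b → ¬ (Odd b ⊎ Hw b) → x b ≡ 0ℤ) → (∀ b → Even b → app D x b + x b ≡ 0ℤ) → ∀ b → x b ≡ 0ℤ
        injective x sup eq b = trans (x-split b) (cong₂ _+_ (xₒ≡0 b) (xₑ≡0 b))
          where
          pick : Bool → ℤ → ℤ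
          pick true z = z
          pick false z = 0ℤ
          xₒ xₑ : Vector N
          xₒ b = pick (parity b) (x b)
          xₑ b = pick (not (parity b)) (x b)
          pick-split : ∀ g z → z ≡ pick g z + pick (not g) z
          pick-split true z = sym (+-identityʳ z)
          pick-split false z = sym (+-identityˡ z)
          x-split : ∀ b → x b ≡ xₒ b + xₑ b
          x-split b = pick-split (parity b) (x b)
          pick-false : ∀ {g} z → g ≡ false → pick g z ≡ 0ℤ
          pick-false z refl = refl
          pick-true : ∀ {g} z → g ≡ true → pick g z ≡ z
          pick-true z refl = refl
          xₒ-odd : ∀ b → ¬ Odd b → xₒ b ≡ 0ℤ
          xₒ-odd b ¬o = by-parity (parity b) refl
            where
            by-parity : ∀ g → parity b ≡ g → xₒ b ≡ 0ℤ
            by-parity false e = pick-false (x b) e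
            by-parity true e = trans (pick-true (x b) e) (sup b [ ¬o , (λ h → contradiction (trans (sym e) (proj₂ (hw-even h))) λ ()) ]′)
          xₑ-hw : ∀ b → ¬ Hw b → xₑ b ≡ 0ℤ
          xₑ-hw b ¬h = by-parity (parity b) refl
            where
            by-parity : ∀ g → parity b ≡ g → xₑ b ≡ 0ℤ
            by-parity true e = pick-false (x b) (cong not e)
            by-parity false e = trans (pick-true (x b) (cong not e)) (sup b [ (λ o → contradiction (trans (sym e) (proj₂ o)) λ ()) , ¬h ]′)
          Dxₑ : ∀ b → app D xₑ b ≡ 0ℤ
          Dxₑ b = trans (app-expandᴺ D xₑ b) (∑-0 (bits N) (λ {c} _ → by-cases c (hw? c)))
            where
            app-expandᴺ : ∀ (f : LinOp (Bits N)) (v : Vector N) b → app f v b ≡ ∑ (bits N) (λ U → v U * app f (basis U) b)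
            app-expandᴺ = app-expand
            by-cases : ∀ c → Dec (Hw c) → xₑ c * app D (basis c) b ≡ 0ℤ
            by-cases c (yes h) = trans (cong (xₑ c *_) (D-highest h b)) (*-zeroʳ (xₑ c))
            by-cases c (no ¬h) = trans (cong (_* app D (basis c) b) (xₑ-hw c ¬h)) (*-zeroˡ (app D (basis c) b))
          Dx : ∀ b → app D x b ≡ app D xₒ b
          Dx b = trans (ext D x-split b) (trans (app-+ D xₒ xₑ b) (trans (cong (app D xₒ b +_) (Dxₑ b)) (+-identityʳ (app D xₒ b))))
          xₒ-weight : ∀ b → ¬ AtWeight b → xₒ b ≡ 0ℤ
          xₒ-weight b ¬at = xₒ-odd b (¬at ∘ proj₁)
          Dxₒ-even : ∀ b → ¬ Even b → app D xₒ b ≡ 0ℤ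
          Dxₒ-even b ¬e = by-cases (atWeight? b)
            where
            by-cases : Dec (AtWeight b) → app D xₒ b ≡ 0ℤ
            by-cases (no ¬at) = D-support xₒ-weight b ¬at
            by-cases (yes at) = D-toggles {true} (λ c ne → xₒ-odd c (ne ∘ proj₂)) b (λ e → ¬e (at , e))
          Dxₒ : ∀ b → app D xₒ b ≡ - xₑ b
          Dxₒ b = by-cases (even? b)
            where
            arith : ∀ d y z → d + (y + z) ≡ 0ℤ → y ≡ 0ℤ → d ≡ - z
            arith d y z p refl = trans (cancel d z) (trans (cong (_+ - z) p) (+-identityˡ (- z)))
              where
              cancel : ∀ d z → d ≡ d + (0ℤ + z) + - z
              cancel = solve-∀
            by-cases : Dec (Even b) → app D xₒ b ≡ - xₑ b
            by-cases (no ¬e) = trans (Dxₒ-even b ¬e) (cong (-_) (sym (xₑ-hw b (¬e ∘ hw-even))))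
            by-cases (yes e) = arith (app D xₒ b) (xₒ b) (xₑ b)
              (trans (cong₂ _+_ (sym (Dx b)) (sym (x-split b))) (eq b e))
              (xₒ-odd b (λ o → contradiction (trans (sym (proj₂ o)) (proj₂ e)) λ ()))
          DDxₒ : ∀ b → app D (app D xₒ) b ≡ 0ℤ
          DDxₒ b = trans (ext D Dxₒ b) (trans (app-neg D xₑ b) (cong (-_) (Dxₑ b)))
          xₒ≡0 : ∀ b → xₒ b ≡ 0ℤ
          xₒ≡0 b = by-cases (odd? b)
            where
            by-cases : Dec (Odd b) → xₒ b ≡ 0ℤ
            by-cases (no ¬o) = xₒ-odd b ¬o
            by-cases (yes o) = proj₁ (harmonic-vectors xₒ xₒ-weight DDxₒ) b
              (λ vac → contradiction (trans (sym (proj₂ o)) (vacuum-even b vac)) λ ())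
          xₑ≡0 : ∀ b → xₑ b ≡ 0ℤ
          xₑ≡0 b = trans (sym (neg-involutive (xₑ b))) (cong (-_) (trans (sym (Dxₒ b)) (app-vanish D xₒ≡0 b)))

      -- For even x the odd coordinates of `(D + 1) x` are those of `D x`, so their vanishing gives
      -- D x = 0 and x is a highest weight vector without ghosts. By `span` it lives on `Hw`, where
      -- `(D + 1) x` has the same coordinates as x.
      equality : (∀ x → (∀ b → ¬ (AtWeight b × Vacuum b) → x b ≡ 0ℤ) → (∀ i j → i < j → ∀ b → app (E i j) x b ≡ 0ℤ) →
                  ∀ b → ¬ Hw b → x b ≡ 0ℤ) →
                 length (filter even? (bits N)) ℕ.≤ length (filter (λ b → odd? b ⊎-dec hw? b) (bits N))
      equality span = dimension-≤ even? (λ b → odd? b ⊎-dec hw? b) (D R.+ R.1#) injective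
        where
        injective : ∀ x → (∀ b → ¬ Even b → x b ≡ 0ℤ) → (∀ b → Odd b ⊎ Hw b → app D x b + x b ≡ 0ℤ) → ∀ b → x b ≡ 0ℤ
        injective x sup eq b = by-cases (hw? b)
          where
          x-weight : ∀ b → ¬ AtWeight b → x b ≡ 0ℤ
          x-weight b ¬at = sup b (¬at ∘ proj₁)
          Dx≡0 : ∀ b → app D x b ≡ 0ℤ
          Dx≡0 b = by-odd (odd? b)
            where
            by-weight : Dec (AtWeight b) → ¬ Odd b → app D x b ≡ 0ℤ
            by-weight (no ¬at) ¬o = D-support x-weight b ¬at
            by-weight (yes at) ¬o = D-toggles {false} (λ c ne → sup c (ne ∘ proj₂)) b (λ e → ¬o (at , e))
            by-odd : Dec (Odd b) → app D x b ≡ 0ℤ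
            by-odd (yes o) = trans (sym (+-identityʳ (app D x b))) (trans
              (cong (app D x b +_) (sym (sup b (λ e → contradiction (trans (sym (proj₂ o)) (proj₂ e)) λ ())))) (eq b (inj₁ o)))
            by-odd (no ¬o) = by-weight (atWeight? b) ¬o
          by-cases : Dec (Hw b) → x b ≡ 0ℤ
          by-cases (yes h) = trans (sym (+-identityˡ (x b))) (trans (cong (_+ x b) (sym (Dx≡0 b))) (eq b (inj₂ h)))
          by-cases (no ¬h) = span x support (proj₂ result) b ¬h
            where
            result = harmonic-vectors x x-weight (app-vanish D Dx≡0)
            support : ∀ b → ¬ (AtWeight b × Vacuum b) → x b ≡ 0ℤ
            support b ¬both = by-weight (atWeight? b)
              where
              by-weight : Dec (AtWeight b) → x b ≡ 0ℤ
              by-weight (no ¬at) = x-weight b ¬at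
              by-weight (yes at) = proj₁ result b (λ vac → ¬both (at , vac))

  -- The Casimir element on vectors supported on narrow families

  flip-involutive : ∀ {k} (i : Fin k) b → flip i (flip i b) ≡ b
  flip-involutive zero (h ∷ b) = cong (_∷ b) (Bool.not-involutive h)
  flip-involutive (suc i) (h ∷ b) = cong (h ∷_) (flip-involutive i b)

  ladder-basis : ∀ {k} κ (i : Fin k) b v → lookup b i ≡ κ → lad i κ (basis b) v ≡ 0ℤ
  ladder-basis κ i b v e = by-cases (flip i v ≟ᵇ b)
    where
    not-≢ : ∀ g → g ≢ not g
    not-≢ true ()
    not-≢ false ()
    by-cases : Dec (flip i v ≡ b) → lad i κ (basis b) v ≡ 0ℤ
    by-cases (no ne) = ladder-flip κ i (basis b) v (ι-no (flip i v ≟ᵇ b) ne)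
    by-cases (yes refl) = ladder-head κ i (basis b) v (λ e′ → not-≢ κ (begin
      κ ≡⟨ e ⟨
      lookup (flip i v) i ≡⟨ lookup∘updateAt i v ⟩
      not (lookup v i) ≡⟨ cong not e′ ⟩
      not κ ∎))

  -- The matrix entry of ∑ Eᵢⱼ ⊗ Eⱼᵢ from T ⊗ V to S ⊗ U.
  Ω : ∀ {n} → Bits n → Bits n → Bits n → Bits n → ℤ
  Ω {n} S U T V = ∑ (allFin n) (λ i → ∑ (allFin n) (λ j → ρ i j S T * ρ j i U V))

  -- The matrix entry of the identity minus the flip of the tensor factors, that is, of twice the
  -- projection to antisymmetric tensors.
  exchange : ∀ {n} → Bits n → Bits n → Bits n → Bits n → ℤ
  exchange S U T V = ι (S ≟ᵇ T) * ι (U ≟ᵇ V) - ι (U ≟ᵇ T) * ι (S ≟ᵇ V)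

  -- a†ᵢ aⱼ a†ⱼ aᵢ restores the set from which it starts. Whether j is free is tested after i has
  -- been removed, which makes the formula for the eigenvalue cover i = j too.
  hop-hop-eigen : ∀ {n} (i j : Fin n) → Σ (Bits n → ℤ) λ φ → ∀ S T →
                  app (hop i j) (app (hop j i) (basis T)) S ≡ ι (S ≟ᵇ T) * φ T
  hop-hop-eigen {n} i j = φ , λ S T → begin
    lad i true (lad j false (lad j true (y T))) S
      ≡⟨ ext (ladder true i) (hole T) S ⟩
    lad i true (λ v → (1ℤ - occ (flip i T) j) * y T v) S
      ≡⟨ app-* (ladder true i) (1ℤ - occ (flip i T) j) (y T) S ⟩
    (1ℤ - occ (flip i T) j) * lad i true (y T) S
      ≡⟨ cong ((1ℤ - occ (flip i T) j) *_) (ρ-diag i S T) ⟩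
    (1ℤ - occ (flip i T) j) * (ι (S ≟ᵇ T) * occ T i)
      ≡⟨ *-swapˡ (1ℤ - occ (flip i T) j) (ι (S ≟ᵇ T)) (occ T i) ⟩
    ι (S ≟ᵇ T) * φ T ∎
    where
    φ : Bits n → ℤ
    φ T = (1ℤ - occ (flip i T) j) * occ T i
    y : Bits n → Vector n
    y T = lad i false (basis T)
    hole : ∀ T v → lad j false (lad j true (y T)) v ≡ (1ℤ - occ (flip i T) j) * y T v
    hole T v = begin
      lad j false (lad j true (y T)) v
        ≡⟨ isolate (anticommutator false true j j (y T) v) ⟩
      1ℤ * δᶻ j j * y T v - lad j true (lad j false (y T)) v
        ≡⟨ cong₂ (λ d o → 1ℤ * d * y T v - o) (δᶻ-diag j) (number j (y T) v) ⟩
      1ℤ * 1ℤ * y T v - occ v j * y T v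
        ≡⟨ by-cases (flip i v ≟ᵇ T) ⟩
      (1ℤ - occ (flip i T) j) * y T v ∎
      where
      isolate : ∀ {p q r} → p + q ≡ r → p ≡ r - q
      isolate {p} {q} refl = x≡x+y-y p q
      arith₂ : ∀ o z → 1ℤ * 1ℤ * z - o * z ≡ (1ℤ - o) * z
      arith₂ = solve-∀
      by-cases : Dec (flip i v ≡ T) → 1ℤ * 1ℤ * y T v - occ v j * y T v ≡ (1ℤ - occ (flip i T) j) * y T v
      by-cases (yes refl) = trans (arith₂ (occ v j) (y (flip i v) v))
        (cong (λ w → (1ℤ - occ w j) * y (flip i v) v) (sym (flip-involutive i v)))
      by-cases (no ne) = trans (arith₂ (occ v j) (y T v)) (trans (vanish (1ℤ - occ v j)) (sym (vanish (1ℤ - occ (flip i T) j))))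
        where
        vanish : ∀ z → z * y T v ≡ 0ℤ
        vanish z = trans (cong (z *_) (ladder-flip false i (basis T) v (ι-no (flip i v ≟ᵇ T) ne))) (*-zeroʳ z)

  -- `law` states that ∑ Eᵢⱼ ⊗ Eⱼᵢ is the scalar `ε` on T ∧ V for narrow pairs T, V. It is a
  -- parameter here; `exchange-law` provides it for pairs that differ in at most four places.
  module NarrowVectors {n} (L : List (Bits n)) (L-unique : Unique L)
    (L-closed : ∀ {S T} → T ∈ L → size S ≡ size T → S ∈ L)
    {Narrow : Bits n → Bits n → Set} (narrow? : ∀ T V → Dec (Narrow T V)) (ε : ℤ)
    (law : ∀ S U {T V} → T ∈ L → V ∈ L → Narrow T V → Ω S U T V - Ω U S T V ≡ ε * exchange S U T V) where

    open Families L L-unique L-closed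
    private module R = Ring (opRing (Bits N))
    open DiracOperator (opRing (Bits N)) hiding (tri)
    open SecondQuantization (opRing (Bits N))

    AllNarrow : Bits N → Set
    AllNarrow b = ∀ t v → lookup b (member t) ≡ true → lookup b (member v) ≡ true → Narrow (setOf t) (setOf v)

    NarrowSupport : Vector N → Set
    NarrowSupport x = ∀ b → ¬ AllNarrow b → x b ≡ 0ℤ

    -- The coefficient at `b` stems from `b` with `t` and `v` put back, a basis vector that contains
    -- a wide pair and so lies outside the support of `x`.
    annihilate-wide : ∀ {x} → NarrowSupport x → ∀ t v → ¬ Narrow (setOf t) (setOf v) →
                      ∀ b → app (a v) (app (a t) x) b ≡ 0ℤ
    annihilate-wide {x} sup t v wide b = outer (lookup b (member v)) refl
      where
      b₁ b₂ : Bits N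
      b₁ = flip (member v) b
      b₂ = flip (member t) b₁
      inner-step : ∀ g → lookup b₁ (member t) ≡ g → lookup b (member v) ≡ false → app (a t) x b₁ ≡ 0ℤ
      inner-step true e _ = ladder-head false (member t) x b₁ (λ e′ → contradiction (trans (sym e) e′) λ ())
      inner-step false e ev = ladder-flip false (member t) x b₁ (sup b₂ (λ all → wide (all t v t∈ v∈)))
        where
        t∈ : lookup b₂ (member t) ≡ true
        t∈ = trans (lookup∘updateAt (member t) b₁) (cong not e)
        v∈₁ : lookup b₁ (member v) ≡ true
        v∈₁ = trans (lookup∘updateAt (member v) b) (cong not ev)
        t≢v : member v ≢ member t
        t≢v eq = contradiction (trans (sym v∈₁) (trans (cong (lookup b₁) eq) e)) λ ()
        v∈ : lookup b₂ (member v) ≡ true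
        v∈ = trans (lookup∘updateAt′ (member v) (member t) t≢v b₁) v∈₁
      outer : ∀ g → lookup b (member v) ≡ g → app (a v) (app (a t) x) b ≡ 0ℤ
      outer true e = ladder-head false (member v) (app (a t) x) b (λ e′ → contradiction (trans (sym e) e′) λ ())
      outer false e = ladder-flip false (member v) (app (a t) x) b (inner-step (lookup b₁ (member t)) refl e)

    -- The subtracted term removes the diagonal, where the same mode would be annihilated twice.
    pairs : Bits N → Fin m → Fin m → ℤ
    pairs b t v = occ b (member v) * occ b (member t) - δᶻ (member t) (member v) * occ b (member t)

    pair-number : ∀ x b t v → app (a† t) (app (a† v) (app (a v) (app (a t) x))) b ≡ pairs b t v * x b
    pair-number x b t v = begin
      app (a† t) (app (a† v) w) b
        ≡⟨ isolate {y = w b} (anticommutator true true (member t) (member v) w b) ⟩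
      - app (a† v) (app (a† t) (app (a v) (app (a t) x))) b
        ≡⟨ cong (-_) (ext (a† v) (λ b′ → isolate′ (anticommutator true false (member t) (member v) (app (a t) x) b′)) b) ⟩
      - app (a† v) (λ b′ → 1ℤ * d * app (a t) x b′ + - app (a v) (app (a† t) (app (a t) x)) b′) b
        ≡⟨ cong (-_) (trans (lin (a† v) (1ℤ * d) (app (a t) x) (λ b′ → - app (a v) (app (a† t) (app (a t) x)) b′) b)
          (cong (1ℤ * d * app (a† v) (app (a t) x) b +_) (app-neg (a† v) (app (a v) (app (a† t) (app (a t) x))) b))) ⟩
      - (1ℤ * d * app (a† v) (app (a t) x) b + - app (a† v) (app (a v) (app (a† t) (app (a t) x))) b)
        ≡⟨ cong₂ (λ p q → - (p + - q)) (delta-number (t Fin.≟ v))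
          (trans (number (member v) (app (a† t) (app (a t) x)) b) (cong (occ b (member v) *_) (number (member t) x b))) ⟩
      - (d * (occ b (member t) * x b) + - (occ b (member v) * (occ b (member t) * x b)))
        ≡⟨ arith d (occ b (member t)) (occ b (member v)) (x b) ⟩
      pairs b t v * x b ∎
      where
      d : ℤ
      d = δᶻ (member t) (member v)
      w : Vector N
      w = app (a v) (app (a t) x)
      isolate : ∀ {p q y} → p + q ≡ 0ℤ * d * y → p ≡ - q
      isolate {p} {q} {y} e = trans (x≡x+y-y p q) (trans (cong (_+ - q) e) (vanish d y q))
        where
        vanish : ∀ d y q → 0ℤ * d * y + - q ≡ - q
        vanish = solve-∀
      isolate′ : ∀ {p q r} → p + q ≡ r → p ≡ r + - q
      isolate′ {p} {q} refl = x≡x+y-y p q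
      delta-number : Dec (t ≡ v) → 1ℤ * d * app (a† v) (app (a t) x) b ≡ d * (occ b (member t) * x b)
      delta-number (yes refl) = cong₂ _*_ (*-identityˡ d) (number (member t) x b)
      delta-number (no ne) = trans (cong (λ z → 1ℤ * z * app (a† v) (app (a t) x) b) d≡0)
        (trans (*-zeroˡ (app (a† v) (app (a t) x) b)) (sym (trans (cong (_* (occ b (member t) * x b)) d≡0) (*-zeroˡ (occ b (member t) * x b)))))
        where
        d≡0 : d ≡ 0ℤ
        d≡0 = δᶻ-off (λ e → ne (Fin.↑ʳ-injective (tri n) t v e))
      arith : ∀ d o p x → - (d * (o * x) + - (p * (o * x))) ≡ (p * o - d * o) * x
      arith = solve-∀

    squareCoefficient : Fin n → Fin n → Matrix m
    squareCoefficient i j = _·_ car-a (coeff i j) (coeff j i)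

    oneBody : Fin n → Fin n → Bits N → ℤ
    oneBody i j b = ∑ (allFin m) (λ s → proj₁ (hop-hop-eigen i j) (setOf s) * occ b (member s))

    one-body-expand : ∀ (M : Matrix m) x b → app (dΓ car-a M) x b ≡
      ∑ (allFin m) (λ s → ∑ (allFin m) (λ t → app (M s t) (app (a† s) (app (a t) x)) b))
    one-body-expand M x b = trans (sum-app (λ s → sum (λ t → M s t R.* (a† s R.* a t))) x b)
      (∑-cong (allFin m) (λ s → sum-app (λ t → M s t R.* (a† s R.* a t)) x b))

    one-body : ∀ i j → Eigen (dΓ car-a (squareCoefficient i j)) (oneBody i j)
    one-body i j x b = trans (one-body-expand (squareCoefficient i j) x b) (trans
      (∑-cong (allFin m) (λ s → ∑-cong (allFin m) (λ t → entry s t)))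
      (trans (∑-cong (allFin m) row) (∑-*ʳ (allFin m) (x b) (λ s → φ (setOf s) * occ b (member s)))))
      where
      φ : Bits n → ℤ
      φ = proj₁ (hop-hop-eigen i j)
      entry : ∀ s t → app (squareCoefficient i j s t) (app (a† s) (app (a t) x)) b
                    ≡ ι (setOf s ≟ᵇ setOf t) * (φ (setOf t) * app (a† s) (app (a t) x) b)
      entry s t = trans (coefficient-product i j j i s t (app (a† s) (app (a t) x)) b)
        (trans (cong (_* app (a† s) (app (a t) x) b) (proj₂ (hop-hop-eigen i j) (setOf s) (setOf t)))
          (*-assoc (ι (setOf s ≟ᵇ setOf t)) (φ (setOf t)) (app (a† s) (app (a t) x) b)))
      row : ∀ s → ∑ (allFin m) (λ t → ι (setOf s ≟ᵇ setOf t) * (φ (setOf t) * app (a† s) (app (a t) x) b))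
                ≡ φ (setOf s) * occ b (member s) * x b
      row s = trans (∑-unique (λ t → setOf s ≟ᵇ setOf t) (λ t → φ (setOf t) * app (a† s) (app (a t) x) b)
        (Unique.allFin⁺ m) (∈-allFin s) refl (λ e → sym (lookup-injective L-unique e)))
        (trans (cong (φ (setOf s) *_) (number (member s) x b)) (sym (*-assoc (φ (setOf s)) (occ b (member s)) (x b))))

    private
      ∑∑ : (Fin m → Fin m → ℤ) → ℤ
      ∑∑ f = ∑ (allFin m) (λ s → ∑ (allFin m) (f s))

      ∑∑-cong : ∀ {f g : Fin m → Fin m → ℤ} → (∀ s t → f s t ≡ g s t) → ∑∑ f ≡ ∑∑ g
      ∑∑-cong e = ∑-cong (allFin m) (λ s → ∑-cong (allFin m) (e s))

      ∑∑-+ : ∀ (f g : Fin m → Fin m → ℤ) → ∑∑ (λ s t → f s t + g s t) ≡ ∑∑ f + ∑∑ g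
      ∑∑-+ f g = trans (∑-cong (allFin m) (λ s → ∑-+ (allFin m) (f s) (g s))) (∑-+ (allFin m) _ _)

      ∑∑-* : ∀ z (f : Fin m → Fin m → ℤ) → ∑∑ (λ s t → z * f s t) ≡ z * ∑∑ f
      ∑∑-* z f = trans (∑-cong (allFin m) (λ s → ∑-*ˡ (allFin m) z (f s))) (∑-*ˡ (allFin m) z (λ s → ∑ (allFin m) (f s)))

      ∑∑-*ʳ : ∀ z (f : Fin m → Fin m → ℤ) → ∑∑ (λ s t → f s t * z) ≡ ∑∑ f * z
      ∑∑-*ʳ z f = trans (∑-cong (allFin m) (λ s → ∑-*ʳ (allFin m) z (f s))) (∑-*ʳ (allFin m) z (λ s → ∑ (allFin m) (f s)))

      ∑ⁿ : (Fin n → Fin n → ℤ) → ℤ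
      ∑ⁿ f = ∑ (allFin n) (λ i → ∑ (allFin n) (f i))

      ∑ⁿ-cong : ∀ {f g : Fin n → Fin n → ℤ} → (∀ i j → f i j ≡ g i j) → ∑ⁿ f ≡ ∑ⁿ g
      ∑ⁿ-cong e = ∑-cong (allFin n) (λ s → ∑-cong (allFin n) (e s))

      ∑ⁿ-+ : ∀ (f g : Fin n → Fin n → ℤ) → ∑ⁿ (λ s t → f s t + g s t) ≡ ∑ⁿ f + ∑ⁿ g
      ∑ⁿ-+ f g = trans (∑-cong (allFin n) (λ s → ∑-+ (allFin n) (f s) (g s))) (∑-+ (allFin n) _ _)

      ∑ⁿ-*ʳ : ∀ z (f : Fin n → Fin n → ℤ) → ∑ⁿ (λ s t → f s t * z) ≡ ∑ⁿ f * z
      ∑ⁿ-*ʳ z f = trans (∑-cong (allFin n) (λ s → ∑-*ʳ (allFin n) z (f s))) (∑-*ʳ (allFin n) z (λ s → ∑ (allFin n) (f s)))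

      ∑ⁿ-∑∑ : ∀ (f : Fin n → Fin n → Fin m → Fin m → ℤ) → ∑ⁿ (λ i j → ∑∑ (f i j)) ≡ ∑∑ (λ s t → ∑ⁿ (λ i j → f i j s t))
      ∑ⁿ-∑∑ f = begin
        ∑ (allFin n) (λ i → ∑ (allFin n) (λ j → ∑ (allFin m) (λ s → ∑ (allFin m) (f i j s))))
          ≡⟨ ∑-cong (allFin n) (λ i → ∑-swap (allFin n) (allFin m) (λ j s → ∑ (allFin m) (f i j s))) ⟩
        ∑ (allFin n) (λ i → ∑ (allFin m) (λ s → ∑ (allFin n) (λ j → ∑ (allFin m) (f i j s))))
          ≡⟨ ∑-swap (allFin n) (allFin m) (λ i s → ∑ (allFin n) (λ j → ∑ (allFin m) (f i j s))) ⟩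
        ∑ (allFin m) (λ s → ∑ (allFin n) (λ i → ∑ (allFin n) (λ j → ∑ (allFin m) (f i j s))))
          ≡⟨ ∑-cong (allFin m) (λ s → trans (∑-cong (allFin n) (λ i → ∑-swap (allFin n) (allFin m) (λ j t → f i j s t)))
            (∑-swap (allFin n) (allFin m) (λ i t → ∑ (allFin n) (λ j → f i j s t)))) ⟩
        ∑∑ (λ s t → ∑ⁿ (λ i j → f i j s t)) ∎

    twoBody : Bits N → ℤ
    twoBody b = ∑∑ (λ t v → ε * (pairs b t v + pairs b t v))

    quarticOp : Fin n → Fin n → LinOp (Bits N)
    quarticOp i j = quartic car-a (λ s t u v → coeff i j s t R.* coeff j i u v)

    EE : ∀ i j → E i j R.* E j i R.≈ dΓ car-a (squareCoefficient i j) R.+ quarticOp i j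
    EE i j = dΓ-product car-a {coeff i j} {coeff j i} (central j i)

    quartics : Vector N → Vector N
    quartics x b = ∑ⁿ (λ i j → app (quarticOp i j) x b)

    -- `K s u t v` is antisymmetric in `s` and `u`. Adding a second copy with `s` and `u` exchanged
    -- therefore leaves only `W s u t v − W u s t v`, to which `law` applies; for wide pairs `t`,
    -- `v` every `K` vanishes. The quartic part is thereby reduced to counting pairs of occupied
    -- modes.
    two-body : ∀ {x} → NarrowSupport x → ∀ b → quartics x b + quartics x b ≡ twoBody b * x b
    two-body {x} sup b = begin
      quartics x b + quartics x b
        ≡⟨ cong₂ _+_ collect collect ⟩
      ∑∑ (λ s t → ∑∑ (λ u v → W s u t v * K s u t v)) + ∑∑ (λ s t → ∑∑ (λ u v → W s u t v * K s u t v))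
        ≡⟨ cong₂ _+_ reorder reorder ⟩
      ∑∑ (λ t v → ∑∑ (λ s u → W s u t v * K s u t v)) + ∑∑ (λ t v → ∑∑ (λ s u → W s u t v * K s u t v))
        ≡⟨ ∑∑-+ _ _ ⟨
      ∑∑ (λ t v → ∑∑ (λ s u → W s u t v * K s u t v) + ∑∑ (λ s u → W s u t v * K s u t v))
        ≡⟨ ∑∑-cong (λ t v → at t v (narrow? (setOf t) (setOf v))) ⟩
      ∑∑ (λ t v → ε * (K t v t v + K t v t v))
        ≡⟨ ∑∑-cong (λ t v → trans (cong (λ k → ε * (k + k)) (pair-number x b t v)) (arith₁ ε (pairs b t v) (x b))) ⟩
      ∑∑ (λ t v → ε * (pairs b t v + pairs b t v) * x b)
        ≡⟨ ∑∑-*ʳ (x b) _ ⟩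
      twoBody b * x b ∎
      where
      W K : Fin m → Fin m → Fin m → Fin m → ℤ
      W s u t v = Ω (setOf s) (setOf u) (setOf t) (setOf v)
      K s u t v = app (a† s) (app (a† u) (app (a v) (app (a t) x))) b
      arith₁ : ∀ e p x → e * (p * x + p * x) ≡ e * (p + p) * x
      arith₁ = solve-∀
      collect : quartics x b ≡ ∑∑ (λ s t → ∑∑ (λ u v → W s u t v * K s u t v))
      collect = begin
        quartics x b
          ≡⟨ ∑ⁿ-cong (λ i j → expand i j) ⟩
        ∑ⁿ (λ i j → ∑∑ (λ s t → ∑∑ (λ u v → ρ i j (setOf s) (setOf t) * ρ j i (setOf u) (setOf v) * K s u t v)))
          ≡⟨ ∑ⁿ-∑∑ _ ⟩
        ∑∑ (λ s t → ∑ⁿ (λ i j → ∑∑ (λ u v → ρ i j (setOf s) (setOf t) * ρ j i (setOf u) (setOf v) * K s u t v)))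
          ≡⟨ ∑∑-cong (λ s t → trans (∑ⁿ-∑∑ _) (∑∑-cong (λ u v → ∑ⁿ-*ʳ (K s u t v) _))) ⟩
        ∑∑ (λ s t → ∑∑ (λ u v → W s u t v * K s u t v)) ∎
        where
        expand : ∀ i j → app (quarticOp i j) x b
                 ≡ ∑∑ (λ s t → ∑∑ (λ u v → ρ i j (setOf s) (setOf t) * ρ j i (setOf u) (setOf v) * K s u t v))
        expand i j = trans (sum²-app (λ s t → sum² (λ u v → Q s t u v R.* (a† s R.* a† u R.* (a v R.* a t)))))
          (∑∑-cong (λ s t → trans (sum²-app (λ u v → Q s t u v R.* (a† s R.* a† u R.* (a v R.* a t))))
            (∑∑-cong (λ u v → sym (*-assoc (ρ i j (setOf s) (setOf t)) (ρ j i (setOf u) (setOf v)) (K s u t v))))))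
          where
          Q : Fin m → Fin m → Fin m → Fin m → LinOp (Bits N)
          Q s t u v = coeff i j s t R.* coeff j i u v
          sum²-app : ∀ (f : Matrix m) → app (sum² f) x b ≡ ∑∑ (λ s t → app (f s t) x b)
          sum²-app f = trans (sum-app (λ s → sum (f s)) x b) (∑-cong (allFin m) (λ s → sum-app (f s) x b))
      reorder : ∑∑ (λ s t → ∑∑ (λ u v → W s u t v * K s u t v)) ≡ ∑∑ (λ t v → ∑∑ (λ s u → W s u t v * K s u t v))
      reorder = begin
        ∑ (allFin m) (λ s → ∑ (allFin m) (λ t → ∑ (allFin m) (λ u → ∑ (allFin m) (λ v → F s u t v))))
          ≡⟨ ∑-swap (allFin m) (allFin m) _ ⟩
        ∑ (allFin m) (λ t → ∑ (allFin m) (λ s → ∑ (allFin m) (λ u → ∑ (allFin m) (λ v → F s u t v))))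
          ≡⟨ ∑∑-cong (λ t s → ∑-swap (allFin m) (allFin m) (λ u v → F s u t v)) ⟩
        ∑ (allFin m) (λ t → ∑ (allFin m) (λ s → ∑ (allFin m) (λ v → ∑ (allFin m) (λ u → F s u t v))))
          ≡⟨ ∑-cong (allFin m) (λ t → ∑-swap (allFin m) (allFin m) (λ s v → ∑ (allFin m) (λ u → F s u t v))) ⟩
        ∑∑ (λ t v → ∑∑ (λ s u → F s u t v)) ∎
        where
        F : Fin m → Fin m → Fin m → Fin m → ℤ
        F s u t v = W s u t v * K s u t v
      at : ∀ t v → Dec (Narrow (setOf t) (setOf v)) →
        ∑∑ (λ s u → W s u t v * K s u t v) + ∑∑ (λ s u → W s u t v * K s u t v) ≡ ε * (K t v t v + K t v t v)
      at t v (no wide) = trans (cong₂ _+_ all-zero all-zero) (sym (trans (cong₂ (λ p q → ε * (p + q)) (zero-K t v) (zero-K t v)) (*-zeroʳ ε)))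
        where
        zero-K : ∀ s u → K s u t v ≡ 0ℤ
        zero-K s u = app-vanish (a† s) (app-vanish (a† u) (annihilate-wide sup t v wide)) b
        all-zero : ∑∑ (λ s u → W s u t v * K s u t v) ≡ 0ℤ
        all-zero = ∑-0 (allFin m) (λ {s} _ → ∑-0 (allFin m) (λ {u} _ → trans (cong (W s u t v *_) (zero-K s u)) (*-zeroʳ (W s u t v))))
      at t v (yes narrow) = begin
        ∑∑ (λ s u → W s u t v * k s u) + ∑∑ (λ s u → W s u t v * k s u)
          ≡⟨ cong (∑∑ (λ s u → W s u t v * k s u) +_) (∑-swap (allFin m) (allFin m) (λ s u → W s u t v * k s u)) ⟩
        ∑∑ (λ s u → W s u t v * k s u) + ∑∑ (λ s u → W u s t v * k u s)
          ≡⟨ ∑∑-+ _ _ ⟨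
        ∑∑ (λ s u → W s u t v * k s u + W u s t v * k u s)
          ≡⟨ ∑∑-cong (λ s u → trans (cong (λ z → W s u t v * k s u + W u s t v * z) (anti u s)) (trans (arith₂ (W s u t v) (W u s t v) (k s u))
            (cong (_* k s u) (law (setOf s) (setOf u) (setOf-∈ t) (setOf-∈ v) narrow)))) ⟩
        ∑∑ (λ s u → ε * exchange (setOf s) (setOf u) (setOf t) (setOf v) * k s u)
          ≡⟨ ∑∑-cong (λ s u → arith₃ ε (ι (setOf s ≟ᵇ setOf t)) (ι (setOf u ≟ᵇ setOf v)) (ι (setOf u ≟ᵇ setOf t)) (ι (setOf s ≟ᵇ setOf v)) (k s u)) ⟩
        ∑∑ (λ s u → ε * (ι (setOf s ≟ᵇ setOf t) * (ι (setOf u ≟ᵇ setOf v) * k s u) + ι (setOf s ≟ᵇ setOf v) * (ι (setOf u ≟ᵇ setOf t) * - k s u)))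
          ≡⟨ trans (∑∑-* ε _) (cong (ε *_) (∑∑-+ _ _)) ⟩
        ε * (∑∑ (λ s u → ι (setOf s ≟ᵇ setOf t) * (ι (setOf u ≟ᵇ setOf v) * k s u))
             + ∑∑ (λ s u → ι (setOf s ≟ᵇ setOf v) * (ι (setOf u ≟ᵇ setOf t) * - k s u)))
          ≡⟨ cong (ε *_) (cong₂ _+_ (select t v k) (trans (select v t (λ s u → - k s u)) (sym (anti t v)))) ⟩
        ε * (k t v + k t v) ∎
        where
        k : Fin m → Fin m → ℤ
        k s u = K s u t v
        anti : ∀ s u → k s u ≡ - k u s
        anti s u = isolate {d = δᶻ (member s) (member u)} {app (a v) (app (a t) x) b} (anticommutator true true (member s) (member u) (app (a v) (app (a t) x)) b)
          where
          isolate : ∀ {p q d y} → p + q ≡ 0ℤ * d * y → p ≡ - q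
          isolate {p} {q} {d} {y} e = trans (x≡x+y-y p q) (trans (cong (_+ - q) e) (vanish d y q))
            where
            vanish : ∀ d y q → 0ℤ * d * y + - q ≡ - q
            vanish = solve-∀
        arith₂ : ∀ w w′ k → w * k + w′ * - k ≡ (w - w′) * k
        arith₂ = solve-∀
        arith₃ : ∀ e p q r s k → e * (p * q - r * s) * k ≡ e * (p * (q * k) + s * (r * - k))
        arith₃ = solve-∀
        pick : ∀ t (f : Fin m → ℤ) → ∑ (allFin m) (λ s → ι (setOf s ≟ᵇ setOf t) * f s) ≡ f t
        pick t f = ∑-unique (λ s → setOf s ≟ᵇ setOf t) f (Unique.allFin⁺ m) (∈-allFin t) refl (lookup-injective L-unique)
        select : ∀ t v (f : Fin m → Fin m → ℤ) → ∑∑ (λ s u → ι (setOf s ≟ᵇ setOf t) * (ι (setOf u ≟ᵇ setOf v) * f s u)) ≡ f t v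
        select t v f = trans (∑-cong (allFin m) (λ s → trans (∑-*ˡ (allFin m) (ι (setOf s ≟ᵇ setOf t)) (λ u → ι (setOf u ≟ᵇ setOf v) * f s u))
          (cong (ι (setOf s ≟ᵇ setOf t) *_) (pick v (f s)))))
          (pick t (λ s → f s v))

    casimir-scalar : Bits N → ℤ
    casimir-scalar b = ∑ⁿ (λ i j → oneBody i j b) + ∑ⁿ (λ i j → oneBody i j b) + twoBody b

    casimir-narrow : ∀ {x} → NarrowSupport x → ∀ b →
                     app (casimir n E) x b + app (casimir n E) x b ≡ casimir-scalar b * x b
    casimir-narrow {x} sup b = begin
      app (casimir n E) x b + app (casimir n E) x b
        ≡⟨ cong₂ _+_ split split ⟩
      (κ * x b + quartics x b) + (κ * x b + quartics x b)
        ≡⟨ arith κ (x b) (quartics x b) ⟩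
      (κ + κ) * x b + (quartics x b + quartics x b)
        ≡⟨ cong ((κ + κ) * x b +_) (two-body sup b) ⟩
      (κ + κ) * x b + twoBody b * x b
        ≡⟨ *-distribʳ-+ (x b) (κ + κ) (twoBody b) ⟨
      casimir-scalar b * x b ∎
      where
      κ : ℤ
      κ = ∑ⁿ (λ i j → oneBody i j b)
      arith : ∀ k x q → (k * x + q) + (k * x + q) ≡ (k + k) * x + (q + q)
      arith = solve-∀
      split : app (casimir n E) x b ≡ κ * x b + quartics x b
      split = begin
        app (casimir n E) x b
          ≡⟨ trans (sum-app (λ i → sum (λ j → E i j R.* E j i)) x b) (∑-cong (allFin n) (λ i → sum-app (λ j → E i j R.* E j i) x b)) ⟩
        ∑ⁿ (λ i j → app (E i j) (app (E j i) x) b)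
          ≡⟨ ∑ⁿ-cong (λ i j → trans (EE i j x b) (cong (_+ app (quarticOp i j) x b) (one-body i j x b))) ⟩
        ∑ⁿ (λ i j → oneBody i j b * x b + app (quarticOp i j) x b)
          ≡⟨ ∑ⁿ-+ (λ i j → oneBody i j b * x b) (λ i j → app (quarticOp i j) x b) ⟩
        ∑ⁿ (λ i j → oneBody i j b * x b) + quartics x b
          ≡⟨ cong (_+ quartics x b) (∑ⁿ-*ʳ (x b) (λ i j → oneBody i j b)) ⟩
        κ * x b + quartics x b ∎

    lowerRaise-kills : ∀ k (F : Fin k → Fin k → LinOp (Bits N)) x → (∀ i j → i < j → ∀ b → app (F i j) x b ≡ 0ℤ) →
                       ∀ b → app (lowerRaise k F) x b ≡ 0ℤ
    lowerRaise-kills zero F x e b = refl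
    lowerRaise-kills (suc k) F x e b = cong₂ _+_
      (sum-vanish (λ i → F (suc i) zero R.* F zero (suc i)) x (λ i → app-vanish (F (suc i) zero) (e zero (suc i) (s≤s z≤n))) b)
      (lowerRaise-kills k (λ i j → F (suc i) (suc j)) x (λ i j i<j → e (suc i) (suc j) (s≤s i<j)) b)

    -- On narrow vectors the Casimir element is diagonal, hence so is ∑ Eⱼᵢ Eᵢⱼ (i < j): a basis
    -- vector occurring in a highest weight vector is itself a highest weight vector.
    highest-support : ∀ x → NarrowSupport x → (∀ i j → i < j → ∀ b → app (E i j) x b ≡ 0ℤ) →
      ∀ b → x b ≢ 0ℤ → AllNarrow b → ∀ i j → i < j → ∀ v → app (E i j) (basis b) v ≡ 0ℤ
    highest-support x sup Ex b ne narrow = energy-zero n E (basis b) (begin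
      energy n E (basis b) ≡⟨ inner-lowerRaise n E-adjoint (basis b) ⟨
      inner (basis b) (app (lowerRaise n E) (basis b)) ≡⟨ inner-basis b (app (lowerRaise n E) (basis b)) ⟩
      app (lowerRaise n E) (basis b) b ≡⟨ quarter _ (trans (sym (diagonal (basis b) basis-narrow)) (trans (cong (_* basis b b) h≡0) (*-zeroˡ (basis b b)))) ⟩
      0ℤ ∎)
      where
      Q h : ℤ
      Q = q n (λ i → degree i b)
      -- On narrow vectors, four times the diagonal value of `lowerRaise` at `b`: one factor 2 comes
      -- from `casimir-narrow`, the other from `casimir-ordered`. As `lowerRaise` kills `x` and
      -- `x b` is nonzero, `h` is 0, and then the energy of `basis b` vanishes.
      h = casimir-scalar b - (Q + Q)
      diagonal : ∀ y → NarrowSupport y → h * y b ≡ (app (lowerRaise n E) y b + app (lowerRaise n E) y b) + (app (lowerRaise n E) y b + app (lowerRaise n E) y b)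
      diagonal y supy = begin
        h * y b
          ≡⟨ distrib (casimir-scalar b) Q (y b) ⟩
        casimir-scalar b * y b - (Q * y b + Q * y b)
          ≡⟨ cong (_- (Q * y b + Q * y b)) (sym (casimir-narrow supy b)) ⟩
        app (casimir n E) y b + app (casimir n E) y b - (Q * y b + Q * y b)
          ≡⟨ cong (λ z → z + z - (Q * y b + Q * y b)) ordered ⟩
        (Q * y b + (Λ + Λ)) + (Q * y b + (Λ + Λ)) - (Q * y b + Q * y b)
          ≡⟨ arith (Q * y b) Λ ⟩
        (Λ + Λ) + (Λ + Λ) ∎
        where
        Λ : ℤ
        Λ = app (lowerRaise n E) y b
        distrib : ∀ c q y → (c - (q + q)) * y ≡ c * y - (q * y + q * y)
        distrib = solve-∀
        arith : ∀ q l → (q + (l + l)) + (q + (l + l)) - (q + q) ≡ (l + l) + (l + l)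
        arith = solve-∀
        ordered : app (casimir n E) y b ≡ Q * y b + (Λ + Λ)
        ordered = trans (casimir-ordered n E-GL y b) (cong (_+ (Λ + Λ)) (trans
          (cong₂ _+_ (eigen-squares n {λ i → E i i} {degree} E-eigen y b) (eigen-differences n {λ i → E i i} {degree} E-eigen y b))
          (sym (*-distribʳ-+ (y b) (∑ (allFin n) (λ i → degree i b * degree i b)) (differencesᶻ n (λ i → degree i b))))))
      basis-narrow : NarrowSupport (basis b)
      basis-narrow b′ ¬all = ι-no (b′ ≟ᵇ b) (λ { refl → ¬all narrow })
      h≡0 : h ≡ 0ℤ
      h≡0 = [ (λ e → e) , (λ e → contradiction e ne) ]′ (i*j≡0⇒i≡0∨j≡0 h
        (trans (diagonal x sup) (cong (λ z → (z + z) + (z + z)) (lowerRaise-kills n E x Ex b))))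
      quarter : ∀ z → (z + z) + (z + z) ≡ 0ℤ → z ≡ 0ℤ
      quarter z e = [ (λ ()) , (λ e → e) ]′ (i*j≡0⇒i≡0∨j≡0 (ℤ.+ 4) (trans (four z) e))
        where
        four : ∀ z → ℤ.+ 4 * z ≡ (z + z) + (z + z)
        four = solve-∀

  -- The exchange law, reduced to at most four positions

  same : Bool → Bool → ℤ
  same true true = 1ℤ
  same true false = 0ℤ
  same false true = 0ℤ
  same false false = 1ℤ

  basis-∷ : ∀ {n} s t (S T : Bits n) → basis (t ∷ T) (s ∷ S) ≡ same s t * basis T S
  basis-∷ true true S T = trans (ι-cong ((true ∷ S) ≟ᵇ (true ∷ T)) (S ≟ᵇ T) (λ { refl → refl }) (λ { refl → refl })) (sym (*-identityˡ (basis T S)))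
  basis-∷ true false S T = trans (ι-no ((true ∷ S) ≟ᵇ (false ∷ T)) (λ ())) (sym (*-zeroˡ (basis T S)))
  basis-∷ false true S T = trans (ι-no ((false ∷ S) ≟ᵇ (true ∷ T)) (λ ())) (sym (*-zeroˡ (basis T S)))
  basis-∷ false false S T = trans (ι-cong ((false ∷ S) ≟ᵇ (false ∷ T)) (S ≟ᵇ T) (λ { refl → refl }) (λ { refl → refl })) (sym (*-identityˡ (basis T S)))

  ladder-∷ : ∀ {n} κ (i : Fin n) s t S T →
             lad (suc i) κ (basis (t ∷ T)) (s ∷ S) ≡ signed s (same s t) * lad i κ (basis T) S
  ladder-∷ κ i s t S T = trans (cong (signed s) (trans (ext (ladder κ i) (λ b → basis-∷ s t b T) S)
    (app-* (ladder κ i) (same s t) (basis T) S))) (signed-* s (same s t) (lad i κ (basis T) S))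
    where
    signed-* : ∀ s y z → signed s (y * z) ≡ signed s y * z
    signed-* false y z = refl
    signed-* true y z = neg-distribˡ-* y z

  -- The matrix entry of ∑ aⱼ ⊗ a†ⱼ. This is what remains of `Ω` when exactly one of its two
  -- summation indices is the head position.
  transfer : ∀ {n} → Bits n → Bits n → Bits n → Bits n → ℤ
  transfer {n} S U T V = ∑ (allFin n) (λ j → lad j false (basis T) S * lad j true (basis V) U)

  δ² : ∀ {n} → Bits n → Bits n → Bits n → Bits n → ℤ
  δ² S U T V = basis T S * basis V U

  transfer-∷ : ∀ {n} s u t v (S U T V : Bits n) → transfer (s ∷ S) (u ∷ U) (t ∷ T) (v ∷ V)
    ≡ same s false * same t true * (same u true * same v false) * δ² S U T V
      + signed s (same s t) * signed u (same u v) * transfer S U T V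
  transfer-∷ {n} s u t v S U T V = trans (∑-allFin-suc n (λ j → lad j false (basis (t ∷ T)) (s ∷ S) * lad j true (basis (v ∷ V)) (u ∷ U)))
    (cong₂ _+_ head-part (trans (∑-cong (allFin n) (λ j → trans (cong₂ _*_ (ladder-∷ false j s t S T) (ladder-∷ true j u v U V))
      (*-interchange (signed s (same s t)) (lad j false (basis T) S) (signed u (same u v)) (lad j true (basis V) U))))
      (∑-*ˡ (allFin n) (signed s (same s t) * signed u (same u v)) (λ j → lad j false (basis T) S * lad j true (basis V) U))))
    where
    annihilated : ∀ s t → lad zero false (basis (t ∷ T)) (s ∷ S) ≡ same s false * same t true * basis T S
    annihilated true t = sym (trans (cong (_* basis T S) (*-zeroˡ (same t true))) (*-zeroˡ (basis T S)))
    annihilated false true = basis-∷ true true S T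
    annihilated false false = basis-∷ true false S T
    created : ∀ u v → lad zero true (basis (v ∷ V)) (u ∷ U) ≡ same u true * same v false * basis V U
    created false v = sym (trans (cong (_* basis V U) (*-zeroˡ (same v false))) (*-zeroˡ (basis V U)))
    created true true = basis-∷ false true U V
    created true false = basis-∷ false false U V
    head-part : lad zero false (basis (t ∷ T)) (s ∷ S) * lad zero true (basis (v ∷ V)) (u ∷ U)
              ≡ same s false * same t true * (same u true * same v false) * δ² S U T V
    head-part = trans (cong₂ _*_ (annihilated s t) (created u v)) (*-interchange (same s false * same t true) (basis T S) (same u true * same v false) (basis V U))

  Ω-∷ : ∀ {n} s u t v (S U T V : Bits n) → Ω (s ∷ S) (u ∷ U) (t ∷ T) (v ∷ V)
    ≡ same s t * same u v * (bit t * bit v * δ² S U T V)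
      + same s true * same t false * (same u false * same v true) * transfer S U T V
      + same s false * same t true * (same u true * same v false) * transfer U S V T
      + same s t * same u v * Ω S U T V
  Ω-∷ {n} s u t v S U T V = begin
    Ω (s ∷ S) (u ∷ U) (t ∷ T) (v ∷ V)
      ≡⟨ ∑-allFin-suc n (λ i → ∑ (allFin (suc n)) (g i)) ⟩
    ∑ (allFin (suc n)) (g zero) + ∑ (allFin n) (λ i → ∑ (allFin (suc n)) (g (suc i)))
      ≡⟨ cong₂ _+_ (∑-allFin-suc n (g zero)) (trans (∑-cong (allFin n) (λ i → ∑-allFin-suc n (g (suc i))))
        (∑-+ (allFin n) (λ i → g (suc i) zero) (λ i → ∑ (allFin n) (λ j → g (suc i) (suc j))))) ⟩
    (g zero zero + ∑ (allFin n) (λ j → g zero (suc j))) + (∑ (allFin n) (λ i → g (suc i) zero) + ∑ (allFin n) (λ i → ∑ (allFin n) (λ j → g (suc i) (suc j))))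
      ≡⟨ cong₂ _+_ (cong₂ _+_ corner row) (cong₂ _+_ column block) ⟩
    (A + B) + (C + D)
      ≡⟨ sym (+-assoc (A + B) C D) ⟩
    A + B + C + D ∎
    where
    g : Fin (suc n) → Fin (suc n) → ℤ
    g i j = ρ i j (s ∷ S) (t ∷ T) * ρ j i (u ∷ U) (v ∷ V)
    A B C D : ℤ
    A = same s t * same u v * (bit t * bit v * δ² S U T V)
    B = same s true * same t false * (same u false * same v true) * transfer S U T V
    C = same s false * same t true * (same u true * same v false) * transfer U S V T
    D = same s t * same u v * Ω S U T V
    corner : g zero zero ≡ A
    corner = trans (cong₂ _*_ (diagonal s t S T) (diagonal u v U V)) (arith′ (same s t) (bit t) (basis T S) (same u v) (bit v) (basis V U))
      where
      arith′ : ∀ a b c d e f → a * c * b * (d * f * e) ≡ a * d * (b * e * (c * f))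
      arith′ = solve-∀
      diagonal : ∀ s t S T → ρ zero zero (s ∷ S) (t ∷ T) ≡ same s t * basis T S * bit t
      diagonal s t S T = trans (ρ-diag zero (s ∷ S) (t ∷ T)) (cong₂ _*_ (basis-∷ s t S T) (occ-bit (t ∷ T) zero))
    upper : ∀ s t S T j → ρ zero (suc j) (s ∷ S) (t ∷ T) ≡ same s true * same t false * lad j false (basis T) S
    upper false t S T j = sym (trans (cong (_* lad j false (basis T) S) (*-zeroˡ (same t false))) (*-zeroˡ (lad j false (basis T) S)))
    upper true t S T j = trans (ladder-∷ false j false t S T) (cong (_* lad j false (basis T) S) (trans (same-sym t) (sym (*-identityˡ (same t false)))))
      where
      same-sym : ∀ t → same false t ≡ same t false
      same-sym true = refl
      same-sym false = refl
    lower : ∀ s t S T j → ρ (suc j) zero (s ∷ S) (t ∷ T) ≡ same s false * same t true * lad j true (basis T) S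
    lower s t S T j = trans (cong (signed s) (by-head s t)) (tidy s t (lad j true (basis T) S))
      where
      by-head : ∀ s t → lad j true (λ b → lad zero false (basis (t ∷ T)) (s ∷ b)) S ≡ same s false * same t true * lad j true (basis T) S
      by-head true t = trans (app-0 (ladder true j) S) (sym (trans (cong (_* lad j true (basis T) S) (*-zeroˡ (same t true))) (*-zeroˡ (lad j true (basis T) S))))
      by-head false true = trans (ext (ladder true j) (λ b → basis-∷ true true b T) S) (app-* (ladder true j) 1ℤ (basis T) S)
      by-head false false = trans (ext (ladder true j) (λ b → basis-∷ true false b T) S) (app-* (ladder true j) 0ℤ (basis T) S)
      tidy : ∀ s t z → signed s (same s false * same t true * z) ≡ same s false * same t true * z
      tidy false t z = refl
      tidy true t z = trans (cong (λ w → - (w * z)) (*-zeroˡ (same t true))) (sym (cong (_* z) (*-zeroˡ (same t true))))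
    row : ∑ (allFin n) (λ j → g zero (suc j)) ≡ B
    row = trans (∑-cong (allFin n) (λ j → trans (cong₂ _*_ (upper s t S T j) (lower u v U V j))
      (*-interchange (same s true * same t false) (lad j false (basis T) S) (same u false * same v true) (lad j true (basis V) U))))
      (∑-*ˡ (allFin n) (same s true * same t false * (same u false * same v true)) (λ j → lad j false (basis T) S * lad j true (basis V) U))
    column : ∑ (allFin n) (λ i → g (suc i) zero) ≡ C
    column = trans (∑-cong (allFin n) (λ j → trans (cong₂ _*_ (lower s t S T j) (upper u v U V j))
      (arith′ (same s false * same t true) (lad j true (basis T) S) (same u true * same v false) (lad j false (basis V) U))))
      (∑-*ˡ (allFin n) (same s false * same t true * (same u true * same v false)) (λ j → lad j false (basis V) U * lad j true (basis T) S))
      where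
      arith′ : ∀ a b c d → a * b * (c * d) ≡ a * c * (d * b)
      arith′ = solve-∀
    inner-entry : ∀ s t S T i j → ρ (suc i) (suc j) (s ∷ S) (t ∷ T) ≡ same s t * ρ i j S T
    inner-entry s t S T i j = begin
      signed s (lad i true (λ b → signed s (lad j false (λ b′ → basis (t ∷ T) (s ∷ b′)) b)) S)
        ≡⟨ cong (signed s) (ext (ladder true i) (λ b → ladder-∷ false j s t b T) S) ⟩
      signed s (lad i true (λ b → signed s (same s t) * lad j false (basis T) b) S)
        ≡⟨ cong (signed s) (app-* (ladder true i) (signed s (same s t)) (lad j false (basis T)) S) ⟩
      signed s (signed s (same s t) * ρ i j S T)
        ≡⟨ twice s (same s t) (ρ i j S T) ⟩
      same s t * ρ i j S T ∎
      where
      twice : ∀ s y z → signed s (signed s y * z) ≡ y * z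
      twice false y z = refl
      twice true y z = trans (neg-distribˡ-* (- y) z) (cong (_* z) (neg-involutive y))
    block : ∑ (allFin n) (λ i → ∑ (allFin n) (λ j → g (suc i) (suc j))) ≡ D
    block = trans (∑-cong (allFin n) (λ i → trans (∑-cong (allFin n) (λ j → trans (cong₂ _*_ (inner-entry s t S T i j) (inner-entry u v U V j i))
      (*-interchange (same s t) (ρ i j S T) (same u v) (ρ j i U V)))) (∑-*ˡ (allFin n) (same s t * same u v) (λ j → ρ i j S T * ρ j i U V))))
      (∑-*ˡ (allFin n) (same s t * same u v) (λ i → ∑ (allFin n) (λ j → ρ i j S T * ρ j i U V)))

  ¬ᵇ : ∀ {n} → Bits n → Bits n
  ¬ᵇ = vmap not

  infix 4 _,_∣_,_⇝_∣_∣_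

  -- S , U ∣ T , V ⇝ S′ ∣ T′ ∣ c: deleting the positions where T and V agree leaves
  -- S′, ¬ S′, T′, ¬ T′, and c positions common to T and V have been deleted.
  data _,_∣_,_⇝_∣_∣_ : ∀ {n m} → (S U T V : Bits n) (S′ T′ : Bits m) (c : ℕ) → Set where
    done : [] , [] ∣ [] , [] ⇝ [] ∣ [] ∣ 0
    skip₀ : ∀ {n m c} {S U T V : Bits n} {S′ T′ : Bits m} → S , U ∣ T , V ⇝ S′ ∣ T′ ∣ c →
      (false ∷ S) , (false ∷ U) ∣ (false ∷ T) , (false ∷ V) ⇝ S′ ∣ T′ ∣ c
    skip₁ : ∀ {n m c} {S U T V : Bits n} {S′ T′ : Bits m} → S , U ∣ T , V ⇝ S′ ∣ T′ ∣ c →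
      (true ∷ S) , (true ∷ U) ∣ (true ∷ T) , (true ∷ V) ⇝ S′ ∣ T′ ∣ suc c
    keep : ∀ {n m c} {S U T V : Bits n} {S′ T′ : Bits m} s t → S , U ∣ T , V ⇝ S′ ∣ T′ ∣ c →
      (s ∷ S) , (not s ∷ U) ∣ (t ∷ T) , (not t ∷ V) ⇝ (s ∷ S′) ∣ (t ∷ T′) ∣ c

  -- Deleting positions where T and V agree changes only `Ω`, by one `δ²` for each common element:
  -- the term of ∑ Eᵢⱼ ⊗ Eⱼᵢ in which i and j both equal that element.
  record Agree {n m} (S U T V : Bits n) (S′ U′ T′ V′ : Bits m) (c : ℕ) : Set where
    field
      δ²-eq : δ² S U T V ≡ δ² S′ U′ T′ V′
      transfer-eq : transfer S U T V ≡ transfer S′ U′ T′ V′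
      transfer-eq′ : transfer U S V T ≡ transfer U′ S′ V′ T′
      Ω-eq : Ω S U T V ≡ Ω S′ U′ T′ V′ + ℤ.+ c * δ² S′ U′ T′ V′

  δ²-∷ : ∀ {n} s u t v (S U T V : Bits n) → δ² (s ∷ S) (u ∷ U) (t ∷ T) (v ∷ V) ≡ same s t * same u v * δ² S U T V
  δ²-∷ s u t v S U T V = trans (cong₂ _*_ (basis-∷ s t S T) (basis-∷ u v U V)) (*-interchange (same s t) (basis T S) (same u v) (basis V U))

  -- A common element brings a Jordan-Wigner sign into both factors of `transfer`, so the two signs
  -- cancel. At a kept position both sides satisfy the same recursion.
  agree : ∀ {n m c} {S U T V : Bits n} {S′ T′ : Bits m} → S , U ∣ T , V ⇝ S′ ∣ T′ ∣ c → Agree S U T V S′ (¬ᵇ S′) T′ (¬ᵇ T′) c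
  agree done = record { δ²-eq = refl ; transfer-eq = refl ; transfer-eq′ = refl ; Ω-eq = refl }
  agree (skip₀ {S = S} {U} {T} {V} r) = record
    { δ²-eq = trans (δ²-∷ false false false false S U T V) (trans (one (δ² S U T V)) δ²-eq)
    ; transfer-eq = trans (transfer-∷ false false false false S U T V) (trans (arith₁ (δ² S U T V) (transfer S U T V)) transfer-eq)
    ; transfer-eq′ = trans (transfer-∷ false false false false U S V T) (trans (arith₁ (δ² U S V T) (transfer U S V T)) transfer-eq′)
    ; Ω-eq = trans (Ω-∷ false false false false S U T V) (trans (arith₂ (δ² S U T V) (transfer S U T V) (transfer U S V T) (Ω S U T V)) Ω-eq) }
    where
    open Agree (agree r)
    one : ∀ x → 1ℤ * 1ℤ * x ≡ x
    one = solve-∀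
    arith₁ : ∀ d x → 1ℤ * 0ℤ * (0ℤ * 1ℤ) * d + 1ℤ * 1ℤ * x ≡ x
    arith₁ = solve-∀
    arith₂ : ∀ d x y o → 1ℤ * 1ℤ * (0ℤ * 0ℤ * d) + 0ℤ * 1ℤ * (1ℤ * 0ℤ) * x + 1ℤ * 0ℤ * (0ℤ * 1ℤ) * y + 1ℤ * 1ℤ * o ≡ o
    arith₂ = solve-∀
  agree (skip₁ {c = c} {S} {U} {T} {V} {S′} {T′} r) = record
    { δ²-eq = trans (δ²-∷ true true true true S U T V) (trans (one (δ² S U T V)) δ²-eq)
    ; transfer-eq = trans (transfer-∷ true true true true S U T V) (trans (arith₁ (δ² S U T V) (transfer S U T V)) transfer-eq)
    ; transfer-eq′ = trans (transfer-∷ true true true true U S V T) (trans (arith₁ (δ² U S V T) (transfer U S V T)) transfer-eq′)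
    ; Ω-eq = trans (Ω-∷ true true true true S U T V) (trans (arith₂ (δ² S U T V) (transfer S U T V) (transfer U S V T) (Ω S U T V))
      (trans (cong₂ _+_ δ²-eq Ω-eq) (arith₃ (δ² S′ (¬ᵇ S′) T′ (¬ᵇ T′)) (Ω S′ (¬ᵇ S′) T′ (¬ᵇ T′)) (ℤ.+ c)))) }
    where
    open Agree (agree r)
    one : ∀ x → 1ℤ * 1ℤ * x ≡ x
    one = solve-∀
    arith₁ : ∀ d x → 0ℤ * 1ℤ * (1ℤ * 0ℤ) * d + - 1ℤ * - 1ℤ * x ≡ x
    arith₁ = solve-∀
    arith₂ : ∀ d x y o → 1ℤ * 1ℤ * (1ℤ * 1ℤ * d) + 1ℤ * 0ℤ * (0ℤ * 1ℤ) * x + 0ℤ * 1ℤ * (1ℤ * 0ℤ) * y + 1ℤ * 1ℤ * o ≡ d + o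
    arith₂ = solve-∀
    arith₃ : ∀ d o c → d + (o + c * d) ≡ o + (1ℤ + c) * d
    arith₃ = solve-∀
  agree (keep {c = c} {S} {U} {T} {V} {S′} {T′} s t r) = record
    { δ²-eq = trans (δ²-∷ s (not s) t (not t) S U T V) (trans (cong (same s t * same (not s) (not t) *_) δ²-eq) (sym (δ²-∷ s (not s) t (not t) S′ _ T′ _)))
    ; transfer-eq = trans (transfer-∷ s (not s) t (not t) S U T V) (trans
      (cong₂ (λ d x → same s false * same t true * (same (not s) true * same (not t) false) * d + signed s (same s t) * signed (not s) (same (not s) (not t)) * x) δ²-eq transfer-eq)
      (sym (transfer-∷ s (not s) t (not t) S′ _ T′ _)))
    ; transfer-eq′ = trans (transfer-∷ (not s) s (not t) t U S V T) (trans
      (cong₂ (λ d x → same (not s) false * same (not t) true * (same s true * same t false) * d + signed (not s) (same (not s) (not t)) * signed s (same s t) * x)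
        (trans (*-comm (basis V U) (basis T S)) (trans δ²-eq (*-comm (basis T′ S′) (basis (¬ᵇ T′) (¬ᵇ S′))))) transfer-eq′)
      (sym (transfer-∷ (not s) s (not t) t _ S′ _ T′)))
    ; Ω-eq = trans (Ω-∷ s (not s) t (not t) S U T V) (trans
      (cong₂ _+_ (cong₂ _+_ (cong₂ _+_ (cong (λ d → same s t * same (not s) (not t) * (bit t * bit (not t) * d)) δ²-eq)
        (cong (same s true * same t false * (same (not s) false * same (not t) true) *_) transfer-eq))
        (cong (same s false * same t true * (same (not s) true * same (not t) false) *_) transfer-eq′))
        (cong (same s t * same (not s) (not t) *_) Ω-eq))
      (trans (arith three (same s t * same (not s) (not t)) (Ω S′ (¬ᵇ S′) T′ (¬ᵇ T′)) (ℤ.+ c) (δ² S′ (¬ᵇ S′) T′ (¬ᵇ T′)))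
        (sym (cong₂ _+_ (Ω-∷ s (not s) t (not t) S′ _ T′ _) (cong (ℤ.+ c *_) (δ²-∷ s (not s) t (not t) S′ _ T′ _)))))) }
    where
    open Agree (agree r)
    three : ℤ
    three = same s t * same (not s) (not t) * (bit t * bit (not t) * δ² S′ (¬ᵇ S′) T′ (¬ᵇ T′))
      + same s true * same t false * (same (not s) false * same (not t) true) * transfer S′ (¬ᵇ S′) T′ (¬ᵇ T′)
      + same s false * same t true * (same (not s) true * same (not t) false) * transfer (¬ᵇ S′) S′ (¬ᵇ T′) T′
    arith : ∀ a e o c d → a + e * (o + c * d) ≡ (a + e * o) + c * (e * d)
    arith = solve-∀

  Conserved : ∀ {n} → (S U T V : Bits n) → Set
  Conserved S U T V = ∀ x → occ S x + occ U x ≡ occ T x + occ V x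

  dist : ∀ {n} → Bits n → Bits n → ℕ
  dist [] [] = 0
  dist (false ∷ T) (false ∷ V) = dist T V
  dist (true ∷ T) (true ∷ V) = dist T V
  dist (false ∷ T) (true ∷ V) = suc (dist T V)
  dist (true ∷ T) (false ∷ V) = suc (dist T V)

  -- Conservation of the degree forces S and U to coincide with T and V where these two agree, and
  -- to be complementary where they differ.
  reduce : ∀ {n} (S U T V : Bits n) → Conserved S U T V →
           Σ (Bits (dist T V)) λ S′ → Σ (Bits (dist T V)) λ T′ → Σ ℕ λ c → S , U ∣ T , V ⇝ S′ ∣ T′ ∣ c
  reduce [] [] [] [] con = [] , [] , 0 , done
  reduce (false ∷ S) (false ∷ U) (false ∷ T) (false ∷ V) con =
    let S′ , T′ , c , r = reduce S U T V (con ∘ suc) in S′ , T′ , c , skip₀ r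
  reduce (true ∷ S) (true ∷ U) (true ∷ T) (true ∷ V) con =
    let S′ , T′ , c , r = reduce S U T V (con ∘ suc) in S′ , T′ , suc c , skip₁ r
  reduce (true ∷ S) (false ∷ U) (true ∷ T) (false ∷ V) con =
    let S′ , T′ , c , r = reduce S U T V (con ∘ suc) in true ∷ S′ , true ∷ T′ , c , keep true true r
  reduce (true ∷ S) (false ∷ U) (false ∷ T) (true ∷ V) con =
    let S′ , T′ , c , r = reduce S U T V (con ∘ suc) in true ∷ S′ , false ∷ T′ , c , keep true false r
  reduce (false ∷ S) (true ∷ U) (true ∷ T) (false ∷ V) con =
    let S′ , T′ , c , r = reduce S U T V (con ∘ suc) in false ∷ S′ , true ∷ T′ , c , keep false true r
  reduce (false ∷ S) (true ∷ U) (false ∷ T) (true ∷ V) con =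
    let S′ , T′ , c , r = reduce S U T V (con ∘ suc) in false ∷ S′ , false ∷ T′ , c , keep false false r
  reduce (false ∷ S) (false ∷ U) (false ∷ T) (true ∷ V) con = contradiction (con zero) λ ()
  reduce (false ∷ S) (false ∷ U) (true ∷ T) (false ∷ V) con = contradiction (con zero) λ ()
  reduce (false ∷ S) (false ∷ U) (true ∷ T) (true ∷ V) con = contradiction (con zero) λ ()
  reduce (false ∷ S) (true ∷ U) (false ∷ T) (false ∷ V) con = contradiction (con zero) λ ()
  reduce (false ∷ S) (true ∷ U) (true ∷ T) (true ∷ V) con = contradiction (con zero) λ ()
  reduce (true ∷ S) (false ∷ U) (false ∷ T) (false ∷ V) con = contradiction (con zero) λ ()
  reduce (true ∷ S) (false ∷ U) (true ∷ T) (true ∷ V) con = contradiction (con zero) λ ()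
  reduce (true ∷ S) (true ∷ U) (false ∷ T) (false ∷ V) con = contradiction (con zero) λ ()
  reduce (true ∷ S) (true ∷ U) (false ∷ T) (true ∷ V) con = contradiction (con zero) λ ()
  reduce (true ∷ S) (true ∷ U) (true ∷ T) (false ∷ V) con = contradiction (con zero) λ ()

  ⇝-swap : ∀ {n m c} {S U T V : Bits n} {S′ T′ : Bits m} → S , U ∣ T , V ⇝ S′ ∣ T′ ∣ c → U , S ∣ T , V ⇝ ¬ᵇ S′ ∣ T′ ∣ c
  ⇝-swap done = done
  ⇝-swap (skip₀ r) = skip₀ (⇝-swap r)
  ⇝-swap (skip₁ r) = skip₁ (⇝-swap r)
  ⇝-swap (keep true t r) = keep false t (⇝-swap r)
  ⇝-swap (keep false t r) = keep true t (⇝-swap r)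

  ⇝-size : ∀ {n m c} {S U T V : Bits n} {S′ T′ : Bits m} → S , U ∣ T , V ⇝ S′ ∣ T′ ∣ c →
           size T ≡ size T′ + ℤ.+ c × size V ≡ size (¬ᵇ T′) + ℤ.+ c
  ⇝-size done = refl , refl
  ⇝-size {c = c} (skip₀ {T′ = T′} r) with ⇝-size r
  ... | e , f = trans (+-identityˡ _) e , trans (+-identityˡ _) f
  ⇝-size (skip₁ {c = c} {T′ = T′} r) with ⇝-size r
  ... | e , f = trans (cong (1ℤ * 1ℤ +_) e) (arith (size T′) (ℤ.+ c)) , trans (cong (1ℤ * 1ℤ +_) f) (arith (size (¬ᵇ T′)) (ℤ.+ c))
    where
    arith : ∀ x c → 1ℤ * 1ℤ + (x + c) ≡ x + (1ℤ + c)
    arith = solve-∀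
  ⇝-size (keep {c = c} {T′ = T′} s t r) with ⇝-size r
  ... | e , f = trans (cong (bit t * 1ℤ +_) e) (sym (+-assoc (bit t * 1ℤ) (size T′) (ℤ.+ c)))
              , trans (cong (bit (not t) * 1ℤ +_) f) (sym (+-assoc (bit (not t) * 1ℤ) (size (¬ᵇ T′)) (ℤ.+ c)))

  -- The law for complementary sets of equal size, with the scalar `size T − 2`. Each of the `c`
  -- deleted common elements adds 1 to the scalar and 1 to the size, so undeleting gives `k − 2` for
  -- every `c`.
  Balanced : ∀ m → Set
  Balanced m = All (λ T → All (λ S → size T ≡ size (¬ᵇ T) →
    Ω S (¬ᵇ S) T (¬ᵇ T) - Ω (¬ᵇ S) S T (¬ᵇ T) ≡ (size T - ℤ.+ 2) * (δ² S (¬ᵇ S) T (¬ᵇ T) - δ² (¬ᵇ S) S T (¬ᵇ T))) (bits m)) (bits m)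

  balanced? : ∀ m → Dec (Balanced m)
  balanced? m = All.all? (λ T → All.all? (λ S → (size T ≟ size (¬ᵇ T)) →-dec
    (Ω S (¬ᵇ S) T (¬ᵇ T) - Ω (¬ᵇ S) S T (¬ᵇ T) ≟ (size T - ℤ.+ 2) * (δ² S (¬ᵇ S) T (¬ᵇ T) - δ² (¬ᵇ S) S T (¬ᵇ T)))) (bits m)) (bits m)

  -- A finite check over all S and T at each length, decided by evaluation. Length 4 is the case of
  -- two elements on either side.
  balanced : ∀ m → m ℕ.≤ 4 → Balanced m
  balanced 0 _ = from-yes (balanced? 0)
  balanced 1 _ = from-yes (balanced? 1)
  balanced 2 _ = from-yes (balanced? 2)
  balanced 3 _ = from-yes (balanced? 3)
  balanced 4 _ = from-yes (balanced? 4)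
  balanced (suc (suc (suc (suc (suc m))))) (s≤s (s≤s (s≤s (s≤s ()))))

  module _ {n} {S U T V : Bits n} {x : Fin n} (ne : occ S x + occ U x ≢ occ T x + occ V x) where

    -- Eᵢⱼ and Eⱼᵢ shift the degree at x by opposite amounts, so their tensor product preserves the
    -- total degree at x.
    unconserved-ρ : ∀ i j → ρ i j S T * ρ j i U V ≡ 0ℤ
    unconserved-ρ i j = by-cases (grade (δᶻ x) S ≟ grade (δᶻ x) T + (δᶻ x i - δᶻ x j)) (grade (δᶻ x) U ≟ grade (δᶻ x) V + (δᶻ x j - δᶻ x i))
      where
      arith : ∀ a b c d → (a + (c - d)) + (b + (d - c)) ≡ a + b
      arith = solve-∀
      by-cases : Dec (grade (δᶻ x) S ≡ grade (δᶻ x) T + (δᶻ x i - δᶻ x j)) → Dec (grade (δᶻ x) U ≡ grade (δᶻ x) V + (δᶻ x j - δᶻ x i)) → ρ i j S T * ρ j i U V ≡ 0ℤ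
      by-cases (no e) _ = trans (cong (_* ρ j i U V) (ρ-grade (δᶻ x) i j S T e)) (*-zeroˡ (ρ j i U V))
      by-cases (yes _) (no f) = trans (cong (ρ i j S T *_) (ρ-grade (δᶻ x) j i U V f)) (*-zeroʳ (ρ i j S T))
      by-cases (yes e) (yes f) = contradiction (begin
        occ S x + occ U x ≡⟨ cong₂ _+_ (grade-δᶻ x S) (grade-δᶻ x U) ⟨
        grade (δᶻ x) S + grade (δᶻ x) U ≡⟨ cong₂ _+_ e f ⟩
        (grade (δᶻ x) T + (δᶻ x i - δᶻ x j)) + (grade (δᶻ x) V + (δᶻ x j - δᶻ x i)) ≡⟨ arith (grade (δᶻ x) T) (grade (δᶻ x) V) (δᶻ x i) (δᶻ x j) ⟩
        grade (δᶻ x) T + grade (δᶻ x) V ≡⟨ cong₂ _+_ (grade-δᶻ x T) (grade-δᶻ x V) ⟩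
        occ T x + occ V x ∎) ne

    unconserved-Ω : Ω S U T V ≡ 0ℤ
    unconserved-Ω = ∑-0 (allFin n) (λ {i} _ → ∑-0 (allFin n) (λ {j} _ → unconserved-ρ i j))

    unconserved-δ² : δ² S U T V ≡ 0ℤ
    unconserved-δ² = by-cases (S ≟ᵇ T) (U ≟ᵇ V)
      where
      by-cases : (d : Dec (S ≡ T)) (e : Dec (U ≡ V)) → ι d * ι e ≡ 0ℤ
      by-cases (yes refl) (yes refl) = contradiction refl ne
      by-cases (yes _) (no _) = refl
      by-cases (no _) e = *-zeroˡ (ι e)

  -- On ⋀² of the k-subsets with |T ∆ V| ≤ 4 the operator ∑ Eᵢⱼ ⊗ Eⱼᵢ is the scalar k − 2.
  exchange-law : ∀ {n} k (S U T V : Bits n) → size T ≡ k → size V ≡ k → dist T V ℕ.≤ 4 →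
                 Ω S U T V - Ω U S T V ≡ (k - ℤ.+ 2) * exchange S U T V
  exchange-law k S U T V refl size-V d≤4 = by-cases (Fin.all? (λ x → occ S x + occ U x ≟ occ T x + occ V x))
    where
    by-cases : Dec (Conserved S U T V) → Ω S U T V - Ω U S T V ≡ (size T - ℤ.+ 2) * (δ² S U T V - δ² U S T V)
    by-cases (no ¬con) = trans (cong₂ _-_ (unconserved-Ω {S = S} {U} {T} {V} ne) (unconserved-Ω {S = U} {S} {T} {V} ne′))
      (sym (trans (cong₂ (λ p q → (size T - ℤ.+ 2) * (p - q)) (unconserved-δ² {S = S} {U} {T} {V} ne) (unconserved-δ² {S = U} {S} {T} {V} ne′)) (*-zeroʳ (size T - ℤ.+ 2))))
      where
      witness : Σ (Fin _) (λ x → occ S x + occ U x ≢ occ T x + occ V x)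
      witness = Fin.¬∀⟶∃¬ _ (λ x → occ S x + occ U x ≡ occ T x + occ V x) (λ x → occ S x + occ U x ≟ occ T x + occ V x) ¬con
      ne = proj₂ witness
      ne′ : occ U (proj₁ witness) + occ S (proj₁ witness) ≢ occ T (proj₁ witness) + occ V (proj₁ witness)
      ne′ e = ne (trans (+-comm (occ S (proj₁ witness)) (occ U (proj₁ witness))) e)
    by-cases (yes con) = reduced (reduce S U T V con)
      where
      reduced : Σ (Bits (dist T V)) (λ S′ → Σ (Bits (dist T V)) λ T′ → Σ ℕ λ c → S , U ∣ T , V ⇝ S′ ∣ T′ ∣ c) →
                Ω S U T V - Ω U S T V ≡ (size T - ℤ.+ 2) * (δ² S U T V - δ² U S T V)
      reduced (S′ , T′ , c , r) = begin
        Ω S U T V - Ω U S T V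
          ≡⟨ cong₂ _-_ A.Ω-eq B.Ω-eq ⟩
        (Ω S′ (¬ᵇ S′) T′ (¬ᵇ T′) + ℤ.+ c * δ² S′ (¬ᵇ S′) T′ (¬ᵇ T′)) - (Ω (¬ᵇ S′) (¬ᵇ (¬ᵇ S′)) T′ (¬ᵇ T′) + ℤ.+ c * δ² (¬ᵇ S′) (¬ᵇ (¬ᵇ S′)) T′ (¬ᵇ T′))
          ≡⟨ cong (λ Z → (Ω S′ (¬ᵇ S′) T′ (¬ᵇ T′) + ℤ.+ c * δ² S′ (¬ᵇ S′) T′ (¬ᵇ T′)) - (Ω (¬ᵇ S′) Z T′ (¬ᵇ T′) + ℤ.+ c * δ² (¬ᵇ S′) Z T′ (¬ᵇ T′))) (¬¬ S′) ⟩
        (Ω S′ (¬ᵇ S′) T′ (¬ᵇ T′) + ℤ.+ c * δ² S′ (¬ᵇ S′) T′ (¬ᵇ T′)) - (Ω (¬ᵇ S′) S′ T′ (¬ᵇ T′) + ℤ.+ c * δ² (¬ᵇ S′) S′ T′ (¬ᵇ T′))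
          ≡⟨ arith₁ (Ω S′ (¬ᵇ S′) T′ (¬ᵇ T′)) (Ω (¬ᵇ S′) S′ T′ (¬ᵇ T′)) (ℤ.+ c) (δ² S′ (¬ᵇ S′) T′ (¬ᵇ T′)) (δ² (¬ᵇ S′) S′ T′ (¬ᵇ T′)) ⟩
        (Ω S′ (¬ᵇ S′) T′ (¬ᵇ T′) - Ω (¬ᵇ S′) S′ T′ (¬ᵇ T′)) + ℤ.+ c * (δ² S′ (¬ᵇ S′) T′ (¬ᵇ T′) - δ² (¬ᵇ S′) S′ T′ (¬ᵇ T′))
          ≡⟨ cong (_+ ℤ.+ c * (δ² S′ (¬ᵇ S′) T′ (¬ᵇ T′) - δ² (¬ᵇ S′) S′ T′ (¬ᵇ T′)))
            (All.lookup (All.lookup (balanced (dist T V) d≤4) (∈-bits T′)) (∈-bits S′) equal-sizes) ⟩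
        (size T′ - ℤ.+ 2) * (δ² S′ (¬ᵇ S′) T′ (¬ᵇ T′) - δ² (¬ᵇ S′) S′ T′ (¬ᵇ T′)) + ℤ.+ c * (δ² S′ (¬ᵇ S′) T′ (¬ᵇ T′) - δ² (¬ᵇ S′) S′ T′ (¬ᵇ T′))
          ≡⟨ arith₂ (size T′) (ℤ.+ c) (δ² S′ (¬ᵇ S′) T′ (¬ᵇ T′) - δ² (¬ᵇ S′) S′ T′ (¬ᵇ T′)) ⟩
        (size T′ + ℤ.+ c - ℤ.+ 2) * (δ² S′ (¬ᵇ S′) T′ (¬ᵇ T′) - δ² (¬ᵇ S′) S′ T′ (¬ᵇ T′))
          ≡⟨ cong₂ (λ s d → (s - ℤ.+ 2) * d) (sym (proj₁ (⇝-size r)))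
            (cong₂ _-_ (sym A.δ²-eq) (sym (trans B.δ²-eq (cong (λ Z → δ² (¬ᵇ S′) Z T′ (¬ᵇ T′)) (¬¬ S′))))) ⟩
        (size T - ℤ.+ 2) * (δ² S U T V - δ² U S T V) ∎
        where
        module A = Agree (agree r)
        module B = Agree (agree (⇝-swap r))
        ¬¬ : ∀ {m} (S : Bits m) → ¬ᵇ (¬ᵇ S) ≡ S
        ¬¬ [] = refl
        ¬¬ (true ∷ S) = cong (true ∷_) (¬¬ S)
        ¬¬ (false ∷ S) = cong (false ∷_) (¬¬ S)
        equal-sizes : size T′ ≡ size (¬ᵇ T′)
        equal-sizes = +-cancelʳ (ℤ.+ c) (trans (sym (proj₁ (⇝-size r))) (trans (sym size-V) (proj₂ (⇝-size r))))
          where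
          +-cancelʳ : ∀ {x y} z → x + z ≡ y + z → x ≡ y
          +-cancelʳ {x} {y} z e = trans (x≡x+y-y x z) (trans (cong (_- z) e) (sym (x≡x+y-y y z)))
        arith₁ : ∀ o p c d e → (o + c * d) - (p + c * e) ≡ (o - p) + c * (d - e)
        arith₁ = solve-∀
        arith₂ : ∀ t c d → (t - ℤ.+ 2) * d + c * d ≡ (t + c - ℤ.+ 2) * d
        arith₂ = solve-∀

  -- Closed families and highest weight basis vectors

  module _ {n} (L : List (Bits n)) (L-unique : Unique L)
    (L-closed : ∀ {S T} → T ∈ L → size S ≡ size T → S ∈ L) where

    open Families L L-unique L-closed

    Closed : Bits N → Set
    Closed b = ∀ i j → i < j → ∀ s t → lookup b (member t) ≡ true →
               ρ i j (setOf s) (setOf t) ≢ 0ℤ → lookup b (member s) ≡ true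

    ρ-irreflexive : ∀ {i j : Fin n} S → i < j → ρ i j S S ≡ 0ℤ
    ρ-irreflexive {i} {j} S i<j = ρ-grade (δᶻ i) i j S S λ e → contradiction (begin
      1ℤ ≡⟨ cong₂ _-_ (δᶻ-diag i) (δᶻ-off (Fin.<⇒≢ i<j)) ⟨
      δᶻ i i - δᶻ i j ≡⟨ y≡x+y-x (grade (δᶻ i) S) (δᶻ i i - δᶻ i j) ⟩
      grade (δᶻ i) S + (δᶻ i i - δᶻ i j) - grade (δᶻ i) S ≡⟨ cong (_- grade (δᶻ i) S) (sym e) ⟩
      grade (δᶻ i) S - grade (δᶻ i) S ≡⟨ +-inverseʳ (grade (δᶻ i) S) ⟩
      0ℤ ∎) λ ()

    anticommute-a†a : ∀ s t x b → s ≢ t → app (a† s) (app (a t) x) b ≡ - app (a t) (app (a† s) x) b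
    anticommute-a†a s t x b s≢t = trans (x≡x+y-y _ _) (trans (cong (_+ - app (a t) (app (a† s) x) b)
      (trans (anticommutator true false (member s) (member t) x b)
        (trans (cong (λ d → 1ℤ * d * x b) (δᶻ-off (s≢t ∘ Fin.↑ʳ-injective (tri n) s t))) (*-zeroˡ (x b))))) (+-identityˡ _))

    -- In a term with nonzero coefficient either `t` is absent and `a t` kills the vector, or `s` is
    -- present by closedness and `a† s` does. Bringing `a† s` to the front of the action uses s ≠ t,
    -- which holds as a raising operator has no diagonal entries.
    closed⇒highest : ∀ {b} → Closed b → ∀ i j → i < j → ∀ v → app (E i j) (basis b) v ≡ 0ℤ
    closed⇒highest {b} closed i j i<j v = trans (E-app i j (basis b) v)
      (∑-0 (allFin m) (λ {s} _ → ∑-0 (allFin m) (λ {t} _ → entry s t)))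
      where
      entry : ∀ s t → ρ i j (setOf s) (setOf t) * app (a† s) (app (a t) (basis b)) v ≡ 0ℤ
      entry s t = by-ρ (ρ i j (setOf s) (setOf t) ≟ 0ℤ)
        where
        kill : app (a† s) (app (a t) (basis b)) v ≡ 0ℤ → ρ i j (setOf s) (setOf t) * app (a† s) (app (a t) (basis b)) v ≡ 0ℤ
        kill e = trans (cong (ρ i j (setOf s) (setOf t) *_) e) (*-zeroʳ (ρ i j (setOf s) (setOf t)))
        by-occupation : ∀ g → lookup b (member t) ≡ g → ρ i j (setOf s) (setOf t) ≢ 0ℤ →
                        ρ i j (setOf s) (setOf t) * app (a† s) (app (a t) (basis b)) v ≡ 0ℤ
        by-occupation false e ne = kill (app-vanish (a† s) (λ v → ladder-basis false (member t) b v e) v)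
        by-occupation true e ne = kill (trans (anticommute-a†a s t (basis b) v (λ { refl → ne (ρ-irreflexive (setOf s) i<j) }))
          (cong (-_) (app-vanish (a t) (λ v → ladder-basis true (member s) b v (closed i j i<j s t e ne)) v)))
        by-ρ : Dec (ρ i j (setOf s) (setOf t) ≡ 0ℤ) → ρ i j (setOf s) (setOf t) * app (a† s) (app (a t) (basis b)) v ≡ 0ℤ
        by-ρ (yes e) = trans (cong (_* app (a† s) (app (a t) (basis b)) v) e) (*-zeroˡ (app (a† s) (app (a t) (basis b)) v))
        by-ρ (no ne) = by-occupation (lookup b (member t)) refl ne

    -- If s ∉ b ∋ t, the coeff of b in a†ₜ aₛ Eᵢⱼ b is the matrix entry ρᵢⱼ(s, t).
    highest⇒closed : ∀ {b} → (∀ i j → i < j → ∀ v → app (E i j) (basis b) v ≡ 0ℤ) → Closed b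
    highest⇒closed {b} high i j i<j s t t∈b ne = by-occupation (lookup b (member s)) refl
      where
      r : Fin m → Fin m → ℤ
      r s t = ρ i j (setOf s) (setOf t)
      by-occupation : ∀ g → lookup b (member s) ≡ g → g ≡ true
      by-occupation true e = refl
      by-occupation false s∉b = contradiction (begin
        r s t
          ≡⟨ ∑-unique (t Fin.≟_) (λ t′ → r s t′) (Unique.allFin⁺ m) (∈-allFin t) refl sym ⟨
        ∑ (allFin m) (λ t′ → ι (t Fin.≟ t′) * r s t′)
          ≡⟨ ∑-cong (allFin m) (λ t′ → trans (*-comm (ι (t Fin.≟ t′)) (r s t′)) (cong (r s t′ *_) (sym (restored t′ (t Fin.≟ t′))))) ⟩
        ∑ (allFin m) (λ t′ → r s t′ * app (a† t) (app (a t′) (basis b)) b)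
          ≡⟨ ∑-unique (s Fin.≟_) (λ s′ → ∑ (allFin m) (λ t′ → r s′ t′ * app (a† t) (app (a t′) (basis b)) b)) (Unique.allFin⁺ m) (∈-allFin s) refl sym ⟨
        ∑ (allFin m) (λ s′ → ι (s Fin.≟ s′) * ∑ (allFin m) (λ t′ → r s′ t′ * app (a† t) (app (a t′) (basis b)) b))
          ≡⟨ ∑-cong (allFin m) (λ s′ → trans (sym (∑-*ˡ (allFin m) (ι (s Fin.≟ s′)) (λ t′ → r s′ t′ * app (a† t) (app (a t′) (basis b)) b)))
            (∑-cong (allFin m) (λ t′ → trans (*-swapˡ (ι (s Fin.≟ s′)) (r s′ t′) (app (a† t) (app (a t′) (basis b)) b)) (cong (r s′ t′ *_) (sym (contract s′ t′ (s Fin.≟ s′))))))) ⟩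
        ∑ (allFin m) (λ s′ → ∑ (allFin m) (λ t′ → r s′ t′ * app (a† t) (app (a s) (app (a† s′) (app (a t′) (basis b)))) b))
          ≡⟨ expand ⟨
        app (a† t) (app (a s) (app (E i j) (basis b))) b
          ≡⟨ app-vanish (a† t) (app-vanish (a s) (high i j i<j)) b ⟩
        0ℤ ∎) ne
        where
        restored : ∀ t′ → (d : Dec (t ≡ t′)) → app (a† t) (app (a t′) (basis b)) b ≡ ι d
        restored t′ (yes refl) = trans (number (member t) (basis b) b)
          (cong₂ _*_ (trans (occ-bit b (member t)) (cong bit t∈b)) (ι-yes (b ≟ᵇ b) refl))
        restored t′ (no t≢t′) = by-t′ (lookup b (member t′)) refl
          where
          by-t′ : ∀ g → lookup b (member t′) ≡ g → app (a† t) (app (a t′) (basis b)) b ≡ 0ℤ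
          by-t′ false e = app-vanish (a† t) (λ v → ladder-basis false (member t′) b v e) b
          by-t′ true e = trans (anticommute-a†a t t′ (basis b) b t≢t′)
            (cong (-_) (app-vanish (a t′) (λ v → ladder-basis true (member t) b v t∈b) b))
        contract : ∀ s′ t′ → (d : Dec (s ≡ s′)) →
          app (a† t) (app (a s) (app (a† s′) (app (a t′) (basis b)))) b ≡ ι d * app (a† t) (app (a t′) (basis b)) b
        contract s′ t′ (no s≢s′) = trans (app-vanish (a† t) (λ v → trans
          (sym (neg-involutive _)) (trans (cong (-_) (sym (anticommute-a†a s′ s (app (a t′) (basis b)) v (s≢s′ ∘ sym))))
            (cong (-_) (app-vanish (a† s′) (commuted t′) v)))) b)
          (sym (*-zeroˡ (app (a† t) (app (a t′) (basis b)) b)))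
          where
          commuted : ∀ t′ v → app (a s) (app (a t′) (basis b)) v ≡ 0ℤ
          commuted t′ v = trans (x≡x+y-y _ _) (trans (cong (_+ - app (a t′) (app (a s) (basis b)) v)
            (trans (anticommutator false false (member s) (member t′) (basis b) v)
              (trans (cong (_* basis b v) (*-zeroˡ (δᶻ (member s) (member t′)))) (*-zeroˡ (basis b v)))))
            (trans (+-identityˡ _) (cong (-_) (app-vanish (a t′) (λ v → ladder-basis false (member s) b v s∉b) v))))
        contract s′ t′ (yes refl) = trans (ext (a† t) holes b) (sym (*-identityˡ (app (a† t) (app (a t′) (basis b)) b)))
          where
          w : Vector N
          w = app (a t′) (basis b)
          commuted : ∀ v → app (a s) w v ≡ 0ℤ
          commuted v = trans (x≡x+y-y _ _) (trans (cong (_+ - app (a t′) (app (a s) (basis b)) v)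
            (trans (anticommutator false false (member s) (member t′) (basis b) v)
              (trans (cong (_* basis b v) (*-zeroˡ (δᶻ (member s) (member t′)))) (*-zeroˡ (basis b v)))))
            (trans (+-identityˡ _) (cong (-_) (app-vanish (a t′) (λ v → ladder-basis false (member s) b v s∉b) v))))
          holes : ∀ v → app (a s) (app (a† s) w) v ≡ w v
          holes v = trans (sym (+-identityʳ _)) (trans (cong (app (a s) (app (a† s) w) v +_) (sym (app-vanish (a† s) commuted v)))
            (trans (anticommutator false true (member s) (member s) w v)
              (trans (cong (λ d → 1ℤ * d * w v) (δᶻ-diag (member s))) (*-identityˡ (w v)))))
        expand : app (a† t) (app (a s) (app (E i j) (basis b))) b ≡
          ∑ (allFin m) (λ s′ → ∑ (allFin m) (λ t′ → r s′ t′ * app (a† t) (app (a s) (app (a† s′) (app (a t′) (basis b)))) b))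
        expand = trans (ext (a† t) (ext (a s) (E-app i j (basis b))) b) (trans (ext (a† t) (linear (a s)) b) (linear (a† t) b))
          where
          linear : ∀ f {y : Fin m → Fin m → Vector N} v → app f (λ v → ∑ (allFin m) (λ s′ → ∑ (allFin m) (λ t′ → r s′ t′ * y s′ t′ v))) v
                 ≡ ∑ (allFin m) (λ s′ → ∑ (allFin m) (λ t′ → r s′ t′ * app f (y s′ t′) v))
          linear f {y} v = trans (ext f (λ v → ∑-cong (allFin m) (λ s′ → sym (*-identityˡ (∑ (allFin m) (λ t′ → r s′ t′ * y s′ t′ v))))) v)
            (trans (app-∑ f (allFin m) (λ _ → 1ℤ) (λ s′ v → ∑ (allFin m) (λ t′ → r s′ t′ * y s′ t′ v)) v)
              (∑-cong (allFin m) (λ s′ → trans (*-identityˡ (app f (λ v → ∑ (allFin m) (λ t′ → r s′ t′ * y s′ t′ v)) v)) (app-∑ f (allFin m) (r s′) (y s′) v))))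

-- Schur coefficients by inverting the Kostka matrix

module SchurFunctions where

  open import Data.Integer.Base using (_+_; _*_; -_; _-_; ∣_∣)
  open import Data.List.Base using (_++_; upTo; filter; map; _∷ʳ_; concat; zip; applyUpTo)
  open import Data.List.Membership.Propositional.Properties using (∈-++⁻; ∈-upTo⁺; ∈-upTo⁻)
  open import Data.List.Membership.Propositional.Properties.WithK using (unique∧set⇒bag)
  open import Data.List.Properties using (∷-injectiveˡ; ∷-injectiveʳ)
  open import Data.List.Relation.Binary.BagAndSetEquality using (∼bag⇒↭)
  open import Data.List.Relation.Binary.Permutation.Propositional as ↭ using (_↭_)
  open import Data.List.Relation.Binary.Permutation.Propositional.Properties using (++-comm)
  open import Data.List.Relation.Unary.All using (all?)
  open import Data.Nat.Base using (_<_; _≤_; _⊔_; _⊓_)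
  open import Data.Nat.ListAction using (sum)
  open import Data.Nat.ListAction.Properties using (sum-++)
  open import Data.Nat.Properties using (_≤?_; _<?_; _≟_)
  import Data.Nat.Tactic.RingSolver as ℕ-Solver
  open import Data.Product.Base using (uncurry)
  open import Data.Product.Properties using (≡-dec)
  open import Data.List.Membership.DecPropositional _≟_ using (_∈?_)
  open import Defs
  open import Function.Bundles using (mk⇔)
  open ListSums
  open Fermions using (Bits; bits; ∑-bits)

  <-sucʳ : ∀ {i} j k → i < suc j ℕ.+ k → i < j ℕ.+ suc k
  <-sucʳ {i} j k = subst (i <_) (sym (ℕ.+-suc j k))

  <-sucˡ : ∀ {i} j k → i < j ℕ.+ suc k → i < suc j ℕ.+ k
  <-sucˡ {i} j k = subst (i <_) (ℕ.+-suc j k)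

  ≤-sucˡ : ∀ {n} j k → j ℕ.+ suc k ℕ.≤ n → suc j ℕ.+ k ℕ.≤ n
  ≤-sucˡ {n} j k = subst (ℕ._≤ n) (ℕ.+-suc j k)

  empty-window : ∀ {i j} → j ℕ.≤ i → ¬ i < j ℕ.+ 0
  empty-window {i} {j} j≤i i<j = ℕ.≤⇒≯ j≤i (subst (i <_) (ℕ.+-identityʳ j) i<j)

  -- Exponents are integers, because the quotients x_j / x_i lead out of the natural ones.
  Weight : Set
  Weight = ℕ → ℤ

  ε : ℕ → Weight
  ε i x = ι (i ℕ.≟ x)

  Extensional : (Weight → ℤ) → Set
  Extensional f = ∀ {α β} → (∀ i → α i ≡ β i) → f α ≡ f β

  -- The coefficient of x^α in (x_j / x_i) F is the coefficient of x^(α + e_i - e_j) in F.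
  move : ℕ × ℕ → Weight → Weight
  move (i , j) α x = α x + (ε i x - ε j x)

  -- ∏ (1 − x_j / x_i) over the pairs (i , j), acting on coeff functions.
  T : List (ℕ × ℕ) → (Weight → ℤ) → Weight → ℤ
  T [] f α = f α
  T (p ∷ ps) f α = T ps f α - T ps f (move p α)

  T-ext : ∀ ps {f} → Extensional f → Extensional (T ps f)
  T-ext [] e eq = e eq
  T-ext ((i , j) ∷ ps) e eq = cong₂ _-_ (T-ext ps e eq) (T-ext ps e (λ x → cong (_+ (ε i x - ε j x)) (eq x)))

  T-cong : ∀ ps {f g} → (∀ α → f α ≡ g α) → ∀ α → T ps f α ≡ T ps g α
  T-cong [] e α = e α
  T-cong (p ∷ ps) e α = cong₂ _-_ (T-cong ps e α) (T-cong ps e (move p α))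

  T-++ : ∀ ps qs f α → T (ps ++ qs) f α ≡ T ps (T qs f) α
  T-++ [] qs f α = refl
  T-++ (p ∷ ps) qs f α = cong₂ _-_ (T-++ ps qs f α) (T-++ ps qs f (move p α))

  T-∑ : ∀ {A : Set} ps (xs : List A) (f : A → Weight → ℤ) α → T ps (λ β → ∑ xs (λ x → f x β)) α ≡ ∑ xs (λ x → T ps (f x) α)
  T-∑ [] xs f α = refl
  T-∑ (p ∷ ps) xs f α = trans (cong₂ _-_ (T-∑ ps xs f α) (T-∑ ps xs f (move p α)))
    (trans (cong (∑ xs (λ x → T ps (f x) α) +_) (sym (∑-neg xs (λ x → T ps (f x) (move p α)))))
      (sym (∑-+ xs (λ x → T ps (f x) α) (λ x → - T ps (f x) (move p α)))))

  T-* : ∀ ps z f α → T ps (λ β → z * f β) α ≡ z * T ps f α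
  T-* [] z f α = refl
  T-* (p ∷ ps) z f α = trans (cong₂ _-_ (T-* ps z f α) (T-* ps z f (move p α))) (*-minusˡ z (T ps f α) (T ps f (move p α)))

  T-↭ : ∀ {ps qs f} → Extensional f → ps ↭ qs → ∀ α → T ps f α ≡ T qs f α
  T-↭ e ↭.refl α = refl
  T-↭ e (↭.prep p r) α = cong₂ _-_ (T-↭ e r α) (T-↭ e r (move p α))
  T-↭ {f = f} e (↭.swap {xs} {ys} (i , j) (k , l) r) α = begin
    (T xs f α - T xs f (move (k , l) α)) - (T xs f (move (i , j) α) - T xs f (move (k , l) (move (i , j) α)))
      ≡⟨ cong₂ _-_ (cong₂ _-_ (T-↭ e r α) (T-↭ e r (move (k , l) α))) (cong₂ _-_ (T-↭ e r (move (i , j) α))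
        (trans (T-↭ e r (move (k , l) (move (i , j) α))) (T-ext ys e (λ x → arith₁ (α x) (ε i x - ε j x) (ε k x - ε l x))))) ⟩
    (T ys f α - T ys f (move (k , l) α)) - (T ys f (move (i , j) α) - T ys f (move (i , j) (move (k , l) α)))
      ≡⟨ arith₂ (T ys f α) _ _ (T ys f (move (i , j) (move (k , l) α))) ⟩
    (T ys f α - T ys f (move (i , j) α)) - (T ys f (move (k , l) α) - T ys f (move (i , j) (move (k , l) α))) ∎
    where
    arith₁ : ∀ a b c → (a + b) + c ≡ (a + c) + b
    arith₁ = solve-∀
    arith₂ : ∀ a b c d → (a - b) - (c - d) ≡ (a - c) - (b - d)
    arith₂ = solve-∀
  T-↭ e (↭.trans r r′) α = trans (T-↭ e r α) (T-↭ e r′ α)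

  unique-↭ : ∀ {A : Set} {xs ys : List A} → Unique xs → Unique ys →
    (∀ {x} → x ∈ xs → x ∈ ys) → (∀ {x} → x ∈ ys → x ∈ xs) → xs ↭ ys
  unique-↭ ux uy f g = ∼bag⇒↭ (unique∧set⇒bag ux uy (mk⇔ f g))

  tops : ℕ → ℕ → ℕ → List (ℕ × ℕ)
  tops j zero n = []
  tops j (suc k) n = (j , n) ∷ tops (suc j) k n

  pairs : ℕ → List (ℕ × ℕ)
  pairs zero = []
  pairs (suc n) = pairs n ++ tops 0 n n

  ∈-tops⁻ : ∀ j k n {p} → p ∈ tops j k n → j ℕ.≤ proj₁ p × proj₁ p < j ℕ.+ k × proj₂ p ≡ n
  ∈-tops⁻ j (suc k) n (here refl) = ℕ.≤-refl , ℕ.m<m+n j (ℕ.s≤s ℕ.z≤n) , refl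
  ∈-tops⁻ j (suc k) n (there i) = let a , b , c = ∈-tops⁻ (suc j) k n i in
    ℕ.<⇒≤ a , <-sucʳ j k b , c

  ∈-tops⁺ : ∀ j k n {i} → j ℕ.≤ i → i < j ℕ.+ k → (i , n) ∈ tops j k n
  ∈-tops⁺ j zero n j≤i i<j = contradiction i<j (empty-window j≤i)
  ∈-tops⁺ j (suc k) n {i} j≤i i<jk with j ℕ.≟ i
  ... | yes refl = here refl
  ... | no j≢i = there (∈-tops⁺ (suc j) k n (ℕ.≤∧≢⇒< j≤i j≢i) (<-sucˡ j k i<jk))

  tops-unique : ∀ j k n → Unique (tops j k n)
  tops-unique j zero n = []
  tops-unique j (suc k) n = All.tabulate (λ { i refl → ℕ.<-irrefl refl (proj₁ (∈-tops⁻ (suc j) k n i)) }) ∷ tops-unique (suc j) k n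

  ∈-pairs⁻ : ∀ n {p} → p ∈ pairs n → proj₁ p < proj₂ p × proj₂ p < n
  ∈-pairs⁻ (suc n) i with ∈-++⁻ (pairs n) i
  ... | inj₁ j = let a , b = ∈-pairs⁻ n j in a , ℕ.m<n⇒m<1+n b
  ... | inj₂ j with ∈-tops⁻ 0 n n j
  ... | _ , a , refl = a , ℕ.≤-refl

  ∈-pairs⁺ : ∀ n {i j} → i < j → j < n → (i , j) ∈ pairs n
  ∈-pairs⁺ (suc n) {i} {j} i<j (ℕ.s≤s j≤n) with j ℕ.≟ n
  ... | yes refl = ∈-++⁺ʳ (pairs n) (∈-tops⁺ 0 n n ℕ.z≤n i<j)
  ... | no j≢n = ∈-++⁺ˡ (∈-pairs⁺ n i<j (ℕ.≤∧≢⇒< j≤n j≢n))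

  pairs-unique : ∀ n → Unique (pairs n)
  pairs-unique zero = []
  pairs-unique (suc n) = Unique.++⁺ (pairs-unique n) (tops-unique 0 n n)
    (λ (i , j) → ℕ.<-irrefl (proj₂ (proj₂ (∈-tops⁻ 0 n n j))) (proj₂ (∈-pairs⁻ n i)))

  -- The transposition of i and i + 1.
  swap : ℕ → ℕ → ℕ
  swap zero zero = 1
  swap zero (suc zero) = 0
  swap zero (suc (suc x)) = suc (suc x)
  swap (suc i) zero = 0
  swap (suc i) (suc x) = suc (swap i x)

  swap-involutive : ∀ i x → swap i (swap i x) ≡ x
  swap-involutive zero zero = refl
  swap-involutive zero (suc zero) = refl
  swap-involutive zero (suc (suc x)) = refl
  swap-involutive (suc i) zero = refl
  swap-involutive (suc i) (suc x) = cong suc (swap-involutive i x)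

  swap-i : ∀ i → swap i i ≡ suc i
  swap-i zero = refl
  swap-i (suc i) = cong suc (swap-i i)

  swap-suc : ∀ i → swap i (suc i) ≡ i
  swap-suc zero = refl
  swap-suc (suc i) = cong suc (swap-suc i)

  swap-fix : ∀ i x → x ≢ i → x ≢ suc i → swap i x ≡ x
  swap-fix zero zero p q = contradiction refl p
  swap-fix zero (suc zero) p q = contradiction refl q
  swap-fix zero (suc (suc x)) p q = refl
  swap-fix (suc i) zero p q = refl
  swap-fix (suc i) (suc x) p q = cong suc (swap-fix i x (p ∘ cong suc) (q ∘ cong suc))

  swap-< : ∀ {i n} x → suc i < n → x < n → swap i x < n
  swap-< {zero} zero (ℕ.s≤s p) q = ℕ.s≤s p
  swap-< {zero} (suc zero) p q = ℕ.<-trans (ℕ.s≤s ℕ.z≤n) q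
  swap-< {zero} (suc (suc x)) p q = q
  swap-< {suc i} zero p q = q
  swap-< {suc i} (suc x) (ℕ.s≤s p) (ℕ.s≤s q) = ℕ.s≤s (swap-< x p q)

  swap-mono : ∀ i {x y} → x < y → (x , y) ≢ (i , suc i) → swap i x < swap i y
  swap-mono zero {zero} {suc zero} p ne = contradiction refl ne
  swap-mono zero {zero} {suc (suc y)} p ne = ℕ.s≤s (ℕ.s≤s ℕ.z≤n)
  swap-mono zero {suc zero} {suc zero} (ℕ.s≤s ()) ne
  swap-mono zero {suc zero} {suc (suc y)} p ne = ℕ.s≤s ℕ.z≤n
  swap-mono zero {suc (suc x)} {suc zero} (ℕ.s≤s ()) ne
  swap-mono zero {suc (suc x)} {suc (suc y)} p ne = p
  swap-mono (suc i) {zero} {suc y} p ne = ℕ.s≤s ℕ.z≤n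
  swap-mono (suc i) {suc x} {suc y} (ℕ.s≤s p) ne = ℕ.s≤s (swap-mono i p (λ { refl → ne refl }))

  ε-swap : ∀ i a x → ε (swap i a) x ≡ ε a (swap i x)
  ε-swap i a x = ι-cong (swap i a ℕ.≟ x) (a ℕ.≟ swap i x)
    (λ e → trans (sym (swap-involutive i a)) (cong (swap i) e)) (λ e → trans (cong (swap i) e) (swap-involutive i x))

  swapPair : ℕ → ℕ × ℕ → ℕ × ℕ
  swapPair i (a , b) = swap i a , swap i b

  T-swap : ∀ i ps {f} → Extensional f → ∀ α → T (map (swapPair i) ps) (λ β → f (β ∘ swap i)) α ≡ T ps f (α ∘ swap i)
  T-swap i [] e α = refl
  T-swap i ((a , b) ∷ ps) {f} e α = cong₂ _-_ (T-swap i ps e α) (trans (T-swap i ps e (move (swap i a , swap i b) α))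
    (T-ext ps e (λ x → cong (α (swap i x) +_) (cong₂ _-_ (shifted a x) (shifted b x)))))
    where
    shifted : ∀ a x → ε (swap i a) (swap i x) ≡ ε a x
    shifted a x = trans (ε-swap i a (swap i x)) (cong (ε a) (swap-involutive i x))

  -- The factors other than 1 - x_(i+1) / x_i are permuted by the transposition of i and i + 1, so
  -- they turn a symmetric function into a symmetric one. The remaining factor takes the difference
  -- of its values at β and at β moved by (i, i + 1); for an ascent by exactly 1 the moved exponent
  -- is β with the two entries swapped.
  T-antisymmetric : ∀ n i {f} → suc i < n → Extensional f → (∀ α → f (α ∘ swap i) ≡ f α) →
                    ∀ {β} → β (suc i) ≡ β i + 1ℤ → T (pairs n) f β ≡ 0ℤ
  T-antisymmetric n i {f} i<n ext-f sym-f {β} eq = begin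
    T (pairs n) f β ≡⟨ T-↭ ext-f split β ⟩
    T others f β - T others f (move (i , suc i) β) ≡⟨ cong (λ z → T others f β - z) (T-ext others ext-f moved) ⟩
    T others f β - T others f (β ∘ swap i) ≡⟨ cong (λ z → T others f β - z) invariant ⟩
    T others f β - T others f β ≡⟨ +-inverseʳ (T others f β) ⟩
    0ℤ ∎
    where
    _≟ₚ_ : (p q : ℕ × ℕ) → Dec (p ≡ q)
    _≟ₚ_ = ≡-dec ℕ._≟_ ℕ._≟_
    other? : ∀ p → Dec (p ≢ (i , suc i))
    other? p = ¬? (p ≟ₚ (i , suc i))
    others : List (ℕ × ℕ)
    others = filter other? (pairs n)
    others-unique : Unique others
    others-unique = Unique.filter⁺ other? (pairs-unique n)
    split : pairs n ↭ (i , suc i) ∷ others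
    split = unique-↭ (pairs-unique n) (All.tabulate (λ j e → proj₂ (∈-filter⁻ other? {xs = pairs n} j) (sym e)) ∷ others-unique) to from
      where
      to : ∀ {p} → p ∈ pairs n → p ∈ (i , suc i) ∷ others
      to {p} j with p ≟ₚ (i , suc i)
      ... | yes e = here e
      ... | no ne = there (∈-filter⁺ other? j ne)
      from : ∀ {p} → p ∈ (i , suc i) ∷ others → p ∈ pairs n
      from (here refl) = ∈-pairs⁺ n ℕ.≤-refl i<n
      from (there j) = proj₁ (∈-filter⁻ other? {xs = pairs n} j)
    swapPair-others : ∀ {p} → p ∈ others → swapPair i p ∈ others
    swapPair-others {a , b} j =
      let a<b , b<n = ∈-pairs⁻ n (proj₁ (∈-filter⁻ other? {xs = pairs n} j))
          ne = proj₂ (∈-filter⁻ other? {xs = pairs n} j) in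
      ∈-filter⁺ other? (∈-pairs⁺ n (swap-mono i a<b ne) (swap-< b i<n b<n)) (image-≢ a b a<b)
      where
      image-≢ : ∀ a b → a < b → swapPair i (a , b) ≢ (i , suc i)
      image-≢ a b a<b e = ℕ.<-asym a<b (subst₂ _<_
        (trans (sym (swap-suc i)) (trans (cong (swap i) (sym (cong proj₂ e))) (swap-involutive i b)))
        (trans (sym (swap-i i)) (trans (cong (swap i) (sym (cong proj₁ e))) (swap-involutive i a))) ℕ.≤-refl)
    swapPair-involutive : ∀ p → swapPair i (swapPair i p) ≡ p
    swapPair-involutive (a , b) = cong₂ _,_ (swap-involutive i a) (swap-involutive i b)
    permuted : map (swapPair i) others ↭ others
    permuted = unique-↭ (Unique.map⁺ (λ {p} {q} e → trans (sym (swapPair-involutive p)) (trans (cong (swapPair i) e) (swapPair-involutive q))) others-unique)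
      others-unique to from
      where
      to : ∀ {p} → p ∈ map (swapPair i) others → p ∈ others
      to j with ∈-map⁻ (swapPair i) j
      ... | q , k , refl = swapPair-others k
      from : ∀ {p} → p ∈ others → p ∈ map (swapPair i) others
      from {p} j = subst (_∈ map (swapPair i) others) (swapPair-involutive p) (∈-map⁺ (swapPair i) (swapPair-others j))
    invariant : T others f (β ∘ swap i) ≡ T others f β
    invariant = begin
      T others f (β ∘ swap i) ≡⟨ T-swap i others ext-f β ⟨
      T (map (swapPair i) others) (λ α → f (α ∘ swap i)) β ≡⟨ T-cong (map (swapPair i) others) sym-f β ⟩
      T (map (swapPair i) others) f β ≡⟨ T-↭ ext-f permuted β ⟩
      T others f β ∎
    moved : ∀ x → move (i , suc i) β x ≡ β (swap i x)
    moved x with x ℕ.≟ i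
    ... | yes refl = begin
      β i + (ι (i ℕ.≟ i) - ι (suc i ℕ.≟ i))
        ≡⟨ cong₂ (λ p q → β i + (p - q)) (ι-yes (i ℕ.≟ i) refl) (ι-no (suc i ℕ.≟ i) ℕ.1+n≢n) ⟩
      β i + 1ℤ ≡⟨ eq ⟨
      β (suc i) ≡⟨ cong β (swap-i i) ⟨
      β (swap i i) ∎
    ... | no x≢i with x ℕ.≟ suc i
    ... | yes refl = begin
      β (suc i) + (ι (i ℕ.≟ suc i) - ι (suc i ℕ.≟ suc i))
        ≡⟨ cong₂ (λ p q → β (suc i) + (p - q)) (ι-no (i ℕ.≟ suc i) (ℕ.1+n≢n ∘ sym)) (ι-yes (suc i ℕ.≟ suc i) refl) ⟩
      β (suc i) - 1ℤ ≡⟨ cong (_- 1ℤ) eq ⟩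
      β i + 1ℤ - 1ℤ ≡⟨ cancel (β i) ⟩
      β i ≡⟨ cong β (swap-suc i) ⟨
      β (swap i (suc i)) ∎
      where
      cancel : ∀ b → b + 1ℤ - 1ℤ ≡ b
      cancel = solve-∀
    ... | no x≢si = begin
      β x + (ι (i ℕ.≟ x) - ι (suc i ℕ.≟ x))
        ≡⟨ cong₂ (λ p q → β x + (p - q)) (ι-no (i ℕ.≟ x) (x≢i ∘ sym)) (ι-no (suc i ℕ.≟ x) (x≢si ∘ sym)) ⟩
      β x + 0ℤ ≡⟨ +-identityʳ (β x) ⟩
      β x ≡⟨ cong β (swap-fix i x x≢i x≢si) ⟨
      β (swap i x) ∎

  ∑-pick : ∀ {A : Set} {P : A → Set} (P? : Decidable P) {xs} {x} (f : A → ℤ) → Unique xs → x ∈ xs → P x →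
    (∀ {y} → y ∈ xs → P y → y ≡ x) → ∑ xs (λ y → ι (P? y) * f y) ≡ f x
  ∑-pick P? {x ∷ xs} f (x∉ ∷ _) (here refl) px only = begin
    ι (P? x) * f x + ∑ xs (λ y → ι (P? y) * f y)
      ≡⟨ cong₂ _+_ (cong (_* f x) (ι-yes (P? x) px))
        (∑-0 xs (λ {y} i → trans (cong (_* f y) (ι-no (P? y) (λ py → All.lookup x∉ i (sym (only (there i) py))))) (*-zeroˡ (f y)))) ⟩
    1ℤ * f x + 0ℤ ≡⟨ trans (+-identityʳ (1ℤ * f x)) (*-identityˡ (f x)) ⟩
    f x ∎
  ∑-pick P? {y ∷ xs} {x} f (y∉ ∷ u) (there i) px only = begin
    ι (P? y) * f y + ∑ xs (λ z → ι (P? z) * f z)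
      ≡⟨ cong₂ _+_ (cong (_* f y) (ι-no (P? y) (λ py → All.lookup y∉ i (only (here refl) py)))) (∑-pick P? f u i px (only ∘ there)) ⟩
    0ℤ * f y + f x ≡⟨ trans (cong (_+ f x) (*-zeroˡ (f y))) (+-identityˡ (f x)) ⟩
    f x ∎

  ∑-involution : ∀ {A : Set} (_≟_ : DecidableEquality A) {xs : List A} (φ : A → A) (f : A → ℤ) → Unique xs →
    (∀ {x} → x ∈ xs → φ x ∈ xs) → (∀ {x} → x ∈ xs → φ (φ x) ≡ x) → ∑ xs f ≡ ∑ xs (f ∘ φ)
  ∑-involution _≟_ {xs} φ f u closed inv = begin
    ∑ xs f
      ≡⟨ ∑-cong∈ xs (λ {x} i → sym (∑-pick (λ y → φ y ≟ x) (λ _ → f x) u (closed i) (inv i)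
        (λ {y} j e → trans (sym (inv j)) (cong φ e)))) ⟩
    ∑ xs (λ x → ∑ xs (λ y → ι (φ y ≟ x) * f x))
      ≡⟨ ∑-swap xs xs (λ x y → ι (φ y ≟ x) * f x) ⟩
    ∑ xs (λ y → ∑ xs (λ x → ι (φ y ≟ x) * f x))
      ≡⟨ ∑-cong∈ xs (λ {y} j → ∑-pick (λ x → φ y ≟ x) f u (closed j) refl (λ _ → sym)) ⟩
    ∑ xs (f ∘ φ) ∎

  -- Gelfand-Tsetlin patterns and the symmetry of Kostka numbers

  range : ℕ → ℕ → List ℕ
  range lo hi = map (lo ℕ.+_) (upTo (suc hi ∸ lo))

  ∈-range⁺ : ∀ {lo hi v} → lo ≤ v → v ≤ hi → v ∈ range lo hi
  ∈-range⁺ {lo} {hi} {v} p q = subst (_∈ range lo hi) (ℕ.m+[n∸m]≡n p)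
    (∈-map⁺ (lo ℕ.+_) (∈-upTo⁺ (ℕ.∸-monoˡ-< (s≤s q) p)))

  ∈-range⁻ : ∀ {lo hi v} → v ∈ range lo hi → lo ≤ v × v ≤ hi
  ∈-range⁻ {lo} {hi} i with ∈-map⁻ (lo ℕ.+_) i
  ... | w , j , refl = ℕ.m≤m+n lo w , ℕ.s≤s⁻¹ (ℕ.≤-trans (ℕ.+-monoʳ-< lo (∈-upTo⁻ j))
    (ℕ.≤-reflexive (ℕ.m+[n∸m]≡n (ℕ.<⇒≤ (ℕ.m∸n≢0⇒n<m {suc hi} {lo} (λ e → ℕ.n≮0 (subst (w <_) e (∈-upTo⁻ j))))))))

  range-unique : ∀ lo hi → Unique (range lo hi)
  range-unique lo hi = Unique.map⁺ (ℕ.+-cancelˡ-≡ lo _ _) (Unique.upTo⁺ (suc hi ∸ lo))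

  -- The shapes ν interlacing μ: μᵢ₊₁ ≤ νᵢ ≤ μᵢ.
  box : List ℕ → List (List ℕ)
  box [] = []
  box (_ ∷ []) = [] ∷ []
  box (m ∷ m′ ∷ μ) = concatMap (λ v → map (v ∷_) (box (m′ ∷ μ))) (range m′ m)

  data Interlaces : List ℕ → List ℕ → Set where
    end : ∀ {m} → Interlaces (m ∷ []) []
    step : ∀ {m m′ μ v ν} → m′ ≤ v → v ≤ m → Interlaces (m′ ∷ μ) ν → Interlaces (m ∷ m′ ∷ μ) (v ∷ ν)

  ∈-concatMap∷⁺ : ∀ {A : Set} {vs : List A} {νs : List (List A)} {v ν} → v ∈ vs → ν ∈ νs →
    (v ∷ ν) ∈ concatMap (λ v → map (v ∷_) νs) vs
  ∈-concatMap∷⁺ {vs = _ ∷ _} (here refl) j = ∈-++⁺ˡ (∈-map⁺ (_ ∷_) j)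
  ∈-concatMap∷⁺ {vs = x ∷ _} {νs} (there i) j = ∈-++⁺ʳ (map (x ∷_) νs) (∈-concatMap∷⁺ i j)

  ∈-concatMap∷⁻ : ∀ {A : Set} (vs : List A) {νs : List (List A)} {ξ} → ξ ∈ concatMap (λ v → map (v ∷_) νs) vs →
                 Σ A λ v → Σ (List A) λ ν → v ∈ vs × ν ∈ νs × ξ ≡ v ∷ ν
  ∈-concatMap∷⁻ (x ∷ vs) {νs} i with ∈-++⁻ (map (x ∷_) νs) i
  ... | inj₁ j with ∈-map⁻ (x ∷_) j
  ... | ν , k , refl = x , ν , here refl , k , refl
  ∈-concatMap∷⁻ (x ∷ vs) i | inj₂ j with ∈-concatMap∷⁻ vs j
  ... | v , ν , k , l , e = v , ν , there k , l , e

  concatMap∷-unique : ∀ {A : Set} {vs : List A} {νs : List (List A)} → Unique vs → Unique νs →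
                     Unique (concatMap (λ v → map (v ∷_) νs) vs)
  concatMap∷-unique {vs = []} u w = []
  concatMap∷-unique {vs = x ∷ vs} {νs} (x∉ ∷ u) w = Unique.++⁺ (Unique.map⁺ ∷-injectiveʳ w) (concatMap∷-unique u w)
    (λ (i , j) → disjoint (∈-map⁻ (x ∷_) i) (∈-concatMap∷⁻ vs j))
    where
    disjoint : ∀ {ξ} → Σ (List _) (λ ν → ν ∈ νs × ξ ≡ x ∷ ν) →
               Σ _ (λ v → Σ (List _) λ ν → v ∈ vs × ν ∈ νs × ξ ≡ v ∷ ν) → _
    disjoint (_ , _ , refl) (_ , _ , k , _ , e) = All.lookup x∉ k (∷-injectiveˡ e)

  ∈-box⁻ : ∀ μ {ν} → ν ∈ box μ → Interlaces μ ν
  ∈-box⁻ (m ∷ []) (here refl) = end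
  ∈-box⁻ (m ∷ m′ ∷ μ) i with ∈-concatMap∷⁻ (range m′ m) i
  ... | v , ν , j , k , refl = let p , q = ∈-range⁻ j in step p q (∈-box⁻ (m′ ∷ μ) k)

  ∈-box⁺ : ∀ {μ ν} → Interlaces μ ν → ν ∈ box μ
  ∈-box⁺ end = here refl
  ∈-box⁺ (step p q r) = ∈-concatMap∷⁺ (∈-range⁺ p q) (∈-box⁺ r)

  box-unique : ∀ μ → Unique (box μ)
  box-unique [] = []
  box-unique (_ ∷ []) = [] ∷ []
  box-unique (m ∷ m′ ∷ μ) = concatMap∷-unique (range-unique m′ m) (box-unique (m′ ∷ μ))

  interlaces-length : ∀ {μ ν} → Interlaces μ ν → length μ ≡ suc (length ν)
  interlaces-length end = refl
  interlaces-length (step _ _ r) = cong suc (interlaces-length r)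

  -- The number of Gelfand–Tsetlin patterns of shape μ and weight α.
  kost : ℕ → List ℕ → Weight → ℤ
  kost zero μ α = 1ℤ
  kost (suc n) μ α = ∑ (box μ) (λ ν → ι (ℤ.+ sum μ ℤ.≟ ℤ.+ sum ν + α n) * kost n ν α)

  kost-local : ∀ n μ {α β} → (∀ i → i < n → α i ≡ β i) → kost n μ α ≡ kost n μ β
  kost-local zero μ e = refl
  kost-local (suc n) μ e = ∑-cong (box μ) (λ ν → cong₂ _*_ (cong (λ a → ι (ℤ.+ sum μ ℤ.≟ ℤ.+ sum ν + a)) (e n ℕ.≤-refl))
    (kost-local n ν (λ i i<n → e i (ℕ.m<n⇒m<1+n i<n))))

  kost-ext : ∀ n μ → Extensional (kost n μ)
  kost-ext n μ e = kost-local n μ (λ i _ → e i)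

  -- The chains μ ≻ ν ≻ κ with κ fixed are permuted by reflecting each νᵢ in the
  -- interval [max(κᵢ, μᵢ₊₁), min(κᵢ₋₁, μᵢ)]; c stands for the upper end.
  reflect : ℕ → List ℕ → List ℕ → List ℕ → List ℕ
  reflect c (m ∷ []) (v ∷ _) _ = (c ℕ.+ m ∸ v) ∷ []
  reflect c (m ∷ m′ ∷ μ) (v ∷ ν) (k ∷ κ) = (c ℕ.+ (k ⊔ m) ∸ v) ∷ reflect (k ⊓ m) (m′ ∷ μ) ν κ
  reflect c _ ν _ = ν

  -- The two interlacing conditions in μ ≻ ν ≻ κ become independent intervals for the entries of ν,
  -- which is why each entry can be reflected on its own. The first part of μ is split off as the
  -- initial upper end `c`.
  data Chain : ℕ → List ℕ → List ℕ → List ℕ → Set where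
    end : ∀ {c m v} → m ≤ v → v ≤ c → Chain c (m ∷ []) (v ∷ []) []
    step : ∀ {c m m′ μ v ν k κ} → k ⊔ m ≤ v → v ≤ c → Chain (k ⊓ m) (m′ ∷ μ) ν κ → Chain c (m ∷ m′ ∷ μ) (v ∷ ν) (k ∷ κ)

  chain⁺ : ∀ {c m μ ν κ} → Interlaces (c ∷ m ∷ μ) ν → Interlaces ν κ → Chain c (m ∷ μ) ν κ
  chain⁺ (step p q end) end = end p q
  chain⁺ (step p q (step r s t)) (step u w x) =
    step (ℕ.⊔-lub w p) q (chain⁺ (step r (ℕ.⊓-glb u s) t) x)

  chain⁻ : ∀ {c m μ ν κ} → Chain c (m ∷ μ) ν κ → Interlaces (c ∷ m ∷ μ) ν × Interlaces ν κ
  chain⁻ (end p q) = step p q end , end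
  chain⁻ (step {k = k} p q r) with chain⁻ r
  ... | step a b t , x = step (ℕ.m⊔n≤o⇒n≤o k _ p) q (step a (ℕ.≤-trans b (ℕ.m⊓n≤n k _)) t)
                       , step (ℕ.≤-trans b (ℕ.m⊓n≤m k _)) (ℕ.m⊔n≤o⇒m≤o k _ p) x

  mirror : ∀ {lo hi v} → lo ≤ v → v ≤ hi → lo ≤ hi ℕ.+ lo ∸ v × hi ℕ.+ lo ∸ v ≤ hi
  mirror {lo} {hi} {v} p q =
    ℕ.≤-trans (ℕ.≤-reflexive (sym (ℕ.m+n∸m≡n v lo))) (ℕ.∸-monoˡ-≤ v (ℕ.+-monoˡ-≤ lo q)) ,
    ℕ.≤-trans (ℕ.∸-monoʳ-≤ (hi ℕ.+ lo) p) (ℕ.≤-reflexive (ℕ.m+n∸n≡m hi lo))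

  reflect-chain : ∀ {c μ ν κ} → Chain c μ ν κ → Chain c μ (reflect c μ ν κ) κ
  reflect-chain (end p q) = let a , b = mirror p q in end a b
  reflect-chain (step p q r) = let a , b = mirror p q in step a b (reflect-chain r)

  reflect-involutive : ∀ {c μ ν κ} → Chain c μ ν κ → reflect c μ (reflect c μ ν κ) κ ≡ ν
  reflect-involutive (end {c} {m} p q) = cong (_∷ []) (ℕ.m∸[m∸n]≡n (ℕ.≤-trans q (ℕ.m≤m+n c m)))
  reflect-involutive (step {c} p q r) = cong₂ _∷_ (ℕ.m∸[m∸n]≡n (ℕ.≤-trans q (ℕ.m≤m+n c _))) (reflect-involutive r)

  -- Each entry and its mirror image add up to the two ends of the interval. Over the whole chain
  -- the ends add up to the sums of μ and κ, since a maximum and the minimum of the same two numbers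
  -- have the sum of the numbers.
  reflect-sum : ∀ {c μ ν κ} → Chain c μ ν κ → sum (reflect c μ ν κ) ℕ.+ sum ν ≡ c ℕ.+ sum μ ℕ.+ sum κ
  reflect-sum (end {c} {m} {v} p q) = begin
    (c ℕ.+ m ∸ v) ℕ.+ 0 ℕ.+ (v ℕ.+ 0) ≡⟨ cong₂ ℕ._+_ (ℕ.+-identityʳ (c ℕ.+ m ∸ v)) (ℕ.+-identityʳ v) ⟩
    (c ℕ.+ m ∸ v) ℕ.+ v ≡⟨ ℕ.m∸n+n≡m (ℕ.≤-trans q (ℕ.m≤m+n c m)) ⟩
    c ℕ.+ m ≡⟨ arith c m ⟩
    c ℕ.+ (m ℕ.+ 0) ℕ.+ 0 ∎
    where
    arith : ∀ c m → c ℕ.+ m ≡ c ℕ.+ (m ℕ.+ 0) ℕ.+ 0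
    arith = ℕ-Solver.solve-∀
  reflect-sum (step {c} {m} {m′} {μ} {v} {ν} {k} {κ} p q r) = begin
    (c ℕ.+ (k ⊔ m) ∸ v) ℕ.+ sum ν̃ ℕ.+ (v ℕ.+ sum ν)
      ≡⟨ arith₁ (c ℕ.+ (k ⊔ m) ∸ v) (sum ν̃) v (sum ν) ⟩
    ((c ℕ.+ (k ⊔ m) ∸ v) ℕ.+ v) ℕ.+ (sum ν̃ ℕ.+ sum ν)
      ≡⟨ cong₂ ℕ._+_ (ℕ.m∸n+n≡m (ℕ.≤-trans q (ℕ.m≤m+n c (k ⊔ m)))) (reflect-sum r) ⟩
    (c ℕ.+ (k ⊔ m)) ℕ.+ ((k ⊓ m) ℕ.+ sum (m′ ∷ μ) ℕ.+ sum κ)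
      ≡⟨ arith₂ c (k ⊔ m) (k ⊓ m) (sum (m′ ∷ μ)) (sum κ) ⟩
    c ℕ.+ ((k ⊓ m) ℕ.+ (k ⊔ m)) ℕ.+ sum (m′ ∷ μ) ℕ.+ sum κ
      ≡⟨ cong (λ z → c ℕ.+ z ℕ.+ sum (m′ ∷ μ) ℕ.+ sum κ) (max-min k m) ⟩
    c ℕ.+ (k ℕ.+ m) ℕ.+ sum (m′ ∷ μ) ℕ.+ sum κ
      ≡⟨ arith₃ c k m (sum (m′ ∷ μ)) (sum κ) ⟩
    c ℕ.+ (m ℕ.+ sum (m′ ∷ μ)) ℕ.+ (k ℕ.+ sum κ) ∎
    where
    ν̃ : List ℕ
    ν̃ = reflect (k ⊓ m) (m′ ∷ μ) ν κ
    max-min : ∀ k m → (k ⊓ m) ℕ.+ (k ⊔ m) ≡ k ℕ.+ m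
    max-min k m with ℕ.≤-total k m
    ... | inj₁ k≤m = cong₂ ℕ._+_ (ℕ.m≤n⇒m⊓n≡m k≤m) (ℕ.m≤n⇒m⊔n≡n k≤m)
    ... | inj₂ m≤k = trans (cong₂ ℕ._+_ (ℕ.m≥n⇒m⊓n≡n m≤k) (ℕ.m≥n⇒m⊔n≡m m≤k)) (ℕ.+-comm m k)
    arith₁ : ∀ a b c d → a ℕ.+ b ℕ.+ (c ℕ.+ d) ≡ (a ℕ.+ c) ℕ.+ (b ℕ.+ d)
    arith₁ = ℕ-Solver.solve-∀
    arith₂ : ∀ c x y s t → (c ℕ.+ x) ℕ.+ (y ℕ.+ s ℕ.+ t) ≡ c ℕ.+ (y ℕ.+ x) ℕ.+ s ℕ.+ t
    arith₂ = ℕ-Solver.solve-∀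
    arith₃ : ∀ c k m s t → c ℕ.+ (k ℕ.+ m) ℕ.+ s ℕ.+ t ≡ c ℕ.+ (m ℕ.+ s) ℕ.+ (k ℕ.+ t)
    arith₃ = ℕ-Solver.solve-∀

  Pattern₂ : Set
  Pattern₂ = List ℕ × List ℕ

  chains : List ℕ → List Pattern₂
  chains μ = concatMap (λ ν → map (ν ,_) (box ν)) (box μ)

  ∈-chains⁻ : ∀ νs {p} → p ∈ concatMap (λ ν → map (ν ,_) (box ν)) νs → proj₁ p ∈ νs × proj₂ p ∈ box (proj₁ p)
  ∈-chains⁻ (ν ∷ νs) i with ∈-++⁻ (map (ν ,_) (box ν)) i
  ... | inj₁ j with ∈-map⁻ (ν ,_) j
  ... | κ , k , refl = here refl , k
  ∈-chains⁻ (ν ∷ νs) i | inj₂ j = let a , b = ∈-chains⁻ νs j in there a , b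

  ∈-chains⁺ : ∀ {νs ν κ} → ν ∈ νs → κ ∈ box ν → (ν , κ) ∈ concatMap (λ ν → map (ν ,_) (box ν)) νs
  ∈-chains⁺ (here refl) j = ∈-++⁺ˡ (∈-map⁺ (_ ,_) j)
  ∈-chains⁺ {ξ ∷ νs} (there i) j = ∈-++⁺ʳ (map (ξ ,_) (box ξ)) (∈-chains⁺ i j)

  chains-unique : ∀ {νs} → Unique νs → Unique (concatMap (λ ν → map (ν ,_) (box ν)) νs)
  chains-unique {[]} u = []
  chains-unique {ν ∷ νs} (ν∉ ∷ u) = Unique.++⁺ (Unique.map⁺ (cong proj₂) (box-unique ν)) (chains-unique u) disjoint
    where
    disjoint : ∀ {p} → ¬ (p ∈ map (ν ,_) (box ν) × p ∈ concatMap (λ ν → map (ν ,_) (box ν)) νs)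
    disjoint (i , j) with ∈-map⁻ (ν ,_) i
    ... | κ , k , refl = All.lookup ν∉ (proj₁ (∈-chains⁻ νs j)) refl

  -- The Bender-Knuth involution in terms of patterns: by `reflect-sum`, reflecting the middle row
  -- interchanges |μ| - |ν| with |ν| - |κ|, the last two entries of the weight.
  kost-swap-top : ∀ n μ → length μ ≡ suc (suc n) → ∀ α → kost (suc (suc n)) μ (α ∘ swap n) ≡ kost (suc (suc n)) μ α
  kost-swap-top n (c ∷ m ∷ μ) len α = begin
    kost (suc (suc n)) (c ∷ m ∷ μ) (α ∘ swap n) ≡⟨ flatten (α ∘ swap n) ⟩
    ∑ (chains (c ∷ m ∷ μ)) (term (α ∘ swap n)) ≡⟨ ∑-cong∈ (chains (c ∷ m ∷ μ)) (λ {p} i → swapped p i) ⟩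
    ∑ (chains (c ∷ m ∷ μ)) (λ p → term α (φ p)) ≡⟨ ∑-involution _≟ₚ_ φ (term α) (chains-unique (box-unique (c ∷ m ∷ μ))) φ-closed φ-involutive ⟨
    ∑ (chains (c ∷ m ∷ μ)) (term α) ≡⟨ flatten α ⟨
    kost (suc (suc n)) (c ∷ m ∷ μ) α ∎
    where
    open import Data.Product.Properties using (≡-dec)
    import Data.List.Properties as List
    _≟ₚ_ : DecidableEquality Pattern₂
    _≟ₚ_ = ≡-dec (List.≡-dec ℕ._≟_) (List.≡-dec ℕ._≟_)
    term : Weight → Pattern₂ → ℤ
    term α (ν , κ) = ι (ℤ.+ sum (c ∷ m ∷ μ) ℤ.≟ ℤ.+ sum ν + α (suc n)) * (ι (ℤ.+ sum ν ℤ.≟ ℤ.+ sum κ + α n) * kost n κ α)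
    flatten : ∀ α → kost (suc (suc n)) (c ∷ m ∷ μ) α ≡ ∑ (chains (c ∷ m ∷ μ)) (term α)
    flatten α = sym (trans (∑-concatMap (λ ν → map (ν ,_) (box ν)) (box (c ∷ m ∷ μ)) (term α))
      (∑-cong (box (c ∷ m ∷ μ)) (λ ν → trans (∑-map (ν ,_) (box ν) (term α))
        (∑-*ˡ (box ν) (ι (ℤ.+ sum (c ∷ m ∷ μ) ℤ.≟ ℤ.+ sum ν + α (suc n))) (λ κ → ι (ℤ.+ sum ν ℤ.≟ ℤ.+ sum κ + α n) * kost n κ α)))))
    φ : Pattern₂ → Pattern₂
    φ (ν , κ) = reflect c (m ∷ μ) ν κ , κ
    chain-of : ∀ {p} → p ∈ chains (c ∷ m ∷ μ) → Chain c (m ∷ μ) (proj₁ p) (proj₂ p)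
    chain-of i = let a , b = ∈-chains⁻ (box (c ∷ m ∷ μ)) i in chain⁺ (∈-box⁻ (c ∷ m ∷ μ) a) (∈-box⁻ _ b)
    φ-closed : ∀ {p} → p ∈ chains (c ∷ m ∷ μ) → φ p ∈ chains (c ∷ m ∷ μ)
    φ-closed i = let a , b = chain⁻ (reflect-chain (chain-of i)) in ∈-chains⁺ (∈-box⁺ a) (∈-box⁺ b)
    φ-involutive : ∀ {p} → p ∈ chains (c ∷ m ∷ μ) → φ (φ p) ≡ p
    φ-involutive {ν , κ} i = cong (_, κ) (reflect-involutive (chain-of i))
    swapped : ∀ p → p ∈ chains (c ∷ m ∷ μ) → term (α ∘ swap n) p ≡ term α (φ p)
    swapped (ν , κ) i = begin
      ι (M ℤ.≟ ℤ.+ sum ν + α (swap n (suc n))) * (ι (ℤ.+ sum ν ℤ.≟ ℤ.+ sum κ + α (swap n n)) * kost n κ (α ∘ swap n))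
        ≡⟨ cong₂ _*_ (cong (λ x → ι (M ℤ.≟ ℤ.+ sum ν + α x)) (swap-suc n))
          (cong₂ _*_ (cong (λ x → ι (ℤ.+ sum ν ℤ.≟ ℤ.+ sum κ + α x)) (swap-i n))
            (kost-local n κ (λ x x<n → cong α (swap-fix n x (ℕ.<⇒≢ x<n) (ℕ.<⇒≢ (ℕ.m<n⇒m<1+n x<n)))))) ⟩
      ι (M ℤ.≟ ℤ.+ sum ν + α n) * (ι (ℤ.+ sum ν ℤ.≟ ℤ.+ sum κ + α (suc n)) * kost n κ α)
        ≡⟨ *-swapˡ (ι (M ℤ.≟ ℤ.+ sum ν + α n)) (ι (ℤ.+ sum ν ℤ.≟ ℤ.+ sum κ + α (suc n))) (kost n κ α) ⟩
      ι (ℤ.+ sum ν ℤ.≟ ℤ.+ sum κ + α (suc n)) * (ι (M ℤ.≟ ℤ.+ sum ν + α n) * kost n κ α)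
        ≡⟨ cong₂ _*_
          (ι-cong (ℤ.+ sum ν ℤ.≟ ℤ.+ sum κ + α (suc n)) (M ℤ.≟ ν̃ + α (suc n)) (forward₁ V K ν̃ M (α (suc n)) total) (backward₁ V K ν̃ M (α (suc n)) total))
          (cong (_* kost n κ α) (ι-cong (M ℤ.≟ ℤ.+ sum ν + α n) (ν̃ ℤ.≟ ℤ.+ sum κ + α n) (forward₂ V K ν̃ M (α n) total) (backward₂ V K ν̃ M (α n) total))) ⟩
      ι (M ℤ.≟ ν̃ + α (suc n)) * (ι (ν̃ ℤ.≟ ℤ.+ sum κ + α n) * kost n κ α) ∎
      where
      M ν̃ V K : ℤ
      V = ℤ.+ sum ν
      K = ℤ.+ sum κ
      M = ℤ.+ sum (c ∷ m ∷ μ)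
      ν̃ = ℤ.+ sum (reflect c (m ∷ μ) ν κ)
      total : ν̃ + ℤ.+ sum ν ≡ M + ℤ.+ sum κ
      total = cong ℤ.+_ (reflect-sum (chain-of i))
      solve₁ : ∀ M T V K a → M - (T + a) ≡ (M + K) - (T + V) + (V - (K + a))
      solve₁ = solve-∀
      solve₂ : ∀ M T V K a → V - (K + a) ≡ (T + V) - (M + K) + (M - (T + a))
      solve₂ = solve-∀
      zero-diff : ∀ {x y} → x ≡ y → x - y ≡ 0ℤ
      zero-diff {x} refl = +-inverseʳ x
      conclude : ∀ {x y p q} → x - y ≡ p + q → p ≡ 0ℤ → q ≡ 0ℤ → x ≡ y
      conclude {x} {y} e refl refl = i-j≡0⇒i≡j x y e
      forward₁ : ∀ V K T M a → T + V ≡ M + K → V ≡ K + a → M ≡ T + a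
      forward₁ V K T M a tot e = conclude (solve₁ M T V K a) (zero-diff (sym tot)) (zero-diff e)
      backward₁ : ∀ V K T M a → T + V ≡ M + K → M ≡ T + a → V ≡ K + a
      backward₁ V K T M a tot e = conclude (solve₂ M T V K a) (zero-diff tot) (zero-diff e)
      solve₃ : ∀ M T V K a → T - (K + a) ≡ (T + V) - (M + K) + (M - (V + a))
      solve₃ = solve-∀
      solve₄ : ∀ M T V K a → M - (V + a) ≡ (M + K) - (T + V) + (T - (K + a))
      solve₄ = solve-∀
      forward₂ : ∀ V K T M a → T + V ≡ M + K → M ≡ V + a → T ≡ K + a
      forward₂ V K T M a tot e = conclude (solve₃ M T V K a) (zero-diff tot) (zero-diff e)
      backward₂ : ∀ V K T M a → T + V ≡ M + K → T ≡ K + a → M ≡ V + a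
      backward₂ V K T M a tot e = conclude (solve₄ M T V K a) (zero-diff (sym tot)) (zero-diff e)

  kost-symmetric : ∀ n i μ → length μ ≡ n → suc i < n → ∀ α → kost n μ (α ∘ swap i) ≡ kost n μ α
  kost-symmetric (suc n) i μ len (s≤s i<n) α with suc i ℕ.≟ n
  ... | yes refl = kost-swap-top i μ len α
  ... | no i≢n = ∑-cong∈ (box μ) (λ {ν} j → cong₂ _*_
    (cong (λ x → ι (ℤ.+ sum μ ℤ.≟ ℤ.+ sum ν + α x)) (swap-fix i n (λ { refl → ℕ.<-irrefl refl i<n }) (i≢n ∘ sym)))
    (kost-symmetric n i ν (ℕ.suc-injective (trans (sym (interlaces-length (∈-box⁻ μ j))) len)) (ℕ.≤∧≢⇒< i<n i≢n) α))

  -- The inverse of the Kostka matrix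

  Decreasing : List ℕ → Set
  Decreasing = Linked (λ a b → b ℕ.≤ a)

  interlaces-decreasing : ∀ {μ ν} → Interlaces μ ν → Decreasing ν
  interlaces-decreasing end = []
  interlaces-decreasing (step p q end) = [-]
  interlaces-decreasing (step p q r@(step a b _)) = ℕ.≤-trans b p ∷ interlaces-decreasing r

  eqAt : ℕ → List ℕ → Weight → ℤ
  eqAt j [] α = 1ℤ
  eqAt j (m ∷ μ) α = ι (α j ℤ.≟ ℤ.+ m) * eqAt (suc j) μ α

  eqAt-cong : ∀ j μ {α β} → (∀ i → j ℕ.≤ i → i ℕ.< j ℕ.+ length μ → α i ≡ β i) → eqAt j μ α ≡ eqAt j μ β
  eqAt-cong j [] e = refl
  eqAt-cong j (m ∷ μ) e = cong₂ _*_ (cong (λ z → ι (z ℤ.≟ ℤ.+ m)) (e j ℕ.≤-refl (ℕ.m<m+n j (s≤s z≤n))))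
    (eqAt-cong (suc j) μ (λ i p q → e i (ℕ.<⇒≤ p) (<-sucʳ j (length μ) q)))

  eqAt-violation : ∀ i j μ {α} → Decreasing μ → suc i ℕ.< length μ → α (suc (j ℕ.+ i)) ≡ α (j ℕ.+ i) + 1ℤ → eqAt j μ α ≡ 0ℤ
  eqAt-violation zero j (m ∷ m′ ∷ μ) {α} (m′≤m ∷ _) _ e = trans (sym (*-assoc (ι (α j ℤ.≟ ℤ.+ m)) (ι (α (suc j) ℤ.≟ ℤ.+ m′)) (eqAt (suc (suc j)) μ α)))
    (trans (cong (_* eqAt (suc (suc j)) μ α) (clash (α j ℤ.≟ ℤ.+ m) (α (suc j) ℤ.≟ ℤ.+ m′))) (*-zeroˡ (eqAt (suc (suc j)) μ α)))
    where
    clash : (d : Dec (α j ≡ ℤ.+ m)) (d′ : Dec (α (suc j) ≡ ℤ.+ m′)) → ι d * ι d′ ≡ 0ℤ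
    clash (no _) d′ = *-zeroˡ (ι d′)
    clash (yes _) (no _) = refl
    clash (yes p) (yes p′) = contradiction (+-injective (begin
      ℤ.+ m′ ≡⟨ p′ ⟨
      α (suc j) ≡⟨ cong (α ∘ suc) (ℕ.+-identityʳ j) ⟨
      α (suc (j ℕ.+ 0)) ≡⟨ e ⟩
      α (j ℕ.+ 0) + 1ℤ ≡⟨ cong (λ x → α x + 1ℤ) (ℕ.+-identityʳ j) ⟩
      α j + 1ℤ ≡⟨ cong (_+ 1ℤ) p ⟩
      ℤ.+ (m ℕ.+ 1) ∎)) (ℕ.<⇒≢ (ℕ.≤-<-trans m′≤m (ℕ.m<m+n m (s≤s z≤n))))
  eqAt-violation _ j (m ∷ []) [-] (s≤s ()) e
  eqAt-violation (suc i) j (m ∷ m′ ∷ μ) {α} (_ ∷ dec) (s≤s lt) e =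
    trans (cong (ι (α j ℤ.≟ ℤ.+ m) *_) (eqAt-violation i (suc j) (m′ ∷ μ) {α} dec lt
      (trans (cong (α ∘ suc) (sym (ℕ.+-suc j i))) (trans e (cong (λ x → α x + 1ℤ) (ℕ.+-suc j i)))))) (*-zeroʳ (ι (α j ℤ.≟ ℤ.+ m)))

  wsum : ℕ → ℕ → Weight → ℤ
  wsum j zero α = 0ℤ
  wsum j (suc k) α = α j + wsum (suc j) k α

  wsum-cong : ∀ j k {α β} → (∀ i → j ℕ.≤ i → i ℕ.< j ℕ.+ k → α i ≡ β i) → wsum j k α ≡ wsum j k β
  wsum-cong j zero e = refl
  wsum-cong j (suc k) e = cong₂ _+_ (e j ℕ.≤-refl (ℕ.m<m+n j (s≤s z≤n)))
    (wsum-cong (suc j) k (λ i p q → e i (ℕ.<⇒≤ p) (<-sucʳ j k q)))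

  wsum-snoc : ∀ j k α → wsum j (suc k) α ≡ wsum j k α + α (j ℕ.+ k)
  wsum-snoc j zero α = trans (+-identityʳ (α j)) (trans (cong α (sym (ℕ.+-identityʳ j))) (sym (+-identityˡ (α (j ℕ.+ 0)))))
  wsum-snoc j (suc k) α = trans (cong (α j +_) (trans (wsum-snoc (suc j) k α) (cong (λ x → wsum (suc j) k α + α x) (sym (ℕ.+-suc j k)))))
    (sym (+-assoc (α j) (wsum (suc j) k α) (α (j ℕ.+ suc k))))

  eqAt-sum : ∀ j ν α → eqAt j ν α ≡ 0ℤ ⊎ ℤ.+ sum ν ≡ wsum j (length ν) α
  eqAt-sum j [] α = inj₂ refl
  eqAt-sum j (v ∷ ν) α = by-cases (α j ℤ.≟ ℤ.+ v) (eqAt-sum (suc j) ν α)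
    where
    by-cases : (d : Dec (α j ≡ ℤ.+ v)) → eqAt (suc j) ν α ≡ 0ℤ ⊎ ℤ.+ sum ν ≡ wsum (suc j) (length ν) α →
               ι d * eqAt (suc j) ν α ≡ 0ℤ ⊎ ℤ.+ (v ℕ.+ sum ν) ≡ α j + wsum (suc j) (length ν) α
    by-cases (no _) _ = inj₁ (*-zeroˡ (eqAt (suc j) ν α))
    by-cases (yes p) (inj₁ e) = inj₁ (trans (cong (1ℤ *_) e) refl)
    by-cases (yes p) (inj₂ e) = inj₂ (cong₂ _+_ (sym p) e)

  move-self : ∀ j n α → j ≢ n → move (j , n) α j ≡ α j + 1ℤ
  move-self j n α j≢n = cong₂ (λ p q → α j + (p - q)) (ι-yes (j ℕ.≟ j) refl) (ι-no (n ℕ.≟ j) (j≢n ∘ sym))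

  move-target : ∀ j n α → j ≢ n → move (j , n) α n ≡ α n - 1ℤ
  move-target j n α j≢n = cong₂ (λ p q → α n + (p - q)) (ι-no (j ℕ.≟ n) j≢n) (ι-yes (n ℕ.≟ n) refl)

  move-other : ∀ j n α x → x ≢ j → x ≢ n → move (j , n) α x ≡ α x
  move-other j n α x x≢j x≢n = trans (cong₂ (λ p q → α x + (p - q)) (ι-no (j ℕ.≟ x) (x≢j ∘ sym)) (ι-no (n ℕ.≟ x) (x≢n ∘ sym)))
    (+-identityʳ (α x))

  wsum-move : ∀ a k j n α → a ℕ.≤ j → j ℕ.< a ℕ.+ k → a ℕ.+ k ℕ.≤ n → wsum a k (move (j , n) α) ≡ wsum a k α + 1ℤ
  wsum-move a zero j n α a≤j j<a _ = contradiction j<a (empty-window a≤j)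
  wsum-move a (suc k) j n α a≤j j<ak ak≤n = by-cases (a ℕ.≟ j)
    where
    sak≤n : suc a ℕ.+ k ℕ.≤ n
    sak≤n = ≤-sucˡ a k ak≤n
    a<n : a ℕ.< n
    a<n = ℕ.≤-trans (s≤s (ℕ.m≤m+n a k)) sak≤n
    arith₁ : ∀ x w → x + 1ℤ + w ≡ x + w + 1ℤ
    arith₁ = solve-∀
    by-cases : Dec (a ≡ j) → move (j , n) α a + wsum (suc a) k (move (j , n) α) ≡ α a + wsum (suc a) k α + 1ℤ
    by-cases (yes refl) = trans (cong₂ _+_ (move-self a n α (ℕ.<⇒≢ a<n)) (wsum-cong (suc a) k (λ i p q →
        move-other a n α i (λ { refl → ℕ.<-irrefl refl p }) (ℕ.<⇒≢ (ℕ.<-≤-trans q sak≤n))))) (arith₁ (α a) (wsum (suc a) k α))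
    by-cases (no a≢j) = trans (cong₂ _+_ (move-other j n α a a≢j (ℕ.<⇒≢ a<n))
      (wsum-move (suc a) k j n α (ℕ.≤∧≢⇒< a≤j a≢j) (<-sucˡ a k j<ak) sak≤n))
      (sym (+-assoc (α a) (wsum (suc a) k α) 1ℤ))

  sgn : ∀ {k} → Bits k → ℤ
  sgn [] = 1ℤ
  sgn (false ∷ ψ) = sgn ψ
  sgn (true ∷ ψ) = - sgn ψ

  -- The exponent after each factor 1 - x_n / x_j selected by `ψ` has contributed its second term.
  raise : ∀ {k} → ℕ → Bits k → ℕ → Weight → Weight
  raise j [] n α = α
  raise j (false ∷ ψ) n α = raise (suc j) ψ n α
  raise j (true ∷ ψ) n α = raise (suc j) ψ n (move (j , n) α)

  T-tops : ∀ j k n g α → T (tops j k n) g α ≡ ∑ (bits k) (λ ψ → sgn ψ * g (raise j ψ n α))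
  T-tops j zero n g α = sym (trans (+-identityʳ (1ℤ * g α)) (*-identityˡ (g α)))
  T-tops j (suc k) n g α = trans (cong₂ _-_ (T-tops (suc j) k n g α) (T-tops (suc j) k n g (move (j , n) α)))
    (trans (cong (∑ (bits k) (λ ψ → sgn ψ * g (raise (suc j) ψ n α)) +_) (trans (sym (∑-neg (bits k) (λ ψ → sgn ψ * g (raise (suc j) ψ n (move (j , n) α)))))
      (∑-cong (bits k) (λ ψ → neg-distribˡ-* (sgn ψ) (g (raise (suc j) ψ n (move (j , n) α)))))))
      (sym (∑-bits k (λ ψ → sgn ψ * g (raise j ψ n α)))))

  raise-below : ∀ {k} j (ψ : Bits k) n α i → i ℕ.< j → i ≢ n → raise j ψ n α i ≡ α i
  raise-below j [] n α i i<j i≢n = refl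
  raise-below j (false ∷ ψ) n α i i<j i≢n = raise-below (suc j) ψ n α i (ℕ.m<n⇒m<1+n i<j) i≢n
  raise-below j (true ∷ ψ) n α i i<j i≢n = trans (raise-below (suc j) ψ n (move (j , n) α) i (ℕ.m<n⇒m<1+n i<j) i≢n)
    (move-other j n α i (ℕ.<⇒≢ i<j) i≢n)

  raise-bounds : ∀ {k} j (ψ : Bits k) n α i → i ≢ n → α i ℤ.≤ raise j ψ n α i × raise j ψ n α i ℤ.≤ α i + 1ℤ
  raise-bounds j [] n α i i≢n = ≤-refl , i≤i+j (α i) 1ℤ
  raise-bounds j (false ∷ ψ) n α i i≢n = raise-bounds (suc j) ψ n α i i≢n
  raise-bounds j (true ∷ ψ) n α i i≢n = by-cases (i ℕ.≟ j)
    where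
    β : Weight
    β = raise (suc j) ψ n (move (j , n) α)
    by-cases : Dec (i ≡ j) → α i ℤ.≤ β i × β i ℤ.≤ α i + 1ℤ
    by-cases (yes refl) = ≤-trans (i≤i+j (α i) 1ℤ) (≤-reflexive (sym e)) , ≤-reflexive e
      where
      e : β i ≡ α i + 1ℤ
      e = trans (raise-below (suc i) ψ n (move (i , n) α) i ℕ.≤-refl i≢n) (move-self i n α i≢n)
    by-cases (no i≢j) = subst (λ z → z ℤ.≤ β i × β i ℤ.≤ z + 1ℤ) (move-other j n α i i≢j i≢n) (raise-bounds (suc j) ψ n (move (j , n) α) i i≢n)

  raise-total : ∀ {k} j (ψ : Bits k) n α → j ℕ.+ k ℕ.≤ n → wsum 0 n (raise j ψ n α) + raise j ψ n α n ≡ wsum 0 n α + α n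
  raise-total j [] n α j≤n = refl
  raise-total {suc k} j (false ∷ ψ) n α jk≤n = raise-total (suc j) ψ n α (≤-sucˡ j k jk≤n)
  raise-total {suc k} j (true ∷ ψ) n α jk≤n = trans (raise-total (suc j) ψ n (move (j , n) α) sjk≤n)
    (trans (cong₂ _+_ (wsum-move 0 n j n α z≤n j<n ℕ.≤-refl) (move-target j n α (ℕ.<⇒≢ j<n))) (arith (wsum 0 n α) (α n)))
    where
    sjk≤n : suc j ℕ.+ k ℕ.≤ n
    sjk≤n = ≤-sucˡ j k jk≤n
    j<n : j ℕ.< n
    j<n = ℕ.≤-trans (s≤s (ℕ.m≤m+n j k)) sjk≤n
    arith : ∀ w a → w + 1ℤ + (a - 1ℤ) ≡ w + a
    arith = solve-∀

  -- No move among the given pairs touches the coordinate `n`, so a factor depending on it alone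
  -- passes through `T`. This isolates the condition on the last letter in the branching rule.
  T-local : ∀ ps n (u : ℤ → ℤ) h α → (∀ {p} → p ∈ ps → proj₁ p ≢ n × proj₂ p ≢ n) →
            T ps (λ β → u (β n) * h β) α ≡ u (α n) * T ps h α
  T-local [] n u h α away = refl
  T-local ((i , j) ∷ ps) n u h α away = trans (cong₂ _-_ (T-local ps n u h α (away ∘ there))
    (trans (T-local ps n u h (move (i , j) α) (away ∘ there)) (cong (λ z → u z * T ps h (move (i , j) α))
      (move-other i j α n (proj₁ (away (here refl)) ∘ sym) (proj₂ (away (here refl)) ∘ sym)))))
    (*-minusˡ (u (α n)) (T ps h α) (T ps h (move (i , j) α)))

  -- The effect of the factor 1 - x_n / x_j on the condition that the coordinate j equals `v`.
  step₁ : ℤ → ℕ → ℤ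
  step₁ z v = ι (z ℤ.≟ ℤ.+ v) - ι (z + 1ℤ ℤ.≟ ℤ.+ v)

  factor : ℕ → List ℕ → Weight → ℤ
  factor j [] α = 1ℤ
  factor j (v ∷ ν) α = step₁ (α j) v * factor (suc j) ν α

  factor-cong : ∀ j μ {α β} → (∀ i → j ℕ.≤ i → i ℕ.< j ℕ.+ length μ → α i ≡ β i) → factor j μ α ≡ factor j μ β
  factor-cong j [] e = refl
  factor-cong j (m ∷ μ) e = cong₂ _*_ (cong (λ z → step₁ z m) (e j ℕ.≤-refl (ℕ.m<m+n j (s≤s z≤n))))
    (factor-cong (suc j) μ (λ i p q → e i (ℕ.<⇒≤ p) (<-sucʳ j (length μ) q)))

  signed-eqAt : ∀ j ν n α → j ℕ.+ length ν ℕ.≤ n → ∑ (bits (length ν)) (λ ψ → sgn ψ * eqAt j ν (raise j ψ n α)) ≡ factor j ν α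
  signed-eqAt j [] n α _ = refl
  signed-eqAt j (v ∷ ν) n α jk≤n = begin
    ∑ (bits (suc (length ν))) (λ ψ → sgn ψ * eqAt j (v ∷ ν) (raise j ψ n α))
      ≡⟨ ∑-bits (length ν) (λ ψ → sgn ψ * eqAt j (v ∷ ν) (raise j ψ n α)) ⟩
    ∑ (bits (length ν)) (λ ψ → sgn ψ * (ι (raise (suc j) ψ n α j ℤ.≟ ℤ.+ v) * eqAt (suc j) ν (raise (suc j) ψ n α)))
      + ∑ (bits (length ν)) (λ ψ → - sgn ψ * (ι (raise (suc j) ψ n α′ j ℤ.≟ ℤ.+ v) * eqAt (suc j) ν (raise (suc j) ψ n α′)))
      ≡⟨ cong₂ _+_ (half α) (trans (∑-cong (bits (length ν)) (λ ψ → sym (neg-distribˡ-* (sgn ψ) _)))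
        (trans (∑-neg (bits (length ν)) _) (cong (-_) (half α′)))) ⟩
    ι (α j ℤ.≟ ℤ.+ v) * factor (suc j) ν α - ι (α′ j ℤ.≟ ℤ.+ v) * factor (suc j) ν α′
      ≡⟨ cong₂ (λ z f → ι (α j ℤ.≟ ℤ.+ v) * factor (suc j) ν α - ι (z ℤ.≟ ℤ.+ v) * f) (move-self j n α (ℕ.<⇒≢ j<n))
        (factor-cong (suc j) ν (λ i p q → move-other j n α i (λ { refl → ℕ.<-irrefl refl p }) (ℕ.<⇒≢ (ℕ.<-≤-trans q sjk≤n)))) ⟩
    ι (α j ℤ.≟ ℤ.+ v) * factor (suc j) ν α - ι (α j + 1ℤ ℤ.≟ ℤ.+ v) * factor (suc j) ν α
      ≡⟨ *-minusʳ (ι (α j ℤ.≟ ℤ.+ v)) (ι (α j + 1ℤ ℤ.≟ ℤ.+ v)) (factor (suc j) ν α) ⟩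
    factor j (v ∷ ν) α ∎
    where
    α′ : Weight
    α′ = move (j , n) α
    sjk≤n : suc j ℕ.+ length ν ℕ.≤ n
    sjk≤n = ≤-sucˡ j (length ν) jk≤n
    j<n : j ℕ.< n
    j<n = ℕ.≤-trans (s≤s (ℕ.m≤m+n j (length ν))) sjk≤n
    half : ∀ α → ∑ (bits (length ν)) (λ ψ → sgn ψ * (ι (raise (suc j) ψ n α j ℤ.≟ ℤ.+ v) * eqAt (suc j) ν (raise (suc j) ψ n α)))
               ≡ ι (α j ℤ.≟ ℤ.+ v) * factor (suc j) ν α
    half α = trans (∑-cong (bits (length ν)) (λ ψ → trans (cong (λ z → sgn ψ * (ι (z ℤ.≟ ℤ.+ v) * eqAt (suc j) ν (raise (suc j) ψ n α)))
      (raise-below (suc j) ψ n α j ℕ.≤-refl (ℕ.<⇒≢ j<n))) (*-swapˡ (sgn ψ) (ι (α j ℤ.≟ ℤ.+ v)) (eqAt (suc j) ν (raise (suc j) ψ n α)))))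
      (trans (∑-*ˡ (bits (length ν)) (ι (α j ℤ.≟ ℤ.+ v)) (λ ψ → sgn ψ * eqAt (suc j) ν (raise (suc j) ψ n α)))
        (cong (ι (α j ℤ.≟ ℤ.+ v) *_) (signed-eqAt (suc j) ν n α sjk≤n)))

  -- A telescoping sum. For lo ≤ hi it is 1 at z = hi, -1 at z = lo - 1 and 0 elsewhere: only the
  -- boundary of the interval survives.
  χ : ℤ → ℕ → ℕ → ℤ
  χ z lo hi = ∑ (range lo hi) (step₁ z)

  prod : ℕ → List ℕ → Weight → ℤ
  -- The box of the empty list is empty, so the sum that `prod` evaluates is 0 here, not an empty
  -- product.
  prod j [] α = 0ℤ
  prod j (m ∷ []) α = 1ℤ
  prod j (m ∷ m′ ∷ μ) α = χ (α j) m′ m * prod (suc j) (m′ ∷ μ) α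

  ∑-box-factor : ∀ j μ α → ∑ (box μ) (λ ν → factor j ν α) ≡ prod j μ α
  ∑-box-factor j [] α = refl
  ∑-box-factor j (m ∷ []) α = refl
  ∑-box-factor j (m ∷ m′ ∷ μ) α = begin
    ∑ (box (m ∷ m′ ∷ μ)) (λ ν → factor j ν α)
      ≡⟨ ∑-concatMap (λ v → map (v ∷_) (box (m′ ∷ μ))) (range m′ m) (λ ν → factor j ν α) ⟩
    ∑ (range m′ m) (λ v → ∑ (map (v ∷_) (box (m′ ∷ μ))) (λ ν → factor j ν α))
      ≡⟨ ∑-cong (range m′ m) (λ v → trans (∑-map (v ∷_) (box (m′ ∷ μ)) (λ ν → factor j ν α))
        (trans (∑-*ˡ (box (m′ ∷ μ)) (step₁ (α j) v) (λ ν → factor (suc j) ν α)) (cong (step₁ (α j) v *_) (∑-box-factor (suc j) (m′ ∷ μ) α)))) ⟩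
    ∑ (range m′ m) (λ v → step₁ (α j) v * prod (suc j) (m′ ∷ μ) α)
      ≡⟨ ∑-*ʳ (range m′ m) (prod (suc j) (m′ ∷ μ) α) (step₁ (α j)) ⟩
    prod j (m ∷ m′ ∷ μ) α ∎

  hit : ℤ → ℕ → ℕ → ℤ
  hit z lo hi = ∑ (range lo hi) (λ v → ι (z ℤ.≟ ℤ.+ v))

  χ-hit : ∀ z lo hi → χ z lo hi ≡ hit z lo hi - hit (z + 1ℤ) lo hi
  χ-hit z lo hi = trans (∑-+ (range lo hi) (λ v → ι (z ℤ.≟ ℤ.+ v)) (λ v → - ι (z + 1ℤ ℤ.≟ ℤ.+ v)))
    (cong (hit z lo hi +_) (∑-neg (range lo hi) (λ v → ι (z + 1ℤ ℤ.≟ ℤ.+ v))))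

  hit-in : ∀ {z lo hi} → ℤ.+ lo ℤ.≤ z → z ℤ.≤ ℤ.+ hi → hit z lo hi ≡ 1ℤ
  hit-in {ℤ.+ v} {lo} {hi} (ℤ.+≤+ p) (ℤ.+≤+ q) = trans (∑-cong (range lo hi) (λ w → sym (*-identityʳ (ι (ℤ.+ v ℤ.≟ ℤ.+ w)))))
    (∑-unique (λ w → ℤ.+ v ℤ.≟ ℤ.+ w) (λ _ → 1ℤ) (range-unique lo hi) (∈-range⁺ p q) refl (λ e → sym (+-injective e)))

  hit-above : ∀ {z lo hi} → ℤ.+ hi ℤ.< z → hit z lo hi ≡ 0ℤ
  hit-above {z} {lo} {hi} hi<z = ∑-0 (range lo hi) (λ {v} i → ι-no (z ℤ.≟ ℤ.+ v)
    (λ { refl → <⇒≱ hi<z (ℤ.+≤+ (proj₂ (∈-range⁻ i))) }))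

  i<j⇒i+1≤j : ∀ {i j} → i ℤ.< j → i + 1ℤ ℤ.≤ j
  i<j⇒i+1≤j {i} {j} p = subst (ℤ._≤ j) (+-comm 1ℤ i) (i<j⇒suc[i]≤j p)

  i<i+1 : ∀ i → i ℤ.< i + 1ℤ
  i<i+1 i = subst (i ℤ.<_) (+-comm 1ℤ i) (suc[i]≤j⇒i<j ≤-refl)

  WindowDecreasing : ℕ → ℕ → Weight → Set
  WindowDecreasing j k α = ∀ i → j ℕ.≤ i → suc i ℕ.< j ℕ.+ k → α (suc i) ℤ.≤ α i

  window-tail : ∀ {j k α} → WindowDecreasing j (suc k) α → WindowDecreasing (suc j) k α
  window-tail {j} {k} dec i p q = dec i (ℕ.<⇒≤ p) (<-sucʳ j k q)

  -- If αⱼ < m, every nonvanishing factor of the product forces αᵢ < μᵢ for all later i.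
  prod-deficit : ∀ j m μ α → WindowDecreasing j (suc (length μ)) α → α j ℤ.< ℤ.+ m →
                 prod j (m ∷ μ) α ≡ 0ℤ ⊎ wsum j (suc (length μ)) α ℤ.< ℤ.+ sum (m ∷ μ)
  prod-deficit j m [] α dec lt = inj₂ (+-mono-<-≤ lt ≤-refl)
  prod-deficit j m (m′ ∷ μ) α dec lt = by-cases (ℤ.+ m′ ℤ.≤? α j)
    where
    by-cases : Dec (ℤ.+ m′ ℤ.≤ α j) → prod j (m ∷ m′ ∷ μ) α ≡ 0ℤ ⊎ wsum j (suc (suc (length μ))) α ℤ.< ℤ.+ sum (m ∷ m′ ∷ μ)
    by-cases (yes m′≤) = inj₁ (trans (cong (_* prod (suc j) (m′ ∷ μ) α) (trans (χ-hit (α j) m′ m)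
      (cong₂ _-_ (hit-in m′≤ (<⇒≤ lt)) (hit-in (≤-trans m′≤ (i≤i+j (α j) 1ℤ)) (i<j⇒i+1≤j lt))))) (*-zeroˡ (prod (suc j) (m′ ∷ μ) α)))
    by-cases (no m′≰) with prod-deficit (suc j) m′ μ α (window-tail dec)
      (≤-<-trans (dec j ℕ.≤-refl (ℕ.≤-trans (ℕ.≤-reflexive (cong suc (sym (ℕ.+-comm j 1)))) (<-sucʳ j (suc (length μ)) (ℕ.+-monoʳ-≤ (suc j) (s≤s z≤n))))) (≰⇒> m′≰))
    ... | inj₁ e = inj₁ (trans (cong (χ (α j) m′ m *_) e) (*-zeroʳ (χ (α j) m′ m)))
    ... | inj₂ l = inj₂ (+-mono-< lt l)

  -- In the interval [m′, m] the factor `χ` survives only at αⱼ = m, as wanted. Below m′ the total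
  -- is too small by `prod-deficit`, which disposes of the value -1 at m′ - 1. The product has no
  -- factor for the last part, whose value is then fixed by the total.
  prod-eqAt : ∀ j m μ α → Decreasing (m ∷ μ) → WindowDecreasing j (suc (length μ)) α →
    ι (ℤ.+ sum (m ∷ μ) ℤ.≟ wsum j (suc (length μ)) α) * prod j (m ∷ μ) α ≡ eqAt j (m ∷ μ) α
  prod-eqAt j m [] α _ _ = cong (_* 1ℤ) (ι-cong (ℤ.+ (m ℕ.+ 0) ℤ.≟ α j + 0ℤ) (α j ℤ.≟ ℤ.+ m)
    (λ e → trans (sym (+-identityʳ (α j))) (trans (sym e) (cong ℤ.+_ (ℕ.+-identityʳ m))))
    (λ e → trans (cong ℤ.+_ (ℕ.+-identityʳ m)) (trans (sym e) (sym (+-identityʳ (α j))))))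
  prod-eqAt j m (m′ ∷ μ) α (m′≤m ∷ dec) window = by-cases (α j ℤ.≟ ℤ.+ m)
    where
    W : ℤ
    W = wsum (suc j) (suc (length μ)) α
    next : α (suc j) ℤ.≤ α j
    next = window j ℕ.≤-refl (ℕ.≤-trans (ℕ.≤-reflexive (cong suc (sym (ℕ.+-comm j 1)))) (<-sucʳ j (suc (length μ)) (ℕ.+-monoʳ-≤ (suc j) (s≤s z≤n))))
    by-cases : (d : Dec (α j ≡ ℤ.+ m)) → ι (ℤ.+ sum (m ∷ m′ ∷ μ) ℤ.≟ α j + W) * (χ (α j) m′ m * prod (suc j) (m′ ∷ μ) α) ≡ ι d * eqAt (suc j) (m′ ∷ μ) α
    by-cases (yes e) = trans (cong₂ _*_
      (ι-cong (ℤ.+ sum (m ∷ m′ ∷ μ) ℤ.≟ α j + W) (ℤ.+ sum (m′ ∷ μ) ℤ.≟ W)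
        (λ s → +-cancelˡ (ℤ.+ m) (trans s (cong (_+ W) e))) (λ s → cong₂ _+_ (sym e) s))
      (trans (cong (_* prod (suc j) (m′ ∷ μ) α) χ≡1) (*-identityˡ (prod (suc j) (m′ ∷ μ) α))))
      (trans (prod-eqAt (suc j) m′ μ α dec (window-tail window)) (sym (*-identityˡ (eqAt (suc j) (m′ ∷ μ) α))))
      where
      +-cancelˡ : ∀ x {y z} → x + y ≡ x + z → y ≡ z
      +-cancelˡ x {y} {z} s = trans (y≡x+y-x x y) (trans (cong (_- x) s) (sym (y≡x+y-x x z)))
      χ≡1 : χ (α j) m′ m ≡ 1ℤ
      χ≡1 = trans (χ-hit (α j) m′ m) (cong₂ _-_
        (hit-in (≤-trans (ℤ.+≤+ m′≤m) (≤-reflexive (sym e))) (≤-reflexive e))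
        (hit-above {lo = m′} (≤-<-trans (≤-reflexive (sym e)) (i<i+1 (α j)))))
    by-cases (no ne) = trans (vanish (ℤ.+ m′ ℤ.≤? α j) (α j ℤ.≤? ℤ.+ m)) (sym (*-zeroˡ (eqAt (suc j) (m′ ∷ μ) α)))
      where
      D : Dec (ℤ.+ sum (m ∷ m′ ∷ μ) ≡ α j + W)
      D = ℤ.+ sum (m ∷ m′ ∷ μ) ℤ.≟ α j + W
      no-χ : χ (α j) m′ m ≡ 0ℤ → ι D * (χ (α j) m′ m * prod (suc j) (m′ ∷ μ) α) ≡ 0ℤ
      no-χ e = trans (cong (λ z → ι D * (z * prod (suc j) (m′ ∷ μ) α)) e) (trans (cong (ι D *_) (*-zeroˡ (prod (suc j) (m′ ∷ μ) α))) (*-zeroʳ (ι D)))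
      deficit : α j ℤ.< ℤ.+ m′ → prod (suc j) (m′ ∷ μ) α ≡ 0ℤ ⊎ W ℤ.< ℤ.+ sum (m′ ∷ μ) → ι D * (χ (α j) m′ m * prod (suc j) (m′ ∷ μ) α) ≡ 0ℤ
      deficit lt (inj₁ e) = trans (cong (λ z → ι D * (χ (α j) m′ m * z)) e) (trans (cong (ι D *_) (*-zeroʳ (χ (α j) m′ m))) (*-zeroʳ (ι D)))
      deficit lt (inj₂ l) = trans (cong (_* (χ (α j) m′ m * prod (suc j) (m′ ∷ μ) α)) (ι-no D (λ e → <-irrefl (sym e)
        (+-mono-< (<-≤-trans lt (ℤ.+≤+ m′≤m)) l)))) (*-zeroˡ (χ (α j) m′ m * prod (suc j) (m′ ∷ μ) α))
      vanish : Dec (ℤ.+ m′ ℤ.≤ α j) → Dec (α j ℤ.≤ ℤ.+ m) → ι D * (χ (α j) m′ m * prod (suc j) (m′ ∷ μ) α) ≡ 0ℤ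
      vanish (yes lo) (yes hi) = no-χ (trans (χ-hit (α j) m′ m) (cong₂ _-_ (hit-in lo hi)
        (hit-in (≤-trans lo (i≤i+j (α j) 1ℤ)) (i<j⇒i+1≤j (≤∧≢⇒< hi ne)))))
      vanish (yes lo) (no hi) = no-χ (trans (χ-hit (α j) m′ m) (cong₂ _-_ (hit-above {lo = m′} (≰⇒> hi))
        (hit-above {lo = m′} (<-trans (≰⇒> hi) (i<i+1 (α j))))))
      vanish (no lo) _ = deficit (≰⇒> lo) (prod-deficit (suc j) m′ μ α (window-tail window) (≤-<-trans next (≰⇒> lo)))

  -- The form of the hypothesis that survives branching: `raise` adds 0 or 1 to each coordinate
  -- before the last, so a decreasing exponent acquires ascents by at most 1.
  AlmostDecreasing : ℕ → Weight → Set
  AlmostDecreasing n β = ∀ i → suc i ℕ.< n → β (suc i) ℤ.≤ β i + 1ℤ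

  ascent : ∀ n {β} → AlmostDecreasing n β →
    (Σ ℕ λ i → suc i ℕ.< n × β (suc i) ≡ β i + 1ℤ) ⊎ (∀ i → suc i ℕ.< n → β (suc i) ℤ.≤ β i)
  ascent zero almost = inj₂ (λ _ ())
  ascent (suc zero) almost = inj₂ (λ { _ (s≤s ()) })
  ascent (suc (suc n)) {β} almost with ascent (suc n) {β} (λ i p → almost i (ℕ.m<n⇒m<1+n p)) | β (suc n) ℤ.≟ β n + 1ℤ
  ... | inj₁ (i , p , e) | _ = inj₁ (i , ℕ.m<n⇒m<1+n p , e)
  ... | inj₂ _ | yes e = inj₁ (n , ℕ.≤-refl , e)
  ... | inj₂ dec | no ne = inj₂ λ i p → by-cases i p (i ℕ.≟ n)
    where
    by-cases : ∀ i → suc i ℕ.< suc (suc n) → Dec (i ≡ n) → β (suc i) ℤ.≤ β i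
    by-cases i p (yes refl) = subst₂ ℤ._≤_ refl (cancel (β i)) (i<j⇒i≤j-1 (≤∧≢⇒< (almost i p) ne))
      where
      cancel : ∀ b → b + 1ℤ - 1ℤ ≡ b
      cancel = solve-∀
      i<j⇒i≤j-1 : ∀ {x y} → x ℤ.< y → x ℤ.≤ y - 1ℤ
      i<j⇒i≤j-1 {x} {y} lt = subst₂ ℤ._≤_ (cancel x) refl (+-monoˡ-≤ (- 1ℤ) (i<j⇒i+1≤j lt))
    by-cases i (s≤s p) (no i≢n) = dec i (ℕ.≤∧≢⇒< p (i≢n ∘ ℕ.suc-injective))

  -- The antisymmetrized Kostka numbers are the identity matrix: a_ρ s_μ = a_{μ+ρ}.
  inversion : ∀ n μ → length μ ≡ n → Decreasing μ → ∀ {β} → AlmostDecreasing n β → T (pairs n) (kost n μ) β ≡ eqAt 0 μ β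
  inversion zero [] len dec almost = refl
  inversion (suc n) μ@(m ∷ μ′) len dec {β} almost with ascent (suc n) {β} almost
  -- At an ascent by exactly 1 the left side vanishes by antisymmetry, and the right side because
  -- the parts of μ decrease.
  ... | inj₁ (i , p , e) = trans (T-antisymmetric (suc n) i p (kost-ext (suc n) μ) (kost-symmetric (suc n) i μ len p) e)
    (sym (eqAt-violation i 0 μ {β} dec (subst (suc i ℕ.<_) (sym len) p) e))
  -- Without ascents, the factors with the last variable are expanded as a signed sum over `ψ`.
  -- Induction inverts the branching rule inside each summand; as `raise` keeps the total `Λ`, the
  -- condition on it comes out in front, and summing over `ψ` and the box leaves `prod`.
  ... | inj₂ down = begin
    T (pairs n ++ tops 0 n n) (kost (suc n) μ) β
      ≡⟨ T-↭ (kost-ext (suc n) μ) (++-comm (pairs n) (tops 0 n n)) β ⟩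
    T (tops 0 n n ++ pairs n) (kost (suc n) μ) β
      ≡⟨ T-++ (tops 0 n n) (pairs n) (kost (suc n) μ) β ⟩
    T (tops 0 n n) (T (pairs n) (kost (suc n) μ)) β
      ≡⟨ T-tops 0 n n (T (pairs n) (kost (suc n) μ)) β ⟩
    ∑ (bits n) (λ ψ → sgn ψ * T (pairs n) (kost (suc n) μ) (raise 0 ψ n β))
      ≡⟨ ∑-cong (bits n) (λ ψ → trans (cong (sgn ψ *_) (branch ψ)) (*-swapˡ (sgn ψ) (ι (ℤ.+ sum μ ℤ.≟ Λ)) (∑ (box μ) (λ ν → eqAt 0 ν (raise 0 ψ n β))))) ⟩
    ∑ (bits n) (λ ψ → ι (ℤ.+ sum μ ℤ.≟ Λ) * (sgn ψ * ∑ (box μ) (λ ν → eqAt 0 ν (raise 0 ψ n β))))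
      ≡⟨ ∑-*ˡ (bits n) (ι (ℤ.+ sum μ ℤ.≟ Λ)) (λ ψ → sgn ψ * ∑ (box μ) (λ ν → eqAt 0 ν (raise 0 ψ n β))) ⟩
    ι (ℤ.+ sum μ ℤ.≟ Λ) * ∑ (bits n) (λ ψ → sgn ψ * ∑ (box μ) (λ ν → eqAt 0 ν (raise 0 ψ n β)))
      ≡⟨ cong (ι (ℤ.+ sum μ ℤ.≟ Λ) *_) (trans (∑-cong (bits n) (λ ψ → sym (∑-*ˡ (box μ) (sgn ψ) (λ ν → eqAt 0 ν (raise 0 ψ n β)))))
        (trans (∑-swap (bits n) (box μ) (λ ψ ν → sgn ψ * eqAt 0 ν (raise 0 ψ n β))) (∑-cong∈ (box μ) factorise))) ⟩
    ι (ℤ.+ sum μ ℤ.≟ Λ) * ∑ (box μ) (λ ν → factor 0 ν β)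
      ≡⟨ cong₂ _*_ (cong (λ z → ι (ℤ.+ sum μ ℤ.≟ z)) (trans (sym (wsum-snoc 0 n β)) (cong (λ k → wsum 0 k β) (sym len)))) (∑-box-factor 0 μ β) ⟩
    ι (ℤ.+ sum μ ℤ.≟ wsum 0 (suc (length μ′)) β) * prod 0 μ β
      ≡⟨ prod-eqAt 0 m μ′ β dec (λ i _ p → down i (subst (suc i ℕ.<_) len p)) ⟩
    eqAt 0 μ β ∎
    where
    Λ : ℤ
    Λ = wsum 0 n β + β n
    ν-length : ∀ {ν} → ν ∈ box μ → length ν ≡ n
    ν-length i = ℕ.suc-injective (trans (sym (interlaces-length (∈-box⁻ μ i))) len)
    factorise : ∀ {ν} → ν ∈ box μ → ∑ (bits n) (λ ψ → sgn ψ * eqAt 0 ν (raise 0 ψ n β)) ≡ factor 0 ν β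
    factorise {ν} i = subst (λ k → k ℕ.≤ n → ∑ (bits k) (λ ψ → sgn ψ * eqAt 0 ν (raise 0 ψ n β)) ≡ factor 0 ν β) (ν-length i)
      (signed-eqAt 0 ν n β) ℕ.≤-refl
    branch : ∀ (ψ : Bits n) → T (pairs n) (kost (suc n) μ) (raise 0 ψ n β) ≡ ι (ℤ.+ sum μ ℤ.≟ Λ) * ∑ (box μ) (λ ν → eqAt 0 ν (raise 0 ψ n β))
    branch ψ = begin
      T (pairs n) (kost (suc n) μ) γ
        ≡⟨ T-∑ (pairs n) (box μ) (λ ν α → ι (ℤ.+ sum μ ℤ.≟ ℤ.+ sum ν + α n) * kost n ν α) γ ⟩
      ∑ (box μ) (λ ν → T (pairs n) (λ α → ι (ℤ.+ sum μ ℤ.≟ ℤ.+ sum ν + α n) * kost n ν α) γ)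
        ≡⟨ ∑-cong∈ (box μ) (λ {ν} i → trans (T-local (pairs n) n (λ z → ι (ℤ.+ sum μ ℤ.≟ ℤ.+ sum ν + z)) (kost n ν) γ away)
          (trans (cong (ι (ℤ.+ sum μ ℤ.≟ ℤ.+ sum ν + γ n) *_)
            (inversion n ν (ν-length i) (interlaces-decreasing (∈-box⁻ μ i)) almost-γ)) (by-sum ν (ν-length i) (eqAt-sum 0 ν γ)))) ⟩
      ∑ (box μ) (λ ν → ι (ℤ.+ sum μ ℤ.≟ Λ) * eqAt 0 ν γ)
        ≡⟨ ∑-*ˡ (box μ) (ι (ℤ.+ sum μ ℤ.≟ Λ)) (λ ν → eqAt 0 ν γ) ⟩
      ι (ℤ.+ sum μ ℤ.≟ Λ) * ∑ (box μ) (λ ν → eqAt 0 ν γ) ∎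
      where
      γ : Weight
      γ = raise 0 ψ n β
      away : ∀ {p} → p ∈ pairs n → proj₁ p ≢ n × proj₂ p ≢ n
      away i = let a , b = ∈-pairs⁻ n i in ℕ.<⇒≢ (ℕ.<-trans a b) , ℕ.<⇒≢ b
      almost-γ : AlmostDecreasing n γ
      almost-γ i p = ≤-trans (proj₂ (raise-bounds 0 ψ n β (suc i) (ℕ.<⇒≢ p))) (≤-trans (+-monoˡ-≤ 1ℤ (down i (ℕ.m<n⇒m<1+n p)))
        (+-monoˡ-≤ 1ℤ (proj₁ (raise-bounds 0 ψ n β i (ℕ.<⇒≢ (ℕ.<-trans ℕ.≤-refl p))))))
      by-sum : ∀ ν → length ν ≡ n → eqAt 0 ν γ ≡ 0ℤ ⊎ ℤ.+ sum ν ≡ wsum 0 (length ν) γ →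
               ι (ℤ.+ sum μ ℤ.≟ ℤ.+ sum ν + γ n) * eqAt 0 ν γ ≡ ι (ℤ.+ sum μ ℤ.≟ Λ) * eqAt 0 ν γ
      by-sum ν len (inj₁ e) = trans (cong (ι (ℤ.+ sum μ ℤ.≟ ℤ.+ sum ν + γ n) *_) e) (trans (*-zeroʳ (ι (ℤ.+ sum μ ℤ.≟ ℤ.+ sum ν + γ n)))
        (sym (trans (cong (ι (ℤ.+ sum μ ℤ.≟ Λ) *_) e) (*-zeroʳ (ι (ℤ.+ sum μ ℤ.≟ Λ))))))
      by-sum ν len (inj₂ e) = cong (λ z → ι (ℤ.+ sum μ ℤ.≟ z) * eqAt 0 ν γ)
        (trans (cong (_+ γ n) (trans e (cong (λ k → wsum 0 k γ) len))) (raise-total 0 ψ n β ℕ.≤-refl))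

  -- From semistandard tableaux to Gelfand-Tsetlin patterns

  weq : ℕ → Weight → Weight → ℤ
  weq zero u α = 1ℤ
  weq (suc n) u α = ι (u n ℤ.≟ α n) * weq n u α

  weq-cong : ∀ n {u v} α → (∀ i → i < n → u i ≡ v i) → weq n u α ≡ weq n v α
  weq-cong zero α e = refl
  weq-cong (suc n) α e = cong₂ _*_ (cong (λ z → ι (z ℤ.≟ α n)) (e n ℕ.≤-refl)) (weq-cong n α (λ i p → e i (ℕ.m<n⇒m<1+n p)))

  upTo-suc : ∀ n → upTo (suc n) ≡ upTo n ∷ʳ n
  upTo-suc zero = refl
  upTo-suc (suc n) = cong (0 ∷_) (trans (sym (List.map-upTo suc (suc n)))
    (trans (cong (map suc) (upTo-suc n)) (trans (List.map-++ suc (upTo n) (n ∷ [])) (cong (_∷ʳ suc n) (List.map-upTo suc n)))))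

  ∑-upTo-zero : ∀ n (f : ℕ → ℤ) → ∑ (upTo (suc n)) f ≡ f 0 + ∑ (upTo n) (f ∘ suc)
  ∑-upTo-zero n f = cong (f 0 +_) (trans (cong (λ xs → ∑ xs f) (sym (List.map-upTo suc n))) (∑-map suc (upTo n) f))

  ∑-upTo-last : ∀ n (f : ℕ → ℤ) → ∑ (upTo (suc n)) f ≡ ∑ (upTo n) f + f n
  ∑-upTo-last n f = trans (cong (λ xs → ∑ xs f) (upTo-suc n)) (trans (∑-++ (upTo n) (n ∷ []) f) (cong (∑ (upTo n) f +_) (+-identityʳ (f n))))

  below-length : ∀ n r {R} → R ∈ listsBelow n r → length R ≡ r
  below-length n zero (here refl) = refl
  below-length n (suc r) i with ∈-concatMap∷⁻ (upTo n) i
  ... | _ , _ , _ , j , refl = cong suc (below-length n r j)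

  below-bound : ∀ n r {R} → R ∈ listsBelow n r → All (_< n) R
  below-bound n zero (here refl) = []
  below-bound n (suc r) i with ∈-concatMap∷⁻ (upTo n) i
  ... | _ , _ , j , k , refl = ∈-upTo⁻ j ∷ below-bound n r k

  ∑-listsBelow : ∀ n r (f : List ℕ → ℤ) → ∑ (listsBelow n (suc r)) f ≡ ∑ (upTo n) (λ i → ∑ (listsBelow n r) (λ R → f (i ∷ R)))
  ∑-listsBelow n r f = trans (∑-concatMap (λ i → map (i ∷_) (listsBelow n r)) (upTo n) f)
    (∑-cong (upTo n) (λ i → ∑-map (i ∷_) (listsBelow n r) f))

  hd : ℕ → List ℕ → ℤ
  hd i [] = 1ℤ
  hd i (x ∷ _) = ι (i ≤? x)

  incr : List ℕ → ℤ
  incr R = ι (linked? _≤?_ R)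

  increasing-∷ : ∀ i R → incr (i ∷ R) ≡ hd i R * incr R
  increasing-∷ i [] = refl
  increasing-∷ i (x ∷ R) = trans (ι-cong (linked? _≤?_ (i ∷ x ∷ R)) ((i ≤? x) ×-dec linked? _≤?_ (x ∷ R))
    (λ { (p ∷ q) → p , q }) (λ { (p , q) → p ∷ q })) (ι-× (i ≤? x) (linked? _≤?_ (x ∷ R)))

  rows : ℕ → ℕ → (List ℕ → ℤ) → ℤ
  rows n r g = ∑ (listsBelow n r) (λ R → incr R * g R)

  rows-cong : ∀ n r {g h : List ℕ → ℤ} → (∀ R → length R ≡ r → All (_< n) R → g R ≡ h R) → rows n r g ≡ rows n r h
  rows-cong n r e = ∑-cong∈ (listsBelow n r) (λ {R} i → cong (incr R *_) (e R (below-length n r i) (below-bound n r i)))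

  rows-suc : ∀ n r g → rows n (suc r) g ≡ ∑ (upTo n) (λ i → rows n r (λ R → hd i R * g (i ∷ R)))
  rows-suc n r g = trans (∑-listsBelow n r (λ R → incr R * g R)) (∑-cong (upTo n) (λ i → ∑-cong (listsBelow n r) (λ R →
    trans (cong (_* g (i ∷ R)) (increasing-∷ i R)) (arith (hd i R) (incr R) (g (i ∷ R))))))
    where
    arith : ∀ h k g → h * k * g ≡ k * (h * g)
    arith = solve-∀

  fill : ℕ → ℕ → List ℕ → List ℕ
  fill n r R = R ++ replicate (r ∸ length R) n

  -- A weakly incr row with letters ≤ n is a row with letters < n followed by copies of n.
  rows-split : ∀ n r g → rows (suc n) r g ≡ ∑ (upTo (suc r)) (λ v → rows n v (λ R → g (fill n r R)))
  rows-split n zero g = sym (+-identityʳ (rows n zero (λ R → g (fill n zero R))))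
  rows-split n (suc r) g = begin
    rows (suc n) (suc r) g
      ≡⟨ rows-suc (suc n) r g ⟩
    ∑ (upTo (suc n)) (λ i → rows (suc n) r (λ R → hd i R * g (i ∷ R)))
      ≡⟨ ∑-upTo-last n (λ i → rows (suc n) r (λ R → hd i R * g (i ∷ R))) ⟩
    ∑ (upTo n) (λ i → rows (suc n) r (λ R → hd i R * g (i ∷ R))) + rows (suc n) r (λ R → hd n R * g (n ∷ R))
      ≡⟨ cong₂ _+_ (∑-cong∈ (upTo n) (λ {i} j → small i (∈-upTo⁻ j))) all-n ⟩
    ∑ (upTo n) (λ i → ∑ (upTo (suc r)) (λ v → rows n v (λ R → hd i R * g (fill n (suc r) (i ∷ R))))) + g (fill n (suc r) [])
      ≡⟨ cong (_+ g (fill n (suc r) [])) (∑-swap (upTo n) (upTo (suc r)) (λ i v → rows n v (λ R → hd i R * g (fill n (suc r) (i ∷ R))))) ⟩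
    ∑ (upTo (suc r)) (λ v → ∑ (upTo n) (λ i → rows n v (λ R → hd i R * g (fill n (suc r) (i ∷ R))))) + g (fill n (suc r) [])
      ≡⟨ cong₂ _+_ (∑-cong (upTo (suc r)) (λ v → sym (rows-suc n v (λ R → g (fill n (suc r) R))))) (sym (trans (+-identityʳ (1ℤ * g (fill n (suc r) []))) (*-identityˡ (g (fill n (suc r) []))))) ⟩
    ∑ (upTo (suc r)) (λ v → rows n (suc v) (λ R → g (fill n (suc r) R))) + rows n 0 (λ R → g (fill n (suc r) R))
      ≡⟨ +-comm (∑ (upTo (suc r)) (λ v → rows n (suc v) (λ R → g (fill n (suc r) R)))) (rows n 0 (λ R → g (fill n (suc r) R))) ⟩
    rows n 0 (λ R → g (fill n (suc r) R)) + ∑ (upTo (suc r)) (λ v → rows n (suc v) (λ R → g (fill n (suc r) R)))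
      ≡⟨ ∑-upTo-zero (suc r) (λ v → rows n v (λ R → g (fill n (suc r) R))) ⟨
    ∑ (upTo (suc (suc r))) (λ v → rows n v (λ R → g (fill n (suc r) R))) ∎
    where
    small : ∀ i → i < n → rows (suc n) r (λ R → hd i R * g (i ∷ R)) ≡ ∑ (upTo (suc r)) (λ v → rows n v (λ R → hd i R * g (fill n (suc r) (i ∷ R))))
    small i i<n = trans (rows-split n r (λ R → hd i R * g (i ∷ R)))
      (∑-cong (upTo (suc r)) (λ v → rows-cong n v (λ R _ _ → cong (_* g (fill n (suc r) (i ∷ R))) (head-fill R (r ∸ length R)))))
      where
      head-fill : ∀ R c → hd i (R ++ replicate c n) ≡ hd i R
      head-fill [] zero = refl
      head-fill [] (suc c) = ι-yes (i ≤? n) (ℕ.<⇒≤ i<n)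
      head-fill (x ∷ R) c = refl
    all-n : rows (suc n) r (λ R → hd n R * g (n ∷ R)) ≡ g (fill n (suc r) [])
    all-n = begin
      rows (suc n) r (λ R → hd n R * g (n ∷ R))
        ≡⟨ rows-split n r (λ R → hd n R * g (n ∷ R)) ⟩
      ∑ (upTo (suc r)) (λ v → rows n v (λ R → hd n (fill n r R) * g (n ∷ fill n r R)))
        ≡⟨ ∑-upTo-zero r (λ v → rows n v (λ R → hd n (fill n r R) * g (n ∷ fill n r R))) ⟩
      rows n 0 (λ R → hd n (fill n r R) * g (n ∷ fill n r R)) + ∑ (upTo r) (λ v → rows n (suc v) (λ R → hd n (fill n r R) * g (n ∷ fill n r R)))
        ≡⟨ cong₂ _+_ (trans (+-identityʳ (1ℤ * (hd n (replicate r n) * g (n ∷ replicate r n)))) (trans (*-identityˡ (hd n (replicate r n) * g (n ∷ replicate r n))) (cong (_* g (n ∷ replicate r n)) (head-n r))))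
          (∑-0 (upTo r) (λ {v} _ → trans (rows-cong n (suc v) (λ R len bound → trans (cong (_* g (n ∷ fill n r R)) (blocked R (r ∸ length R) len bound)) (*-zeroˡ (g (n ∷ fill n r R)))))
            (∑-0 (listsBelow n (suc v)) (λ {R} _ → *-zeroʳ (incr R))))) ⟩
      1ℤ * g (n ∷ replicate r n) + 0ℤ
        ≡⟨ trans (+-identityʳ (1ℤ * g (n ∷ replicate r n))) (*-identityˡ (g (n ∷ replicate r n))) ⟩
      g (fill n (suc r) []) ∎
      where
      head-n : ∀ c → hd n (replicate c n) ≡ 1ℤ
      head-n zero = refl
      head-n (suc c) = ι-yes (n ≤? n) ℕ.≤-refl
      blocked : ∀ R c {v} → length R ≡ suc v → All (_< n) R → hd n (R ++ replicate c n) ≡ 0ℤ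
      blocked (x ∷ R) c len (x<n ∷ _) = ι-no (n ≤? x) (ℕ.<⇒≱ x<n)

  colStrict? : ∀ R R′ → Dec (ColStrict R R′)
  colStrict? R R′ = all? (λ p → uncurry _<?_ p) (zip R R′)

  col : List ℕ → List (List ℕ) → ℤ
  col R [] = 1ℤ
  col R (R′ ∷ _) = ι (colStrict? R R′)

  ssyt : List (List ℕ) → ℤ
  ssyt T = ι (isSSYT? T)

  ssyt-∷ : ∀ R T → ssyt (R ∷ T) ≡ incr R * (col R T * ssyt T)
  ssyt-∷ R [] = trans (ι-cong (isSSYT? (R ∷ [])) (linked? _≤?_ R) (λ { (p ∷ _ , _) → p }) (λ p → p ∷ [] , [-])) (sym (*-identityʳ (incr R)))
  ssyt-∷ R (R′ ∷ T) = trans (ι-cong (isSSYT? (R ∷ R′ ∷ T)) (linked? _≤?_ R ×-dec (colStrict? R R′ ×-dec isSSYT? (R′ ∷ T)))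
    (λ { (p ∷ q , s ∷ t) → p , s , q , t }) (λ { (p , s , q , t) → p ∷ q , s ∷ t }))
    (trans (ι-× (linked? _≤?_ R) (colStrict? R R′ ×-dec isSSYT? (R′ ∷ T))) (cong (incr R *_) (ι-× (colStrict? R R′) (isSSYT? (R′ ∷ T)))))

  S : ℕ → List ℕ → (List (List ℕ) → ℤ) → ℤ
  S n μ G = ∑ (fillings n μ) (λ T → ssyt T * G T)

  Shape : ℕ → List ℕ → List (List ℕ) → Set
  Shape n μ T = map length T ≡ μ × All (All (_< n)) T

  fillings-shape : ∀ n μ {T} → T ∈ fillings n μ → Shape n μ T
  fillings-shape n [] (here refl) = refl , []
  fillings-shape n (r ∷ μ) i with ∈-concatMap∷⁻ (listsBelow n r) i
  ... | _ , _ , j , k , refl = let a , b = fillings-shape n μ k in cong₂ _∷_ (below-length n r j) a , below-bound n r j ∷ b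

  S-cong : ∀ n μ {G H : List (List ℕ) → ℤ} → (∀ T → Shape n μ T → G T ≡ H T) → S n μ G ≡ S n μ H
  S-cong n μ e = ∑-cong∈ (fillings n μ) (λ {T} i → cong (ssyt T *_) (e T (fillings-shape n μ i)))

  S-∷ : ∀ n r μ G → S n (r ∷ μ) G ≡ rows n r (λ R → S n μ (λ T → col R T * G (R ∷ T)))
  S-∷ n r μ G = begin
    S n (r ∷ μ) G
      ≡⟨ ∑-concatMap (λ R → map (R ∷_) (fillings n μ)) (listsBelow n r) (λ T → ssyt T * G T) ⟩
    ∑ (listsBelow n r) (λ R → ∑ (map (R ∷_) (fillings n μ)) (λ T → ssyt T * G T))
      ≡⟨ ∑-cong (listsBelow n r) (λ R → trans (∑-map (R ∷_) (fillings n μ) (λ T → ssyt T * G T))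
        (trans (∑-cong (fillings n μ) (λ T → trans (cong (_* G (R ∷ T)) (ssyt-∷ R T)) (arith (incr R) (col R T) (ssyt T) (G (R ∷ T)))))
          (∑-*ˡ (fillings n μ) (incr R) (λ T → ssyt T * (col R T * G (R ∷ T)))))) ⟩
    rows n r (λ R → S n μ (λ T → col R T * G (R ∷ T))) ∎
    where
    arith : ∀ i c s g → i * (c * s) * g ≡ i * (s * (c * g))
    arith = solve-∀

  S-* : ∀ n μ z G → S n μ (λ T → z * G T) ≡ z * S n μ G
  S-* n μ z G = trans (∑-cong (fillings n μ) (λ T → *-swapˡ (ssyt T) z (G T))) (∑-*ˡ (fillings n μ) z (λ T → ssyt T * G T))

  extend : ℕ → List ℕ → List (List ℕ) → List (List ℕ)
  extend n (r ∷ μ) (R ∷ T) = fill n r R ∷ extend n μ T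
  extend n _ _ = []

  -- The possible row lengths once the largest letter is removed, bounded row by row only. The
  -- interlacing condition is kept apart as the weight `inter`, because it arises from comparing
  -- neighbouring rows.
  cuts : List ℕ → List (List ℕ)
  cuts [] = [] ∷ []
  cuts (m ∷ μ) = concatMap (λ v → map (v ∷_) (cuts μ)) (upTo (suc m))

  inter : List ℕ → List ℕ → ℤ
  inter (m ∷ m′ ∷ μ) (v ∷ ν) = ι (m′ ≤? v) * inter (m′ ∷ μ) ν
  inter _ _ = 1ℤ

  ∑-cuts : ∀ m μ (f : List ℕ → ℤ) → ∑ (cuts (m ∷ μ)) f ≡ ∑ (upTo (suc m)) (λ v → ∑ (cuts μ) (λ ν → f (v ∷ ν)))
  ∑-cuts m μ f = trans (∑-concatMap (λ v → map (v ∷_) (cuts μ)) (upTo (suc m)) f) (∑-cong (upTo (suc m)) (λ v → ∑-map (v ∷_) (cuts μ) f))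

  above-empty : ∀ R → ColStrict R []
  above-empty [] = []
  above-empty (_ ∷ _) = []

  -- No letter exceeds n, so no cell can lie below an n. The whole padded lower row, its own copies
  -- of n included, must therefore fit under the unpadded part `R`.
  colStrict-fill : ∀ n {R R′} c c′ → All (_< n) R → All (_< n) R′ → length R′ ℕ.+ c′ ≤ length R ℕ.+ c →
    ι (colStrict? (R ++ replicate c n) (R′ ++ replicate c′ n)) ≡ ι (length R′ ℕ.+ c′ ≤? length R) * ι (colStrict? R R′)
  colStrict-fill n {R} {R′} c c′ bR bR′ le = trans (ι-cong (colStrict? (R ++ replicate c n) (R′ ++ replicate c′ n))
    ((length R′ ℕ.+ c′ ≤? length R) ×-dec colStrict? R R′) (λ p → to R R′ c c′ bR bR′ le p) (λ (p , q) → from R R′ c c′ bR bR′ p q))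
    (ι-× (length R′ ℕ.+ c′ ≤? length R) (colStrict? R R′))
    where
    to : ∀ R R′ c c′ → All (_< n) R → All (_< n) R′ → length R′ ℕ.+ c′ ≤ length R ℕ.+ c →
         ColStrict (R ++ replicate c n) (R′ ++ replicate c′ n) → length R′ ℕ.+ c′ ≤ length R × ColStrict R R′
    to [] [] zero zero bR bR′ le p = z≤n , []
    to [] [] (suc c) zero bR bR′ le p = z≤n , []
    to [] [] (suc c) (suc c′) bR bR′ le (p ∷ _) = contradiction p (ℕ.<-irrefl refl)
    to [] (y ∷ R′) (suc c) c′ bR (y<n ∷ _) le (p ∷ _) = contradiction p (ℕ.<-asym y<n)
    to (x ∷ R) [] c zero bR bR′ le p = z≤n , []
    to (x ∷ R) [] c (suc c′) (_ ∷ bR) bR′ (s≤s le) (_ ∷ p) = s≤s (proj₁ (to R [] c c′ bR bR′ le p)) , []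
    to (x ∷ R) (y ∷ R′) c c′ (_ ∷ bR) (_ ∷ bR′) (s≤s le) (q ∷ p) = let a , b = to R R′ c c′ bR bR′ le p in s≤s a , q ∷ b
    from : ∀ R R′ c c′ → All (_< n) R → All (_< n) R′ → length R′ ℕ.+ c′ ≤ length R → ColStrict R R′ →
           ColStrict (R ++ replicate c n) (R′ ++ replicate c′ n)
    from [] [] zero zero bR bR′ le p = []
    from [] [] (suc c) zero bR bR′ le p = []
    from (x ∷ R) [] c zero bR bR′ le p = []
    from (x ∷ R) [] c (suc c′) (b ∷ bR) bR′ (s≤s le) p = b ∷ from R [] c c′ bR bR′ le (above-empty R)
    from (x ∷ R) (y ∷ R′) c c′ (_ ∷ bR) (_ ∷ bR′) (s≤s le) (q ∷ p) = q ∷ from R R′ c c′ bR bR′ le p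

  -- Row by row: `rows-split` takes the largest letters out of the top row, and `colStrict-fill`
  -- converts strictness towards the next row into a factor of `inter` and strictness of the
  -- shortened rows.
  S-split : ∀ n μ G → Decreasing μ → S (suc n) μ G ≡ ∑ (cuts μ) (λ ν → inter μ ν * S n ν (λ T → G (extend n μ T)))
  S-split n [] G _ = trans (arith (G [])) refl
    where
    arith : ∀ g → 1ℤ * g + 0ℤ ≡ 1ℤ * (1ℤ * g + 0ℤ) + 0ℤ
    arith = solve-∀
  S-split n (m ∷ []) G _ = begin
    S (suc n) (m ∷ []) G
      ≡⟨ trans (S-∷ (suc n) m [] G) (rows-split n m _) ⟩
    ∑ (upTo (suc m)) (λ v → rows n v (λ R → S (suc n) [] (λ T → col (fill n m R) T * G (fill n m R ∷ T))))
      ≡⟨ ∑-cong (upTo (suc m)) (λ v → sym (trans (trans (+-identityʳ (1ℤ * S n (v ∷ []) (λ T → G (extend n (m ∷ []) T)))) (*-identityˡ (S n (v ∷ []) (λ T → G (extend n (m ∷ []) T))))) (S-∷ n v [] (λ T → G (extend n (m ∷ []) T))))) ⟩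
    ∑ (upTo (suc m)) (λ v → ∑ (cuts []) (λ ν → inter (m ∷ []) (v ∷ ν) * S n (v ∷ ν) (λ T → G (extend n (m ∷ []) T))))
      ≡⟨ ∑-cuts m [] (λ ν → inter (m ∷ []) ν * S n ν (λ T → G (extend n (m ∷ []) T))) ⟨
    ∑ (cuts (m ∷ [])) (λ ν → inter (m ∷ []) ν * S n ν (λ T → G (extend n (m ∷ []) T))) ∎
  S-split n (m ∷ m′ ∷ μ) G (m′≤m ∷ dec) = begin
    S (suc n) (m ∷ m′ ∷ μ) G
      ≡⟨ trans (S-∷ (suc n) m (m′ ∷ μ) G) (rows-split n m _) ⟩
    ∑ (upTo (suc m)) (λ v → rows n v (λ R → S (suc n) (m′ ∷ μ) (λ T → col (fill n m R) T * G (fill n m R ∷ T))))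
      ≡⟨ ∑-cong∈ (upTo (suc m)) (λ {v} i → trans (rows-cong n v (λ R len bR → inner-rows v (ℕ.s≤s⁻¹ (∈-upTo⁻ i)) R len bR)) (regroup v)) ⟩
    ∑ (upTo (suc m)) (λ v → ∑ (cuts (m′ ∷ μ)) (λ ν → inter (m ∷ m′ ∷ μ) (v ∷ ν) * S n (v ∷ ν) (λ T → G (extend n (m ∷ m′ ∷ μ) T))))
      ≡⟨ ∑-cuts m (m′ ∷ μ) (λ ν → inter (m ∷ m′ ∷ μ) ν * S n ν (λ T → G (extend n (m ∷ m′ ∷ μ) T))) ⟨
    ∑ (cuts (m ∷ m′ ∷ μ)) (λ ν → inter (m ∷ m′ ∷ μ) ν * S n ν (λ T → G (extend n (m ∷ m′ ∷ μ) T))) ∎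
    where
    H : List ℕ → List ℕ → ℤ
    H R ν = S n ν (λ T → col R T * G (extend n (m ∷ m′ ∷ μ) (R ∷ T)))
    inner-rows : ∀ v → v ≤ m → ∀ R → length R ≡ v → All (_< n) R →
      S (suc n) (m′ ∷ μ) (λ T → col (fill n m R) T * G (fill n m R ∷ T)) ≡ ∑ (cuts (m′ ∷ μ)) (λ ν → inter (m ∷ m′ ∷ μ) (v ∷ ν) * H R ν)
    inner-rows v v≤m R refl bR = trans (S-split n (m′ ∷ μ) (λ T → col (fill n m R) T * G (fill n m R ∷ T)) dec)
      (∑-cong∈ (cuts (m′ ∷ μ)) (λ {ν} i → by-cut ν (∈-concatMap∷⁻ (upTo (suc m′)) i)))
      where
      arith′ : ∀ a b c → a * b * c ≡ a * (b * c)
      arith′ = solve-∀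
      by-cut : ∀ ν → Σ ℕ (λ w → Σ (List ℕ) λ ν′ → w ∈ upTo (suc m′) × ν′ ∈ cuts μ × ν ≡ w ∷ ν′) →
        inter (m′ ∷ μ) ν * S n ν (λ T → col (fill n m R) (extend n (m′ ∷ μ) T) * G (fill n m R ∷ extend n (m′ ∷ μ) T))
        ≡ inter (m ∷ m′ ∷ μ) (length R ∷ ν) * H R ν
      by-cut _ (w , ν′ , j , _ , refl) = trans (cong (inter (m′ ∷ μ) (w ∷ ν′) *_) (trans (S-cong n (w ∷ ν′) rewrite-col)
        (S-* n (w ∷ ν′) (ι (m′ ≤? length R)) (λ T → col R T * G (fill n m R ∷ extend n (m′ ∷ μ) T)))))
        (*-swap-assoc (inter (m′ ∷ μ) (w ∷ ν′)) (ι (m′ ≤? length R)) (H R (w ∷ ν′)))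
        where
        rewrite-col : ∀ T → Shape n (w ∷ ν′) T → col (fill n m R) (extend n (m′ ∷ μ) T) * G (fill n m R ∷ extend n (m′ ∷ μ) T)
                    ≡ ι (m′ ≤? length R) * (col R T * G (fill n m R ∷ extend n (m′ ∷ μ) T))
        rewrite-col (R′ ∷ T) (shape , bR′ ∷ _) = trans (cong (_* G (fill n m R ∷ extend n (m′ ∷ μ) (R′ ∷ T)))
          (trans (colStrict-fill n (m ∸ length R) (m′ ∸ length R′) bR bR′
            (ℕ.≤-trans (ℕ.≤-reflexive full′) (ℕ.≤-trans m′≤m (ℕ.≤-reflexive (sym (ℕ.m+[n∸m]≡n v≤m))))))
            (cong (_* ι (colStrict? R R′)) (cong (λ k → ι (k ≤? length R)) full′))))
          (arith′ (ι (m′ ≤? length R)) (ι (colStrict? R R′)) (G (fill n m R ∷ extend n (m′ ∷ μ) (R′ ∷ T))))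
          where
          full′ : length R′ ℕ.+ (m′ ∸ length R′) ≡ m′
          full′ = ℕ.m+[n∸m]≡n (subst (_≤ m′) (sym (List.∷-injectiveˡ shape)) (ℕ.s≤s⁻¹ (∈-upTo⁻ j)))
    regroup : ∀ v → rows n v (λ R → ∑ (cuts (m′ ∷ μ)) (λ ν → inter (m ∷ m′ ∷ μ) (v ∷ ν) * H R ν))
            ≡ ∑ (cuts (m′ ∷ μ)) (λ ν → inter (m ∷ m′ ∷ μ) (v ∷ ν) * S n (v ∷ ν) (λ T → G (extend n (m ∷ m′ ∷ μ) T)))
    regroup v = begin
      ∑ (listsBelow n v) (λ R → incr R * ∑ (cuts (m′ ∷ μ)) (λ ν → inter (m ∷ m′ ∷ μ) (v ∷ ν) * H R ν))
        ≡⟨ ∑-cong (listsBelow n v) (λ R → sym (∑-*ˡ (cuts (m′ ∷ μ)) (incr R) (λ ν → inter (m ∷ m′ ∷ μ) (v ∷ ν) * H R ν))) ⟩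
      ∑ (listsBelow n v) (λ R → ∑ (cuts (m′ ∷ μ)) (λ ν → incr R * (inter (m ∷ m′ ∷ μ) (v ∷ ν) * H R ν)))
        ≡⟨ ∑-swap (listsBelow n v) (cuts (m′ ∷ μ)) (λ R ν → incr R * (inter (m ∷ m′ ∷ μ) (v ∷ ν) * H R ν)) ⟩
      ∑ (cuts (m′ ∷ μ)) (λ ν → ∑ (listsBelow n v) (λ R → incr R * (inter (m ∷ m′ ∷ μ) (v ∷ ν) * H R ν)))
        ≡⟨ ∑-cong (cuts (m′ ∷ μ)) (λ ν → trans (∑-cong (listsBelow n v) (λ R → *-swapˡ (incr R) (inter (m ∷ m′ ∷ μ) (v ∷ ν)) (H R ν)))
          (trans (∑-*ˡ (listsBelow n v) (inter (m ∷ m′ ∷ μ) (v ∷ ν)) (λ R → incr R * H R ν))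
            (cong (inter (m ∷ m′ ∷ μ) (v ∷ ν) *_) (sym (S-∷ n v ν (λ T → G (extend n (m ∷ m′ ∷ μ) T))))))) ⟩
      ∑ (cuts (m′ ∷ μ)) (λ ν → inter (m ∷ m′ ∷ μ) (v ∷ ν) * S n (v ∷ ν) (λ T → G (extend n (m ∷ m′ ∷ μ) T))) ∎

  -- The first column of a tableau strictly increases.
  too-tall : ∀ n m x R T → Linked ColStrict ((x ∷ R) ∷ T) → All (All (_< n)) ((x ∷ R) ∷ T) → All (λ Q → 1 ≤ length Q) T →
             m ≤ x → m ℕ.+ length T < n
  too-tall n m x R [] _ ((x<n ∷ _) ∷ _) _ m≤x = ℕ.≤-<-trans (ℕ.≤-reflexive (ℕ.+-identityʳ m)) (ℕ.≤-<-trans m≤x x<n)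
  too-tall n m x R ((y ∷ Q) ∷ T) ((x<y ∷ _) ∷ l) (_ ∷ b) (_ ∷ ne) m≤x =
    ℕ.≤-<-trans (ℕ.≤-reflexive (ℕ.+-suc m (length T))) (too-tall n (suc m) y Q T l b ne (ℕ.≤-<-trans m≤x x<y))

  S-vanish : ∀ n μ G → All (1 ≤_) μ → n < length μ → S n μ G ≡ 0ℤ
  S-vanish n μ G positive n<len = ∑-0 (fillings n μ) (λ {T} i → trans (cong (_* G T) (ι-no (isSSYT? T)
    (λ st → not-ssyt T (fillings-shape n μ i) st))) (*-zeroˡ (G T)))
    where
    not-ssyt : ∀ T → Shape n μ T → ¬ IsSSYT T
    not-ssyt [] (refl , _) st = contradiction n<len λ ()
    not-ssyt (R ∷ T) (shape , bound) (_ , strict) = by-row R strict bound (All.map⁻ (subst (All (1 ≤_)) (sym shape) positive))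
      where
      by-row : ∀ R → Linked ColStrict (R ∷ T) → All (All (_< n)) (R ∷ T) → All (λ Q → 1 ≤ length Q) (R ∷ T) → _
      by-row (x ∷ Q) strict bound (_ ∷ nonempty) = ℕ.<-irrefl refl (ℕ.<-≤-trans (too-tall n 0 x Q T strict bound nonempty z≤n)
        (ℕ.s≤s⁻¹ (ℕ.≤-trans n<len (ℕ.≤-reflexive (trans (cong length (sym shape)) (List.length-map length (R ∷ T)))))))

  S-snoc : ∀ n ν G → S n (ν ∷ʳ 0) G ≡ S n ν (λ T → G (T ∷ʳ []))
  S-snoc n [] G = refl
  S-snoc n (r ∷ ν) G = trans (S-∷ n r (ν ∷ʳ 0) G) (trans (rows-cong n r (λ R _ _ → trans (S-snoc n ν (λ T → col R T * G (R ∷ T)))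
    (S-cong n ν (λ T _ → cong (_* G (R ∷ (T ∷ʳ []))) (col-snoc R T))))) (sym (S-∷ n r ν (λ T → G (T ∷ʳ [])))))
    where
    col-snoc : ∀ R T → col R (T ∷ʳ []) ≡ col R T
    col-snoc [] [] = refl
    col-snoc (_ ∷ _) [] = refl
    col-snoc R (_ ∷ _) = refl

  -- Only the cuts with an empty last row contribute; these are the interlacing shapes.
  ∑-cuts-box : ∀ m μ (H : List ℕ → ℤ) → (∀ ν v → (ν ∷ʳ suc v) ∈ cuts (m ∷ μ) → inter (m ∷ μ) (ν ∷ʳ suc v) * H (ν ∷ʳ suc v) ≡ 0ℤ) →
               ∑ (cuts (m ∷ μ)) (λ ν → inter (m ∷ μ) ν * H ν) ≡ ∑ (box (m ∷ μ)) (λ ν → H (ν ∷ʳ 0))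
  ∑-cuts-box m [] H vanish = begin
    ∑ (cuts (m ∷ [])) (λ ν → 1ℤ * H ν)
      ≡⟨ ∑-cuts m [] (λ ν → inter (m ∷ []) ν * H ν) ⟩
    ∑ (upTo (suc m)) (λ v → 1ℤ * H (v ∷ []) + 0ℤ)
      ≡⟨ ∑-upTo-zero m (λ v → 1ℤ * H (v ∷ []) + 0ℤ) ⟩
    1ℤ * H (0 ∷ []) + 0ℤ + ∑ (upTo m) (λ v → 1ℤ * H (suc v ∷ []) + 0ℤ)
      ≡⟨ cong₂ _+_ (trans (+-identityʳ (1ℤ * H (0 ∷ []))) (*-identityˡ (H (0 ∷ [])))) (∑-0 (upTo m) (λ {v} i → cong (_+ 0ℤ) (vanish [] v (∈-concatMap∷⁺ (∈-upTo⁺ (s≤s (∈-upTo⁻ i))) (here refl))))) ⟩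
    H (0 ∷ []) + 0ℤ ∎
  ∑-cuts-box m (m′ ∷ μ) H vanish = begin
    ∑ (cuts (m ∷ m′ ∷ μ)) (λ ν → inter (m ∷ m′ ∷ μ) ν * H ν)
      ≡⟨ ∑-cuts m (m′ ∷ μ) (λ ν → inter (m ∷ m′ ∷ μ) ν * H ν) ⟩
    ∑ (upTo (suc m)) (λ v → ∑ (cuts (m′ ∷ μ)) (λ ν → ι (m′ ≤? v) * inter (m′ ∷ μ) ν * H (v ∷ ν)))
      ≡⟨ ∑-cong∈ (upTo (suc m)) (λ {v} i → trans (∑-cong (cuts (m′ ∷ μ)) (λ ν → *-assoc (ι (m′ ≤? v)) (inter (m′ ∷ μ) ν) (H (v ∷ ν))))
        (trans (∑-*ˡ (cuts (m′ ∷ μ)) (ι (m′ ≤? v)) (λ ν → inter (m′ ∷ μ) ν * H (v ∷ ν)))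
          (by-cases v i (m′ ≤? v)))) ⟩
    ∑ (upTo (suc m)) (λ v → ι (m′ ≤? v) * ∑ (box (m′ ∷ μ)) (λ ν → H (v ∷ (ν ∷ʳ 0))))
      ≡⟨ upTo-range (λ v → ∑ (box (m′ ∷ μ)) (λ ν → H (v ∷ (ν ∷ʳ 0)))) ⟩
    ∑ (range m′ m) (λ v → ∑ (box (m′ ∷ μ)) (λ ν → H (v ∷ (ν ∷ʳ 0))))
      ≡⟨ trans (∑-concatMap (λ v → map (v ∷_) (box (m′ ∷ μ))) (range m′ m) (λ ν → H (ν ∷ʳ 0)))
        (∑-cong (range m′ m) (λ v → ∑-map (v ∷_) (box (m′ ∷ μ)) (λ ν → H (ν ∷ʳ 0)))) ⟨
    ∑ (box (m ∷ m′ ∷ μ)) (λ ν → H (ν ∷ʳ 0)) ∎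
    where
    by-cases : ∀ v → v ∈ upTo (suc m) → (d : Dec (m′ ≤ v)) → ι d * ∑ (cuts (m′ ∷ μ)) (λ ν → inter (m′ ∷ μ) ν * H (v ∷ ν)) ≡ ι d * ∑ (box (m′ ∷ μ)) (λ ν → H (v ∷ (ν ∷ʳ 0)))
    by-cases v i (no _) = refl
    by-cases v i (yes p) = cong (1ℤ *_) (∑-cuts-box m′ μ (λ ν → H (v ∷ ν)) (λ ν w j → trans (sym (*-identityˡ (inter (m′ ∷ μ) (ν ∷ʳ suc w) * H (v ∷ (ν ∷ʳ suc w)))))
      (trans (sym (*-assoc 1ℤ (inter (m′ ∷ μ) (ν ∷ʳ suc w)) (H (v ∷ (ν ∷ʳ suc w)))))
        (trans (cong (λ z → z * inter (m′ ∷ μ) (ν ∷ʳ suc w) * H (v ∷ (ν ∷ʳ suc w))) (sym (ι-yes (m′ ≤? v) p))) (vanish (v ∷ ν) w (∈-concatMap∷⁺ i j))))))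
    upTo-range : ∀ (f : ℕ → ℤ) → ∑ (upTo (suc m)) (λ v → ι (m′ ≤? v) * f v) ≡ ∑ (range m′ m) f
    upTo-range f = begin
      ∑ (upTo (suc m)) (λ v → ι (m′ ≤? v) * f v)
        ≡⟨ ∑-cong∈ (upTo (suc m)) (λ {v} i → expand v (ℕ.s≤s⁻¹ (∈-upTo⁻ i)) (m′ ≤? v)) ⟩
      ∑ (upTo (suc m)) (λ v → ∑ (range m′ m) (λ w → ι (v ≟ w) * f w))
        ≡⟨ ∑-swap (upTo (suc m)) (range m′ m) (λ v w → ι (v ≟ w) * f w) ⟩
      ∑ (range m′ m) (λ w → ∑ (upTo (suc m)) (λ v → ι (v ≟ w) * f w))
        ≡⟨ ∑-cong∈ (range m′ m) (λ {w} i → ∑-unique (_≟ w) (λ _ → f w) (Unique.upTo⁺ (suc m)) (∈-upTo⁺ (s≤s (proj₂ (∈-range⁻ {m′} i)))) refl (λ e → e)) ⟩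
      ∑ (range m′ m) f ∎
      where
      expand : ∀ v → v ≤ m → (d : Dec (m′ ≤ v)) → ι d * f v ≡ ∑ (range m′ m) (λ w → ι (v ≟ w) * f w)
      expand v v≤m (yes p) = trans (*-identityˡ (f v)) (sym (∑-unique (v ≟_) f (range-unique m′ m) (∈-range⁺ p v≤m) refl sym))
      expand v v≤m (no ¬p) = trans (*-zeroˡ (f v)) (sym (∑-0 (range m′ m) (λ {w} i → trans (cong (_* f w)
        (ι-no (v ≟ w) (λ { refl → ¬p (proj₁ (∈-range⁻ i)) }))) (*-zeroˡ (f w)))))

  weq-one : ∀ n {u α} → (∀ i → i < n → u i ≡ α i) → weq n u α ≡ 1ℤ
  weq-one zero e = refl
  weq-one (suc n) {u} {α} e = cong₂ _*_ (ι-yes (u n ℤ.≟ α n) (e n ℕ.≤-refl)) (weq-one n (λ i p → e i (ℕ.m<n⇒m<1+n p)))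

  weq-zero : ∀ n {u α i} → i < n → u i ≢ α i → weq n u α ≡ 0ℤ
  weq-zero (suc n) {u} {α} {i} (s≤s i≤n) ne = by-cases (i ≟ n)
    where
    by-cases : Dec (i ≡ n) → ι (u n ℤ.≟ α n) * weq n u α ≡ 0ℤ
    by-cases (yes refl) = trans (cong (_* weq n u α) (ι-no (u n ℤ.≟ α n) ne)) (*-zeroˡ (weq n u α))
    by-cases (no i≢n) = trans (cong (ι (u n ℤ.≟ α n) *_) (weq-zero n (ℕ.≤∧≢⇒< i≤n i≢n) ne)) (*-zeroʳ (ι (u n ℤ.≟ α n)))

  agree? : ∀ n (u α : Weight) → (∀ i → i < n → u i ≡ α i) ⊎ Σ ℕ λ i → i < n × u i ≢ α i
  agree? zero u α = inj₁ (λ _ ())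
  agree? (suc n) u α with agree? n u α | u n ℤ.≟ α n
  ... | inj₂ (i , p , ne) | _ = inj₂ (i , ℕ.m<n⇒m<1+n p , ne)
  ... | inj₁ _ | no ne = inj₂ (n , ℕ.≤-refl , ne)
  ... | inj₁ e | yes f = inj₁ λ i p → by-cases i p (i ≟ n)
    where
    by-cases : ∀ i → i < suc n → Dec (i ≡ n) → u i ≡ α i
    by-cases i _ (yes refl) = f
    by-cases i (s≤s p) (no i≢n) = e i (ℕ.≤∧≢⇒< p i≢n)

  weq-ι : ∀ n {u α : Weight} {P : Set} (d : Dec P) → (P → ∀ i → i < n → u i ≡ α i) → ((∀ i → i < n → u i ≡ α i) → P) → ι d ≡ weq n u α
  weq-ι n {u} {α} d f g with agree? n u α
  ... | inj₁ e = trans (ι-yes d (g e)) (sym (weq-one n e))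
  ... | inj₂ (i , p , ne) = trans (ι-no d (λ q → ne (f q i p))) (sym (weq-zero n p ne))

  wt : List ℕ → Weight
  wt [] i = 0ℤ
  wt (a ∷ α) zero = ℤ.+ a
  wt (a ∷ α) (suc i) = wt α i

  applyUpTo-wt : ∀ (u : ℕ → ℕ) n → ∀ i → i < n → wt (applyUpTo u n) i ≡ ℤ.+ u i
  applyUpTo-wt u (suc n) zero _ = refl
  applyUpTo-wt u (suc n) (suc i) (s≤s p) = applyUpTo-wt (u ∘ suc) n i p

  wt-injective : ∀ (u : ℕ → ℕ) n α → length α ≡ n → (∀ i → i < n → ℤ.+ u i ≡ wt α i) → applyUpTo u n ≡ α
  wt-injective u zero [] len e = refl
  wt-injective u (suc n) (a ∷ α) len e = cong₂ _∷_ (+-injective (e 0 (s≤s z≤n)))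
    (wt-injective (u ∘ suc) n α (ℕ.suc-injective len) (λ i p → e (suc i) (s≤s p)))

  tabulated-eq : ∀ (u : ℕ → ℕ) n α → length α ≡ n → ι (map u (upTo n) ≟L α) ≡ weq n (ℤ.+_ ∘ u) (wt α)
  tabulated-eq u n α len = weq-ι n (map u (upTo n) ≟L α)
    (λ e i p → trans (sym (applyUpTo-wt u n i p)) (cong (λ xs → wt xs i) (trans (sym (List.map-upTo u n)) e)))
    (λ e → trans (List.map-upTo u n) (wt-injective u n α len e))

  count-++ : ∀ i xs ys → count (_≟ i) (xs ++ ys) ≡ count (_≟ i) xs ℕ.+ count (_≟ i) ys
  count-++ i xs ys = trans (cong length (List.filter-++ (_≟ i) xs ys)) (List.length-++ (filter (_≟ i) xs))

  count-replicate-≢ : ∀ i n c → n ≢ i → count (_≟ i) (replicate c n) ≡ 0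
  count-replicate-≢ i n zero n≢i = refl
  count-replicate-≢ i n (suc c) n≢i = trans (cong length (List.filter-reject (_≟ i) n≢i)) (count-replicate-≢ i n c n≢i)

  count-replicate-≡ : ∀ n c → count (_≟ n) (replicate c n) ≡ c
  count-replicate-≡ n zero = refl
  count-replicate-≡ n (suc c) = trans (cong length (List.filter-accept (_≟ n) refl)) (cong suc (count-replicate-≡ n c))

  count-absent : ∀ n R → All (_< n) R → count (_≟ n) R ≡ 0
  count-absent n [] [] = refl
  count-absent n (x ∷ R) (x<n ∷ b) = trans (cong length (List.filter-reject (_≟ n) (ℕ.<⇒≢ x<n))) (count-absent n R b)

  cnt : List (List ℕ) → Weight
  cnt T i = ℤ.+ count (_≟ i) (concat T)

  extend-small : ∀ n μ T i → i < n → length T ≡ length μ → count (_≟ i) (concat (extend n μ T)) ≡ count (_≟ i) (concat T)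
  extend-small n [] [] i i<n len = refl
  extend-small n (r ∷ μ) (R ∷ T) i i<n len = begin
    count (_≟ i) (fill n r R ++ concat (extend n μ T))
      ≡⟨ count-++ i (fill n r R) (concat (extend n μ T)) ⟩
    count (_≟ i) (fill n r R) ℕ.+ count (_≟ i) (concat (extend n μ T))
      ≡⟨ cong₂ ℕ._+_ (trans (count-++ i R (replicate (r ∸ length R) n)) (trans (cong (count (_≟ i) R ℕ.+_)
        (count-replicate-≢ i n (r ∸ length R) (λ { refl → ℕ.<-irrefl refl i<n }))) (ℕ.+-identityʳ (count (_≟ i) R))))
        (extend-small n μ T i i<n (ℕ.suc-injective len)) ⟩
    count (_≟ i) R ℕ.+ count (_≟ i) (concat T)
      ≡⟨ count-++ i R (concat T) ⟨
    count (_≟ i) (concat (R ∷ T)) ∎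

  extend-new : ∀ n {ν μ} T → Pointwise _≤_ ν μ → Shape n ν T → count (_≟ n) (concat (extend n μ T)) ℕ.+ sum ν ≡ sum μ
  extend-new n [] [] _ = refl
  extend-new n {v ∷ ν} {r ∷ μ} (R ∷ T) (v≤r ∷ le) (shape , bR ∷ bT) = begin
    count (_≟ n) (fill n r R ++ concat (extend n μ T)) ℕ.+ (v ℕ.+ sum ν)
      ≡⟨ cong (ℕ._+ (v ℕ.+ sum ν)) (trans (count-++ n (fill n r R) (concat (extend n μ T))) (cong (ℕ._+ count (_≟ n) (concat (extend n μ T)))
        (trans (count-++ n R (replicate (r ∸ length R) n)) (cong₂ ℕ._+_ (count-absent n R bR)
          (trans (count-replicate-≡ n (r ∸ length R)) (cong (r ∸_) (List.∷-injectiveˡ shape))))))) ⟩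
    (r ∸ v) ℕ.+ count (_≟ n) (concat (extend n μ T)) ℕ.+ (v ℕ.+ sum ν)
      ≡⟨ arith (r ∸ v) (count (_≟ n) (concat (extend n μ T))) v (sum ν) ⟩
    ((r ∸ v) ℕ.+ v) ℕ.+ (count (_≟ n) (concat (extend n μ T)) ℕ.+ sum ν)
      ≡⟨ cong₂ ℕ._+_ (ℕ.m∸n+n≡m v≤r) (extend-new n T le (List.∷-injectiveʳ shape , bT)) ⟩
    r ℕ.+ sum μ ∎
    where
    arith : ∀ a b c d → a ℕ.+ b ℕ.+ (c ℕ.+ d) ≡ (a ℕ.+ c) ℕ.+ (b ℕ.+ d)
    arith = ℕ-Solver.solve-∀

  interlaces-≤ : ∀ {μ ν} → Interlaces μ ν → Pointwise _≤_ (ν ∷ʳ 0) μ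
  interlaces-≤ end = z≤n ∷ []
  interlaces-≤ (step _ q r) = q ∷ interlaces-≤ r

  -- Interlacing passes positivity of the last part up to all earlier ones. In `K-kost` the shape
  -- then has n + 1 nonempty rows and admits no tableau on n letters.
  cut-positive : ∀ m μ ν v → (ν ∷ʳ suc v) ∈ cuts (m ∷ μ) →
                 inter (m ∷ μ) (ν ∷ʳ suc v) ≡ 0ℤ ⊎ (1 ≤ m × All (1 ≤_) (ν ∷ʳ suc v) × length (ν ∷ʳ suc v) ≡ suc (length μ))
  cut-positive m [] [] v i with ∈-concatMap∷⁻ (upTo (suc m)) i
  ... | _ , _ , j , here refl , refl = inj₂ (ℕ.≤-trans (s≤s z≤n) (ℕ.s≤s⁻¹ (∈-upTo⁻ j)) , s≤s z≤n ∷ [] , refl)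
  cut-positive m [] (w ∷ ν) v i with ∈-concatMap∷⁻ (upTo (suc m)) i
  cut-positive m [] (w ∷ []) v i | _ , _ , j , here refl , ()
  cut-positive m [] (w ∷ _ ∷ _) v i | _ , _ , j , here refl , ()
  cut-positive m (m′ ∷ μ) [] v i with ∈-concatMap∷⁻ (upTo (suc m)) i
  ... | _ , _ , j , k , refl with ∈-concatMap∷⁻ (upTo (suc m′)) k
  ... | _ , _ , _ , _ , ()
  cut-positive m (m′ ∷ μ) (w ∷ ν) v i with ∈-concatMap∷⁻ (upTo (suc m)) i
  ... | _ , _ , j , k , refl with cut-positive m′ μ ν v k | m′ ≤? w
  ... | inj₁ e | d = inj₁ (trans (cong (ι d *_) e) (*-zeroʳ (ι d)))
  ... | inj₂ _ | no _ = inj₁ (*-zeroˡ (inter (m′ ∷ μ) (ν ∷ʳ suc v)))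
  ... | inj₂ (1≤m′ , pos , len) | yes m′≤w =
    inj₂ (ℕ.≤-trans 1≤m′ (ℕ.≤-trans m′≤w (ℕ.s≤s⁻¹ (∈-upTo⁻ j))) , ℕ.≤-trans 1≤m′ m′≤w ∷ pos , cong suc len)

  K : ℕ → List ℕ → Weight → ℤ
  K n μ α = S n μ (λ T → weq n (cnt T) α)

  concat-snoc : ∀ (T : List (List ℕ)) → concat (T ∷ʳ []) ≡ concat T
  concat-snoc [] = refl
  concat-snoc (R ∷ T) = cong (R ++_) (concat-snoc T)

  K-snoc : ∀ n ν α → K n (ν ∷ʳ 0) α ≡ K n ν α
  K-snoc n ν α = trans (S-snoc n ν (λ T → weq n (cnt T) α))
    (S-cong n ν (λ T _ → weq-cong n α (λ i _ → cong (λ xs → ℤ.+ count (_≟ i) xs) (concat-snoc T))))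

  K-pad : ∀ n μ c α → K n (μ ++ replicate c 0) α ≡ K n μ α
  K-pad n μ zero α = cong (λ ν → K n ν α) (List.++-identityʳ μ)
  K-pad n μ (suc c) α = trans (cong (λ ν → K n ν α) (sym (List.++-assoc μ (0 ∷ []) (replicate c 0))))
    (trans (K-pad n (μ ∷ʳ 0) c α) (K-snoc n μ α))

  -- Removing the letter n from a tableau is the branching rule.
  K-kost : ∀ n μ α → length μ ≡ n → Decreasing μ → K n μ α ≡ kost n μ α
  K-kost zero [] α len dec = refl
  K-kost (suc n) (m ∷ μ) α len dec = begin
    K (suc n) (m ∷ μ) α
      ≡⟨ S-split n (m ∷ μ) (λ T → weq (suc n) (cnt T) α) dec ⟩
    ∑ (cuts (m ∷ μ)) (λ ν → inter (m ∷ μ) ν * H ν)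
      ≡⟨ ∑-cuts-box m μ H vanish ⟩
    ∑ (box (m ∷ μ)) (λ ν → H (ν ∷ʳ 0))
      ≡⟨ ∑-cong∈ (box (m ∷ μ)) (λ {ν} i → branch ν (∈-box⁻ (m ∷ μ) i)) ⟩
    kost (suc n) (m ∷ μ) α ∎
    where
    H : List ℕ → ℤ
    H ν = S n ν (λ T → weq (suc n) (cnt (extend n (m ∷ μ) T)) α)
    vanish : ∀ ν v → (ν ∷ʳ suc v) ∈ cuts (m ∷ μ) → inter (m ∷ μ) (ν ∷ʳ suc v) * H (ν ∷ʳ suc v) ≡ 0ℤ
    vanish ν v i with cut-positive m μ ν v i
    ... | inj₁ e = trans (cong (_* H (ν ∷ʳ suc v)) e) (*-zeroˡ (H (ν ∷ʳ suc v)))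
    ... | inj₂ (_ , pos , l) = trans (cong (inter (m ∷ μ) (ν ∷ʳ suc v) *_) (S-vanish n (ν ∷ʳ suc v) _ pos
      (ℕ.≤-reflexive (sym (trans l len))))) (*-zeroʳ (inter (m ∷ μ) (ν ∷ʳ suc v)))
    branch : ∀ ν → Interlaces (m ∷ μ) ν → H (ν ∷ʳ 0) ≡ ι (ℤ.+ sum (m ∷ μ) ℤ.≟ ℤ.+ sum ν + α n) * kost n ν α
    branch ν r = begin
      S n (ν ∷ʳ 0) (λ T → weq (suc n) (cnt (extend n (m ∷ μ) T)) α)
        ≡⟨ S-cong n (ν ∷ʳ 0) (λ T shape → cong₂ _*_ (new T shape) (weq-cong n α (λ i p → cong ℤ.+_
          (extend-small n (m ∷ μ) T i p (trans (same-length T shape) (sym len))))) ) ⟩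
      S n (ν ∷ʳ 0) (λ T → ι (ℤ.+ sum (m ∷ μ) ℤ.≟ ℤ.+ sum ν + α n) * weq n (cnt T) α)
        ≡⟨ S-* n (ν ∷ʳ 0) (ι (ℤ.+ sum (m ∷ μ) ℤ.≟ ℤ.+ sum ν + α n)) (λ T → weq n (cnt T) α) ⟩
      ι (ℤ.+ sum (m ∷ μ) ℤ.≟ ℤ.+ sum ν + α n) * K n (ν ∷ʳ 0) α
        ≡⟨ cong (ι (ℤ.+ sum (m ∷ μ) ℤ.≟ ℤ.+ sum ν + α n) *_) (trans (K-snoc n ν α)
          (K-kost n ν α ν-length (interlaces-decreasing r))) ⟩
      ι (ℤ.+ sum (m ∷ μ) ℤ.≟ ℤ.+ sum ν + α n) * kost n ν α ∎
      where
      ν-length : length ν ≡ n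
      ν-length = ℕ.suc-injective (trans (sym (interlaces-length r)) len)
      same-length : ∀ T → Shape n (ν ∷ʳ 0) T → length T ≡ suc n
      same-length T (shape , _) = trans (sym (List.length-map length T)) (trans (cong length shape)
        (trans (List.length-++ ν) (trans (ℕ.+-comm (length ν) 1) (cong suc ν-length))))
      new : ∀ T → Shape n (ν ∷ʳ 0) T → ι (cnt (extend n (m ∷ μ) T) n ℤ.≟ α n) ≡ ι (ℤ.+ sum (m ∷ μ) ℤ.≟ ℤ.+ sum ν + α n)
      new T shape = ι-cong (cnt (extend n (m ∷ μ) T) n ℤ.≟ α n) (ℤ.+ sum (m ∷ μ) ℤ.≟ ℤ.+ sum ν + α n)
        (λ e → trans (sym total) (trans (+-comm (cnt (extend n (m ∷ μ) T) n) (ℤ.+ sum ν)) (cong (ℤ.+ sum ν +_) e)))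
        (λ e → trans (x≡x+y-y (cnt (extend n (m ∷ μ) T) n) (ℤ.+ sum ν)) (trans (cong (_- ℤ.+ sum ν) (trans total e)) (x+y-x≡y (ℤ.+ sum ν) (α n))))
        where
        total : cnt (extend n (m ∷ μ) T) n + ℤ.+ sum ν ≡ ℤ.+ sum (m ∷ μ)
        total = cong ℤ.+_ (trans (cong (count (_≟ n) (concat (extend n (m ∷ μ) T)) ℕ.+_)
          (sym (trans (sum-++ ν (0 ∷ [])) (ℕ.+-identityʳ (sum ν))))) (extend-new n T (interlaces-≤ r) shape))

  kostka-K : ∀ n μ α → length α ≡ n → ℤ.+ kostka n μ α ≡ K n μ (wt α)
  kostka-K n μ α len = trans (count-∑ (λ T → isSSYT? T ×-dec (content n T ≟L α)) (fillings n μ)) (∑-cong (fillings n μ) (λ T →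
      trans (ι-× (isSSYT? T) (content n T ≟L α)) (cong (ssyt T *_) (tabulated-eq (λ i → count (_≟ i) (concat T)) n α len))))

  decreasing-zeros : ∀ c → Decreasing (replicate c 0)
  decreasing-zeros zero = []
  decreasing-zeros (suc zero) = [-]
  decreasing-zeros (suc (suc c)) = z≤n ∷ decreasing-zeros (suc c)

  decreasing-pad : ∀ {μ} c → Decreasing μ → Decreasing (μ ++ replicate c 0)
  decreasing-pad c [] = decreasing-zeros c
  decreasing-pad zero [-] = [-]
  decreasing-pad (suc c) [-] = z≤n ∷ decreasing-zeros (suc c)
  decreasing-pad c (p ∷ d) = p ∷ decreasing-pad c d

  pad-length : ∀ n μ → length μ ≤ n → length (pad n μ) ≡ n
  pad-length n μ le = trans (List.length-++ μ) (trans (cong (length μ ℕ.+_) (List.length-replicate (n ∸ length μ))) (ℕ.m+[n∸m]≡n le))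

  weq-local : ∀ n u {α β} → (∀ i → i < n → α i ≡ β i) → weq n u α ≡ weq n u β
  weq-local zero u e = refl
  weq-local (suc n) u e = cong₂ _*_ (cong (λ z → ι (u n ℤ.≟ z)) (e n ℕ.≤-refl)) (weq-local n u (λ i p → e i (ℕ.m<n⇒m<1+n p)))

  -- Extracting a Schur coefficient from the product

  familyDegree : List (List ℕ) → Weight
  familyDegree K i = ℤ.+ count (i ∈?_) K

  families : ℕ → ℕ → Weight → ℤ
  families n k β = ∑ (kFamilies n k) (λ K → weq n (familyDegree K) β)

  famCount-families : ∀ n k α → length α ≡ n → ℤ.+ famCount n k α ≡ families n k (wt α)
  famCount-families n k α len = trans (count-∑ (λ K → degree n K ≟L α) (kFamilies n k))
    (∑-cong (kFamilies n k) (λ K → tabulated-eq (λ i → count (i ∈?_) K) n α len))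

  wsum-+ : ∀ j k (α β : Weight) → wsum j k (λ x → α x + β x) ≡ wsum j k α + wsum j k β
  wsum-+ j zero α β = refl
  wsum-+ j (suc k) α β = trans (cong (λ z → α j + β j + z) (wsum-+ (suc j) k α β)) (+-interchange (α j) (β j) (wsum (suc j) k α) (wsum (suc j) k β))

  wsum-neg : ∀ j k (α : Weight) → wsum j k (λ x → - α x) ≡ - wsum j k α
  wsum-neg j zero α = refl
  wsum-neg j (suc k) α = trans (cong (- α j +_) (wsum-neg (suc j) k α)) (sym (neg-distrib-+ (α j) (wsum (suc j) k α)))

  wsum-0 : ∀ j k {α : Weight} → (∀ i → j ≤ i → α i ≡ 0ℤ) → wsum j k α ≡ 0ℤ
  wsum-0 j zero e = refl
  wsum-0 j (suc k) e = cong₂ _+_ (e j ℕ.≤-refl) (wsum-0 (suc j) k (λ i p → e i (ℕ.<⇒≤ p)))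

  wsum-ε : ∀ j k {i} → j ≤ i → i < j ℕ.+ k → wsum j k (ε i) ≡ 1ℤ
  wsum-ε j zero {i} j≤i i<j = contradiction i<j (empty-window j≤i)
  wsum-ε j (suc k) {i} j≤i i<jk = by-cases (i ≟ j)
    where
    by-cases : (d : Dec (i ≡ j)) → ι (i ≟ j) + wsum (suc j) k (ε i) ≡ 1ℤ
    by-cases (yes refl) = cong₂ _+_ (ι-yes (i ≟ i) refl) (wsum-0 (suc i) k (λ x p → ι-no (i ≟ x) (ℕ.<⇒≢ p)))
    by-cases (no i≢j) = cong₂ _+_ (ι-no (i ≟ j) i≢j)
      (wsum-ε (suc j) k (ℕ.≤∧≢⇒< j≤i (i≢j ∘ sym)) (<-sucˡ j k i<jk))

  wsum-move-inside : ∀ n i j β → i < n → j < n → wsum 0 n (move (i , j) β) ≡ wsum 0 n β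
  wsum-move-inside n i j β i<n j<n = begin
    wsum 0 n (λ x → β x + (ε i x + - ε j x))
      ≡⟨ trans (wsum-+ 0 n β (λ x → ε i x + - ε j x)) (cong (wsum 0 n β +_) (trans (wsum-+ 0 n (ε i) (λ x → - ε j x))
        (cong (wsum 0 n (ε i) +_) (wsum-neg 0 n (ε j))))) ⟩
    wsum 0 n β + (wsum 0 n (ε i) - wsum 0 n (ε j))
      ≡⟨ cong (wsum 0 n β +_) (cong₂ _-_ (wsum-ε 0 n z≤n i<n) (wsum-ε 0 n z≤n j<n)) ⟩
    wsum 0 n β + 0ℤ
      ≡⟨ +-identityʳ (wsum 0 n β) ⟩
    wsum 0 n β ∎

  -- Moves inside the first n coordinates keep the total degree, so an identity known in one degree,
  -- such as the Schur expansion over the partitions of d, can be used under `T`.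
  T-cong-total : ∀ n ps {f g} d → (∀ {p} → p ∈ ps → proj₁ p < n × proj₂ p < n) → (∀ β → wsum 0 n β ≡ d → f β ≡ g β) →
                 ∀ β → wsum 0 n β ≡ d → T ps f β ≡ T ps g β
  T-cong-total n [] d inside e β t = e β t
  T-cong-total n ((i , j) ∷ ps) d inside e β t = cong₂ _-_ (T-cong-total n ps d (inside ∘ there) e β t)
    (T-cong-total n ps d (inside ∘ there) e (move (i , j) β)
      (trans (wsum-move-inside n i j β (proj₁ (inside (here refl))) (proj₂ (inside (here refl)))) t))

  below-unique : ∀ n r → Unique (listsBelow n r)
  below-unique n zero = [] ∷ []
  below-unique n (suc r) = concatMap∷-unique (Unique.upTo⁺ n) (below-unique n r)

  ∈-below : ∀ n R → All (_< n) R → R ∈ listsBelow n (length R)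
  ∈-below n [] [] = here refl
  ∈-below n (x ∷ R) (x<n ∷ b) = ∈-concatMap∷⁺ (∈-upTo⁺ x<n) (∈-below n R b)

  byLength : ℕ → List ℕ → List (List ℕ)
  byLength n rs = concatMap (listsBelow n) rs

  ∈-byLength⁺ : ∀ {n rs R} → length R ∈ rs → All (_< n) R → R ∈ byLength n rs
  ∈-byLength⁺ {n} {r ∷ rs} {R} (here refl) b = ∈-++⁺ˡ (∈-below n R b)
  ∈-byLength⁺ {n} {r ∷ rs} (there i) b = ∈-++⁺ʳ (listsBelow n r) (∈-byLength⁺ i b)

  ∈-byLength⁻ : ∀ {n} rs {R} → R ∈ byLength n rs → length R ∈ rs
  ∈-byLength⁻ {n} (r ∷ rs) i with ∈-++⁻ (listsBelow n r) i
  ... | inj₁ j = here (below-length n r j)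
  ... | inj₂ j = there (∈-byLength⁻ rs j)

  byLength-unique : ∀ n {rs} → Unique rs → Unique (byLength n rs)
  byLength-unique n {[]} [] = []
  byLength-unique n {r ∷ rs} (r∉ ∷ u) = Unique.++⁺ (below-unique n r) (byLength-unique n u)
    (λ (i , j) → All.lookup r∉ (∈-byLength⁻ rs j) (sym (below-length n r i)))

  partitions-unique : ∀ d → Unique (partitionsOf d)
  partitions-unique d = Unique.filter⁺ (λ xs → isPartition? xs ×-dec (sum xs ≟ d)) (byLength-unique (suc d) (Unique.upTo⁺ (suc d)))

  part≤sum : ∀ μ → All (_≤ sum μ) μ
  part≤sum [] = []
  part≤sum (m ∷ μ) = ℕ.m≤m+n m (sum μ) ∷ All.map (λ p → ℕ.≤-trans p (ℕ.m≤n+m (sum μ) m)) (part≤sum μ)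

  length≤sum : ∀ {μ} → All (1 ≤_) μ → length μ ≤ sum μ
  length≤sum [] = z≤n
  length≤sum (p ∷ a) = ℕ.+-mono-≤ p (length≤sum a)

  ∈-partitions : ∀ la → IsPartition la → la ∈ partitionsOf (sum la)
  ∈-partitions la p = ∈-filter⁺ (λ xs → isPartition? xs ×-dec (sum xs ≟ sum la))
    (∈-byLength⁺ (∈-upTo⁺ (s≤s (length≤sum (proj₂ p)))) (All.map s≤s (part≤sum la))) (p , refl)

  eqAt-zeros : ∀ j c {α} → (∀ i → α (j ℕ.+ i) ≡ 0ℤ) → eqAt j (replicate c 0) α ≡ 1ℤ
  eqAt-zeros j zero e = refl
  eqAt-zeros j (suc c) {α} e = cong₂ _*_ (ι-yes (α j ℤ.≟ 0ℤ) (trans (cong α (sym (ℕ.+-identityʳ j))) (e 0)))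
    (eqAt-zeros (suc j) c (λ i → trans (cong α (sym (ℕ.+-suc j i))) (e (suc i))))

  eqAt-pad : ∀ j μ la c {α} → All (1 ≤_) μ → All (1 ≤_) la → length la ≤ length μ ℕ.+ c → (∀ i → α (j ℕ.+ i) ≡ wt la i) →
             eqAt j (μ ++ replicate c 0) α ≡ ι (μ ≟L la)
  eqAt-pad j [] [] c pos pos′ le e = eqAt-zeros j c e
  eqAt-pad j [] (a ∷ la) (suc c) {α} pos (1≤a ∷ _) le e = trans (cong (_* eqAt (suc j) (replicate c 0) α) (ι-no (α j ℤ.≟ 0ℤ)
    (λ z → contradiction (+-injective (trans (sym (e 0)) (trans (cong α (ℕ.+-identityʳ j)) z))) (ℕ.<⇒≢ 1≤a ∘ sym)))) (*-zeroˡ (eqAt (suc j) (replicate c 0) α))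
  eqAt-pad j (m ∷ μ) [] c {α} (1≤m ∷ _) pos′ le e = trans (cong (_* eqAt (suc j) (μ ++ replicate c 0) α) (ι-no (α j ℤ.≟ ℤ.+ m)
    (λ z → contradiction (+-injective (trans (sym z) (trans (cong α (sym (ℕ.+-identityʳ j))) (e 0)))) (ℕ.<⇒≢ 1≤m ∘ sym)))) (*-zeroˡ (eqAt (suc j) (μ ++ replicate c 0) α))
  eqAt-pad j (m ∷ μ) (a ∷ la) c {α} (_ ∷ pos) (_ ∷ pos′) (s≤s le) e = begin
    ι (α j ℤ.≟ ℤ.+ m) * eqAt (suc j) (μ ++ replicate c 0) α
      ≡⟨ cong₂ _*_ (ι-cong (α j ℤ.≟ ℤ.+ m) (m ≟ a) (λ z → +-injective (trans (sym z) αj)) (λ { refl → αj }))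
        (eqAt-pad (suc j) μ la c pos pos′ le (λ i → trans (cong α (sym (ℕ.+-suc j i))) (e (suc i)))) ⟩
    ι (m ≟ a) * ι (μ ≟L la)
      ≡⟨ ι-× (m ≟ a) (μ ≟L la) ⟨
    ι ((m ≟ a) ×-dec (μ ≟L la))
      ≡⟨ ι-cong ((m ≟ a) ×-dec (μ ≟L la)) ((m ∷ μ) ≟L (a ∷ la)) (λ { (refl , refl) → refl }) (λ { refl → refl , refl }) ⟩
    ι ((m ∷ μ) ≟L (a ∷ la)) ∎
    where
    αj : α j ≡ ℤ.+ a
    αj = trans (cong α (sym (ℕ.+-identityʳ j))) (e 0)

  wt-decreasing : ∀ {la} → Decreasing la → ∀ i → wt la (suc i) ℤ.≤ wt la i
  wt-decreasing {[]} d i = ≤-refl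
  wt-decreasing {a ∷ []} d zero = ℤ.+≤+ z≤n
  wt-decreasing {a ∷ b ∷ la} (p ∷ d) zero = ℤ.+≤+ p
  wt-decreasing {a ∷ la} d (suc i) = wt-decreasing (tail d) i
    where
    tail : ∀ {a la} → Decreasing (a ∷ la) → Decreasing la
    tail [-] = []
    tail (_ ∷ d) = d

  wsum-wt : ∀ n la → length la ≤ n → wsum 0 n (wt la) ≡ ℤ.+ sum la
  wsum-wt n la le = go 0 n la le (λ _ → refl)
    where
    go : ∀ j k la {α : Weight} → length la ≤ k → (∀ i → α (j ℕ.+ i) ≡ wt la i) → wsum j k α ≡ ℤ.+ sum la
    go j k [] {α} le e = wsum-0 j k (λ i p → trans (cong α (sym (ℕ.m+[n∸m]≡n p))) (e (i ∸ j)))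
    go j (suc k) (a ∷ la) {α} (s≤s le) e = cong₂ _+_ (trans (cong α (sym (ℕ.+-identityʳ j))) (e 0))
      (go (suc j) k la le (λ i → trans (cong α (sym (ℕ.+-suc j i))) (e (suc i))))

  nonneg? : ∀ n (β : Weight) → (∀ i → i < n → ℤ.+ ∣ β i ∣ ≡ β i) ⊎ Σ ℕ λ i → i < n × (∀ a → ℤ.+ a ≢ β i)
  nonneg? zero β = inj₁ (λ _ ())
  nonneg? (suc n) β with nonneg? n β | β n in eq
  ... | inj₂ (i , p , ne) | _ = inj₂ (i , ℕ.m<n⇒m<1+n p , ne)
  ... | inj₁ _ | ℤ.-[1+ a ] = inj₂ (n , ℕ.≤-refl , λ b e → contradiction (trans e eq) λ ())
  ... | inj₁ nn | ℤ.+ a = inj₁ λ i p → by-cases i p (i ≟ n)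
    where
    by-cases : ∀ i → i < suc n → Dec (i ≡ n) → ℤ.+ ∣ β i ∣ ≡ β i
    by-cases i _ (yes refl) = trans (cong (ℤ.+_ ∘ ∣_∣) eq) (sym eq)
    by-cases i (s≤s p) (no i≢n) = nn i (ℕ.≤∧≢⇒< p i≢n)

  module _ (n k : ℕ) (c : List ℕ → ℤ) (expansion : IsSchurExpansion n k c) where

    sumℤ-∑ : ∀ (f : List ℕ → ℤ) xs → sumℤ (map f xs) ≡ ∑ xs f
    sumℤ-∑ f [] = refl
    sumℤ-∑ f (x ∷ xs) = cong (f x +_) (sumℤ-∑ f xs)

    -- Extends the expansion to integer exponents. If some coordinate is negative both sides are 0,
    -- as degrees of families and contents of tableaux are natural numbers; otherwise β is a list of
    -- naturals and the hypothesis applies.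
    expansion-weights : ∀ d β → wsum 0 n β ≡ ℤ.+ d → families n k β ≡ ∑ (partitionsOf d) (λ μ → c μ * K n μ β)
    expansion-weights d β total with nonneg? n β
    ... | inj₂ (i , i<n , neg) = trans (∑-0 (kFamilies n k) (λ {K} _ → weq-zero n i<n (neg (count (i ∈?_) K))))
      (sym (∑-0 (partitionsOf d) (λ {μ} _ → trans (cong (c μ *_) (∑-0 (fillings n μ) (λ {T} _ →
          trans (cong (ssyt T *_) (weq-zero n i<n (neg (count (_≟ i) (concatT T))))) (*-zeroʳ (ssyt T))))) (*-zeroʳ (c μ)))))
      where
      concatT : List (List ℕ) → List ℕ
      concatT = List.concat
    ... | inj₁ nn = begin
      families n k β
        ≡⟨ ∑-cong (kFamilies n k) (λ K → weq-local n (familyDegree K) agrees) ⟩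
      families n k (wt α)
        ≡⟨ famCount-families n k α α-length ⟨
      ℤ.+ famCount n k α
        ≡⟨ trans (expansion α α-length) (sumℤ-∑ (λ μ → c μ * ℤ.+ kostka n μ α) (partitionsOf (sum α))) ⟩
      ∑ (partitionsOf (sum α)) (λ μ → c μ * ℤ.+ kostka n μ α)
        ≡⟨ cong (λ e → ∑ (partitionsOf e) (λ μ → c μ * ℤ.+ kostka n μ α)) α-sum ⟩
      ∑ (partitionsOf d) (λ μ → c μ * ℤ.+ kostka n μ α)
        ≡⟨ ∑-cong (partitionsOf d) (λ μ → cong (c μ *_) (trans (kostka-K n μ α α-length)
          (S-cong n μ (λ T _ → weq-local n (cnt T) (λ i p → sym (agrees i p)))))) ⟩
      ∑ (partitionsOf d) (λ μ → c μ * K n μ β) ∎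
      where
      α : List ℕ
      α = applyUpTo (λ i → ∣ β i ∣) n
      α-length : length α ≡ n
      α-length = List.length-applyUpTo (λ i → ∣ β i ∣) n
      agrees : ∀ i → i < n → β i ≡ wt α i
      agrees i p = trans (sym (nn i p)) (sym (applyUpTo-wt (λ i → ∣ β i ∣) n i p))
      α-sum : sum α ≡ d
      α-sum = +-injective (trans (sym (wsum-wt n α (ℕ.≤-reflexive α-length))) (trans (wsum-cong 0 n (λ i _ p → sym (agrees i p))) total))

    -- `T` turns each Kostka row into an indicator at its own shape, so it singles out `la` among
    -- the partitions. Shapes with more than n parts have no tableaux on n letters and differ from
    -- `la`, hence contribute 0 as they should.
    coefficient-formula : ∀ la → IsPartition la → length la ≤ n → c la ≡ T (pairs n) (families n k) (wt la)
    coefficient-formula la part le = sym (begin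
      T (pairs n) (families n k) (wt la)
        ≡⟨ T-cong-total n (pairs n) (ℤ.+ sum la) (λ i → let a , b = ∈-pairs⁻ n i in ℕ.<-trans a b , b)
          (expansion-weights (sum la)) (wt la) (wsum-wt n la le) ⟩
      T (pairs n) (λ β → ∑ (partitionsOf (sum la)) (λ μ → c μ * K n μ β)) (wt la)
        ≡⟨ T-∑ (pairs n) (partitionsOf (sum la)) (λ μ β → c μ * K n μ β) (wt la) ⟩
      ∑ (partitionsOf (sum la)) (λ μ → T (pairs n) (λ β → c μ * K n μ β) (wt la))
        ≡⟨ ∑-cong∈ (partitionsOf (sum la)) (λ {μ} i → trans (T-* (pairs n) (c μ) (K n μ) (wt la))
          (trans (cong (c μ *_) (orthogonal μ (partition-of i) (length μ ℕ.≤? n))) (*-comm (c μ) (ι (μ ≟L la))))) ⟩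
      ∑ (partitionsOf (sum la)) (λ μ → ι (μ ≟L la) * c μ)
        ≡⟨ ∑-unique (_≟L la) c (partitions-unique (sum la)) (∈-partitions la part) refl (λ e → e) ⟩
      c la ∎)
      where
      partition-of : ∀ {μ} → μ ∈ partitionsOf (sum la) → IsPartition μ
      partition-of i = proj₁ (proj₂ (∈-filter⁻ (λ xs → isPartition? xs ×-dec (sum xs ≟ sum la)) {xs = byLength (suc (sum la)) (upTo (suc (sum la)))} i))
      orthogonal : ∀ μ → IsPartition μ → Dec (length μ ≤ n) → T (pairs n) (K n μ) (wt la) ≡ ι (μ ≟L la)
      orthogonal μ (dec , pos) (yes le′) = begin
        T (pairs n) (K n μ) (wt la)
          ≡⟨ T-cong (pairs n) (λ β → trans (sym (K-pad n μ (n ∸ length μ) β)) (K-kost n (pad n μ) β (pad-length n μ le′) (decreasing-pad (n ∸ length μ) dec))) (wt la) ⟩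
        T (pairs n) (kost n (pad n μ)) (wt la)
          ≡⟨ inversion n (pad n μ) (pad-length n μ le′) (decreasing-pad (n ∸ length μ) dec)
            (λ i _ → ≤-trans (wt-decreasing (proj₁ part) i) (i≤i+j (wt la i) 1ℤ)) ⟩
        eqAt 0 (pad n μ) (wt la)
          ≡⟨ eqAt-pad 0 μ la (n ∸ length μ) pos (proj₂ part) (ℕ.≤-trans le (ℕ.≤-reflexive (sym (ℕ.m+[n∸m]≡n le′)))) (λ _ → refl) ⟩
        ι (μ ≟L la) ∎
      orthogonal μ (dec , pos) (no gt) = trans (trans (T-cong (pairs n) (λ β → S-vanish n μ (λ T → weq n (cnt T) β) pos (ℕ.≰⇒> gt)) (wt la))
        (T-zero (pairs n) (wt la))) (sym (ι-no (μ ≟L la) (λ { refl → gt le })))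
        where
        T-zero : ∀ ps α → T ps (λ _ → 0ℤ) α ≡ 0ℤ
        T-zero [] α = refl
        T-zero (p ∷ ps) α = cong₂ _-_ (T-zero ps α) (T-zero ps (move p α))

-- Subsets as lists and as bit vectors

module ShiftedFamilies where

  open import Data.Empty using (⊥; ⊥-elim)
  open import Data.Fin.Base as Fin using (toℕ; fromℕ<; splitAt; join)
  open import Data.Integer.Base using (_+_; _*_; -_; _-_)
  open import Data.List.Base using (_∷ʳ_; map; filter; tabulate)
  open import Data.List.Membership.Propositional.Properties using (∈-tabulate⁺; ∈-tabulate⁻)
  import Data.List.Relation.Binary.Pointwise as Pointwise
  open import Data.Nat.Base using (_≤_; _<_)
  open import Data.Nat.Properties using (_≟_; _<?_)
  open import Data.Vec.Base using (lookup; _++_; drop)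
  open import Data.Vec.Properties using (lookup-++ˡ; lookup-++ʳ)
  open import Data.List.Membership.DecPropositional _≟_ using (_∈?_)
  open import Defs
  open ListSums
  open LinearOperators using (app)
  open Fermions
  open SchurFunctions using (<-sucʳ; <-sucˡ; empty-window; Weight; ε; Extensional; move; T; T-↭; unique-↭; pairs; pairs-unique; ∈-pairs⁺; ∈-pairs⁻; sgn; below-length; below-bound; below-unique; ∈-below; weq; weq-ι; weq-local; tabulated-eq; pad-length; wt-decreasing; familyDegree; families; coefficient-formula) renaming (wt to weight)

  -- Rep j S b: the incr list S is the set of positions, counted from j, of the ones of b.
  data Rep : ℕ → ∀ {n} → List ℕ → Bits n → Set where
    nil : ∀ {j} → Rep j [] []
    skip : ∀ {j n S} {b : Bits n} → Rep (suc j) S b → Rep j S (false ∷ b)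
    take : ∀ {j n S} {b : Bits n} → Rep (suc j) S b → Rep j (j ∷ S) (true ∷ b)

  rep-lower : ∀ {j n S} {b : Bits n} → Rep j S b → All (j ≤_) S
  rep-lower nil = []
  rep-lower (skip r) = All.map ℕ.<⇒≤ (rep-lower r)
  rep-lower (take r) = ℕ.≤-refl ∷ All.map ℕ.<⇒≤ (rep-lower r)

  rep-upper : ∀ {j n S} {b : Bits n} → Rep j S b → All (_< j ℕ.+ n) S
  rep-upper nil = []
  rep-upper {j} {suc n} (skip r) = All.map (λ p → <-sucʳ j n p) (rep-upper r)
  rep-upper {j} {suc n} (take r) = ℕ.m<m+n j (s≤s z≤n) ∷ All.map (λ p → <-sucʳ j n p) (rep-upper r)

  rep-sorted : ∀ {j n S} {b : Bits n} → Rep j S b → Linked _<_ S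
  rep-sorted nil = []
  rep-sorted (skip r) = rep-sorted r
  rep-sorted (take r) = cons (rep-lower r) (rep-sorted r)
    where
    cons : ∀ {j S} → All (suc j ≤_) S → Linked _<_ S → Linked _<_ (j ∷ S)
    cons [] l = [-]
    cons (p ∷ _) l = p ∷ l

  rep-size : ∀ {j n S} {b : Bits n} → Rep j S b → size b ≡ ℤ.+ length S
  rep-size nil = refl
  rep-size (skip r) = trans (+-identityˡ _) (rep-size r)
  rep-size (take r) = cong (1ℤ * 1ℤ +_) (rep-size r)

  rep-list : ∀ {j n S T} {b : Bits n} → Rep j S b → Rep j T b → S ≡ T
  rep-list nil nil = refl
  rep-list (skip r) (skip s) = rep-list r s
  rep-list (take r) (take s) = cong (_ ∷_) (rep-list r s)

  rep-bits : ∀ {j n S} {b c : Bits n} → Rep j S b → Rep j S c → b ≡ c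
  rep-bits nil nil = refl
  rep-bits (skip r) (skip s) = cong (false ∷_) (rep-bits r s)
  rep-bits (take r) (take s) = cong (true ∷_) (rep-bits r s)
  rep-bits (skip r) (take s) = contradiction (All.head (rep-lower r)) (ℕ.<-irrefl refl)
  rep-bits (take r) (skip s) = contradiction (All.head (rep-lower s)) (ℕ.<-irrefl refl)

  positions : ∀ {n} → ℕ → Bits n → List ℕ
  positions j [] = []
  positions j (false ∷ b) = positions (suc j) b
  positions j (true ∷ b) = j ∷ positions (suc j) b

  rep-positions : ∀ {n} j (b : Bits n) → Rep j (positions j b) b
  rep-positions j [] = nil
  rep-positions j (false ∷ b) = skip (rep-positions (suc j) b)
  rep-positions j (true ∷ b) = take (rep-positions (suc j) b)

  indicator : ∀ n → ℕ → List ℕ → Bits n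
  indicator zero j S = []
  indicator (suc n) j [] = false ∷ indicator n (suc j) []
  indicator (suc n) j (x ∷ S) with x ≟ j
  ... | yes _ = true ∷ indicator n (suc j) S
  ... | no _ = false ∷ indicator n (suc j) (x ∷ S)

  sorted-above : ∀ {x S} → Linked _<_ (x ∷ S) → All (suc x ≤_) S
  sorted-above [-] = []
  sorted-above (p ∷ l) = p ∷ All.map (ℕ.<-trans p) (sorted-above l)

  sorted-tail : ∀ {x S} → Linked _<_ (x ∷ S) → Linked _<_ S
  sorted-tail [-] = []
  sorted-tail (_ ∷ l) = l

  rep-indicator : ∀ n j S → Linked _<_ S → All (j ≤_) S → All (_< j ℕ.+ n) S → Rep j S (indicator n j S)
  rep-indicator zero j [] l lo hi = nil
  rep-indicator zero j (x ∷ S) l (p ∷ _) (q ∷ _) = contradiction q (empty-window p)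
  rep-indicator (suc n) j [] l lo hi = skip (rep-indicator n (suc j) [] [] [] [])
  rep-indicator (suc n) j (x ∷ S) l (p ∷ lo) (q ∷ hi) with x ≟ j
  ... | yes refl = take (rep-indicator n (suc j) S (sorted-tail l) (sorted-above l) (All.map (λ r → <-sucˡ j n r) hi))
  ... | no x≢j = skip (rep-indicator n (suc j) (x ∷ S) l (j<x ∷ All.map (ℕ.<-trans j<x) (sorted-above l))
    (All.map (λ r → <-sucˡ j n r) (q ∷ hi)))
    where
    j<x : j < x
    j<x = ℕ.≤∧≢⇒< p (x≢j ∘ sym)

  rep-occ : ∀ {j n S} {b : Bits n} → Rep j S b → ∀ x → occ b x ≡ ι ((j ℕ.+ toℕ x) ∈? S)
  rep-occ {j} {S = S} (skip {b = b} r) zero = sym (ι-no ((j ℕ.+ 0) ∈? S) (λ i → ℕ.<-irrefl refl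
    (ℕ.≤-trans (All.lookup (rep-lower r) i) (ℕ.≤-reflexive (ℕ.+-identityʳ j)))))
  rep-occ {j} (take {S = S} r) zero = sym (ι-yes ((j ℕ.+ 0) ∈? (j ∷ S)) (here (ℕ.+-identityʳ j)))
  rep-occ {j} {S = S} (skip r) (suc x) = trans (rep-occ r x) (cong (λ y → ι (y ∈? S)) (sym (ℕ.+-suc j (toℕ x))))
  rep-occ {j} (take {S = S} r) (suc x) = trans (rep-occ r x) (ι-cong ((suc j ℕ.+ toℕ x) ∈? S) ((j ℕ.+ suc (toℕ x)) ∈? (j ∷ S))
    (λ i → there (subst (_∈ S) (sym (ℕ.+-suc j (toℕ x))) i))
    (λ { (here e) → contradiction e (ℕ.<⇒≢ (ℕ.m<m+n j (s≤s z≤n)) ∘ sym) ; (there i) → subst (_∈ S) (ℕ.+-suc j (toℕ x)) i }))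

  -- The invariant of a scan from i to j: the lower set stays one element ahead, and `q` is the last
  -- element read from it. At position j the other set catches up and the rest coincides.
  lowered-head : ∀ {p q n S T} {b : Bits n} (j : Fin n) → q ≤ p → Rep p S b → Rep p T (flip j b) → lookup b j ≡ false → Pointwise _≤_ (q ∷ S) T
  lowered-head zero q≤p (skip r) (take s) e with refl ← rep-list r s = q≤p ∷ Pointwise.refl ℕ.≤-refl
  lowered-head (suc j) q≤p (skip r) (skip s) e = lowered-head j (ℕ.m≤n⇒m≤1+n q≤p) r s e
  lowered-head (suc j) q≤p (take r) (take s) e = q≤p ∷ lowered-head j (ℕ.n≤1+n _) r s e

  lowered : ∀ {p n S T} {b : Bits n} (i j : Fin n) → i Fin.< j → Rep p S b → Rep p T (flip j (flip i b)) →
            lookup b i ≡ true → lookup b j ≡ false → Pointwise _≤_ S T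
  lowered zero (suc j) _ (take r) (skip s) e f = lowered-head j (ℕ.n≤1+n _) r s f
  lowered (suc i) (suc j) (s≤s i<j) (skip r) (skip s) e f = lowered i j i<j r s e f
  lowered (suc i) (suc j) (s≤s i<j) (take r) (take s) e f = ℕ.≤-refl ∷ lowered i j i<j r s e f

  remove-first : ∀ {p n s S} {b : Bits n} → Rep p (s ∷ S) b → Σ (Fin n) λ j → lookup b j ≡ true × Rep p S (flip j b)
  remove-first (skip r) = let j , e , s = remove-first r in suc j , e , skip s
  remove-first (take r) = zero , refl , skip r

  -- As `t` lies strictly between the prefix and `s`, its position is empty, so exchanging `s` for
  -- `t` is a single hop to a smaller position.
  replace : ∀ {p n s t S} P {b : Bits n} → Rep p (P List.++ s ∷ S) b → All (_< t) P → p ≤ t → t < s →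
            Σ (Fin n) λ i → Σ (Fin n) λ j → i Fin.< j × lookup b i ≡ false × lookup b j ≡ true × Rep p (P List.++ t ∷ S) (flip i (flip j b))
  replace (q ∷ P) (skip r) (q<t ∷ a) p≤t t<s =
    let i , j , lt , e , f , r′ = replace (q ∷ P) r (q<t ∷ a) (ℕ.≤-trans (All.head (rep-lower r)) (ℕ.<⇒≤ q<t)) t<s in
    suc i , suc j , s≤s lt , e , f , skip r′
  replace (q ∷ P) (take r) (q<t ∷ a) p≤t t<s =
    let i , j , lt , e , f , r′ = replace P r a q<t t<s in suc i , suc j , s≤s lt , e , f , take r′
  replace [] (take r) a p≤t t<s = contradiction (ℕ.≤-<-trans p≤t t<s) (ℕ.<-irrefl refl)
  replace {p} {t = t} [] (skip r) a p≤t t<s with p ≟ t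
  ... | yes refl = let j , e , r′ = remove-first r in zero , suc j , s≤s z≤n , refl , e , take r′
  ... | no p≢t = let i , j , lt , e , f , r′ = replace [] r [] (ℕ.≤∧≢⇒< p≤t p≢t) t<s in suc i , suc j , s≤s lt , e , f , skip r′

  ladder-nonzero : ∀ {N} κ (i : Fin N) x b → lookup b i ≡ κ → x (flip i b) ≢ 0ℤ → lad i κ x b ≢ 0ℤ
  ladder-nonzero true zero x (true ∷ b) e ne = ne
  ladder-nonzero false zero x (false ∷ b) e ne = ne
  ladder-nonzero κ (suc i) x (h ∷ b) e ne = signed-≢ h (ladder-nonzero κ i (x ∘ (h ∷_)) b e ne)
    where
    signed-≢ : ∀ h {z} → z ≢ 0ℤ → signed h z ≢ 0ℤ
    signed-≢ false ne e = ne e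
    signed-≢ true {z} ne e = ne (trans (sym (neg-involutive z)) (cong (-_) e))
      where open import Data.Integer.Properties using (neg-involutive)

  ρ-nonzero : ∀ {n} {i j : Fin n} {b : Bits n} → i ≢ j → lookup b i ≡ false → lookup b j ≡ true → ρ i j (flip i (flip j b)) b ≢ 0ℤ
  ρ-nonzero {i = i} {j} {b} i≢j e f = ladder-nonzero true i (lad j false (basis b)) (flip i (flip j b))
    (trans (lookup∘updateAt i (flip j b)) (cong not (trans (lookup∘updateAt′ i j i≢j b) e)))
    (subst (λ c → lad j false (basis b) c ≢ 0ℤ) (sym (flip-involutive i (flip j b)))
      (ladder-nonzero false j (basis b) (flip j b) (trans (lookup∘updateAt j b) (cong not f))
        (λ z → contradiction (trans (sym (ι-yes (flip j (flip j b) ≟ᵇ b) (flip-involutive j b))) z) λ ())))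

  ρ-support : ∀ {n} (i j : Fin n) S T → i ≢ j → ρ i j S T ≢ 0ℤ → lookup S i ≡ true × lookup S j ≡ false × flip j (flip i S) ≡ T
  ρ-support i j S T i≢j ne = by-lookup (lookup S i) refl , trans (sym (lookup∘updateAt′ j i (i≢j ∘ sym) S)) (by-lookup′ (lookup (flip i S) j) refl) , by-eq (flip j (flip i S) ≟ᵇ T)
    where
    by-lookup : ∀ g → lookup S i ≡ g → g ≡ true
    by-lookup true e = refl
    by-lookup false e = contradiction (ladder-head true i (lad j false (basis T)) S (λ f → contradiction (trans (sym e) f) λ ())) ne
    by-lookup′ : ∀ g → lookup (flip i S) j ≡ g → lookup (flip i S) j ≡ false
    by-lookup′ false e = e
    by-lookup′ true e = contradiction (ladder-flip true i (lad j false (basis T)) S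
      (ladder-head false j (basis T) (flip i S) (λ f → contradiction (trans (sym e) f) λ ()))) ne
    by-eq : Dec (flip j (flip i S) ≡ T) → flip j (flip i S) ≡ T
    by-eq (yes e) = e
    by-eq (no n≢) = contradiction (ladder-flip true i (lad j false (basis T)) S
      (ladder-flip false j (basis T) (flip i S) (ι-no (flip j (flip i S) ≟ᵇ T) n≢))) ne

  -- Shifted families of k-sets and closed bit vectors

  ∈-ksets⁻ : ∀ n k {S} → S ∈ ksets n k → Linked _<_ S × All (_< n) S × length S ≡ k
  ∈-ksets⁻ n k i = let j , l = ∈-filter⁻ (linked? _<?_) {xs = listsBelow n k} i in l , below-bound n k j , below-length n k j

  ∈-ksets⁺ : ∀ {n S} → Linked _<_ S → All (_< n) S → S ∈ ksets n (length S)
  ∈-ksets⁺ {n} {S} l b = ∈-filter⁺ (linked? _<?_) (∈-below n S b) l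

  select : ∀ {A B : Set} (f : A → B) (xs : List A) → Bits (length (map f xs)) → List A
  select f [] b = []
  select f (x ∷ xs) (true ∷ b) = x ∷ select f xs b
  select f (x ∷ xs) (false ∷ b) = select f xs b

  select-∈⁺ : ∀ {A B : Set} (f : A → B) xs b s → lookup b s ≡ true →
              Σ A λ x → x ∈ xs × x ∈ select f xs b × List.lookup (map f xs) s ≡ f x
  select-∈⁺ f (x ∷ xs) (true ∷ b) zero e = x , here refl , here refl , refl
  select-∈⁺ f (x ∷ xs) (true ∷ b) (suc s) e = let y , i , j , q = select-∈⁺ f xs b s e in y , there i , there j , q
  select-∈⁺ f (x ∷ xs) (false ∷ b) (suc s) e = let y , i , j , q = select-∈⁺ f xs b s e in y , there i , j , q

  select-∈⁻ : ∀ {A B : Set} (f : A → B) xs b {x} → x ∈ select f xs b →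
              Σ (Fin (length (map f xs))) λ s → lookup b s ≡ true × List.lookup (map f xs) s ≡ f x × x ∈ xs
  select-∈⁻ f (x ∷ xs) (true ∷ b) (here refl) = zero , refl , refl , here refl
  select-∈⁻ f (x ∷ xs) (true ∷ b) (there i) = let s , e , q , j = select-∈⁻ f xs b i in suc s , e , q , there j
  select-∈⁻ f (x ∷ xs) (false ∷ b) i = let s , e , q , j = select-∈⁻ f xs b i in suc s , e , q , there j

  ∑-sublists : ∀ {A B : Set} (f : A → B) xs (g : List A → ℤ) → ∑ (sublists xs) g ≡ ∑ (bits (length (map f xs))) (g ∘ select f xs)
  ∑-sublists f [] g = refl
  ∑-sublists f (x ∷ xs) g = trans (∑-++ (sublists xs) (map (x ∷_) (sublists xs)) g) (trans
    (cong₂ _+_ (∑-sublists f xs g) (trans (∑-map (x ∷_) (sublists xs) g) (∑-sublists f xs (g ∘ (x ∷_)))))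
    (sym (∑-bits (length (map f xs)) (g ∘ select f (x ∷ xs)))))

  module KSets (n k : ℕ) where

    χ : List ℕ → Bits n
    χ = indicator n 0

    L : List (Bits n)
    L = map χ (ksets n k)

    rep-kset : ∀ {S} → S ∈ ksets n k → Rep 0 S (χ S)
    rep-kset {S} i = let l , b , _ = ∈-ksets⁻ n k i in rep-indicator n 0 S l (All.tabulate (λ _ → z≤n)) b

    χ-injective : ∀ {S T} → S ∈ ksets n k → T ∈ ksets n k → χ S ≡ χ T → S ≡ T
    χ-injective i j e = rep-list (subst (Rep 0 _) e (rep-kset i)) (rep-kset j)

    L-unique : Unique L
    L-unique = map-unique (ksets n k) (λ i → i) (Unique.filter⁺ (linked? _<?_) (below-unique n k))
      where
      map-unique : ∀ xs → (∀ {S} → S ∈ xs → S ∈ ksets n k) → Unique xs → Unique (map χ xs)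
      map-unique [] sub [] = []
      map-unique (S ∷ xs) sub (S∉ ∷ u) = All.map⁺ (All.tabulate (λ {T} j e → All.lookup S∉ j (χ-injective (sub (here refl)) (sub (there j)) e)))
        ∷ map-unique xs (sub ∘ there) u

    size-L : ∀ {T} → T ∈ L → size T ≡ ℤ.+ k
    size-L i with ∈-map⁻ χ i
    ... | S , j , refl = trans (rep-size (rep-kset j)) (cong ℤ.+_ (proj₂ (proj₂ (∈-ksets⁻ n k j))))

    L-closed : ∀ {S T} → T ∈ L → size S ≡ size T → S ∈ L
    L-closed {S} T∈ e = subst (_∈ L) (rep-bits (rep-kset pos∈) r) (∈-map⁺ χ pos∈)
      where
      r : Rep 0 (positions 0 S) S
      r = rep-positions 0 S
      pos-length : length (positions 0 S) ≡ k
      pos-length = +-injective (trans (sym (rep-size r)) (trans e (size-L T∈)))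
      pos∈ : positions 0 S ∈ ksets n k
      pos∈ = subst (λ l → positions 0 S ∈ ksets n l) pos-length (∈-ksets⁺ (rep-sorted r) (rep-upper r))

    open Families L L-unique L-closed

    members : Bits m → List (List ℕ)
    members = select χ (ksets n k)

    SetClosed : Bits m → Set
    SetClosed b = ∀ i j → i Fin.< j → ∀ s t → lookup b t ≡ true → ρ i j (setOf s) (setOf t) ≢ 0ℤ → lookup b s ≡ true

    member-bit : ∀ b {S} → S ∈ members b → ∀ s → setOf s ≡ χ S → lookup b s ≡ true
    member-bit b i s e = let s′ , f , g , _ = select-∈⁻ χ (ksets n k) b i in
      subst (λ s → lookup b s ≡ true) (lookup-injective L-unique (trans g (sym e))) f

    shifted⇒closed : ∀ b → Shifted n k (members b) → SetClosed b
    shifted⇒closed b shifted i j i<j s t t∈b ne =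
      let T , T∈ , T∈K , eT = select-∈⁺ χ (ksets n k) b t t∈b
          S , S∈ , eS = ∈-map⁻ χ (setOf-∈ s)
          e , f , g = ρ-support i j (setOf s) (setOf t) (Fin.<⇒≢ i<j) ne
          S≤T = lowered i j i<j (subst (Rep 0 S) (sym eS) (rep-kset S∈))
            (subst (Rep 0 T) (trans (sym eT) (sym g)) (rep-kset T∈)) e f
      in member-bit b (All.lookup (All.lookup shifted T∈K) S∈ S≤T) s eS

    -- Closedness concerns single hops, shiftedness the whole componentwise order. `descend` bridges
    -- the two by lowering the entries of S to those of T from the left: the prefix `P` already
    -- agrees with T, and since the next entry of T exceeds `P`, each replacement gives a k-set
    -- again and is one hop.
    closed⇒shifted : ∀ b → SetClosed b → Shifted n k (members b)
    closed⇒shifted b closed = All.tabulate (λ {S} S∈K → All.tabulate (λ {T} T∈ T≤S →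
      let _ , _ , _ , S∈ = select-∈⁻ χ (ksets n k) b S∈K in descend [] T S S∈K S∈ T∈ T≤S []))
      where
      one-step : ∀ P {s t S} → (P List.++ s ∷ S) ∈ members b → (P List.++ s ∷ S) ∈ ksets n k → All (_< t) P → t < s → (P List.++ t ∷ S) ∈ members b × (P List.++ t ∷ S) ∈ ksets n k
      one-step P {s} {t} {S} i ki a t<s =
        let x , y , x<y , e , f , r = replace P (rep-kset ki) a z≤n t<s
            u , u∈ , eu , _ = select-∈⁻ χ (ksets n k) b i
            sorted = rep-sorted r
            new∈ = subst (λ l → (P List.++ t ∷ S) ∈ ksets n l) (trans (List.length-++ P) (trans (sym (List.length-++ P)) (proj₂ (proj₂ (∈-ksets⁻ n k ki))))) (∈-ksets⁺ sorted (rep-upper r))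
            v , ev = index-of (∈-map⁺ χ new∈)
            ne = subst₂ (λ p q → ρ x y p q ≢ 0ℤ) (trans (rep-bits r (rep-kset new∈)) (sym ev)) (sym eu) (ρ-nonzero (Fin.<⇒≢ x<y) e f)
            w , w∈ , w∈K , ew = select-∈⁺ χ (ksets n k) b v (closed x y x<y v u u∈ ne)
        in subst (_∈ members b) (χ-injective w∈ new∈ (trans (sym ew) ev)) w∈K , new∈
        where
        index-of : ∀ {X} → X ∈ L → Σ (Fin m) λ v → setOf v ≡ X
        index-of i = Any.index i , sym (Any.lookup-index i)
          where
          import Data.List.Relation.Unary.Any as Any using (index)
          import Data.List.Relation.Unary.Any.Properties as Any using (lookup-index)
      descend : ∀ P T S → (P List.++ S) ∈ members b → (P List.++ S) ∈ ksets n k → (P List.++ T) ∈ ksets n k → Pointwise _≤_ T S → All (λ p → All (p <_) T) P → (P List.++ T) ∈ members b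
      descend P [] [] i ki kt [] a = i
      descend P (t ∷ T) (s ∷ S) i ki kt (t≤s ∷ le) a = subst (_∈ members b) (List.++-assoc P (t ∷ []) T)
        (descend (P ∷ʳ t) T S (subst (_∈ members b) (sym (List.++-assoc P (t ∷ []) S)) (proj₁ next))
          (subst (_∈ ksets n k) (sym (List.++-assoc P (t ∷ []) S)) (proj₂ next))
          (subst (_∈ ksets n k) (sym (List.++-assoc P (t ∷ []) T)) kt) le
          (All.++⁺ (All.map (λ { (_ ∷ x) → x }) a) (sorted-above (drop-prefix P (proj₁ (∈-ksets⁻ n k kt))) ∷ [])))
        where
        drop-prefix : ∀ P {Q} → Linked _<_ (P List.++ Q) → Linked _<_ Q
        drop-prefix [] l = l
        drop-prefix (p ∷ P) l = drop-prefix P (sorted-tail l)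
        next : (P List.++ t ∷ S) ∈ members b × (P List.++ t ∷ S) ∈ ksets n k
        next with t ≟ s
        ... | yes refl = i , ki
        ... | no t≢s = one-step P i ki (All.map (λ { (x ∷ _) → x }) a) (ℕ.≤∧≢⇒< t≤s t≢s)

  -- Ghosts as the factors of the product over positive roots

  ghostPair : ∀ n → Fin (tri n) → ℕ × ℕ
  pairOf : ∀ n → Fin n ⊎ Fin (tri n) → ℕ × ℕ
  ghostPair (suc n) p = pairOf n (splitAt n p)
  pairOf n (inj₁ i) = 0 , suc (toℕ i)
  pairOf n (inj₂ p) = suc (proj₁ (ghostPair n p)) , suc (proj₂ (ghostPair n p))

  ghostWt-pair : ∀ n {θ : Fin n → ℤ} (u : Weight) → (∀ i → θ i ≡ u (toℕ i)) →
                     ∀ p → ghostWt n θ p ≡ u (proj₂ (ghostPair n p)) - u (proj₁ (ghostPair n p))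
  ghostWt-pair (suc n) {θ} u e p = by-side (splitAt n p)
    where
    by-side : ∀ q → [ (λ i → θ (suc i) - θ zero) , ghostWt n (θ ∘ suc) ]′ q ≡ u (proj₂ (pairOf n q)) - u (proj₁ (pairOf n q))
    by-side (inj₁ i) = cong₂ _-_ (e (suc i)) (e zero)
    by-side (inj₂ p) = ghostWt-pair n (u ∘ suc) (e ∘ suc) p

  ghostPair-injective : ∀ n {p q} → ghostPair n p ≡ ghostPair n q → p ≡ q
  ghostPair-injective (suc n) {p} {q} e = trans (sym (Fin.join-splitAt n (tri n) p))
    (trans (cong (join n (tri n)) (by-side (splitAt n p) (splitAt n q) e)) (Fin.join-splitAt n (tri n) q))
    where
    by-side : ∀ x y → pairOf n x ≡ pairOf n y → x ≡ y
    by-side (inj₁ i) (inj₁ j) e = cong inj₁ (Fin.toℕ-injective (cong (ℕ.pred ∘ proj₂) e))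
    by-side (inj₁ i) (inj₂ q) e = contradiction (cong proj₁ e) λ ()
    by-side (inj₂ p) (inj₁ j) e = contradiction (cong proj₁ e) λ ()
    by-side (inj₂ p) (inj₂ q) e = cong inj₂ (ghostPair-injective n (cong₂ _,_ (cong (ℕ.pred ∘ proj₁) e) (cong (ℕ.pred ∘ proj₂) e)))

  ghostPair-< : ∀ n p → proj₁ (ghostPair n p) < proj₂ (ghostPair n p) × proj₂ (ghostPair n p) < n
  ghostPair-< (suc n) p = by-side (splitAt n p)
    where
    by-side : ∀ q → proj₁ (pairOf n q) < proj₂ (pairOf n q) × proj₂ (pairOf n q) < suc n
    by-side (inj₁ i) = s≤s z≤n , s≤s (Fin.toℕ<n i)
    by-side (inj₂ p) = let a , b = ghostPair-< n p in s≤s a , s≤s b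

  ghostPair-surjective : ∀ n {i j} → i < j → j < n → Σ (Fin (tri n)) λ p → (i , j) ≡ ghostPair n p
  ghostPair-surjective (suc n) {zero} {suc j} _ (s≤s j<n) = fromℕ< j<n ↑ˡ tri n ,
    sym (trans (cong (pairOf n) (Fin.splitAt-↑ˡ n (fromℕ< j<n) (tri n))) (cong (λ x → 0 , suc x) (Fin.toℕ-fromℕ< j<n)))
  ghostPair-surjective (suc n) {suc i} {suc j} (s≤s i<j) (s≤s j<n) = let p , e = ghostPair-surjective n i<j j<n in n ↑ʳ p ,
    trans (cong (λ (a , b) → suc a , suc b) e) (sym (cong (pairOf n) (Fin.splitAt-↑ʳ n (tri n) p)))

  moves : ∀ {G} → (Fin G → ℕ × ℕ) → Bits G → Weight → Weight
  moves pr [] α = α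
  moves pr (false ∷ g) α = moves (pr ∘ suc) g α
  moves pr (true ∷ g) α = moves (pr ∘ suc) g (move (pr zero) α)

  T-bits : ∀ {G} (pr : Fin G → ℕ × ℕ) f α → T (tabulate pr) f α ≡ ∑ (bits G) (λ g → sgn g * f (moves pr g α))
  T-bits {zero} pr f α = sym (trans (+-identityʳ (1ℤ * f α)) (*-identityˡ (f α)))
  T-bits {suc G} pr f α = begin
    T (tabulate (pr ∘ suc)) f α - T (tabulate (pr ∘ suc)) f (move (pr zero) α)
      ≡⟨ cong₂ _-_ (T-bits (pr ∘ suc) f α) (T-bits (pr ∘ suc) f (move (pr zero) α)) ⟩
    S (λ g → sgn g * f (moves (pr ∘ suc) g α)) - S (λ g → sgn g * f (moves (pr ∘ suc) g (move (pr zero) α)))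
      ≡⟨ cong (S (λ g → sgn g * f (moves (pr ∘ suc) g α)) +_) (trans (sym (∑-neg (bits G) (λ g → sgn g * f (moves (pr ∘ suc) g (move (pr zero) α)))))
        (∑-cong (bits G) (λ g → neg-distribˡ-* (sgn g) (f (moves (pr ∘ suc) g (move (pr zero) α)))))) ⟩
    S (λ g → sgn g * f (moves (pr ∘ suc) g α)) + S (λ g → - sgn g * f (moves (pr ∘ suc) g (move (pr zero) α)))
      ≡⟨ ∑-bits G (λ g → sgn g * f (moves pr g α)) ⟨
    ∑ (bits (suc G)) (λ g → sgn g * f (moves pr g α)) ∎
    where
    S : (Bits G → ℤ) → ℤ
    S = ∑ (bits G)

  moves-value : ∀ {G} (pr : Fin G → ℕ × ℕ) (w : Fin G → ℤ) g α x → (∀ p → w p ≡ ε (proj₂ (pr p)) x - ε (proj₁ (pr p)) x) →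
                moves pr g α x + grade w g ≡ α x
  moves-value pr w [] α x e = +-identityʳ (α x)
  moves-value pr w (false ∷ g) α x e = trans (cong (moves (pr ∘ suc) g α x +_) (+-identityˡ (grade (w ∘ suc) g)))
    (moves-value (pr ∘ suc) (w ∘ suc) g α x (e ∘ suc))
  moves-value pr w (true ∷ g) α x e = begin
    M + (1ℤ * w zero + grade (w ∘ suc) g) ≡⟨ arith₁ M (w zero) (grade (w ∘ suc) g) ⟩
    (M + grade (w ∘ suc) g) + w zero ≡⟨ cong₂ _+_ (moves-value (pr ∘ suc) (w ∘ suc) g (move (pr zero) α) x (e ∘ suc)) (e zero) ⟩
    (α x + (ε i x - ε j x)) + (ε j x - ε i x) ≡⟨ arith₂ (α x) (ε i x) (ε j x) ⟩
    α x ∎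
    where
    i = proj₁ (pr zero)
    j = proj₂ (pr zero)
    M : ℤ
    M = moves (pr ∘ suc) g (move (pr zero) α) x
    arith₁ : ∀ m w g → m + (1ℤ * w + g) ≡ (m + g) + w
    arith₁ = solve-∀
    arith₂ : ∀ a i j → (a + (i - j)) + (j - i) ≡ a
    arith₂ = solve-∀

  δᶻ-ε : ∀ {n} (x i : Fin n) → δᶻ x i ≡ ε (toℕ i) (toℕ x)
  δᶻ-ε x i = by-cases (i Fin.≟ x)
    where
    open import Relation.Nullary using (Dec; yes; no)
    by-cases : Dec (i ≡ x) → δᶻ x i ≡ ε (toℕ i) (toℕ x)
    by-cases (yes refl) = trans (δᶻ-diag i) (sym (ι-yes (toℕ i ≟ toℕ i) refl))
    by-cases (no i≢x) = trans (δᶻ-off (i≢x ∘ sym)) (sym (ι-no (toℕ i ≟ toℕ x) (i≢x ∘ Fin.toℕ-injective)))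

  -- The ghost weights undo the moves: a family whose degree is the moved exponent has, together
  -- with the ghosts `g`, the total weight α.
  ghost-moves : ∀ n g α x → moves (ghostPair n) g α (toℕ x) + grade (ghostWt n (δᶻ x)) g ≡ α (toℕ x)
  ghost-moves n g α x = moves-value (ghostPair n) (ghostWt n (δᶻ x)) g α (toℕ x)
    (ghostWt-pair n (λ i → ε i (toℕ x)) (δᶻ-ε x))

  -- Ghosts list the positive roots by their smaller index, `pairs` by their larger one. Both lists
  -- are duplicate-free with the same members, and the factors of `T` commute.
  T-ghosts : ∀ n {f} → Extensional f → ∀ α → T (pairs n) f α ≡ ∑ (bits (tri n)) (λ g → sgn g * f (moves (ghostPair n) g α))
  T-ghosts n {f} ext α = trans (T-↭ ext (unique-↭ (pairs-unique n) (Unique.tabulate⁺ (ghostPair-injective n)) to from) α)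
    (T-bits (ghostPair n) f α)
    where
    to : ∀ {p} → p ∈ pairs n → p ∈ tabulate (ghostPair n)
    to {i , j} m = let i<j , j<n = ∈-pairs⁻ n m
                       p , e = ghostPair-surjective n i<j j<n
                   in subst (_∈ tabulate (ghostPair n)) (sym e) (∈-tabulate⁺ p)
    from : ∀ {p} → p ∈ tabulate (ghostPair n) → p ∈ pairs n
    from m with ∈-tabulate⁻ m
    ... | p , refl = let a , b = ghostPair-< n p in ∈-pairs⁺ n a b

  ∑-bits-++ : ∀ G {k} (f : Vector (G ℕ.+ k)) → ∑ (bits (G ℕ.+ k)) f ≡ ∑ (bits G) (λ g → ∑ (bits k) (λ b → f (g ++ b)))
  ∑-bits-++ zero {k} f = sym (+-identityʳ (∑ (bits k) f))
  ∑-bits-++ (suc G) {k} f = begin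
    ∑ (bits (suc G ℕ.+ k)) f
      ≡⟨ ∑-bits (G ℕ.+ k) f ⟩
    ∑ (bits (G ℕ.+ k)) (f ∘ (false ∷_)) + ∑ (bits (G ℕ.+ k)) (f ∘ (true ∷_))
      ≡⟨ cong₂ _+_ (∑-bits-++ G (f ∘ (false ∷_))) (∑-bits-++ G (f ∘ (true ∷_))) ⟩
    ∑ (bits G) (λ g → ∑ (bits k) (λ b → f (false ∷ g ++ b))) + ∑ (bits G) (λ g → ∑ (bits k) (λ b → f (true ∷ g ++ b)))
      ≡⟨ ∑-bits G (λ g → ∑ (bits k) (λ b → f (g ++ b))) ⟨
    ∑ (bits (suc G)) (λ g → ∑ (bits k) (λ b → f (g ++ b))) ∎

  sign : Bool → ℤ
  sign false = 1ℤ
  sign true = - 1ℤ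

  sgn-parity : ∀ {G k} (g : Bits G) (b : Bits k) → sgn g ≡ sign (ghostParity G (g ++ b))
  sgn-parity [] b = refl
  sgn-parity (false ∷ g) b = sgn-parity g b
  sgn-parity {suc G} (true ∷ g) b = trans (cong (-_) (sgn-parity g b)) (negated (ghostParity G (g ++ b)))
    where
    negated : ∀ h → - sign h ≡ sign (true xor h)
    negated true = refl
    negated false = refl

  open import Algebra.Bundles using (AbelianGroup)
  open import Algebra.Properties.Group (AbelianGroup.group +-0-abelianGroup) using () renaming (∙-cancelʳ to +-cancelʳ)

  grade-select : ∀ {A B : Set} (f : A → B) xs (F : B → ℤ) b → grade (F ∘ List.lookup (map f xs)) b ≡ ∑ (select f xs b) (F ∘ f)
  grade-select f [] F [] = refl
  grade-select f (x ∷ xs) F (false ∷ b) = trans (+-identityˡ (grade (F ∘ List.lookup (map f xs)) b)) (grade-select f xs F b)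
  grade-select f (x ∷ xs) F (true ∷ b) = cong₂ _+_ (*-identityˡ (F (f x))) (grade-select f xs F b)

  drop-++ : ∀ {G k} (g : Bits G) (b : Bits k) → drop G (g ++ b) ≡ b
  drop-++ [] b = refl
  drop-++ (_ ∷ g) b = drop-++ g b

  lookup-drop : ∀ G {k} (b : Bits (G ℕ.+ k)) s → lookup (drop G b) s ≡ lookup b (G ↑ʳ s)
  lookup-drop zero b s = refl
  lookup-drop (suc G) (_ ∷ b) s = lookup-drop G b s

  occ-++ˡ : ∀ {G k} (g : Bits G) (b : Bits k) p → occ (g ++ b) (p ↑ˡ k) ≡ occ g p
  occ-++ˡ g b p = trans (occ-bit (g ++ b) (p ↑ˡ _)) (trans (cong bit (lookup-++ˡ g b p)) (sym (occ-bit g p)))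

  occ-++ʳ : ∀ {G k} (g : Bits G) (b : Bits k) s → occ (g ++ b) (G ↑ʳ s) ≡ occ b s
  occ-++ʳ {G} g b s = trans (occ-bit (g ++ b) (G ↑ʳ s)) (trans (cong bit (lookup-++ʳ g b s)) (sym (occ-bit b s)))

  empty : ∀ G → Bits G
  empty zero = []
  empty (suc G) = false ∷ empty G

  occ-empty : ∀ G p → occ (empty G) p ≡ 0ℤ
  occ-empty (suc G) zero = refl
  occ-empty (suc G) (suc p) = occ-empty G p

  unoccupied : ∀ {N} (b : Bits N) p → occ b p ≡ 0ℤ → lookup b p ≡ false
  unoccupied b p e = by-cases (lookup b p) refl
    where
    by-cases : ∀ h → lookup b p ≡ h → lookup b p ≡ false
    by-cases false e′ = e′
    by-cases true e′ = contradiction (trans (sym (trans (occ-bit b p) (cong bit e′))) e) λ ()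

  empty-unique : ∀ {G} (g : Bits G) → (∀ p → occ g p ≡ 0ℤ) → g ≡ empty G
  empty-unique [] e = refl
  empty-unique (h ∷ g) e = cong₂ _∷_ (unoccupied (h ∷ g) zero (e zero)) (empty-unique g (e ∘ suc))

  moves-empty : ∀ {G} (pr : Fin G → ℕ × ℕ) α → moves pr (empty G) α ≡ α
  moves-empty {zero} pr α = refl
  moves-empty {suc G} pr α = moves-empty (pr ∘ suc) α

  ι-⊎ : ∀ {P Q : Set} (d : Dec P) (e : Dec Q) → (P → Q → ⊥) → ι (d ⊎-dec e) ≡ ι d + ι e
  ι-⊎ (yes p) (yes q) disjoint = ⊥-elim (disjoint p q)
  ι-⊎ (yes p) (no _) disjoint = refl
  ι-⊎ (no _) (yes q) disjoint = refl
  ι-⊎ (no _) (no _) disjoint = refl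

  weight-antitone : ∀ {la} → IsPartition la → ∀ {i j} → i ≤ j → weight la j ℤ.≤ weight la i
  weight-antitone {la} part {i} {j} i≤j = subst (λ j → weight la j ℤ.≤ weight la i) (ℕ.m+[n∸m]≡n i≤j) (go (j ℕ.∸ i))
    where
    go : ∀ d → weight la (i ℕ.+ d) ℤ.≤ weight la i
    go zero = ≤-reflexive (cong (weight la) (ℕ.+-identityʳ i))
    go (suc d) = ≤-trans (≤-reflexive (cong (weight la) (ℕ.+-suc i d))) (≤-trans (wt-decreasing (proj₁ part) (i ℕ.+ d)) (go d))

  weight-beyond : ∀ la {i} → length la ≤ i → weight la i ≡ 0ℤ
  weight-beyond [] le = refl
  weight-beyond (_ ∷ la) (s≤s le) = weight-beyond la le

  weight-++0 : ∀ la c i → weight (la List.++ replicate c 0) i ≡ weight la i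
  weight-++0 [] zero i = refl
  weight-++0 [] (suc c) zero = refl
  weight-++0 [] (suc c) (suc i) = weight-++0 [] c i
  weight-++0 (_ ∷ la) c zero = refl
  weight-++0 (_ ∷ la) c (suc i) = weight-++0 la c i

  card : ∀ {n} → Bits n → ℕ
  card [] = 0
  card (false ∷ b) = card b
  card (true ∷ b) = suc (card b)

  size-card : ∀ {n} (b : Bits n) → size b ≡ ℤ.+ card b
  size-card [] = refl
  size-card (false ∷ b) = trans (+-identityˡ (size b)) (size-card b)
  size-card (true ∷ b) = cong (1ℤ +_) (size-card b)

  dist≤card : ∀ {n} (T V : Bits n) → dist T V ≤ card T ℕ.+ card V
  dist≤card [] [] = z≤n
  dist≤card (false ∷ T) (false ∷ V) = dist≤card T V
  dist≤card (true ∷ T) (true ∷ V) = ℕ.≤-trans (dist≤card T V) (ℕ.+-mono-≤ (ℕ.n≤1+n (card T)) (ℕ.n≤1+n (card V)))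
  dist≤card (false ∷ T) (true ∷ V) = ℕ.≤-trans (s≤s (dist≤card T V)) (ℕ.≤-reflexive (sym (ℕ.+-suc (card T) (card V))))
  dist≤card (true ∷ T) (false ∷ V) = s≤s (dist≤card T V)

  Below : ∀ {n} → ℕ → Bits n → Set
  Below ℓ T = ∀ x → ℓ ≤ toℕ x → lookup T x ≡ false

  -- dist T V + |T| + |V| = 2 |T ∪ V|
  dist-below : ∀ {n} ℓ (T V : Bits n) → Below ℓ T → Below ℓ V → dist T V ℕ.+ (card T ℕ.+ card V) ≤ ℓ ℕ.+ ℓ
  dist-below ℓ [] [] p q = z≤n
  dist-below zero (true ∷ T) V p q = contradiction (p zero z≤n) λ ()
  dist-below zero (false ∷ T) (true ∷ V) p q = contradiction (q zero z≤n) λ ()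
  dist-below zero (false ∷ T) (false ∷ V) p q = dist-below zero T V (λ x _ → p (suc x) z≤n) (λ x _ → q (suc x) z≤n)
  dist-below (suc ℓ) (t ∷ T) (v ∷ V) p q = step t v
    where
    ih : dist T V ℕ.+ (card T ℕ.+ card V) ≤ ℓ ℕ.+ ℓ
    ih = dist-below ℓ T V (λ x le → p (suc x) (s≤s le)) (λ x le → q (suc x) (s≤s le))
    two : suc (suc (dist T V ℕ.+ (card T ℕ.+ card V))) ≤ suc ℓ ℕ.+ suc ℓ
    two = ℕ.≤-trans (s≤s (s≤s ih)) (ℕ.≤-reflexive (cong suc (sym (ℕ.+-suc ℓ ℓ))))
    step : ∀ t v → dist (t ∷ T) (v ∷ V) ℕ.+ (card (t ∷ T) ℕ.+ card (v ∷ V)) ≤ suc ℓ ℕ.+ suc ℓ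
    step false false = ℕ.≤-trans (ℕ.m≤n+m _ 2) two
    step false true = ℕ.≤-trans (ℕ.≤-reflexive (cong suc (trans (cong (dist T V ℕ.+_) (ℕ.+-suc (card T) (card V))) (ℕ.+-suc (dist T V) _)))) two
    step true false = ℕ.≤-trans (ℕ.≤-reflexive (cong suc (ℕ.+-suc (dist T V) _))) two
    step true true = ℕ.≤-trans (ℕ.≤-reflexive (trans (ℕ.+-suc (dist T V) _) (cong suc
      (trans (cong (dist T V ℕ.+_) (ℕ.+-suc (card T) (card V))) (ℕ.+-suc (dist T V) _))))) two

  -- Comparison of the coefficients with the count of shifted families

  module _ (n k : ℕ) (la : List ℕ) (part : IsPartition la) (la≤n : length la ≤ n) where

    open KSets n k
    open Families L L-unique L-closed hiding (c) renaming (degree to total)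
    open Dominant L L-unique L-closed (weight la ∘ toℕ) (λ i<j → weight-antitone part (ℕ.<⇒≤ i<j))

    degree-family : ∀ (g : Bits (tri n)) (b : Bits m) x → total x (g ++ b) ≡ familyDegree (members b) (toℕ x)
    degree-family g b x = begin
      ∑ (allFin m) (λ s → occ (g ++ b) (member s) * occ (setOf s) x)
        ≡⟨ ∑-cong (allFin m) (λ s → cong (_* occ (setOf s) x) (occ-++ʳ g b s)) ⟩
      ∑ (allFin m) (λ s → occ b s * occ (setOf s) x)
        ≡⟨ grade-∑ (λ s → occ (setOf s) x) b ⟨
      grade (λ s → occ (setOf s) x) b
        ≡⟨ grade-select χ (ksets n k) (λ S → occ S x) b ⟩
      ∑ (members b) (λ S → occ (χ S) x)
        ≡⟨ ∑-cong∈ (members b) (λ {S} i → let _ , _ , _ , S∈ = select-∈⁻ χ (ksets n k) b i in rep-occ (rep-kset S∈) x) ⟩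
      ∑ (members b) (λ S → ι (toℕ x ∈? S))
        ≡⟨ count-∑ (toℕ x ∈?_) (members b) ⟨
      familyDegree (members b) (toℕ x) ∎

    wt-family : ∀ (g : Bits (tri n)) (b : Bits m) x → wt (g ++ b) x ≡ familyDegree (members b) (toℕ x) + grade (ghostWt n (δᶻ x)) g
    wt-family g b x = trans (wt-total (g ++ b) x) (cong₂ _+_ (degree-family g b x)
      (trans (∑-cong (allFin (tri n)) (λ p → cong (_* ghostWt n (δᶻ x) p) (occ-++ˡ g b p))) (sym (grade-∑ (ghostWt n (δᶻ x)) g))))

    atWeight-weq : ∀ g b → ι (atWeight? (g ++ b)) ≡ weq n (familyDegree (members b)) (moves (ghostPair n) g (weight la))
    atWeight-weq g b = weq-ι n (atWeight? (g ++ b)) to from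
      where
      fd mv : ℕ → ℤ
      fd = familyDegree (members b)
      mv = moves (ghostPair n) g (weight la)
      to : AtWeight (g ++ b) → ∀ i → i < n → fd i ≡ mv i
      to at i i<n = subst (λ i → fd i ≡ mv i) (Fin.toℕ-fromℕ< i<n) (+-cancelʳ (grade (ghostWt n (δᶻ x)) g) (fd (toℕ x)) (mv (toℕ x))
        (trans (sym (wt-family g b x)) (trans (at x) (sym (ghost-moves n g (weight la) x)))))
        where
        x : Fin n
        x = fromℕ< i<n
      from : (∀ i → i < n → fd i ≡ mv i) → AtWeight (g ++ b)
      from e x = trans (wt-family g b x) (trans (cong (_+ grade (ghostWt n (δᶻ x)) g) (e (toℕ x) (Fin.toℕ<n x))) (ghost-moves n g (weight la) x))

    families-ext : Extensional (families n k)
    families-ext e = ∑-cong (kFamilies n k) (λ K → weq-local n (familyDegree K) (λ i _ → e i))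

    even-odd : ∀ b → sign (parity b) * ι (atWeight? b) ≡ ι (even? b) - ι (odd? b)
    even-odd b = trans (by-parity (parity b) (ι (atWeight? b)))
      (sym (cong₂ _-_ (ι-× (atWeight? b) (parity b Bool.≟ false)) (ι-× (atWeight? b) (parity b Bool.≟ true))))
      where
      arith₁ : ∀ z → 1ℤ * z ≡ z * 1ℤ - z * 0ℤ
      arith₁ = solve-∀
      arith₂ : ∀ z → - 1ℤ * z ≡ z * 0ℤ - z * 1ℤ
      arith₂ = solve-∀
      by-parity : ∀ h z → sign h * z ≡ z * ι (h Bool.≟ false) - z * ι (h Bool.≟ true)
      by-parity false = arith₁
      by-parity true = arith₂

    #even #odd : ℤ
    #even = ℤ.+ length (filter even? (bits N))
    #odd = ℤ.+ length (filter odd? (bits N))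

    -- A ghost configuration `g` selects one term of the expanded product, with the ghost parity as
    -- its sign. The families counted at the moved exponent are exactly the `b` for which `g ++ b`
    -- has weight `la`.
    coefficient-difference : ∀ (c : List ℕ → ℤ) → IsSchurExpansion n k c →
      c la ≡ #even - #odd
    coefficient-difference c expansion = begin
      c la
        ≡⟨ coefficient-formula n k c expansion la part la≤n ⟩
      T (pairs n) (families n k) (weight la)
        ≡⟨ T-ghosts n families-ext (weight la) ⟩
      ∑ (bits (tri n)) (λ g → sgn g * families n k (moves (ghostPair n) g (weight la)))
        ≡⟨ ∑-cong (bits (tri n)) per-ghost ⟩
      ∑ (bits (tri n)) (λ g → ∑ (bits m) (λ b → sign (parity (g ++ b)) * ι (atWeight? (g ++ b))))
        ≡⟨ ∑-bits-++ (tri n) (λ b → sign (parity b) * ι (atWeight? b)) ⟨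
      ∑ (bits N) (λ b → sign (parity b) * ι (atWeight? b))
        ≡⟨ ∑-cong (bits N) even-odd ⟩
      ∑ (bits N) (λ b → ι (even? b) - ι (odd? b))
        ≡⟨ trans (∑-+ (bits N) (ι ∘ even?) (λ b → - ι (odd? b))) (cong (∑ (bits N) (ι ∘ even?) +_) (∑-neg (bits N) (ι ∘ odd?))) ⟩
      ∑ (bits N) (ι ∘ even?) - ∑ (bits N) (ι ∘ odd?)
        ≡⟨ cong₂ _-_ (count-∑ even? (bits N)) (count-∑ odd? (bits N)) ⟨
      #even - #odd ∎
      where

      per-ghost : ∀ g → sgn g * families n k (moves (ghostPair n) g (weight la))
        ≡ ∑ (bits m) (λ b → sign (parity (g ++ b)) * ι (atWeight? (g ++ b)))
      per-ghost g = trans (cong (sgn g *_) (∑-sublists χ (ksets n k) (λ K → weq n (familyDegree K) α)))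
        (trans (sym (∑-*ˡ (bits m) (sgn g) (λ b → weq n (familyDegree (members b)) α)))
          (∑-cong (bits m) (λ b → cong₂ _*_ (sgn-parity g b) (sym (atWeight-weq g b)))))
        where
        α : ℕ → ℤ
        α = moves (ghostPair n) g (weight la)

    Extremal : Bits N → Set
    Extremal b = AtWeight b × Vacuum b × Shifted n k (members (drop (tri n) b))

    vacuum? : Decidable Vacuum
    vacuum? b = Fin.all? (λ p → occ b (ghost p) ℤ.≟ 0ℤ)

    extremal? : Decidable Extremal
    extremal? b = atWeight? b ×-dec (vacuum? b ×-dec shifted? n k (members (drop (tri n) b)))

    closed-drop : ∀ {b} → SetClosed (drop (tri n) b) → Closed L L-unique L-closed b
    closed-drop {b} closed i j i<j s t e ne = trans (sym (lookup-drop (tri n) b s)) (closed i j i<j s t (trans (lookup-drop (tri n) b t) e) ne)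

    drop-closed : ∀ {b} → Closed L L-unique L-closed b → SetClosed (drop (tri n) b)
    drop-closed {b} closed i j i<j s t e ne = trans (lookup-drop (tri n) b s) (closed i j i<j s t (trans (sym (lookup-drop (tri n) b t)) e) ne)

    extremal-sound : ∀ {b} → Extremal b → AtWeight b × Vacuum b × Highest b
    extremal-sound {b} (at , vac , shifted) = at , vac ,
      closed⇒highest L L-unique L-closed (closed-drop {b} (shifted⇒closed (drop (tri n) b) shifted))

    -- Vacuum vectors are those with empty ghost part, for which `moves` is the identity; what
    -- remains is a sum over families of degree `la`.
    shifted-count : ℤ.+ length (filter extremal? (bits N)) ≡ ℤ.+ aShift n k la
    shifted-count = begin
      ℤ.+ length (filter extremal? (bits N))
        ≡⟨ count-∑ extremal? (bits N) ⟩
      ∑ (bits N) (ι ∘ extremal?)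
        ≡⟨ ∑-bits-++ (tri n) (ι ∘ extremal?) ⟩
      ∑ (bits (tri n)) (λ g → ∑ (bits m) (λ b → ι (extremal? (g ++ b))))
        ≡⟨ ∑-cong (bits (tri n)) (λ g → trans (∑-cong (bits m) (factor g)) (∑-*ˡ (bits m) (ι (g ≟ᵇ empty (tri n))) (λ b → ι (good? (members b))))) ⟩
      ∑ (bits (tri n)) (λ g → ι (g ≟ᵇ empty (tri n)) * ∑ (bits m) (λ b → ι (good? (members b))))
        ≡⟨ ∑-unique (_≟ᵇ empty (tri n)) (λ _ → ∑ (bits m) (λ b → ι (good? (members b)))) (bits-unique (tri n)) (∈-bits (empty (tri n))) refl (λ e → e) ⟩
      ∑ (bits m) (λ b → ι (good? (members b)))
        ≡⟨ ∑-sublists χ (ksets n k) (ι ∘ good?) ⟨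
      ∑ (kFamilies n k) (ι ∘ good?)
        ≡⟨ count-∑ good? (kFamilies n k) ⟨
      ℤ.+ aShift n k la ∎
      where
      good? : ∀ K → Dec (Shifted n k K × degree n K ≡ pad n la)
      good? K = shifted? n k K ×-dec (degree n K ≟L pad n la)
      degree-weq : ∀ K → ι (degree n K ≟L pad n la) ≡ weq n (familyDegree K) (weight la)
      degree-weq K = trans (tabulated-eq (λ i → count (i ∈?_) K) n (pad n la) (pad-length n la la≤n))
        (weq-local n (familyDegree K) (λ i _ → weight-++0 la (n ℕ.∸ length la) i))
      vacuum-empty : ∀ g b → ι (vacuum? (g ++ b)) ≡ ι (g ≟ᵇ empty (tri n))
      vacuum-empty g b = ι-cong (vacuum? (g ++ b)) (g ≟ᵇ empty (tri n))
        (λ vac → empty-unique g (λ p → trans (sym (occ-++ˡ g b p)) (vac p)))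
        (λ { refl p → trans (occ-++ˡ g b p) (occ-empty (tri n) p) })
      factor : ∀ g b → ι (extremal? (g ++ b)) ≡ ι (g ≟ᵇ empty (tri n)) * ι (good? (members b))
      factor g b = begin
        ι (extremal? (g ++ b))
          ≡⟨ trans (ι-× (atWeight? (g ++ b)) (vacuum? (g ++ b) ×-dec shifted? n k K′)) (cong (ι (atWeight? (g ++ b)) *_) (ι-× (vacuum? (g ++ b)) (shifted? n k K′))) ⟩
        ι (atWeight? (g ++ b)) * (ι (vacuum? (g ++ b)) * ι (shifted? n k K′))
          ≡⟨ *-swapˡ (ι (atWeight? (g ++ b))) (ι (vacuum? (g ++ b))) (ι (shifted? n k K′)) ⟩
        ι (vacuum? (g ++ b)) * (ι (atWeight? (g ++ b)) * ι (shifted? n k K′))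
          ≡⟨ cong₂ _*_ (vacuum-empty g b) (cong₂ (λ z K → z * ι (shifted? n k K)) (atWeight-weq g b) (cong members (drop-++ g b))) ⟩
        ι (g ≟ᵇ empty (tri n)) * (weq n (familyDegree K) (moves (ghostPair n) g (weight la)) * ι (shifted? n k K))
          ≡⟨ ι-*-cong (g ≟ᵇ empty (tri n)) (λ { refl → trans (cong (λ α → weq n (familyDegree K) α * ι (shifted? n k K)) (moves-empty (ghostPair n) (weight la)))
            (trans (*-comm (weq n (familyDegree K) (weight la)) (ι (shifted? n k K))) (trans (cong (ι (shifted? n k K) *_) (sym (degree-weq K)))
              (sym (ι-× (shifted? n k K) (degree n K ≟L pad n la))))) }) ⟩
        ι (g ≟ᵇ empty (tri n)) * ι (good? K) ∎
        where
        K K′ : List (List ℕ)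
        K = members b
        K′ = members (drop (tri n) (g ++ b))

    -- The two conditions exclude each other, because a vector without ghosts is even.
    disjoint-count : ℤ.+ length (filter (λ b → odd? b ⊎-dec extremal? b) (bits N))
                     ≡ #odd + ℤ.+ aShift n k la
    disjoint-count = begin
      ℤ.+ length (filter (λ b → odd? b ⊎-dec extremal? b) (bits N))
        ≡⟨ count-∑ (λ b → odd? b ⊎-dec extremal? b) (bits N) ⟩
      ∑ (bits N) (λ b → ι (odd? b ⊎-dec extremal? b))
        ≡⟨ ∑-cong (bits N) (λ b → ι-⊎ (odd? b) (extremal? b) (λ o h → contradiction (trans (sym (proj₂ o)) (vacuum-even b (proj₁ (proj₂ h)))) λ ())) ⟩
      ∑ (bits N) (λ b → ι (odd? b) + ι (extremal? b))
        ≡⟨ ∑-+ (bits N) (ι ∘ odd?) (ι ∘ extremal?) ⟩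
      ∑ (bits N) (ι ∘ odd?) + ∑ (bits N) (ι ∘ extremal?)
        ≡⟨ cong₂ _+_ (count-∑ odd? (bits N)) (count-∑ extremal? (bits N)) ⟨
      #odd + ℤ.+ length (filter extremal? (bits N))
        ≡⟨ cong (#odd +_) shifted-count ⟩
      #odd + ℤ.+ aShift n k la ∎

    open Bound extremal? extremal-sound

    shifted≤coefficient : ∀ (c : List ℕ → ℤ) → IsSchurExpansion n k c → ℤ.+ aShift n k la ℤ.≤ c la
    shifted≤coefficient c expansion = subst₂ ℤ._≤_ (trans (cong (_- #odd) disjoint-count) (x+y-x≡y #odd (ℤ.+ aShift n k la)))
      (sym (coefficient-difference c expansion)) (+-monoˡ-≤ (- #odd) (ℤ.+≤+ inequality))

    Narrow : Bits n → Bits n → Set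
    Narrow T V = dist T V ≤ 4

    open NarrowVectors L L-unique L-closed {Narrow} (λ T V → dist T V ℕ.≤? 4) (ℤ.+ k - ℤ.+ 2)
      (λ S U {T} {V} T∈ V∈ → exchange-law (ℤ.+ k) S U T V (size-L T∈) (size-L V∈))

    card-L : ∀ {T} → T ∈ L → card T ≡ k
    card-L {T} T∈ = +-injective (trans (sym (size-card T)) (size-L T∈))

    -- Without ghosts the weight is the degree sequence. Beyond the length of `la` it is 0, and as a
    -- sum of nonnegative terms it vanishes only if no member contains such a position.
    members-below : ∀ {b} → AtWeight b → Vacuum b → ∀ t → lookup b (member t) ≡ true → Below (length la) (setOf t)
    members-below {b} at vac t t∈b x la≤x = unoccupied (setOf t) x (begin
      occ (setOf t) x ≡⟨ *-identityˡ (occ (setOf t) x) ⟨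
      1ℤ * occ (setOf t) x ≡⟨ cong (_* occ (setOf t) x) (trans (occ-bit b (member t)) (cong bit t∈b)) ⟨
      occ b (member t) * occ (setOf t) x ≡⟨ ∑-nonneg-0 (allFin m) (λ s → term-nonneg s) degree-zero (∈-allFin t) ⟩
      0ℤ ∎)
      where
      term-nonneg : ∀ s → 0ℤ ℤ.≤ occ b (member s) * occ (setOf s) x
      term-nonneg s = subst₂ (λ p q → 0ℤ ℤ.≤ p * q) (sym (occ-bit b (member s))) (sym (occ-bit (setOf s) x)) (product (lookup b (member s)) (lookup (setOf s) x))
        where
        product : ∀ g h → 0ℤ ℤ.≤ bit g * bit h
        product true true = ℤ.+≤+ z≤n
        product true false = ℤ.+≤+ z≤n
        product false true = ℤ.+≤+ z≤n
        product false false = ℤ.+≤+ z≤n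
      degree-zero : ∑ (allFin m) (λ s → occ b (member s) * occ (setOf s) x) ≡ 0ℤ
      degree-zero = begin
        d ≡⟨ +-identityʳ d ⟨
        d + 0ℤ ≡⟨ cong (d +_) (∑-0 (allFin (tri n)) (λ {p} _ → trans (cong (_* ghostWt n (δᶻ x) p) (vac p)) (*-zeroˡ (ghostWt n (δᶻ x) p)))) ⟨
        d + ∑ (allFin (tri n)) (λ p → occ b (ghost p) * ghostWt n (δᶻ x) p) ≡⟨ wt-total b x ⟨
        wt b x ≡⟨ at x ⟩
        weight la (toℕ x) ≡⟨ weight-beyond la la≤x ⟩
        0ℤ ∎
        where
        d : ℤ
        d = ∑ (allFin m) (λ s → occ b (member s) * occ (setOf s) x)

    -- For k = 2 the symmetric difference has at most 2 + 2 elements. In the other case |T ∆ V| = 2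
    -- |T ∪ V| - 2 k, and both sets lie in the first ℓ(λ) positions, so it is at most 2 (k + 2) - 2
    -- k = 4.
    all-narrow : k ≡ 2 ⊎ length la ≤ k ℕ.+ 2 → ∀ {b} → AtWeight b → Vacuum b → AllNarrow b
    all-narrow (inj₁ k≡2) at vac t v t∈b v∈b = ℕ.≤-trans (dist≤card (setOf t) (setOf v))
      (ℕ.≤-reflexive (cong₂ ℕ._+_ (trans (card-L (setOf-∈ t)) k≡2) (trans (card-L (setOf-∈ v)) k≡2)))
    all-narrow (inj₂ la≤k+2) {b} at vac t v t∈b v∈b = ℕ.+-cancelʳ-≤ (k ℕ.+ k) _ 4 (ℕ.≤-trans
      (subst₂ (λ p q → dist (setOf t) (setOf v) ℕ.+ (p ℕ.+ q) ≤ length la ℕ.+ length la) (card-L (setOf-∈ t)) (card-L (setOf-∈ v))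
        (dist-below (length la) (setOf t) (setOf v) (members-below {b} at vac t t∈b) (members-below {b} at vac v v∈b)))
      (ℕ.≤-trans (ℕ.+-mono-≤ la≤k+2 la≤k+2) (ℕ.≤-reflexive (arith k))))
      where
      open import Data.Nat.Tactic.RingSolver using () renaming (solve-∀ to solveℕ)
      arith : ∀ k → (k ℕ.+ 2) ℕ.+ (k ℕ.+ 2) ≡ 4 ℕ.+ (k ℕ.+ k)
      arith = solveℕ

    highest-shifted : k ≡ 2 ⊎ length la ≤ k ℕ.+ 2 → ∀ x → (∀ b → ¬ (AtWeight b × Vacuum b) → x b ≡ 0ℤ) →
      (∀ i j → i Fin.< j → ∀ b → app (E i j) x b ≡ 0ℤ) → ∀ b → ¬ Extremal b → x b ≡ 0ℤ
    highest-shifted small x sup Ex b ¬shifted = by-value (x b ℤ.≟ 0ℤ)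
      where
      at-vacuum : Dec (AtWeight b × Vacuum b) → x b ≢ 0ℤ → x b ≡ 0ℤ
      at-vacuum (no ¬av) ne = sup b ¬av
      at-vacuum (yes (at , vac)) ne = contradiction (at , vac , closed⇒shifted (drop (tri n) b) (drop-closed {b} (highest⇒closed L L-unique L-closed
        (highest-support x (λ b ¬narrow → sup b (λ (at , vac) → ¬narrow (all-narrow small {b} at vac))) Ex b ne (all-narrow small {b} at vac))))) ¬shifted
      by-value : Dec (x b ≡ 0ℤ) → x b ≡ 0ℤ
      by-value (yes e) = e
      by-value (no ne) = at-vacuum (atWeight? b ×-dec vacuum? b) ne

    coefficient≡shifted : ∀ (c : List ℕ → ℤ) → IsSchurExpansion n k c → k ≡ 2 ⊎ length la ≤ k ℕ.+ 2 → c la ≡ ℤ.+ aShift n k la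
    coefficient≡shifted c expansion small = ≤-antisym (subst₂ ℤ._≤_ (sym (coefficient-difference c expansion))
      (trans (cong (_- #odd) disjoint-count) (x+y-x≡y #odd (ℤ.+ aShift n k la)))
      (+-monoˡ-≤ (- #odd) (ℤ.+≤+ (equality (highest-shifted small)))))
      (shifted≤coefficient c expansion)

open import Defs
open import Data.Nat using (ℕ; _≤_; _+_)
open import Data.Integer using (ℤ; +_) renaming (_≤_ to _≤ℤ_)
open import Data.List using (List; length)
open import Data.Product using (_×_; _,_)
open import Data.Sum using (_⊎_)
open import Relation.Binary.PropositionalEquality using (_≡_)

theorem5p9 : (k : ℕ) (la : List ℕ) → IsPartition la →
    (n : ℕ) → length la ≤ n →
    (c : List ℕ → ℤ) → IsSchurExpansion n k c →
    (+ aShift n k la ≤ℤ c la)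
    × ((k ≡ 2 ⊎ length la ≤ k + 2) → c la ≡ + aShift n k la)
theorem5p9 k la part n la≤n c expansion =
  shifted≤coefficient n k la part la≤n c expansion ,
  coefficient≡shifted n k la part la≤n c expansion
  where open ShiftedFamilies
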